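{- Suppose $0<1/n \ll \epsilon \ll \alpha, d, 1/\Delta$. Let $H_1,\dots, H_{s}$ be $n$-vertex bipartite graphs with $\Delta(H_i)\leq \Delta$ for all $i\in [s]$. Let $G$ be an $(\epsilon,d)$-super-regular bipartite graph with bipartition $(A,B)$ such that $|A|=\lfloor n/2\rfloor$ and $|B|=n-1$. If $\sum_{i=1}^{s} e(H_i) \leq (1-\alpha) e(G)$, then $H_1,\dots, H_s$ pack into $G$.
   Context: Hierarchy convention: a statement holding whenever $0<1/n\ll a\ll b,\dots$ means there are non-decreasing functions such that it holds whenever each constant is at most the appropriate function of the constants to its right. A bipartite graph with classes $A,B$ is $(\epsilon,d)$-regular if for all $A'\subseteq A$, $B'\subseteq B$ with $|A'|>\epsilon|A|$, $|B'|>\epsilon|B|$ the density between $A'$ and $B'$ is $d\pm\epsilon$; it is $(\epsilon,d)$-super-regular if moreover every vertex of $A$ has degree $(d\pm\epsilon)|B|$ and every vertex of $B$ has degree $(d\pm\epsilon)|A|$. Graphs pack into $G$ if there are pairwise edge-disjoint copies of them in $G$.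
   Formalization: The constants α, d and ε are taken to be rational numbers instead of real numbers; the hierarchy is read as: for all α, d, Δ there is ε₀ such that for every ε ≤ ε₀ there is n₀ such that the claim holds for all n ≥ n₀. -}

module Defs where

open import Data.Nat as ℕ using (ℕ; zero; suc)
open import Data.Fin using (Fin; zero; suc)
open import Data.Fin.Subset using (Subset; _∈_)
import Data.Fin.Subset as Sub
open import Data.Bool using (Bool; true; false; if_then_else_)
open import Data.Sum using (_⊎_; inj₁; inj₂)
open import Data.Product using (Σ; _×_; _,_)
open import Data.Integer using (+_)
open import Data.Rational as ℚ using (ℚ; _/_)
open import Relation.Binary.PropositionalEquality using (_≡_; _≢_)
open import Relation.Nullary using (¬_)
open import Function.Definitions using (Injective)
open import Data.Vec using (lookup)

ℕtoℚ : ℕ → ℚ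
ℕtoℚ n = (+ n) / 1

sumFin : {n : ℕ} → (Fin n → ℕ) → ℕ
sumFin {zero}  f = 0
sumFin {suc n} f = f zero ℕ.+ sumFin (λ i → f (suc i))

b2n : Bool → ℕ
b2n true  = 1
b2n false = 0

record Graph (n : ℕ) : Set where
  field
    adj    : Fin n → Fin n → Bool
    sym    : ∀ i j → adj i j ≡ adj j i
    irrefl : ∀ i → adj i i ≡ false
open Graph public

degree : {n : ℕ} → Graph n → Fin n → ℕ
degree H i = sumFin (λ j → b2n (adj H i j))

edges : {n : ℕ} → Graph n → ℕ
edges H = sumFin (degree H) ℕ./ 2

MaxDegreeAtMost : {n : ℕ} → Graph n → ℕ → Set
MaxDegreeAtMost H Δ = ∀ i → degree H i ℕ.≤ Δ

IsBipartite : {n : ℕ} → Graph n → Set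
IsBipartite {n} H =
  Σ (Fin n → Bool) λ c → ∀ i j → adj H i j ≡ true → c i ≢ c j

record BipGraph (a b : ℕ) : Set where
  field
    edge : Fin a → Fin b → Bool
open BipGraph public

BVert : ℕ → ℕ → Set
BVert a b = Fin a ⊎ Fin b

badj : {a b : ℕ} → BipGraph a b → BVert a b → BVert a b → Bool
badj G (inj₁ x) (inj₂ y) = edge G x y
badj G (inj₂ y) (inj₁ x) = edge G x y
badj G (inj₁ _) (inj₁ _) = false
badj G (inj₂ _) (inj₂ _) = false

bdegA : {a b : ℕ} → BipGraph a b → Fin a → ℕ
bdegA G x = sumFin (λ y → b2n (edge G x y))

bdegB : {a b : ℕ} → BipGraph a b → Fin b → ℕ
bdegB G y = sumFin (λ x → b2n (edge G x y))

bedges : {a b : ℕ} → BipGraph a b → ℕ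
bedges G = sumFin (bdegA G)

inS : {n : ℕ} → Subset n → Fin n → ℕ
inS S i = b2n (lookup S i)

edgesBetween : {a b : ℕ} → BipGraph a b → Subset a → Subset b → ℕ
edgesBetween G A' B' =
  sumFin (λ x → sumFin (λ y → inS A' x ℕ.* inS B' y ℕ.* b2n (edge G x y)))

-- (ε,d)-regular: for A'⊆A, B'⊆B with |A'|>ε|A|, |B'|>ε|B| the density
-- e(A',B')/(|A'||B'|) is d ± ε (multiplied out by |A'||B'| > 0)
Regular : {a b : ℕ} → ℚ → ℚ → BipGraph a b → Set
Regular {a} {b} ε d G =
  (A' : Subset a) (B' : Subset b) →
  ε ℚ.* ℕtoℚ a ℚ.< ℕtoℚ (Sub.∣ A' ∣) →
  ε ℚ.* ℕtoℚ b ℚ.< ℕtoℚ (Sub.∣ B' ∣) →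
  ℚ.∣ ℕtoℚ (edgesBetween G A' B') ℚ.- d ℚ.* ℕtoℚ (Sub.∣ A' ∣ ℕ.* Sub.∣ B' ∣) ∣
    ℚ.≤ ε ℚ.* ℕtoℚ (Sub.∣ A' ∣ ℕ.* Sub.∣ B' ∣)

SuperRegular : {a b : ℕ} → ℚ → ℚ → BipGraph a b → Set
SuperRegular {a} {b} ε d G =
  Regular ε d G
  × (∀ x → ℚ.∣ ℕtoℚ (bdegA G x) ℚ.- d ℚ.* ℕtoℚ b ∣ ℚ.≤ ε ℚ.* ℕtoℚ b)
  × (∀ y → ℚ.∣ ℕtoℚ (bdegB G y) ℚ.- d ℚ.* ℕtoℚ a ∣ ℚ.≤ ε ℚ.* ℕtoℚ a)

IsCopy : {n a b : ℕ} → Graph n → BipGraph a b → (Fin n → BVert a b) → Set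
IsCopy H G φ =
  Injective _≡_ _≡_ φ × (∀ i j → adj H i j ≡ true → badj G (φ i) (φ j) ≡ true)

PackInto : {s n a b : ℕ} → (Fin s → Graph n) → BipGraph a b → Set
PackInto {s} {n} {a} {b} H G =
  Σ (Fin s → Fin n → BVert a b) λ φ →
    (∀ k → IsCopy (H k) G (φ k))
    × (∀ k l → k ≢ l → ∀ u v u' v' →
         adj (H k) u v ≡ true → adj (H l) u' v' ≡ true →
         ¬ (φ k u ≡ φ l u' × φ k v ≡ φ l v'))

{-# OPTIONS --safe #-}
-- The graphs are embedded one after another, each in what is left of G. The smaller colour class of H (without its
-- isolated vertices) goes to A, so a fixed proportion of B stays free of non-isolated vertices.
--
-- One step: place the A-side of H by a random permutation. A vertex y whose k neighbours go to the tuple t is then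
-- spread over the common neighbourhood of t with weight proportional to (|A| / deg v)^k; averaging over t shows that
-- every v ∈ B receives the right load and that any given weighting of the edges is met as often as by a random edge.
-- A second moment bound and averaging yield a single permutation for which this holds up to few exceptions, which are
-- repaired by swaps; the resulting fractional assignment is rounded by Birkhoff's theorem without raising the weight.
--
-- What has to survive is that degrees in B and common neighbourhoods of tuples in A shrink no faster than the density
-- predicts. Give each such statistic the value (predicted / actual)^Λ with Λ linear in n and let the weight of an edge
-- be the first-order effect of its deletion on the sum Ψ of these values. As the embedding uses no more weight than a
-- random edge set, log Ψ / Λ grows by at most a constant factor times the proportion of edges removed, and Ψ starts
-- polynomial in n, so every statistic stays within 1 + η of its prediction.
module Submission where

open import Defs hiding (sym)
open import Data.Bool using (Bool; true; false; if_then_else_; _∧_; _∨_; not)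
open import Data.Bool.Properties using (∧-comm; ∧-assoc; ∧-zeroʳ)
open import Data.Empty using (⊥; ⊥-elim)
open import Data.Fin using (Fin; zero; suc; _≟_; inject≤; fromℕ<)
import Data.Fin.Properties as Fin
open import Data.Fin.Subset using (Subset)
import Data.Fin.Subset as Subset
import Data.Integer as ℤ
import Data.Integer.Properties as ℤ
open import Data.List using (List; []; _∷_; _++_; map; length; filterᵇ; allFin; lookup; tabulate)
open import Data.List.Properties using (length-map; length-++; map-++; length-tabulate)
open import Data.List.Membership.Propositional using (_∈_; _∉_)
open import Data.List.Membership.Propositional.Properties using (∈-allFin; ∈-map⁺; ∈-map⁻; ∈-++⁺ˡ; ∈-++⁺ʳ; ∈-++⁻)
open import Data.List.Relation.Unary.All as All using (All; []; _∷_)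
open import Data.List.Relation.Unary.Any as Any using (Any; here; there)
open import Data.List.Relation.Unary.AllPairs using ([]; _∷_)
open import Data.List.Relation.Unary.Unique.Propositional using (Unique)
import Data.List.Relation.Unary.Unique.Propositional.Properties as Unique
open import Data.Maybe using (Maybe; just; nothing)
open import Data.Nat as ℕ using (ℕ; zero; suc; z≤n; s≤s)
import Data.Nat.Properties as ℕ
import Data.Nat.DivMod as ℕ
open import Data.Product using (Σ; ∃; _×_; _,_; proj₁; proj₂)
open import Data.Rational as ℚ using (ℚ; 0ℚ; 1ℚ; _≤_; _<_)
import Data.Rational.Properties as ℚ
import Data.Rational.Unnormalised as ℚᵘ
import Data.Rational.Unnormalised.Properties as ℚᵘ
open import Data.Sum using (_⊎_; inj₁; inj₂)
import Data.Sum.Properties as Sum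
open import Data.Vec using (Vec; []; _∷_)
import Data.Vec as Vec
import Data.Vec.Properties as Vec
open import Function using (id)
open import Function.Definitions using (Injective)
open import Level using (0ℓ)
open import Relation.Binary.PropositionalEquality using (_≡_; _≢_; refl; sym; trans; cong; cong₂; subst; subst₂; module ≡-Reasoning)
open import Relation.Nullary using (¬_; Dec; yes; no; does)
open import Relation.Nullary.Decidable using (dec-true; dec-false)
open import Tactic.RingSolver using (solve-∀)
open import Tactic.RingSolver.Core.AlmostCommutativeRing using (AlmostCommutativeRing; fromCommutativeRing)

-- The steps are too many for their errors to be added up, and regularity of what remains of G
-- cannot be re-established after each of them. Regularity is therefore used in the initial graph
-- `G₀` only: typical tuples and repair levels are defined there, and the current graph is compared
-- with `G₀` through the statistics alone. All invariants are one-sided, degrees and common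
-- neighbourhoods from below, the number of edges from above. This suffices: if no degree in B is
-- much below the average, no subset of B can have a large excess of degree, and convexity then
-- keeps the row sums of the fractional assignment close to 1. Two demands fix the exponent:
-- `(1 + h₀) ^ Λ` has to exceed the number of statistics, while `Λ` times the relative loss in one
-- step, of order `1 / n`, has to be small. The error `h` feeds back into the weight bound, so
-- removing a proportion `θ` of the edges multiplies it by `1 + M θ`. Hence `h * p ^ M` does not
-- increase, and as the density stays above `pm`, the initial precision `h₀ = hmax * pm ^ M` is
-- enough.

infixl 6 _+_ _-_
infixl 7 _*_
infixr 8 _^_
infix 8 -_

-- Opaque copies of the rational operations keep the normalisation of fractions out of type checking.
opaque
  _+_ _*_ : ℚ → ℚ → ℚ
  _+_ = ℚ._+_
  _*_ = ℚ._*_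
  -_ : ℚ → ℚ
  -_ = ℚ.-_

_-_ : ℚ → ℚ → ℚ
x - y = x + (- y)

_^_ : ℚ → ℕ → ℚ
x ^ zero = 1ℚ
x ^ suc n = x * x ^ n

ringℚ : AlmostCommutativeRing 0ℓ 0ℓ
ringℚ = fromCommutativeRing ℚ.+-*-commutativeRing isZero
  where
  isZero : ∀ x → Maybe (0ℚ ≡ x)
  isZero x with 0ℚ ℚ.≟ x
  ... | yes p = just p
  ... | no _ = nothing

2ℚ 4ℚ : ℚ
2ℚ = 1ℚ + 1ℚ
4ℚ = 2ℚ + 2ℚ

opaque
  unfolding _+_
  +-comm : ∀ x y → x + y ≡ y + x
  +-comm = ℚ.+-comm
  +-assoc : ∀ x y z → (x + y) + z ≡ x + (y + z)
  +-assoc = ℚ.+-assoc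
  +-identityˡ : ∀ x → 0ℚ + x ≡ x
  +-identityˡ = ℚ.+-identityˡ
  +-identityʳ : ∀ x → x + 0ℚ ≡ x
  +-identityʳ = ℚ.+-identityʳ
  *-comm : ∀ x y → x * y ≡ y * x
  *-comm = ℚ.*-comm
  *-assoc : ∀ x y z → (x * y) * z ≡ x * (y * z)
  *-assoc = ℚ.*-assoc
  *-identityˡ : ∀ x → 1ℚ * x ≡ x
  *-identityˡ = ℚ.*-identityˡ
  *-identityʳ : ∀ x → x * 1ℚ ≡ x
  *-identityʳ = ℚ.*-identityʳ
  *-zeroˡ : ∀ x → 0ℚ * x ≡ 0ℚ
  *-zeroˡ = ℚ.*-zeroˡ
  *-zeroʳ : ∀ x → x * 0ℚ ≡ 0ℚ
  *-zeroʳ = ℚ.*-zeroʳ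
  *-distribˡ-+ : ∀ x y z → x * (y + z) ≡ x * y + x * z
  *-distribˡ-+ = ℚ.*-distribˡ-+
  *-distribʳ-+ : ∀ x y z → (y + z) * x ≡ y * x + z * x
  *-distribʳ-+ = ℚ.*-distribʳ-+
  -‿inverse : ∀ x → x - x ≡ 0ℚ
  -‿inverse = ℚ.+-inverseʳ
  +-mono : ∀ {x y u v} → x ≤ y → u ≤ v → x + u ≤ y + v
  +-mono = ℚ.+-mono-≤
  +-mono-<-≤ : ∀ {x y u v} → x < y → u ≤ v → x + u < y + v
  +-mono-<-≤ = ℚ.+-mono-<-≤
  +-mono-≤-< : ∀ {x y u v} → x ≤ y → u < v → x + u < y + v
  +-mono-≤-< = ℚ.+-mono-≤-<
  *-monoˡ : ∀ {c x y} → 0ℚ ≤ c → x ≤ y → c * x ≤ c * y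
  *-monoˡ {c} 0≤c = ℚ.*-monoˡ-≤-nonNeg c {{ℚ.nonNegative 0≤c}}
  *-monoʳ : ∀ {c x y} → 0ℚ ≤ c → x ≤ y → x * c ≤ y * c
  *-monoʳ {c} 0≤c = ℚ.*-monoʳ-≤-nonNeg c {{ℚ.nonNegative 0≤c}}
  *-mono-< : ∀ {c x y} → 0ℚ < c → x < y → x * c < y * c
  *-mono-< {c} 0<c = ℚ.*-monoˡ-<-pos c {{ℚ.positive 0<c}}
  x+y-x : ∀ x y → x + (y - x) ≡ y
  x+y-x = solve-∀ ringℚ
  +-middle : ∀ x y u v → (x + y) + (u + v) ≡ (x + u) + (y + v)
  +-middle = solve-∀ ringℚ
  *-middle : ∀ x y u v → (x * y) * (u * v) ≡ (x * u) * (y * v)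
  *-middle = solve-∀ ringℚ
  *-swap : ∀ x y z → x * (y * z) ≡ y * (x * z)
  *-swap = solve-∀ ringℚ
  +-cancelʳ′ : ∀ x z → (x + z) - z ≡ x
  +-cancelʳ′ = solve-∀ ringℚ
  *-swap₂₃ : ∀ x y z → x * y * z ≡ x * z * y
  *-swap₂₃ = solve-∀ ringℚ
  2*≡ : ∀ x → 2ℚ * x ≡ x + x
  2*≡ = solve-∀ ringℚ

-- Order lemmas and a total inverse

≤-refl : ∀ {x} → x ≤ x
≤-refl = ℚ.≤-refl

≤-trans : ∀ {x y z} → x ≤ y → y ≤ z → x ≤ z
≤-trans = ℚ.≤-trans

≡⇒≤ : ∀ {x y} → x ≡ y → x ≤ y
≡⇒≤ refl = ℚ.≤-refl

<⇒≤ : ∀ {x y} → x < y → x ≤ y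
<⇒≤ = ℚ.<⇒≤

infixr 2 _≤⟨_⟩_ _≡⟨_⟩≤_
infix 3 _■
_≤⟨_⟩_ : ∀ x {y z} → x ≤ y → y ≤ z → x ≤ z
x ≤⟨ p ⟩ q = ≤-trans p q
_≡⟨_⟩≤_ : ∀ x {y z} → x ≡ y → y ≤ z → x ≤ z
x ≡⟨ refl ⟩≤ q = q
_■ : ∀ x → x ≤ x
x ■ = ≤-refl

≤-by : ∀ {x y} r → 0ℚ ≤ r → y ≡ x + r → x ≤ y
≤-by {x} r 0≤r refl = subst (_≤ x + r) (+-identityʳ x) (+-mono (≤-refl {x}) 0≤r)

0≤- : ∀ {x y} → x ≤ y → 0ℚ ≤ y - x
0≤- {x} {y} x≤y = subst (_≤ y - x) (-‿inverse x) (+-mono x≤y ≤-refl)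

0<- : ∀ {x y} → x < y → 0ℚ < y - x
0<- {x} {y} x<y = subst (_< y - x) (-‿inverse x) (+-mono-<-≤ x<y ≤-refl)

-≤⇒ : ∀ {x y z} → x ≤ y + z → x - z ≤ y
-≤⇒ {x} {y} {z} p = ≤-trans (+-mono p ≤-refl) (≡⇒≤ (+-cancelʳ′ y z))

-monoʳ : ∀ {x y z} → y ≤ z → x - z ≤ x - y
-monoʳ {x} {y} {z} y≤z = ≤-by (z - y) (0≤- y≤z) (lem x y z)
  where
  opaque
    unfolding _+_
    lem : ∀ x y z → x - y ≡ (x - z) + (z - y)
    lem = solve-∀ ringℚ

0≤+ : ∀ {x y} → 0ℚ ≤ x → 0ℚ ≤ y → 0ℚ ≤ x + y
0≤+ {x} {y} p q = subst (_≤ x + y) (+-identityʳ 0ℚ) (+-mono p q)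

0<+ : ∀ {x y} → 0ℚ < x → 0ℚ ≤ y → 0ℚ < x + y
0<+ {x} {y} p q = subst (_< x + y) (+-identityʳ 0ℚ) (+-mono-<-≤ p q)

0≤* : ∀ {x y} → 0ℚ ≤ x → 0ℚ ≤ y → 0ℚ ≤ x * y
0≤* {x} {y} p q = subst (_≤ x * y) (*-zeroʳ x) (*-monoˡ p q)

0<* : ∀ {x y} → 0ℚ < x → 0ℚ < y → 0ℚ < x * y
0<* {x} {y} p q = subst (_< x * y) (*-zeroˡ y) (*-mono-< q p)

*-mono : ∀ {x y u v} → 0ℚ ≤ x → 0ℚ ≤ v → x ≤ y → u ≤ v → x * u ≤ y * v
*-mono 0≤x 0≤v x≤y u≤v = ≤-trans (*-monoˡ 0≤x u≤v) (*-monoʳ 0≤v x≤y)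

x≤x+y : ∀ {x y} → 0ℚ ≤ y → x ≤ x + y
x≤x+y {x} {y} p = ≤-by y p refl

y≤x+y : ∀ {x y} → 0ℚ ≤ x → y ≤ x + y
y≤x+y {x} {y} p = ≤-by x p (+-comm x y)

x-y≤x : ∀ {x y} → 0ℚ ≤ y → x - y ≤ x
x-y≤x {x} {y} p = -≤⇒ (x≤x+y p)

≮⇒≥ : ∀ {x y} → ¬ x < y → y ≤ x
≮⇒≥ = ℚ.≮⇒≥

≤⇒≯ : ∀ {x y} → x ≤ y → ¬ y < x
≤⇒≯ x≤y y<x = ℚ.<-irrefl refl (ℚ.<-≤-trans y<x x≤y)

*-cancelʳ : ∀ {c x y} → 0ℚ < c → x * c ≤ y * c → x ≤ y
*-cancelʳ 0<c p = ≮⇒≥ λ y<x → ≤⇒≯ p (*-mono-< 0<c y<x)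

*-cancelˡ : ∀ {c x y} → 0ℚ < c → c * x ≤ c * y → x ≤ y
*-cancelˡ {c} {x} {y} 0<c p = *-cancelʳ 0<c (subst₂ _≤_ (*-comm c x) (*-comm c y) p)

opaque
  -- Extended by 0 to the non-positive numbers, so that `0≤inv` holds without a hypothesis.
  inv : ℚ → ℚ
  inv x with 0ℚ ℚ.<? x
  ... | yes p = ℚ.1/_ x {{ℚ.pos⇒nonZero x {{ℚ.positive p}}}}
  ... | no _ = 0ℚ

opaque
  unfolding inv _+_
  *-inv : ∀ {x} → 0ℚ < x → x * inv x ≡ 1ℚ
  *-inv {x} 0<x with 0ℚ ℚ.<? x
  ... | yes p = ℚ.*-inverseʳ x {{ℚ.pos⇒nonZero x {{ℚ.positive p}}}}
  ... | no ¬p = ⊥-elim (¬p 0<x)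

  0≤inv : ∀ x → 0ℚ ≤ inv x
  0≤inv x with 0ℚ ℚ.<? x
  ... | yes p = <⇒≤ (ℚ.positive⁻¹ _ {{ℚ.1/pos⇒pos x {{ℚ.positive p}}}})
  ... | no ¬p = ≤-refl

  0<inv : ∀ {x} → 0ℚ < x → 0ℚ < inv x
  0<inv {x} 0<x with 0ℚ ℚ.<? x
  ... | yes p = ℚ.positive⁻¹ _ {{ℚ.1/pos⇒pos x {{ℚ.positive p}}}}
  ... | no ¬p = ⊥-elim (¬p 0<x)

*-inv-cancel : ∀ {y} x → 0ℚ < y → x * y * inv y ≡ x
*-inv-cancel {y} x 0<y = trans (*-assoc x y (inv y)) (trans (cong (x *_) (*-inv 0<y)) (*-identityʳ x))

*-inv-cancel′ : ∀ {y} x → 0ℚ < y → x * inv y * y ≡ x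
*-inv-cancel′ {y} x 0<y = trans (*-swap₂₃ x (inv y) y) (*-inv-cancel x 0<y)

÷-≤ : ∀ {x y z} → 0ℚ < y → x ≤ z * y → x * inv y ≤ z
÷-≤ {x} {y} {z} 0<y p = ≤-trans (*-monoʳ (0≤inv y) p) (≡⇒≤ (*-inv-cancel z 0<y))

≤-÷ : ∀ {x y z} → 0ℚ < y → x * y ≤ z → x ≤ z * inv y
≤-÷ {x} {y} {z} 0<y p = ≤-trans (≡⇒≤ (sym (*-inv-cancel x 0<y))) (*-monoʳ (0≤inv y) p)

÷-≤⁻¹ : ∀ {x y z} → 0ℚ < y → x * inv y ≤ z → x ≤ z * y
÷-≤⁻¹ {x} {y} {z} 0<y p = ≤-trans (≡⇒≤ (sym (*-inv-cancel′ x 0<y))) (*-monoʳ (<⇒≤ 0<y) p)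

inv-anti : ∀ {x y} → 0ℚ < x → x ≤ y → inv y ≤ inv x
inv-anti {x} {y} 0<x x≤y =
  subst₂ _≤_ (*-identityˡ (inv y)) (*-identityˡ (inv x))
    (÷-≤ 0<y (≤-trans (≡⇒≤ (sym (*-inv 0<x))) (≤-trans (*-monoʳ (0≤inv x) x≤y) (≡⇒≤ (lem (inv x))))))
  where
  0<y = ℚ.<-≤-trans 0<x x≤y
  lem : ∀ z → y * z ≡ 1ℚ * z * y
  lem z = trans (*-comm y z) (cong (_* y) (sym (*-identityˡ z)))

opaque
  unfolding _+_
  0≤1 : 0ℚ ≤ 1ℚ
  0≤1 = ℚ.*≤* (ℤ.+≤+ z≤n)
  0<1 : 0ℚ < 1ℚ
  0<1 = ℚ.*<* (ℤ.+<+ (s≤s z≤n))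

0<2 : 0ℚ < 2ℚ
0<2 = 0<+ 0<1 0≤1
0≤2 : 0ℚ ≤ 2ℚ
0≤2 = <⇒≤ 0<2
0<4 : 0ℚ < 4ℚ
0<4 = 0<+ 0<2 0≤2
0≤4 : 0ℚ ≤ 4ℚ
0≤4 = <⇒≤ 0<4

-- Natural numbers inside the rationals

opaque
  ⟦_⟧ : ℕ → ℚ
  ⟦ n ⟧ = ℕtoℚ n

opaque
  unfolding ⟦_⟧ _+_
  ⟦0⟧ : ⟦ 0 ⟧ ≡ 0ℚ
  ⟦0⟧ = refl

  ⟦suc⟧ : ∀ n → ⟦ suc n ⟧ ≡ 1ℚ + ⟦ n ⟧
  ⟦suc⟧ n = ℚ.toℚᵘ-injective
    (ℚᵘ.≃-trans (ℚ.toℚᵘ-fromℚᵘ (ℚᵘ.mkℚᵘ (ℤ.+ suc n) 0))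
    (ℚᵘ.≃-trans (ℚᵘ.*≡* (cong (λ i → i ℤ.* ℤ.1ℤ) (cong ℤ.suc (sym (ℤ.*-identityʳ (ℤ.+ n))))))
    (ℚᵘ.≃-trans (ℚᵘ.+-cong (ℚᵘ.≃-refl {ℚ.toℚᵘ 1ℚ}) (ℚᵘ.≃-sym (ℚ.toℚᵘ-fromℚᵘ (ℚᵘ.mkℚᵘ (ℤ.+ n) 0))))
    (ℚᵘ.≃-sym (ℚ.toℚᵘ-homo-+ 1ℚ (ℕtoℚ n))))))

⟦1⟧ : ⟦ 1 ⟧ ≡ 1ℚ
⟦1⟧ = trans (⟦suc⟧ 0) (trans (cong (1ℚ +_) ⟦0⟧) (+-identityʳ 1ℚ))

⟦+⟧ : ∀ m n → ⟦ m ℕ.+ n ⟧ ≡ ⟦ m ⟧ + ⟦ n ⟧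
⟦+⟧ zero n = sym (trans (cong (_+ ⟦ n ⟧) ⟦0⟧) (+-identityˡ _))
⟦+⟧ (suc m) n = trans (⟦suc⟧ (m ℕ.+ n)) (trans (cong (1ℚ +_) (⟦+⟧ m n))
  (trans (sym (+-assoc 1ℚ ⟦ m ⟧ ⟦ n ⟧)) (cong (_+ ⟦ n ⟧) (sym (⟦suc⟧ m)))))

⟦*⟧ : ∀ m n → ⟦ m ℕ.* n ⟧ ≡ ⟦ m ⟧ * ⟦ n ⟧
⟦*⟧ zero n = trans ⟦0⟧ (sym (trans (cong (_* ⟦ n ⟧) ⟦0⟧) (*-zeroˡ _)))
⟦*⟧ (suc m) n = trans (⟦+⟧ n (m ℕ.* n)) (trans (cong₂ _+_ (sym (*-identityˡ ⟦ n ⟧)) (⟦*⟧ m n))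
  (trans (sym (*-distribʳ-+ ⟦ n ⟧ 1ℚ ⟦ m ⟧)) (cong (_* ⟦ n ⟧) (sym (⟦suc⟧ m)))))

0≤⟦⟧ : ∀ n → 0ℚ ≤ ⟦ n ⟧
0≤⟦⟧ zero = ≡⇒≤ (sym ⟦0⟧)
0≤⟦⟧ (suc n) = subst (0ℚ ≤_) (sym (⟦suc⟧ n)) (0≤+ 0≤1 (0≤⟦⟧ n))

0<⟦suc⟧ : ∀ n → 0ℚ < ⟦ suc n ⟧
0<⟦suc⟧ n = subst (0ℚ <_) (sym (⟦suc⟧ n)) (0<+ 0<1 (0≤⟦⟧ n))

⟦⟧-mono : ∀ {m n} → m ℕ.≤ n → ⟦ m ⟧ ≤ ⟦ n ⟧
⟦⟧-mono {n = n} z≤n = ≤-trans (≡⇒≤ ⟦0⟧) (0≤⟦⟧ n)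
⟦⟧-mono {suc m} {suc n} (s≤s p) = subst₂ _≤_ (sym (⟦suc⟧ m)) (sym (⟦suc⟧ n)) (+-mono ≤-refl (⟦⟧-mono p))

0<⟦⟧ : ∀ {n} → 1 ℕ.≤ n → 0ℚ < ⟦ n ⟧
0<⟦⟧ {suc n} _ = 0<⟦suc⟧ n

1≤⟦⟧ : ∀ {n} → 1 ℕ.≤ n → 1ℚ ≤ ⟦ n ⟧
1≤⟦⟧ {n} p = subst (_≤ ⟦ n ⟧) ⟦1⟧ (⟦⟧-mono p)

⟦∸⟧ : ∀ {m n} → n ℕ.≤ m → ⟦ m ℕ.∸ n ⟧ ≡ ⟦ m ⟧ - ⟦ n ⟧
⟦∸⟧ {m} {n} p = sym (trans (cong (λ k → ⟦ k ⟧ - ⟦ n ⟧) (sym (ℕ.m∸n+n≡m p)))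
  (trans (cong (_- ⟦ n ⟧) (⟦+⟧ (m ℕ.∸ n) n)) (+-cancelʳ′ _ _)))

opaque
  unfolding ⟦_⟧ _+_
  archimedean : ∀ x → ∃ λ n → x ≤ ⟦ n ⟧
  archimedean x@(ℚ.mkℚ n d-1 _) = ℤ.∣ n ∣ , ℚ.toℚᵘ-cancel-≤
    (ℚᵘ.≤-respʳ-≃ (ℚᵘ.≃-sym (ℚ.toℚᵘ-fromℚᵘ (ℚᵘ.mkℚᵘ (ℤ.+ ℤ.∣ n ∣) 0)))
      (ℚᵘ.*≤* (ℤ.≤-trans (ℤ.≤-reflexive (ℤ.*-identityʳ n)) (bound n))))
    where
    bound : ∀ n → n ℤ.≤ (ℤ.+ ℤ.∣ n ∣) ℤ.* (ℤ.+ suc d-1)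
    bound (ℤ.+ m) = ℤ.≤-trans (ℤ.+≤+ (ℕ.m≤m*n m (suc d-1))) (ℤ.≤-reflexive (ℤ.pos-* m (suc d-1)))
    bound ℤ.-[1+ m ] = ℤ.≤-trans ℤ.-≤+ (ℤ.≤-reflexive (ℤ.pos-* (suc m) (suc d-1)))

-- Powers

0≤^ : ∀ {x} n → 0ℚ ≤ x → 0ℚ ≤ x ^ n
0≤^ zero p = 0≤1
0≤^ (suc n) p = 0≤* p (0≤^ n p)

0<^ : ∀ {x} n → 0ℚ < x → 0ℚ < x ^ n
0<^ zero p = 0<1
0<^ (suc n) p = 0<* p (0<^ n p)

^-mono : ∀ {x y} n → 0ℚ ≤ x → x ≤ y → x ^ n ≤ y ^ n
^-mono zero p q = ≤-refl
^-mono (suc n) p q = *-mono p (0≤^ n (≤-trans p q)) q (^-mono n p q)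

^-mono-< : ∀ {x y} n → 0ℚ ≤ x → x < y → x ^ suc n < y ^ suc n
^-mono-< {x} {y} n 0≤x x<y = ℚ.≤-<-trans (*-monoˡ 0≤x (^-mono n 0≤x (<⇒≤ x<y))) (*-mono-< (0<^ n (ℚ.≤-<-trans 0≤x x<y)) x<y)

^-cancel : ∀ {x y} n → 0ℚ ≤ y → x ^ suc n ≤ y ^ suc n → x ≤ y
^-cancel n 0≤y p = ≮⇒≥ λ y<x → ≤⇒≯ p (^-mono-< n 0≤y y<x)

^-distrib-* : ∀ x y n → (x * y) ^ n ≡ x ^ n * y ^ n
^-distrib-* x y zero = sym (*-identityˡ 1ℚ)
^-distrib-* x y (suc n) = trans (cong (x * y *_) (^-distrib-* x y n)) (*-middle x y (x ^ n) (y ^ n))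

1^ : ∀ n → 1ℚ ^ n ≡ 1ℚ
1^ zero = refl
1^ (suc n) = trans (*-identityˡ _) (1^ n)

^-+ : ∀ x m n → x ^ (m ℕ.+ n) ≡ x ^ m * x ^ n
^-+ x zero n = sym (*-identityˡ _)
^-+ x (suc m) n = trans (cong (x *_) (^-+ x m n)) (sym (*-assoc x _ _))

^-* : ∀ x m n → x ^ (m ℕ.* n) ≡ (x ^ n) ^ m
^-* x zero n = refl
^-* x (suc m) n = trans (^-+ x n (m ℕ.* n)) (cong (x ^ n *_) (^-* x m n))

^-≤1 : ∀ {x} n → 0ℚ ≤ x → x ≤ 1ℚ → x ^ n ≤ 1ℚ
^-≤1 n p q = ≤-trans (^-mono n p q) (≡⇒≤ (1^ n))

1≤^ : ∀ {x} n → 1ℚ ≤ x → 1ℚ ≤ x ^ n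
1≤^ n p = ≤-trans (≡⇒≤ (sym (1^ n))) (^-mono n 0≤1 p)

^-anti : ∀ {x m n} → 0ℚ ≤ x → x ≤ 1ℚ → m ℕ.≤ n → x ^ n ≤ x ^ m
^-anti {n = n} p q z≤n = ^-≤1 n p q
^-anti p q (s≤s r) = *-monoˡ p (^-anti p q r)

^-monoʳ : ∀ {x m n} → 1ℚ ≤ x → m ℕ.≤ n → x ^ m ≤ x ^ n
^-monoʳ {n = n} p z≤n = 1≤^ n p
^-monoʳ p (s≤s r) = *-monoˡ (≤-trans 0≤1 p) (^-monoʳ p r)

inv-^ : ∀ {x} n → 0ℚ < x → x ^ n * inv x ^ n ≡ 1ℚ
inv-^ {x} n p = trans (sym (^-distrib-* x (inv x) n)) (trans (cong (_^ n) (*-inv p)) (1^ n))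

-- In the induction step the two sides differ by `n (x - 1)²`, which covers `x < 1` as well.
bernoulli : ∀ {x} n → 0ℚ ≤ x → 1ℚ + ⟦ n ⟧ * (x - 1ℚ) ≤ x ^ n
bernoulli {x} zero p = ≡⇒≤ (trans (cong (λ z → 1ℚ + z * (x - 1ℚ)) ⟦0⟧) (trans (cong (1ℚ +_) (*-zeroˡ _)) (+-identityʳ 1ℚ)))
bernoulli {x} (suc n) p =
  ≤-trans (≤-by (⟦ n ⟧ * ((x - 1ℚ) * (x - 1ℚ))) (0≤* (0≤⟦⟧ n) (sq x))
     (subst (λ z → x * (1ℚ + ⟦ n ⟧ * (x - 1ℚ)) ≡ 1ℚ + z * (x - 1ℚ) + ⟦ n ⟧ * ((x - 1ℚ) * (x - 1ℚ))) (sym (⟦suc⟧ n)) (lem x ⟦ n ⟧)))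
    (*-monoˡ p (bernoulli n p))
  where
  opaque
    unfolding _+_
    lem : ∀ x n → x * (1ℚ + n * (x - 1ℚ)) ≡ 1ℚ + (1ℚ + n) * (x - 1ℚ) + n * ((x - 1ℚ) * (x - 1ℚ))
    lem = solve-∀ ringℚ
    neg : ∀ x → (x - 1ℚ) * (x - 1ℚ) ≡ (1ℚ - x) * (1ℚ - x)
    neg = solve-∀ ringℚ
  sq : ∀ x → 0ℚ ≤ (x - 1ℚ) * (x - 1ℚ)
  sq x with ℚ.≤-total 1ℚ x
  ... | inj₁ q = 0≤* (0≤- q) (0≤- q)
  ... | inj₂ q = subst (0ℚ ≤_) (sym (neg x)) (0≤* (0≤- q) (0≤- q))

0≤square : ∀ x → 0ℚ ≤ x * x
0≤square x with ℚ.≤-total 0ℚ x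
... | inj₁ q = 0≤* q q
... | inj₂ q = subst (0ℚ ≤_) (lem x) (0≤* (0≤- q) (0≤- q))
  where
  opaque
    unfolding _+_
    lem : ∀ x → (0ℚ - x) * (0ℚ - x) ≡ x * x
    lem = solve-∀ ringℚ

bernoulli⁺ : ∀ {x} n → 0ℚ ≤ x → 1ℚ + ⟦ n ⟧ * x ≤ (1ℚ + x) ^ n
bernoulli⁺ {x} n p = ≤-trans (≡⇒≤ (cong (λ z → 1ℚ + ⟦ n ⟧ * z) (sym (lem x)))) (bernoulli n (0≤+ 0≤1 p))
  where
  opaque
    unfolding _+_
    lem : ∀ x → (1ℚ + x) - 1ℚ ≡ x
    lem = solve-∀ ringℚ

bernoulli⁻ : ∀ {x} n → x ≤ 1ℚ → 1ℚ - ⟦ n ⟧ * x ≤ (1ℚ - x) ^ n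
bernoulli⁻ {x} n p = ≤-trans (≡⇒≤ (lem ⟦ n ⟧ x)) (bernoulli n (0≤- p))
  where
  opaque
    unfolding _+_
    lem : ∀ n x → 1ℚ - n * x ≡ 1ℚ + n * ((1ℚ - x) - 1ℚ)
    lem = solve-∀ ringℚ

-- Convexity: on [0, 1] the power lies below its chord, whose slope is `2 ^ n - 1`.
1+x^≤ : ∀ {x} n → 0ℚ ≤ x → x ≤ 1ℚ → (1ℚ + x) ^ n ≤ 1ℚ + (2ℚ ^ n - 1ℚ) * x
1+x^≤ {x} zero p q = x≤x+y (0≤* (0≤- ≤-refl) p)
1+x^≤ {x} (suc n) p q =
  ≤-trans (*-monoˡ (0≤+ 0≤1 p) (1+x^≤ n p q))
    (≤-by ((2ℚ ^ n - 1ℚ) * (x * (1ℚ - x))) (0≤* (0≤- (1≤^ n (x≤x+y 0≤1))) (0≤* p (0≤- q))) (lem x (2ℚ ^ n)))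
  where
  opaque
    unfolding _+_
    lem : ∀ x t → 1ℚ + ((1ℚ + 1ℚ) * t - 1ℚ) * x ≡ (1ℚ + x) * (1ℚ + (t - 1ℚ) * x) + (t - 1ℚ) * (x * (1ℚ - x))
    lem = solve-∀ ringℚ

-- Finite sums and indicators

opaque
  ∑ : ∀ {n} → (Fin n → ℚ) → ℚ
  ∑ {zero} f = 0ℚ
  ∑ {suc n} f = f zero + ∑ (λ i → f (suc i))

opaque
  unfolding ∑
  ∑-cong : ∀ {n} {f g : Fin n → ℚ} → (∀ i → f i ≡ g i) → ∑ f ≡ ∑ g
  ∑-cong {zero} p = refl
  ∑-cong {suc n} p = cong₂ _+_ (p zero) (∑-cong (λ i → p (suc i)))

opaque
  unfolding ∑
  ∑-mono : ∀ {n} {f g : Fin n → ℚ} → (∀ i → f i ≤ g i) → ∑ f ≤ ∑ g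
  ∑-mono {zero} p = ≤-refl
  ∑-mono {suc n} p = +-mono (p zero) (∑-mono (λ i → p (suc i)))

opaque
  unfolding ∑
  ∑-0 : ∀ {n} → ∑ {n} (λ _ → 0ℚ) ≡ 0ℚ
  ∑-0 {zero} = refl
  ∑-0 {suc n} = trans (+-identityˡ _) (∑-0 {n})

opaque
  unfolding ∑
  0≤∑ : ∀ {n} {f : Fin n → ℚ} → (∀ i → 0ℚ ≤ f i) → 0ℚ ≤ ∑ f
  0≤∑ {n} p = ≤-trans (≡⇒≤ (sym (∑-0 {n}))) (∑-mono p)

opaque
  unfolding ∑
  ∑-+ : ∀ {n} (f g : Fin n → ℚ) → ∑ (λ i → f i + g i) ≡ ∑ f + ∑ g
  ∑-+ {zero} f g = sym (+-identityˡ 0ℚ)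
  ∑-+ {suc n} f g = trans (cong (f zero + g zero +_) (∑-+ (λ i → f (suc i)) (λ i → g (suc i)))) (+-middle _ _ _ _)

opaque
  unfolding ∑
  ∑-*ˡ : ∀ {n} c (f : Fin n → ℚ) → ∑ (λ i → c * f i) ≡ c * ∑ f
  ∑-*ˡ {zero} c f = sym (*-zeroʳ c)
  ∑-*ˡ {suc n} c f = trans (cong (c * f zero +_) (∑-*ˡ c (λ i → f (suc i)))) (sym (*-distribˡ-+ c _ _))

∑-*ʳ : ∀ {n} c (f : Fin n → ℚ) → ∑ (λ i → f i * c) ≡ ∑ f * c
∑-*ʳ c f = trans (∑-cong (λ i → *-comm (f i) c)) (trans (∑-*ˡ c f) (*-comm c (∑ f)))

opaque
  unfolding ∑
  ∑-swap : ∀ {m n} (f : Fin m → Fin n → ℚ) → ∑ (λ i → ∑ (f i)) ≡ ∑ (λ j → ∑ (λ i → f i j))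
  ∑-swap {zero} {n} f = sym (∑-0 {n})
  ∑-swap {suc m} f = trans (cong (∑ (f zero) +_) (∑-swap (λ i → f (suc i)))) (sym (∑-+ (f zero) _))

opaque
  unfolding ∑
  ∑-const : ∀ n c → ∑ {n} (λ _ → c) ≡ ⟦ n ⟧ * c
  ∑-const zero c = sym (trans (cong (_* c) ⟦0⟧) (*-zeroˡ c))
  ∑-const (suc n) c = trans (cong₂ _+_ (sym (*-identityˡ c)) (∑-const n c)) (trans (sym (*-distribʳ-+ c 1ℚ ⟦ n ⟧)) (cong (_* c) (sym (⟦suc⟧ n))))

opaque
  unfolding ∑
  f≤∑ : ∀ {n} {f : Fin n → ℚ} → (∀ i → 0ℚ ≤ f i) → ∀ i → f i ≤ ∑ f
  f≤∑ p zero = x≤x+y (0≤∑ (λ i → p (suc i)))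
  f≤∑ p (suc i) = ≤-trans (f≤∑ (λ i → p (suc i)) i) (y≤x+y (p zero))

ind : Bool → ℚ
ind true = 1ℚ
ind false = 0ℚ

0≤ind : ∀ b → 0ℚ ≤ ind b
0≤ind true = 0≤1
0≤ind false = ≤-refl

ind≤1 : ∀ b → ind b ≤ 1ℚ
ind≤1 true = ≤-refl
ind≤1 false = 0≤1

ind-∧ : ∀ p q → ind (p ∧ q) ≡ ind p * ind q
ind-∧ true q = sym (*-identityˡ _)
ind-∧ false q = sym (*-zeroˡ _)

ind-not : ∀ p → ind p + ind (not p) ≡ 1ℚ
ind-not true = +-identityʳ 1ℚ
ind-not false = +-identityˡ 1ℚ

ind-mono : ∀ {p q} → (p ≡ true → q ≡ true) → ind p ≤ ind q
ind-mono {false} {q} f = 0≤ind q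
ind-mono {true} {q} f = ≡⇒≤ (cong ind (sym (f refl)))

ind-idem : ∀ p → ind p * ind p ≡ ind p
ind-idem true = *-identityˡ 1ℚ
ind-idem false = *-zeroˡ 0ℚ

ind-cong : ∀ p {x y} → (p ≡ true → x ≡ y) → ind p * x ≡ ind p * y
ind-cong true f = cong (1ℚ *_) (f refl)
ind-cong false {x} {y} f = trans (*-zeroˡ x) (sym (*-zeroˡ y))

ind-mono-* : ∀ p {x y} → (p ≡ true → x ≤ y) → ind p * x ≤ ind p * y
ind-mono-* true f = *-monoˡ 0≤1 (f refl)
ind-mono-* false {x} {y} f = ≡⇒≤ (trans (*-zeroˡ x) (sym (*-zeroˡ y)))

ind*≤ : ∀ p {x y} → 0ℚ ≤ y → (p ≡ true → x ≤ y) → ind p * x ≤ y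
ind*≤ true {x} 0≤y f = ≤-trans (≡⇒≤ (*-identityˡ x)) (f refl)
ind*≤ false {x} 0≤y f = ≤-trans (≡⇒≤ (*-zeroˡ x)) 0≤y

ind*≤′ : ∀ p {x} → 0ℚ ≤ x → ind p * x ≤ x
ind*≤′ p 0≤x = ind*≤ p 0≤x (λ _ → ≤-refl)

true≢false : ∀ {b} → b ≡ true → b ≢ false
true≢false refl ()

caseᵇ : ∀ {P : Set} (b : Bool) → (b ≡ true → P) → (b ≡ false → P) → P
caseᵇ true f g = f refl
caseᵇ false f g = g refl

eqF : ∀ {n} → Fin n → Fin n → Bool
eqF i j = does (i ≟ j)

eqF-refl : ∀ {n} (i : Fin n) → eqF i i ≡ true
eqF-refl i = dec-true (i ≟ i) refl

eqF⇒≡ : ∀ {n} {i j : Fin n} → eqF i j ≡ true → i ≡ j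
eqF⇒≡ {i = i} {j} p with i ≟ j
... | yes q = q
... | no _ with () ← p

≢⇒eqF : ∀ {n} {i j : Fin n} → i ≢ j → eqF i j ≡ false
≢⇒eqF {i = i} {j} p = dec-false (i ≟ j) p

eqF-sym : ∀ {n} (i j : Fin n) → eqF i j ≡ eqF j i
eqF-sym i j with i ≟ j | j ≟ i
... | yes _ | yes _ = refl
... | no _ | no _ = refl
... | yes p | no q = ⊥-elim (q (sym p))
... | no q | yes p = ⊥-elim (q (sym p))

opaque
  unfolding ∑
  ∑-at : ∀ {n} (i : Fin n) (f : Fin n → ℚ) → ∑ (λ j → ind (eqF i j) * f j) ≡ f i
  ∑-at {suc n} zero f = trans (cong₂ _+_ (*-identityˡ _) (trans (∑-cong (λ j → *-zeroˡ (f (suc j)))) (∑-0 {n}))) (+-identityʳ _)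
  ∑-at {suc n} (suc i) f = trans (cong₂ _+_ (*-zeroˡ _) (trans (∑-cong (λ j → cong (λ b → ind b * f (suc j)) (lem j))) (∑-at i (λ j → f (suc j))))) (+-identityˡ _)
    where
    lem : ∀ j → eqF (suc i) (suc j) ≡ eqF i j
    lem j with i ≟ j
    ... | yes _ = refl
    ... | no _ = refl

∑-at₁ : ∀ {n} (i : Fin n) → ∑ (λ j → ind (eqF i j)) ≡ 1ℚ
∑-at₁ i = trans (∑-cong (λ j → sym (*-identityʳ _))) (∑-at i (λ _ → 1ℚ))

opaque
  unfolding ∑
  ∑-ind≤1 : ∀ {n} (P : Fin n → Bool) → (∀ i j → P i ≡ true → P j ≡ true → i ≡ j) → ∑ (λ i → ind (P i)) ≤ 1ℚ
  ∑-ind≤1 {zero} P uniq = 0≤1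
  ∑-ind≤1 {suc n} P uniq with P zero in eq
  ... | false = ≤-trans (≡⇒≤ (+-identityˡ _)) (∑-ind≤1 (λ i → P (suc i)) (λ i j p q → Fin.suc-injective (uniq (suc i) (suc j) p q)))
  ... | true = ≡⇒≤ (trans (cong (1ℚ +_) (trans (∑-cong none) (∑-0 {n}))) (+-identityʳ 1ℚ))
    where
    none : ∀ i → ind (P (suc i)) ≡ 0ℚ
    none i with P (suc i) in eq′
    ... | false = refl
    ... | true with () ← uniq zero (suc i) eq eq′

∑-injective : ∀ {m n} {σ : Fin m → Fin n} → Injective _≡_ _≡_ σ → {f : Fin n → ℚ} → (∀ i → 0ℚ ≤ f i) → ∑ (λ i → f (σ i)) ≤ ∑ f
∑-injective {σ = σ} inj {f} 0≤f =
  ∑ (λ i → f (σ i)) ≡⟨ ∑-cong (λ i → sym (∑-at (σ i) f)) ⟩≤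
  ∑ (λ i → ∑ (λ j → ind (eqF (σ i) j) * f j)) ≡⟨ ∑-swap _ ⟩≤
  ∑ (λ j → ∑ (λ i → ind (eqF (σ i) j) * f j)) ≡⟨ ∑-cong (λ j → ∑-*ʳ (f j) _) ⟩≤
  ∑ (λ j → ∑ (λ i → ind (eqF (σ i) j)) * f j) ≤⟨ ∑-mono (λ j → *-monoʳ (0≤f j) (∑-ind≤1 _ (λ i i′ p q → inj (trans (eqF⇒≡ p) (sym (eqF⇒≡ q)))))) ⟩
  ∑ (λ j → 1ℚ * f j) ≡⟨ ∑-cong (λ j → *-identityˡ (f j)) ⟩≤
  ∑ f ■

∑-involution : ∀ {n} {π : Fin n → Fin n} → (∀ i → π (π i) ≡ i) → {f : Fin n → ℚ} → ∑ (λ i → f (π i)) ≡ ∑ f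
∑-involution {n} {π} inv² {f} =
  begin
  ∑ (λ i → f (π i)) ≡⟨ ∑-cong (λ i → sym (∑-at (π i) f)) ⟩
  ∑ (λ i → ∑ (λ j → ind (eqF (π i) j) * f j)) ≡⟨ ∑-swap (λ i j → ind (eqF (π i) j) * f j) ⟩
  ∑ (λ j → ∑ (λ i → ind (eqF (π i) j) * f j)) ≡⟨ ∑-cong (λ j → ∑-cong (λ i → cong (λ b → ind b * f j) (lem i j))) ⟩
  ∑ (λ j → ∑ (λ i → ind (eqF (π j) i) * f j)) ≡⟨ ∑-cong (λ j → ∑-at (π j) (λ _ → f j)) ⟩
  ∑ f ∎
  where
  open ≡-Reasoning
  lem : ∀ i j → eqF (π i) j ≡ eqF (π j) i
  lem i j with π i ≟ j | π j ≟ i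
  ... | yes _ | yes _ = refl
  ... | no _ | no _ = refl
  ... | yes p | no q = ⊥-elim (q (trans (cong π (sym p)) (inv² i)))
  ... | no q | yes p = ⊥-elim (q (trans (cong π (sym p)) (inv² j)))

anyF : ∀ {n} → (Fin n → Bool) → Bool
anyF {zero} P = false
anyF {suc n} P = P zero ∨ anyF (λ i → P (suc i))

anyF⁺ : ∀ {n} {P : Fin n → Bool} i → P i ≡ true → anyF P ≡ true
anyF⁺ {P = P} zero p rewrite p = refl
anyF⁺ {P = P} (suc i) p with P zero
... | true = refl
... | false = anyF⁺ i p

anyF⁻ : ∀ {n} {P : Fin n → Bool} → anyF P ≡ true → ∃ λ i → P i ≡ true
anyF⁻ {suc n} {P} p with P zero in eq
... | true = zero , eq
... | false with i , q ← anyF⁻ {n} p = suc i , q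

anyF-false : ∀ {n} {P : Fin n → Bool} → anyF P ≡ false → ∀ i → P i ≡ false
anyF-false {P = P} p i with P i in eq
... | false = refl
... | true = ⊥-elim (true≢false (anyF⁺ {P = P} i eq) p)

ind-∨ : ∀ p q → ind (p ∨ q) ≤ ind p + ind q
ind-∨ true q = x≤x+y (0≤ind q)
ind-∨ false q = ≡⇒≤ (sym (+-identityˡ _))

opaque
  unfolding ∑
  ind-anyF : ∀ {n} (P : Fin n → Bool) → ind (anyF P) ≤ ∑ (λ i → ind (P i))
  ind-anyF {zero} P = ≤-refl
  ind-anyF {suc n} P = ≤-trans (ind-∨ (P zero) _) (+-mono ≤-refl (ind-anyF (λ i → P (suc i))))

∑-ind≤ : ∀ {n} (P : Fin n → Bool) → ∑ (λ i → ind (P i)) ≤ ⟦ n ⟧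
∑-ind≤ {n} P = ≤-trans (∑-mono (λ i → ind≤1 (P i))) (≡⇒≤ (trans (∑-const n 1ℚ) (*-identityʳ _)))

opaque
  unfolding ∑
  ∃-false : ∀ {n} (P : Fin n → Bool) → ∑ (λ i → ind (P i)) < ⟦ n ⟧ → ∃ λ i → P i ≡ false
  ∃-false {zero} P p = ⊥-elim (ℚ.<-irrefl refl (subst (0ℚ <_) ⟦0⟧ p))
  ∃-false {suc n} P p with P zero in eq
  ... | false = zero , eq
  ... | true with ∑ (λ i → ind (P (suc i))) ℚ.<? ⟦ n ⟧
  ...   | yes q with i , r ← ∃-false (λ i → P (suc i)) q = suc i , r
  ...   | no ¬q = ⊥-elim (≤⇒≯ (≤-trans (≡⇒≤ (⟦suc⟧ n)) (+-mono (≤-refl {1ℚ}) (≮⇒≥ ¬q))) p)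

opaque
  unfolding ∑
  ⟦sumFin⟧ : ∀ {n} (f : Fin n → ℕ) → ⟦ sumFin f ⟧ ≡ ∑ (λ i → ⟦ f i ⟧)
  ⟦sumFin⟧ {zero} f = ⟦0⟧
  ⟦sumFin⟧ {suc n} f = trans (⟦+⟧ (f zero) _) (cong (⟦ f zero ⟧ +_) (⟦sumFin⟧ (λ i → f (suc i))))

⟦b2n⟧ : ∀ b → ⟦ b2n b ⟧ ≡ ind b
⟦b2n⟧ true = ⟦1⟧
⟦b2n⟧ false = ⟦0⟧

-- Sums over lists

∑L : {A : Set} → List A → (A → ℚ) → ℚ
∑L [] f = 0ℚ
∑L (x ∷ xs) f = f x + ∑L xs f

∑L-cong : {A : Set} (xs : List A) {f g : A → ℚ} → (∀ x → f x ≡ g x) → ∑L xs f ≡ ∑L xs g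
∑L-cong [] p = refl
∑L-cong (x ∷ xs) p = cong₂ _+_ (p x) (∑L-cong xs p)

∑L-cong∈ : ∀ {A : Set} (xs : List A) {f g : A → ℚ} → (∀ x → x ∈ xs → f x ≡ g x) → ∑L xs f ≡ ∑L xs g
∑L-cong∈ [] p = refl
∑L-cong∈ (x ∷ xs) p = cong₂ _+_ (p x (here refl)) (∑L-cong∈ xs (λ y q → p y (there q)))

∑L-mono : {A : Set} (xs : List A) {f g : A → ℚ} → (∀ x → x ∈ xs → f x ≤ g x) → ∑L xs f ≤ ∑L xs g
∑L-mono [] p = ≤-refl
∑L-mono (x ∷ xs) p = +-mono (p x (here refl)) (∑L-mono xs (λ y q → p y (there q)))

0≤∑L : {A : Set} (xs : List A) {f : A → ℚ} → (∀ x → 0ℚ ≤ f x) → 0ℚ ≤ ∑L xs f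
0≤∑L [] p = ≤-refl
0≤∑L (x ∷ xs) p = 0≤+ (p x) (0≤∑L xs p)

∑L-+ : {A : Set} (xs : List A) (f g : A → ℚ) → ∑L xs (λ x → f x + g x) ≡ ∑L xs f + ∑L xs g
∑L-+ [] f g = sym (+-identityˡ 0ℚ)
∑L-+ (x ∷ xs) f g = trans (cong (f x + g x +_) (∑L-+ xs f g)) (+-middle _ _ _ _)

∑L-*ˡ : ∀ {A : Set} (xs : List A) c (f : A → ℚ) → ∑L xs (λ x → c * f x) ≡ c * ∑L xs f
∑L-*ˡ [] c f = sym (*-zeroʳ c)
∑L-*ˡ (x ∷ xs) c f = trans (cong (c * f x +_) (∑L-*ˡ xs c f)) (sym (*-distribˡ-+ c _ _))

∑L-const : ∀ {A : Set} (xs : List A) c → ∑L xs (λ _ → c) ≡ ⟦ length xs ⟧ * c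
∑L-const [] c = sym (trans (cong (_* c) ⟦0⟧) (*-zeroˡ c))
∑L-const (x ∷ xs) c = trans (cong₂ _+_ (sym (*-identityˡ c)) (∑L-const xs c)) (trans (sym (*-distribʳ-+ c 1ℚ ⟦ length xs ⟧)) (cong (_* c) (sym (⟦suc⟧ (length xs)))))

∑L-∑ : {A : Set} (xs : List A) {n : ℕ} (f : A → Fin n → ℚ) → ∑L xs (λ x → ∑ (f x)) ≡ ∑ (λ i → ∑L xs (λ x → f x i))
∑L-∑ [] {n} f = sym (∑-0 {n})
∑L-∑ (x ∷ xs) f = trans (cong (∑ (f x) +_) (∑L-∑ xs f)) (sym (∑-+ (f x) _))

∑L-map : {A B : Set} (h : A → B) (xs : List A) (f : B → ℚ) → ∑L (map h xs) f ≡ ∑L xs (λ x → f (h x))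
∑L-map h [] f = refl
∑L-map h (x ∷ xs) f = cong (f (h x) +_) (∑L-map h xs f)

∑L-++ : {A : Set} (xs ys : List A) (f : A → ℚ) → ∑L (xs ++ ys) f ≡ ∑L xs f + ∑L ys f
∑L-++ [] ys f = sym (+-identityˡ _)
∑L-++ (x ∷ xs) ys f = trans (cong (f x +_) (∑L-++ xs ys f)) (sym (+-assoc _ _ _))

f≤∑L : {A : Set} {xs : List A} {f : A → ℚ} → (∀ x → 0ℚ ≤ f x) → ∀ {x} → x ∈ xs → f x ≤ ∑L xs f
f≤∑L {xs = x ∷ xs} p (here refl) = x≤x+y (0≤∑L xs p)
f≤∑L {xs = x ∷ xs} p (there q) = ≤-trans (f≤∑L p q) (y≤x+y (p x))

opaque
  unfolding ∑
  ∑L-filter : ∀ {n} (P : Fin n → Bool) (f : Fin n → ℚ) → ∑L (filterᵇ P (allFin n)) f ≡ ∑ (λ i → ind (P i) * f i)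
  ∑L-filter {n} P f = go n id
    where
    go : ∀ m (h : Fin m → Fin n) → ∑L (filterᵇ P (tabulate h)) f ≡ ∑ (λ i → ind (P (h i)) * f (h i))
    go zero h = refl
    go (suc m) h with P (h zero)
    ... | true = cong₂ _+_ (sym (*-identityˡ _)) (go m (λ i → h (suc i)))
    ... | false = trans (go m (λ i → h (suc i))) (sym (trans (cong (_+ ∑ (λ i → ind (P (h (suc i))) * f (h (suc i)))) (*-zeroˡ (f (h zero)))) (+-identityˡ _)))

infix 4 _≤ᵇ_
opaque
  _≤ᵇ_ : ℚ → ℚ → Bool
  x ≤ᵇ y = does (x ℚ.≤? y)

opaque
  unfolding _≤ᵇ_
  ≤⇒≤ᵇ : ∀ {x y} → x ≤ y → (x ≤ᵇ y) ≡ true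
  ≤⇒≤ᵇ {x} {y} p = dec-true (x ℚ.≤? y) p

  ≰⇒≤ᵇ : ∀ {x y} → ¬ x ≤ y → (x ≤ᵇ y) ≡ false
  ≰⇒≤ᵇ {x} {y} p = dec-false (x ℚ.≤? y) p

≤ᵇ⇒≤ : ∀ {x y} → (x ≤ᵇ y) ≡ true → x ≤ y
≤ᵇ⇒≤ {x} {y} p with x ℚ.≤? y
... | yes q = q
... | no ¬q = ⊥-elim (true≢false p (≰⇒≤ᵇ ¬q))

≤ᵇ⇒> : ∀ {x y} → (x ≤ᵇ y) ≡ false → y < x
≤ᵇ⇒> {x} {y} p = ℚ.≰⇒> λ q → true≢false (≤⇒≤ᵇ q) p

-- Sums over tuples and over vectors

-- Tuples are lists so that one function, such as `cn G`, can be averaged at every length. The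
-- vectors of `SumV` play a different part: they are maps, `v ! x` being the image of `x`.
SumT : ∀ {a} → ℕ → (List (Fin a) → ℚ) → ℚ
SumT zero F = F []
SumT (suc k) F = ∑ λ u → SumT k (λ t → F (u ∷ t))

SumT-cong : ∀ {a} k {F G : List (Fin a) → ℚ} → (∀ t → length t ≡ k → F t ≡ G t) → SumT k F ≡ SumT k G
SumT-cong zero p = p [] refl
SumT-cong (suc k) p = ∑-cong λ u → SumT-cong k λ t q → p (u ∷ t) (cong suc q)

SumT-mono : ∀ {a} k {F G : List (Fin a) → ℚ} → (∀ t → length t ≡ k → F t ≤ G t) → SumT k F ≤ SumT k G
SumT-mono zero p = p [] refl
SumT-mono (suc k) p = ∑-mono λ u → SumT-mono k λ t q → p (u ∷ t) (cong suc q)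

SumT-+ : ∀ {a} k (F G : List (Fin a) → ℚ) → SumT k (λ t → F t + G t) ≡ SumT k F + SumT k G
SumT-+ zero F G = refl
SumT-+ (suc k) F G = trans (∑-cong λ u → SumT-+ k (λ t → F (u ∷ t)) (λ t → G (u ∷ t))) (∑-+ _ _)

SumT-*ˡ : ∀ {a} k c (F : List (Fin a) → ℚ) → SumT k (λ t → c * F t) ≡ c * SumT k F
SumT-*ˡ zero c F = refl
SumT-*ˡ (suc k) c F = trans (∑-cong λ u → SumT-*ˡ k c (λ t → F (u ∷ t))) (∑-*ˡ c _)

SumT-∑ : ∀ {a n} k (F : Fin n → List (Fin a) → ℚ) → SumT k (λ t → ∑ λ i → F i t) ≡ ∑ λ i → SumT k (F i)
SumT-∑ zero F = refl
SumT-∑ (suc k) F = trans (∑-cong λ u → SumT-∑ k (λ i t → F i (u ∷ t))) (∑-swap _)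

SumT-const : ∀ {a} k c → SumT {a} k (λ _ → c) ≡ ⟦ a ⟧ ^ k * c
SumT-const zero c = sym (*-identityˡ c)
SumT-const {a} (suc k) c = trans (∑-cong λ u → SumT-const {a} k c) (trans (∑-const a _) (sym (*-assoc _ _ _)))

0≤SumT : ∀ {a} k {F : List (Fin a) → ℚ} → (∀ t → 0ℚ ≤ F t) → 0ℚ ≤ SumT k F
0≤SumT zero p = p []
0≤SumT (suc k) p = 0≤∑ λ u → 0≤SumT k λ t → p (u ∷ t)

SumT-++ : ∀ {a} j k (F : List (Fin a) → ℚ) → SumT (j ℕ.+ k) F ≡ SumT j (λ t → SumT k (λ s → F (t ++ s)))
SumT-++ zero k F = refl
SumT-++ (suc j) k F = ∑-cong λ u → SumT-++ j k (λ t → F (u ∷ t))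

-- The expectation over `k` independent uniform entries, repetitions allowed; random permutations
-- are compared with it.
avg : ∀ {a} → ℕ → (List (Fin a) → ℚ) → ℚ
avg {a} k g = inv ⟦ a ⟧ ^ k * SumT k g

SumV : ∀ {a} k → (Vec (Fin a) k → ℚ) → ℚ
SumV zero F = F []
SumV (suc k) F = ∑ λ u → SumV k (λ t → F (u ∷ t))

SumV-cong : ∀ {a} k {F G : Vec (Fin a) k → ℚ} → (∀ t → F t ≡ G t) → SumV k F ≡ SumV k G
SumV-cong zero p = p []
SumV-cong (suc k) p = ∑-cong λ u → SumV-cong k λ t → p (u ∷ t)

SumV-mono : ∀ {a} k {F G : Vec (Fin a) k → ℚ} → (∀ t → F t ≤ G t) → SumV k F ≤ SumV k G
SumV-mono zero p = p []
SumV-mono (suc k) p = ∑-mono λ u → SumV-mono k λ t → p (u ∷ t)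

SumV-+ : ∀ {a} k (F G : Vec (Fin a) k → ℚ) → SumV k (λ t → F t + G t) ≡ SumV k F + SumV k G
SumV-+ zero F G = refl
SumV-+ (suc k) F G = trans (∑-cong λ u → SumV-+ k (λ t → F (u ∷ t)) (λ t → G (u ∷ t))) (∑-+ _ _)

SumV-*ˡ : ∀ {a} k c (F : Vec (Fin a) k → ℚ) → SumV k (λ t → c * F t) ≡ c * SumV k F
SumV-*ˡ zero c F = refl
SumV-*ˡ (suc k) c F = trans (∑-cong λ u → SumV-*ˡ k c (λ t → F (u ∷ t))) (∑-*ˡ c _)

SumV-∑ : ∀ {a n} k (F : Fin n → Vec (Fin a) k → ℚ) → SumV k (λ t → ∑ λ i → F i t) ≡ ∑ λ i → SumV k (F i)
SumV-∑ zero F = refl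
SumV-∑ (suc k) F = trans (∑-cong λ u → SumV-∑ k (λ i t → F i (u ∷ t))) (∑-swap _)

0≤SumV : ∀ {a} k {F : Vec (Fin a) k → ℚ} → (∀ t → 0ℚ ≤ F t) → 0ℚ ≤ SumV k F
0≤SumV zero p = p []
0≤SumV (suc k) p = 0≤∑ λ u → 0≤SumV k λ t → p (u ∷ t)

f≤SumV : ∀ {a} k {F : Vec (Fin a) k → ℚ} → (∀ t → 0ℚ ≤ F t) → ∀ v → F v ≤ SumV k F
f≤SumV zero p [] = ≤-refl
f≤SumV (suc k) {F} p (u ∷ v) = ≤-trans (f≤SumV k (λ t → p (u ∷ t)) v) (f≤∑ {f = λ u → SumV k (λ t → F (u ∷ t))} (λ u → 0≤SumV k λ t → p (u ∷ t)) u)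

SumV-involution : ∀ {a} k {π : Fin a → Fin a} → (∀ i → π (π i) ≡ i) → (F : Vec (Fin a) k → ℚ) → SumV k (λ v → F (Vec.map π v)) ≡ SumV k F
SumV-involution zero inv² F = refl
SumV-involution (suc k) {π} inv² F = trans (∑-cong λ u → SumV-involution k inv² (λ v → F (π u ∷ v))) (∑-involution inv² {λ u → SumV k (λ v → F (u ∷ v))})

searchV : ∀ {a} k {Q : Vec (Fin a) k → Set} → (∀ v → Dec (Q v)) → Dec (∃ λ v → Q v)
searchV zero Q? with Q? []
... | yes q = yes ([] , q)
... | no ¬q = no λ { ([] , q) → ¬q q }
searchV (suc k) Q? with Fin.any? (λ u → searchV k (λ v → Q? (u ∷ v)))
... | yes (u , v , q) = yes (u ∷ v , q)
... | no ¬q = no λ { (u ∷ v , q) → ¬q (u , v , q) }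

-- Membership as a Boolean, and transpositions

mem : ∀ {n} → Fin n → List (Fin n) → Bool
mem u [] = false
mem u (x ∷ xs) = eqF u x ∨ mem u xs

∈⇒mem : ∀ {n} {u : Fin n} {t} → u ∈ t → mem u t ≡ true
∈⇒mem {u = u} (here refl) rewrite eqF-refl u = refl
∈⇒mem {u = u} {x ∷ t} (there p) with eqF u x
... | true = refl
... | false = ∈⇒mem p

mem⇒∈ : ∀ {n} {u : Fin n} {t} → mem u t ≡ true → u ∈ t
mem⇒∈ {u = u} {x ∷ t} p with eqF u x in eq
... | true = here (eqF⇒≡ eq)
... | false = there (mem⇒∈ p)

∉⇒mem : ∀ {n} {u : Fin n} {t} → u ∉ t → mem u t ≡ false
∉⇒mem {u = u} {t} p with mem u t in eq
... | true = ⊥-elim (p (mem⇒∈ eq))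
... | false = refl

mem-false⇒∉ : ∀ {n} {u : Fin n} {t} → mem u t ≡ false → u ∉ t
mem-false⇒∉ p q = true≢false (∈⇒mem q) p

not≡true : ∀ {b} → not b ≡ true → b ≡ false
not≡true {false} _ = refl

∑-mem : ∀ {n} (t : List (Fin n)) → Unique t → ∑ (λ u → ind (mem u t)) ≡ ⟦ length t ⟧
∑-mem {n} [] _ = trans (∑-0 {n}) (sym ⟦0⟧)
∑-mem {n} (x ∷ t) (x∉ ∷ uniq) = begin
  ∑ (λ u → ind (eqF u x ∨ mem u t)) ≡⟨ ∑-cong split ⟩
  ∑ (λ u → ind (eqF x u) + ind (mem u t)) ≡⟨ ∑-+ _ _ ⟩
  ∑ (λ u → ind (eqF x u)) + ∑ (λ u → ind (mem u t)) ≡⟨ cong₂ _+_ (∑-at₁ x) (∑-mem t uniq) ⟩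
  1ℚ + ⟦ length t ⟧ ≡⟨ sym (⟦suc⟧ _) ⟩
  ⟦ suc (length t) ⟧ ∎
  where
  open ≡-Reasoning
  split : ∀ u → ind (eqF u x ∨ mem u t) ≡ ind (eqF x u) + ind (mem u t)
  split u rewrite eqF-sym x u with eqF u x in eq
  ... | false = sym (+-identityˡ _)
  ... | true = sym (trans (cong (λ b → 1ℚ + ind b) (∉⇒mem λ q → All.lookup x∉ q (sym (eqF⇒≡ eq)))) (+-identityʳ 1ℚ))

∑-mem≤ : ∀ {n} (t : List (Fin n)) → ∑ (λ u → ind (mem u t)) ≤ ⟦ length t ⟧
∑-mem≤ {n} [] = ≡⇒≤ (trans (∑-0 {n}) (sym ⟦0⟧))
∑-mem≤ {n} (x ∷ t) =
  ∑ (λ u → ind (eqF u x ∨ mem u t)) ≤⟨ ∑-mono (λ u → ind-∨ (eqF u x) (mem u t)) ⟩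
  ∑ (λ u → ind (eqF u x) + ind (mem u t)) ≡⟨ ∑-+ _ _ ⟩≤
  ∑ (λ u → ind (eqF u x)) + ∑ (λ u → ind (mem u t)) ≤⟨ +-mono (≡⇒≤ (trans (∑-cong λ u → cong ind (eqF-sym u x)) (∑-at₁ x))) (∑-mem≤ t) ⟩
  1ℚ + ⟦ length t ⟧ ≡⟨ sym (⟦suc⟧ _) ⟩≤
  ⟦ suc (length t) ⟧ ■

∑-notmem : ∀ {n} (t : List (Fin n)) → Unique t → ∑ (λ u → ind (not (mem u t))) ≡ ⟦ n ⟧ - ⟦ length t ⟧
∑-notmem {n} t uniq = begin
  ∑ (λ u → ind (not (mem u t))) ≡⟨ sym (+-cancelʳ′ _ _) ⟩
  ∑ (λ u → ind (not (mem u t))) + ∑ (λ u → ind (mem u t)) - ∑ (λ u → ind (mem u t)) ≡⟨ cong₂ _-_ (trans (sym (∑-+ _ _)) (trans (∑-cong λ u → trans (+-comm _ _) (ind-not (mem u t))) (trans (∑-const n 1ℚ) (*-identityʳ _)))) (∑-mem t uniq) ⟩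
  ⟦ n ⟧ - ⟦ length t ⟧ ∎
  where open ≡-Reasoning

swapF : ∀ {n} → Fin n → Fin n → Fin n → Fin n
swapF u w y with y ≟ u | y ≟ w
... | yes _ | _ = w
... | no _ | yes _ = u
... | no _ | no _ = y

swapF-l : ∀ {n} (u w : Fin n) → swapF u w u ≡ w
swapF-l u w with u ≟ u | u ≟ w
... | yes _ | _ = refl
... | no q | _ = ⊥-elim (q refl)

swapF-r : ∀ {n} (u w : Fin n) → swapF u w w ≡ u
swapF-r u w with w ≟ u | w ≟ w
... | yes p | _ = p
... | no _ | yes _ = refl
... | no _ | no q = ⊥-elim (q refl)

swapF-other : ∀ {n} {u w y : Fin n} → y ≢ u → y ≢ w → swapF u w y ≡ y
swapF-other {u = u} {w} {y} p q with y ≟ u | y ≟ w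
... | yes r | _ = ⊥-elim (p r)
... | no _ | yes r = ⊥-elim (q r)
... | no _ | no _ = refl

swapF-involutive : ∀ {n} (u w y : Fin n) → swapF u w (swapF u w y) ≡ y
swapF-involutive u w y with y ≟ u | y ≟ w
... | yes refl | _ = swapF-r u w
... | no _ | yes refl = swapF-l u w
... | no p | no q = swapF-other p q

swapF-injective : ∀ {n} (u w : Fin n) → Injective _≡_ _≡_ (swapF u w)
swapF-injective u w {x} {y} p = trans (sym (swapF-involutive u w x)) (trans (cong (swapF u w) p) (swapF-involutive u w y))

mem-map : ∀ {n} {π : Fin n → Fin n} → Injective _≡_ _≡_ π → ∀ u t → mem (π u) (map π t) ≡ mem u t
mem-map inj u [] = refl
mem-map {π = π} inj u (x ∷ t) = cong₂ _∨_ lem (mem-map inj u t)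
  where
  lem : eqF (π u) (π x) ≡ eqF u x
  lem with u ≟ x
  ... | yes refl = eqF-refl (π u)
  ... | no q = ≢⇒eqF λ r → q (inj r)

map-id-local : ∀ {A : Set} {f : A → A} (t : List A) → (∀ y → y ∈ t → f y ≡ y) → map f t ≡ t
map-id-local [] p = refl
map-id-local (x ∷ t) p = cong₂ _∷_ (p x (here refl)) (map-id-local t (λ y q → p y (there q)))

-- Uniformly random permutations

infixl 9 _!_ _!!_
_!_ : ∀ {a k} → Vec (Fin a) k → Fin k → Fin a
_!_ = Vec.lookup

_!!_ : ∀ {a k} → Vec (Fin a) k → List (Fin k) → List (Fin a)
v !! xs = map (v !_) xs

Inj : ∀ {a k} → Vec (Fin a) k → Set
Inj v = ∀ {i j} → v ! i ≡ v ! j → i ≡ j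

inj? : ∀ {a k} (v : Vec (Fin a) k) → Dec (Inj v)
inj? v with Fin.all? (λ i → Fin.all? (λ j → dec i j))
  where
  dec : ∀ i j → Dec (v ! i ≡ v ! j → i ≡ j)
  dec i j with i ≟ j | v ! i ≟ v ! j
  ... | yes p | _ = yes λ _ → p
  ... | no p | yes q = no λ f → p (f q)
  ... | no p | no q = yes λ r → ⊥-elim (q r)
... | yes p = yes λ {i} {j} → p i j
... | no ¬p = no λ q → ¬p λ i j → q

nodup : ∀ {a k} → Vec (Fin a) k → Bool
nodup v = does (inj? v)

nodup⇒Inj : ∀ {a k} (v : Vec (Fin a) k) → nodup v ≡ true → Inj v
nodup⇒Inj v p with inj? v
... | yes q = q
... | no _ with () ← p

Inj⇒nodup : ∀ {a k} (v : Vec (Fin a) k) → Inj v → nodup v ≡ true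
Inj⇒nodup v p = dec-true (inj? v) p

!-map : ∀ {a k} (π : Fin a → Fin a) (v : Vec (Fin a) k) i → Vec.map π v ! i ≡ π (v ! i)
!-map π v i = Vec.lookup-map i π v

!!-map : ∀ {a k} (π : Fin a → Fin a) (v : Vec (Fin a) k) xs → Vec.map π v !! xs ≡ map π (v !! xs)
!!-map π v [] = refl
!!-map π v (x ∷ xs) = cong₂ _∷_ (!-map π v x) (!!-map π v xs)

!!-unique : ∀ {a k} (v : Vec (Fin a) k) → Inj v → ∀ {xs} → Unique xs → Unique (v !! xs)
!!-unique v inj = Unique.map⁺ inj

nodup-map : ∀ {a k} {π : Fin a → Fin a} → (∀ i → π (π i) ≡ i) → (v : Vec (Fin a) k) → nodup (Vec.map π v) ≡ nodup v
nodup-map {π = π} inv² v with inj? v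
... | yes p = Inj⇒nodup (Vec.map π v) λ {i} {j} q → p (trans (sym (inv² _)) (trans (cong π (trans (sym (!-map π v i)) (trans q (!-map π v j)))) (inv² _)))
... | no ¬p = dec-false (inj? (Vec.map π v)) λ q → ¬p λ {i} {j} r → q (trans (!-map π v i) (trans (cong π r) (sym (!-map π v j))))

module Averages {a : ℕ} (1≤a : 1 ℕ.≤ a) where

  0<a : 0ℚ < ⟦ a ⟧
  0<a = 0<⟦⟧ 1≤a

  -- Injective vectors of length `a` over `Fin a` are the permutations; an indicator under a sum
  -- over all vectors avoids listing them.
  S : (Vec (Fin a) a → ℚ) → ℚ
  S F = SumV a (λ v → ind (nodup v) * F v)

  S-cong : ∀ {F G} → (∀ v → Inj v → F v ≡ G v) → S F ≡ S G
  S-cong p = SumV-cong a λ v → ind-cong (nodup v) λ q → p v (nodup⇒Inj v q)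

  S-mono : ∀ {F G} → (∀ v → Inj v → F v ≤ G v) → S F ≤ S G
  S-mono p = SumV-mono a λ v → ind-mono-* (nodup v) λ q → p v (nodup⇒Inj v q)

  S-+ : ∀ F G → S (λ v → F v + G v) ≡ S F + S G
  S-+ F G = trans (SumV-cong a λ v → *-distribˡ-+ _ _ _) (SumV-+ a _ _)

  S-*ˡ : ∀ c F → S (λ v → c * F v) ≡ c * S F
  S-*ˡ c F = trans (SumV-cong a λ v → *-swap _ _ _) (SumV-*ˡ a c _)

  S-∑ : ∀ {n} (F : Fin n → Vec (Fin a) a → ℚ) → S (λ v → ∑ λ i → F i v) ≡ ∑ λ i → S (F i)
  S-∑ F = trans (SumV-cong a λ v → sym (∑-*ˡ (ind (nodup v)) (λ i → F i v))) (SumV-∑ a (λ i v → ind (nodup v) * F i v))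

  S-involution : ∀ {π : Fin a → Fin a} → (∀ i → π (π i) ≡ i) → ∀ F → S (λ v → F (Vec.map π v)) ≡ S F
  S-involution {π} inv² F = trans (SumV-cong a λ v → cong (λ b → ind b * F (Vec.map π v)) (sym (nodup-map inv² v))) (SumV-involution a inv² (λ v → ind (nodup v) * F v))

  identity : Vec (Fin a) a
  identity = Vec.tabulate id

  identity-Inj : Inj identity
  identity-Inj {i} {j} p = trans (sym (Vec.lookup∘tabulate id i)) (trans p (Vec.lookup∘tabulate id j))

  0≤S : ∀ {F} → (∀ v → Inj v → 0ℚ ≤ F v) → 0ℚ ≤ S F
  0≤S {F} p = 0≤SumV a λ v → ≤-trans (≡⇒≤ (sym (*-zeroʳ (ind (nodup v))))) (ind-mono-* (nodup v) λ q → p v (nodup⇒Inj v q))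

  F-identity≤S : ∀ {F} → (∀ v → Inj v → 0ℚ ≤ F v) → F identity ≤ S F
  F-identity≤S {F} p = ≤-trans (≡⇒≤ (sym (trans (cong (λ b → ind b * F identity) (Inj⇒nodup identity identity-Inj)) (*-identityˡ _))))
    (f≤SumV a {λ v → ind (nodup v) * F v} (λ v → ≤-trans (≡⇒≤ (sym (*-zeroʳ (ind (nodup v))))) (ind-mono-* (nodup v) λ q → p v (nodup⇒Inj v q))) identity)

  -- This is a!; positivity is enough to normalise by it.
  T₀ : ℚ
  T₀ = S (λ _ → 1ℚ)

  0<T₀ : 0ℚ < T₀
  0<T₀ = ℚ.<-≤-trans 0<1 (F-identity≤S (λ _ _ → 0≤1))

  -- Transposing the values u and u′ of the permutation trades the event v ! x = u′ for v ! x = u.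
  core : ∀ x xs → x ∉ xs → Unique xs → (g : Fin a → List (Fin a) → ℚ) →
    (⟦ a ⟧ - ⟦ length xs ⟧) * S (λ v → g (v ! x) (v !! xs)) ≡ ∑ λ u → S (λ v → ind (not (mem u (v !! xs))) * g u (v !! xs))
  core x xs x∉xs uniq g = sym (begin
    ∑ (λ u → S (λ v → ind (not (mem u (v !! xs))) * g u (v !! xs))) ≡⟨ ∑-cong step ⟩
    ∑ (λ u → k * S (λ v → ind (eqF (v ! x) u) * g u (v !! xs))) ≡⟨ ∑-*ˡ k _ ⟩
    k * ∑ (λ u → S (λ v → ind (eqF (v ! x) u) * g u (v !! xs))) ≡⟨ cong (k *_) (sym (S-∑ (λ u v → ind (eqF (v ! x) u) * g u (v !! xs)))) ⟩
    k * S (λ v → ∑ λ u → ind (eqF (v ! x) u) * g u (v !! xs)) ≡⟨ cong (k *_) (S-cong λ v _ → ∑-at (v ! x) (λ u → g u (v !! xs))) ⟩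
    k * S (λ v → g (v ! x) (v !! xs)) ∎)
    where
    open ≡-Reasoning
    k = ⟦ a ⟧ - ⟦ length xs ⟧
    exch : ∀ u u′ → S (λ v → ind (eqF (v ! x) u′) * (ind (not (mem u (v !! xs))) * g u (v !! xs)))
                  ≡ S (λ v → ind (eqF (v ! x) u) * (ind (not (mem u′ (v !! xs))) * g u (v !! xs)))
    exch u u′ = trans (sym (S-involution (swapF-involutive u u′) A)) (S-cong pointwise)
      where
      π = swapF u u′
      A : Vec (Fin a) a → ℚ
      A v = ind (eqF (v ! x) u′) * (ind (not (mem u (v !! xs))) * g u (v !! xs))
      pointwise : ∀ v → Inj v → A (Vec.map π v) ≡ ind (eqF (v ! x) u) * (ind (not (mem u′ (v !! xs))) * g u (v !! xs))
      pointwise v inj = trans (cong₂ (λ b c → ind b * c) e₁ (cong₂ (λ b t → ind (not b) * g u t) e₂ (!!-map π v xs)))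
        (ind-cong (eqF (v ! x) u) λ p → ind-cong (not (mem u′ (v !! xs))) λ q → cong (g u) (map-id-local (v !! xs) (fixed p (not≡true q))))
        where
        e₁ : eqF (Vec.map π v ! x) u′ ≡ eqF (v ! x) u
        e₁ with (v ! x) ≟ u
        ... | yes p = trans (cong (λ y → eqF y u′) (trans (!-map π v x) (trans (cong π p) (swapF-l u u′)))) (eqF-refl u′)
        ... | no p = ≢⇒eqF λ q → p (trans (sym (swapF-involutive u u′ (v ! x))) (trans (cong π (trans (sym (!-map π v x)) q)) (swapF-r u u′)))
        e₂ : mem u (Vec.map π v !! xs) ≡ mem u′ (v !! xs)
        e₂ = trans (cong₂ mem (sym (swapF-r u u′)) (!!-map π v xs)) (mem-map (swapF-injective u u′) u′ (v !! xs))
        -- The swap leaves the other images alone: `u` is the image of `x ∉ xs`, so injectivity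
        -- keeps it out of them, and `u′` is kept out by the indicator.
        fixed : eqF (v ! x) u ≡ true → mem u′ (v !! xs) ≡ false → ∀ y → y ∈ v !! xs → π y ≡ y
        fixed p q y y∈ = swapF-other (λ { refl → u∉ y∈ }) (λ { refl → mem-false⇒∉ q y∈ })
          where
          u∉ : u ∉ v !! xs
          u∉ u∈ with z , z∈ , eq ← ∈-map⁻ (v !_) u∈ = x∉xs (subst (_∈ xs) (sym (inj (trans (eqF⇒≡ p) eq))) z∈)
    step : ∀ u → S (λ v → ind (not (mem u (v !! xs))) * g u (v !! xs)) ≡ k * S (λ v → ind (eqF (v ! x) u) * g u (v !! xs))
    step u = begin
      S (λ v → ind (not (mem u (v !! xs))) * g u (v !! xs)) ≡⟨ S-cong (λ v _ → sym (∑-at (v ! x) (λ _ → ind (not (mem u (v !! xs))) * g u (v !! xs)))) ⟩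
      S (λ v → ∑ λ u′ → ind (eqF (v ! x) u′) * (ind (not (mem u (v !! xs))) * g u (v !! xs))) ≡⟨ S-∑ (λ u′ v → ind (eqF (v ! x) u′) * (ind (not (mem u (v !! xs))) * g u (v !! xs))) ⟩
      ∑ (λ u′ → S (λ v → ind (eqF (v ! x) u′) * (ind (not (mem u (v !! xs))) * g u (v !! xs)))) ≡⟨ ∑-cong (exch u) ⟩
      ∑ (λ u′ → S (λ v → ind (eqF (v ! x) u) * (ind (not (mem u′ (v !! xs))) * g u (v !! xs)))) ≡⟨ sym (S-∑ (λ u′ v → ind (eqF (v ! x) u) * (ind (not (mem u′ (v !! xs))) * g u (v !! xs)))) ⟩
      S (λ v → ∑ λ u′ → ind (eqF (v ! x) u) * (ind (not (mem u′ (v !! xs))) * g u (v !! xs))) ≡⟨ S-cong (λ v inj → collect v inj) ⟩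
      S (λ v → k * (ind (eqF (v ! x) u) * g u (v !! xs))) ≡⟨ S-*ˡ k _ ⟩
      k * S (λ v → ind (eqF (v ! x) u) * g u (v !! xs)) ∎
      where
      collect : ∀ v → Inj v → ∑ (λ u′ → ind (eqF (v ! x) u) * (ind (not (mem u′ (v !! xs))) * g u (v !! xs))) ≡ k * (ind (eqF (v ! x) u) * g u (v !! xs))
      collect v inj = trans (∑-*ˡ (ind (eqF (v ! x) u)) _) (trans (cong (ind (eqF (v ! x) u) *_) (trans (∑-*ʳ (g u (v !! xs)) _)
        (cong (_* g u (v !! xs)) (trans (∑-notmem (v !! xs) (!!-unique v inj uniq)) (cong (λ n → ⟦ a ⟧ - ⟦ n ⟧) (length-map (v !_) xs)))))) (*-swap _ _ _))

  E : (Vec (Fin a) a → ℚ) → ℚ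
  E F = S F * inv T₀

  0≤iT : 0ℚ ≤ inv T₀
  0≤iT = 0≤inv T₀

  E-mono : ∀ {F G} → (∀ v → Inj v → F v ≤ G v) → E F ≤ E G
  E-mono p = *-monoʳ 0≤iT (S-mono p)

  E-cong : ∀ {F G} → (∀ v → Inj v → F v ≡ G v) → E F ≡ E G
  E-cong p = cong (_* inv T₀) (S-cong p)

  E-+ : ∀ F G → E (λ v → F v + G v) ≡ E F + E G
  E-+ F G = trans (cong (_* inv T₀) (S-+ F G)) (*-distribʳ-+ _ _ _)

  E-*ˡ : ∀ c F → E (λ v → c * F v) ≡ c * E F
  E-*ˡ c F = trans (cong (_* inv T₀) (S-*ˡ c F)) (*-assoc _ _ _)

  E-∑ : ∀ {n} (F : Fin n → Vec (Fin a) a → ℚ) → E (λ v → ∑ λ i → F i v) ≡ ∑ λ i → E (F i)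
  E-∑ F = trans (cong (_* inv T₀) (S-∑ F)) (sym (∑-*ʳ (inv T₀) _))

  E-1 : E (λ _ → 1ℚ) ≡ 1ℚ
  E-1 = *-inv 0<T₀

  E-const : ∀ c → E (λ _ → c) ≡ c
  E-const c = trans (E-cong λ v _ → sym (*-identityʳ c)) (trans (E-*ˡ c (λ _ → 1ℚ)) (trans (cong (c *_) E-1) (*-identityʳ c)))

  0≤E : ∀ {F} → (∀ v → Inj v → 0ℚ ≤ F v) → 0ℚ ≤ E F
  0≤E p = 0≤* (0≤S p) 0≤iT

  E-core : ∀ x xs → x ∉ xs → Unique xs → (g : Fin a → List (Fin a) → ℚ) →
    (⟦ a ⟧ - ⟦ length xs ⟧) * E (λ v → g (v ! x) (v !! xs)) ≡ ∑ λ u → E (λ v → ind (not (mem u (v !! xs))) * g u (v !! xs))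
  E-core x xs x∉ uniq g = trans (sym (*-assoc _ _ _)) (trans (cong (_* inv T₀) (core x xs x∉ uniq g)) (sym (∑-*ʳ (inv T₀) _)))

  -- The first moment method, made constructive by exhaustive search. Were `F` above `β` on every
  -- permutation, the term of the identity alone would make the sum of `F - β` positive.
  select : ∀ {F β} → E F ≤ β → ∃ λ v → Inj v × F v ≤ β
  select {F} {β} EF≤β with searchV a (λ v → decide v)
    where
    decide : ∀ v → Dec (nodup v ≡ true × F v ≤ β)
    decide v with inj? v | F v ℚ.≤? β
    ... | yes p | yes q = yes (refl , q)
    ... | no p | _ = no λ { (() , _) }
    ... | _ | no q = no λ r → q (proj₂ r)
  ... | yes (v , p , q) = v , nodup⇒Inj v p , q
  ... | no none = ⊥-elim (≤⇒≯ S≤0 (ℚ.<-≤-trans (0<- (F>β identity identity-Inj)) (F-identity≤S {λ v → F v - β} λ v inj → <⇒≤ (0<- (F>β v inj)))))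
    where
    F>β : ∀ v → Inj v → β < F v
    F>β v inj = ℚ.≰⇒> λ q → none (v , Inj⇒nodup v inj , q)
    opaque
      unfolding _+_
      lem : ∀ f b → f - b ≡ f + (- 1ℚ) * (b * 1ℚ)
      lem = solve-∀ ringℚ
      lem₂ : ∀ b t → b * t + (- 1ℚ) * (b * t) ≡ 0ℚ
      lem₂ = solve-∀ ringℚ
    S≤0 : S (λ v → F v - β) ≤ 0ℚ
    S≤0 = S (λ v → F v - β) ≡⟨ S-cong (λ v _ → lem (F v) β) ⟩≤
      S (λ v → F v + (- 1ℚ) * (β * 1ℚ)) ≡⟨ S-+ F _ ⟩≤
      S F + S (λ v → (- 1ℚ) * (β * 1ℚ)) ≡⟨ cong (S F +_) (trans (S-*ˡ (- 1ℚ) (λ _ → β * 1ℚ)) (cong ((- 1ℚ) *_) (S-*ˡ β (λ _ → 1ℚ)))) ⟩≤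
      S F + (- 1ℚ) * (β * T₀) ≤⟨ +-mono (÷-≤⁻¹ 0<T₀ EF≤β) ≤-refl ⟩
      β * T₀ + (- 1ℚ) * (β * T₀) ≡⟨ lem₂ β T₀ ⟩≤
      0ℚ ■

  -- Drawing without replacement costs a factor `a / (a - j)` once `j` values are taken; `κ₀` bounds
  -- all these factors.
  module Marginals {κ₀ : ℚ} (0≤κ₀ : 0ℚ ≤ κ₀) (h : ℕ) (κ₀-bound : ∀ j → j ℕ.≤ h → ⟦ a ⟧ ≤ κ₀ * (⟦ a ⟧ - ⟦ j ⟧)) where

    upper₁ : ∀ x xs → x ∉ xs → Unique xs → length xs ℕ.≤ h → (g : Fin a → List (Fin a) → ℚ) → (∀ u t → 0ℚ ≤ g u t) →
      E (λ v → g (v ! x) (v !! xs)) ≤ κ₀ * inv ⟦ a ⟧ * ∑ (λ u → E (λ v → g u (v !! xs)))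
    upper₁ x xs x∉ uniq len g 0≤g = *-cancelˡ 0<a (
      ⟦ a ⟧ * L ≤⟨ *-monoʳ (0≤E λ v _ → 0≤g _ _) (κ₀-bound (length xs) len) ⟩
      κ₀ * (⟦ a ⟧ - ⟦ length xs ⟧) * L ≡⟨ *-assoc κ₀ _ _ ⟩≤
      κ₀ * ((⟦ a ⟧ - ⟦ length xs ⟧) * L) ≡⟨ cong (κ₀ *_) (E-core x xs x∉ uniq g) ⟩≤
      κ₀ * ∑ (λ u → E (λ v → ind (not (mem u (v !! xs))) * g u (v !! xs))) ≤⟨ *-monoˡ 0≤κ₀ (∑-mono λ u → E-mono λ v _ → ind*≤′ (not (mem u (v !! xs))) (0≤g u _)) ⟩
      κ₀ * R ≡⟨ trans (sym (*-identityˡ _)) (cong (_* (κ₀ * R)) (sym (*-inv 0<a))) ⟩≤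
      ⟦ a ⟧ * inv ⟦ a ⟧ * (κ₀ * R) ≡⟨ lem ⟦ a ⟧ (inv ⟦ a ⟧) κ₀ R ⟩≤
      ⟦ a ⟧ * (κ₀ * inv ⟦ a ⟧ * R) ■)
      where
      L = E (λ v → g (v ! x) (v !! xs))
      R = ∑ (λ u → E (λ v → g u (v !! xs)))
      opaque
        unfolding _+_
        lem : ∀ a i k r → a * i * (k * r) ≡ a * (k * i * r)
        lem = solve-∀ ringℚ

    upper : ∀ xs → Unique xs → length xs ℕ.≤ suc h → (g : List (Fin a) → ℚ) → (∀ t → 0ℚ ≤ g t) →
      E (λ v → g (v !! xs)) ≤ κ₀ ^ length xs * avg (length xs) g
    upper [] _ _ g 0≤g = ≡⇒≤ (trans (E-const (g [])) (sym (trans (*-identityˡ _) (*-identityˡ _))))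
    upper (x ∷ xs) (x∉ ∷ uniq) (s≤s len) g 0≤g =
      E (λ v → g (v ! x ∷ v !! xs)) ≤⟨ upper₁ x xs (λ q → All.lookup x∉ q refl) uniq len (λ u t → g (u ∷ t)) (λ u t → 0≤g _) ⟩
      κ₀ * i * ∑ (λ u → E (λ v → g (u ∷ v !! xs))) ≤⟨ *-monoˡ (0≤* 0≤κ₀ (0≤inv _)) (∑-mono λ u → upper xs uniq (ℕ.m≤n⇒m≤1+n len) (λ t → g (u ∷ t)) (λ t → 0≤g _)) ⟩
      κ₀ * i * ∑ (λ u → κ₀ ^ n * (i ^ n * SumT n (λ t → g (u ∷ t)))) ≡⟨ cong (κ₀ * i *_) (trans (∑-*ˡ (κ₀ ^ n) _) (cong (κ₀ ^ n *_) (∑-*ˡ (i ^ n) _))) ⟩≤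
      κ₀ * i * (κ₀ ^ n * (i ^ n * SumT (suc n) g)) ≡⟨ lem κ₀ i (κ₀ ^ n) (i ^ n) (SumT (suc n) g) ⟩≤
      κ₀ * κ₀ ^ n * (i * i ^ n * SumT (suc n) g) ■
      where
      n = length xs
      i = inv ⟦ a ⟧
      opaque
        unfolding _+_
        lem : ∀ k i k′ i′ s → k * i * (k′ * (i′ * s)) ≡ k * k′ * (i * i′ * s)
        lem = solve-∀ ringℚ

  -- The error accounts for coincidences among `k` independent entries; the induction uses
  -- `k + k² ≤ (k + 1)²`.
  lower : ∀ xs → Unique xs → (g : List (Fin a) → ℚ) → (∀ t → 0ℚ ≤ g t) → (∀ t → length t ≡ length xs → g t ≤ 1ℚ) →
    avg (length xs) g ≤ E (λ v → g (v !! xs)) + ⟦ length xs ℕ.* length xs ⟧ * inv ⟦ a ⟧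
  lower [] _ g 0≤g g≤1 = ≤-trans (≡⇒≤ (trans (*-identityˡ _) (sym (E-const (g []))))) (x≤x+y (0≤* (0≤⟦⟧ 0) (0≤inv _)))
  lower (x ∷ xs) (x∉ ∷ uniq) g 0≤g g≤1 = *-cancelˡ 0<a (
    ⟦ a ⟧ * (i * i ^ n * SumT (suc n) g) ≡⟨ trans (lem₁ ⟦ a ⟧ i (i ^ n) _) (trans (cong (_* (i ^ n * SumT (suc n) g)) (*-inv 0<a)) (*-identityˡ _)) ⟩≤
    i ^ n * SumT (suc n) g ≡⟨ sym (∑-*ˡ (i ^ n) _) ⟩≤
    ∑ (λ u → i ^ n * SumT n (λ t → g (u ∷ t))) ≤⟨ ∑-mono (λ u → lower xs uniq (λ t → g (u ∷ t)) (λ t → 0≤g _) (λ t q → g≤1 _ (cong suc q))) ⟩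
    ∑ (λ u → E (λ v → g (u ∷ v !! xs)) + ⟦ n ℕ.* n ⟧ * i) ≡⟨ trans (∑-+ _ _) (cong (R +_) (∑-const a _)) ⟩≤
    R + ⟦ a ⟧ * (⟦ n ℕ.* n ⟧ * i) ≤⟨ +-mono R≤ (≡⇒≤ (trans (lem₂ ⟦ a ⟧ ⟦ n ℕ.* n ⟧ i) (trans (cong (⟦ n ℕ.* n ⟧ *_) (*-inv 0<a)) (*-identityʳ _)))) ⟩
    (⟦ a ⟧ * L + ⟦ n ⟧) + ⟦ n ℕ.* n ⟧ ≤⟨ ≤-trans (≡⇒≤ (+-assoc _ _ _)) (+-mono ≤-refl (≤-trans (≡⇒≤ (sym (⟦+⟧ n (n ℕ.* n)))) (⟦⟧-mono n+n*n≤))) ⟩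
    ⟦ a ⟧ * L + ⟦ suc n ℕ.* suc n ⟧ ≡⟨ cong (⟦ a ⟧ * L +_) (sym (trans (lem₂ ⟦ a ⟧ ⟦ suc n ℕ.* suc n ⟧ i) (trans (cong (⟦ suc n ℕ.* suc n ⟧ *_) (*-inv 0<a)) (*-identityʳ _)))) ⟩≤
    ⟦ a ⟧ * L + ⟦ a ⟧ * (⟦ suc n ℕ.* suc n ⟧ * i) ≡⟨ sym (*-distribˡ-+ _ _ _) ⟩≤
    ⟦ a ⟧ * (L + ⟦ suc n ℕ.* suc n ⟧ * i) ■)
    where
    n = length xs
    i = inv ⟦ a ⟧
    L = E (λ v → g (v ! x ∷ v !! xs))
    R = ∑ (λ u → E (λ v → g (u ∷ v !! xs)))
    n+n*n≤ : n ℕ.+ n ℕ.* n ℕ.≤ suc n ℕ.* suc n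
    n+n*n≤ = ℕ.*-mono-≤ {suc n} {suc n} {n} {suc n} ℕ.≤-refl (ℕ.n≤1+n n)
    opaque
      unfolding _+_
      lem₁ : ∀ a i j s → a * (i * j * s) ≡ a * i * (j * s)
      lem₁ = solve-∀ ringℚ
      lem₂ : ∀ a m i → a * (m * i) ≡ m * (a * i)
      lem₂ = solve-∀ ringℚ
    split : ∀ b {y} → 0ℚ ≤ y → y ≤ 1ℚ → y ≤ ind (not b) * y + ind b
    split true 0≤y y≤1 = ≤-trans y≤1 (y≤x+y (≡⇒≤ (sym (*-zeroˡ _))))
    split false {y} 0≤y y≤1 = ≤-trans (≡⇒≤ (sym (*-identityˡ y))) (x≤x+y ≤-refl)
    R≤ : R ≤ ⟦ a ⟧ * L + ⟦ n ⟧
    R≤ = ∑ (λ u → E (λ v → g (u ∷ v !! xs))) ≤⟨ ∑-mono (λ u → E-mono λ v _ → split (mem u (v !! xs)) (0≤g _) (g≤1 _ (cong suc (length-map (v !_) xs)))) ⟩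
      ∑ (λ u → E (λ v → ind (not (mem u (v !! xs))) * g (u ∷ v !! xs) + ind (mem u (v !! xs)))) ≡⟨ trans (∑-cong λ u → E-+ _ _) (∑-+ _ _) ⟩≤
      ∑ (λ u → E (λ v → ind (not (mem u (v !! xs))) * g (u ∷ v !! xs))) + ∑ (λ u → E (λ v → ind (mem u (v !! xs)))) ≤⟨ +-mono
          (≤-trans (≡⇒≤ (sym (E-core x xs (λ q → All.lookup x∉ q refl) uniq (λ u t → g (u ∷ t)))))
            (*-monoʳ (0≤E λ v _ → 0≤g _) (x-y≤x (0≤⟦⟧ n))))
          (≤-trans (≡⇒≤ (sym (E-∑ (λ u v → ind (mem u (v !! xs)))))) (≤-trans (E-mono λ v _ → ≤-trans (∑-mem≤ (v !! xs)) (≡⇒≤ (cong ⟦_⟧ (length-map (v !_) xs)))) (≡⇒≤ (E-const ⟦ n ⟧)))) ⟩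
      ⟦ a ⟧ * L + ⟦ n ⟧ ■

-- Rounding a fractional assignment

update : ∀ {n} {A : Set} → (Fin n → A) → Fin n → A → Fin n → A
update f r v y = if eqF r y then v else f y

update-same : ∀ {n} {A : Set} (f : Fin n → A) r v → update f r v r ≡ v
update-same f r v rewrite eqF-refl r = refl

update-other : ∀ {n} {A : Set} (f : Fin n → A) {r y} v → y ≢ r → update f r v y ≡ f y
update-other f v p rewrite ≢⇒eqF (λ q → p (sym q)) = refl

⟦⟧-cancel-≤ : ∀ {m n} → ⟦ m ⟧ ≤ ⟦ n ⟧ → m ℕ.≤ n
⟦⟧-cancel-≤ {m} {n} p with m ℕ.≤? n
... | yes q = q
... | no ¬q = ⊥-elim (1+n≰n (≤-trans (≤-trans (≡⇒≤ (sym (⟦suc⟧ n))) (⟦⟧-mono (ℕ.≰⇒> ¬q))) p))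
  where
  1+n≰n : ¬ 1ℚ + ⟦ n ⟧ ≤ ⟦ n ⟧
  1+n≰n q = ≤⇒≯ q (subst (_< 1ℚ + ⟦ n ⟧) (+-identityˡ _) (+-mono-<-≤ 0<1 (≤-refl {⟦ n ⟧})))

length-unique : ∀ {n} (xs : List (Fin n)) → Unique xs → length xs ℕ.≤ n
length-unique {n} xs uniq = ⟦⟧-cancel-≤ (≤-trans (≡⇒≤ (sym (∑-mem xs uniq))) (∑-ind≤ (λ u → mem u xs)))

∑L-zero : ∀ {A : Set} (xs : List A) {f : A → ℚ} → (∀ x → x ∈ xs → f x ≡ 0ℚ) → ∑L xs f ≡ 0ℚ
∑L-zero [] p = refl
∑L-zero (x ∷ xs) p = trans (cong₂ _+_ (p x (here refl)) (∑L-zero xs (λ y q → p y (there q)))) (+-identityˡ 0ℚ)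

∑L-unique≤ : ∀ {n} (xs : List (Fin n)) → Unique xs → {f : Fin n → ℚ} → (∀ i → 0ℚ ≤ f i) → ∑L xs f ≤ ∑ f
∑L-unique≤ xs uniq {f} 0≤f =
  ∑L xs f ≡⟨ ∑L-cong xs (λ x → sym (∑-at x f)) ⟩≤
  ∑L xs (λ x → ∑ (λ i → ind (eqF x i) * f i)) ≡⟨ ∑L-∑ xs _ ⟩≤
  ∑ (λ i → ∑L xs (λ x → ind (eqF x i) * f i)) ≡⟨ ∑-cong (λ i → trans (∑L-cong xs (λ x → *-comm _ _)) (∑L-*ˡ xs (f i) _)) ⟩≤
  ∑ (λ i → f i * ∑L xs (λ x → ind (eqF x i))) ≤⟨ ∑-mono (λ i → *-monoˡ (0≤f i) (once xs uniq i)) ⟩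
  ∑ (λ i → f i * 1ℚ) ≡⟨ ∑-cong (λ i → *-identityʳ (f i)) ⟩≤
  ∑ f ■
  where
  once : ∀ xs → Unique xs → ∀ i → ∑L xs (λ x → ind (eqF x i)) ≤ 1ℚ
  once [] _ i = 0≤1
  once (x ∷ xs) (x∉ ∷ uniq) i with eqF x i in eq
  ... | false = ≤-trans (≡⇒≤ (+-identityˡ _)) (once xs uniq i)
  ... | true = ≡⇒≤ (trans (cong (1ℚ +_) (∑L-zero xs λ y y∈ → cong ind (≢⇒eqF λ y≡i → All.lookup x∉ y∈ (trans (eqF⇒≡ eq) (sym y≡i))))) (+-identityʳ 1ℚ))

record DoublyStochastic {n} (M : Fin n → Fin n → ℚ) : Set where
  field
    0≤M : ∀ y v → 0ℚ ≤ M y v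
    row : ∀ y → ∑ (M y) ≡ 1ℚ
    col : ∀ v → ∑ (λ y → M y v) ≡ 1ℚ

module Hall {n} {M : Fin n → Fin n → ℚ} (ds : DoublyStochastic M) where
  open DoublyStochastic ds

  Matched : List (Fin n) → (Fin n → Fin n) → Set
  Matched ys f = (∀ y → y ∈ ys → 0ℚ < M y (f y)) × (∀ y y′ → y ∈ ys → y′ ∈ ys → f y ≡ f y′ → y ≡ y′)

  -- A row r is reachable by an alternating path from y₀ when the matching can be rerouted to leave r, instead of y₀, unmatched.
  module Augment (ys : List (Fin n)) (f : Fin n → Fin n) (matched : Matched ys f) (y₀ : Fin n) (y₀∉ : y₀ ∉ ys) where

    -- `R` holds the rows reached so far. Agreement with `f` outside `R` tells `reach` that a new
    -- row `s` still occupies the column `f s` that is about to be taken from it.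
    Alt : List (Fin n) → Fin n → Set
    Alt R r = ∃ λ (g : Fin n → Fin n) →
      (∀ y → y ∈ y₀ ∷ ys → y ≢ r → 0ℚ < M y (g y))
      × (∀ y y′ → y ∈ y₀ ∷ ys → y′ ∈ y₀ ∷ ys → y ≢ r → y′ ≢ r → g y ≡ g y′ → y ≡ y′)
      × (∀ y → y ∈ y₀ ∷ ys → y ≢ r → g y ∈ map f ys)
      × (∀ y → y ∈ ys → y ∉ R → g y ≡ f y)

    tail : ∀ {y} → y ∈ y₀ ∷ ys → y ≢ y₀ → y ∈ ys
    tail (here p) q = ⊥-elim (q p)
    tail (there p) q = p

    alt₀ : Alt [] y₀
    alt₀ = f , (λ y y∈ y≢ → proj₁ matched y (tail y∈ y≢))
      , (λ y y′ y∈ y′∈ y≢ y′≢ → proj₂ matched y y′ (tail y∈ y≢) (tail y′∈ y′≢))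
      , (λ y y∈ y≢ → ∈-map⁺ f (tail y∈ y≢)) , (λ y _ _ → refl)

    weaken : ∀ {R s r} → Alt R r → Alt (s ∷ R) r
    weaken (g , p , q , o , e) = g , p , q , o , λ y y∈ y∉ → e y y∈ (λ z → y∉ (there z))

    finish : ∀ {R r v} → Alt R r → 0ℚ < M r v → v ∉ map f ys → ∃ (Matched (y₀ ∷ ys))
    finish {R} {r} {v} (g , p , q , o , e) pos v∉ = g′ , pos′ , inj′
      where
      g′ = update g r v
      pos′ : ∀ y → y ∈ y₀ ∷ ys → 0ℚ < M y (g′ y)
      pos′ y y∈ with y ≟ r
      ... | yes refl = subst (λ w → 0ℚ < M y w) (sym (update-same g y v)) pos
      ... | no ne = subst (λ w → 0ℚ < M y w) (sym (update-other g v ne)) (p y y∈ ne)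
      inj′ : ∀ y y′ → y ∈ y₀ ∷ ys → y′ ∈ y₀ ∷ ys → g′ y ≡ g′ y′ → y ≡ y′
      inj′ y y′ y∈ y′∈ eq with y ≟ r | y′ ≟ r
      ... | yes a | yes b = trans a (sym b)
      ... | no a | no b = q y y′ y∈ y′∈ a b (trans (sym (update-other g v a)) (trans eq (update-other g v b)))
      ... | yes refl | no b = ⊥-elim (v∉ (subst (_∈ map f ys) (trans (sym (update-other g v b)) (trans (sym eq) (update-same g y v))) (o y′ y′∈ b)))
      ... | no a | yes refl = ⊥-elim (v∉ (subst (_∈ map f ys) (trans (sym (update-other g v a)) (trans eq (update-same g y′ v))) (o y y∈ a)))

    reach : ∀ {R r s} → Alt R r → r ∈ y₀ ∷ R → s ∈ ys → s ∉ y₀ ∷ R → s ≢ r → 0ℚ < M r (f s) → Alt (s ∷ R) s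
    reach {R} {r} {s} (g , p , q , o , e) r∈ s∈ s∉ s≢r pos = g′ , pos′ , inj′ , im′ , agree′
      where
      g′ = update g r (f s)
      gs : g s ≡ f s
      gs = e s s∈ (λ z → s∉ (there z))
      pos′ : ∀ y → y ∈ y₀ ∷ ys → y ≢ s → 0ℚ < M y (g′ y)
      pos′ y y∈ _ with y ≟ r
      ... | yes refl = subst (λ w → 0ℚ < M y w) (sym (update-same g y (f s))) pos
      ... | no ne = subst (λ w → 0ℚ < M y w) (sym (update-other g (f s) ne)) (p y y∈ ne)
      inj′ : ∀ y y′ → y ∈ y₀ ∷ ys → y′ ∈ y₀ ∷ ys → y ≢ s → y′ ≢ s → g′ y ≡ g′ y′ → y ≡ y′
      inj′ y y′ y∈ y′∈ y≢ y′≢ eq with y ≟ r | y′ ≟ r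
      ... | yes a | yes b = trans a (sym b)
      ... | no a | no b = q y y′ y∈ y′∈ a b (trans (sym (update-other g (f s) a)) (trans eq (update-other g (f s) b)))
      ... | yes refl | no b = ⊥-elim (y′≢ (q y′ s y′∈ (there s∈) b s≢r (trans (sym (update-other g (f s) b)) (trans (sym eq) (trans (update-same g y (f s)) (sym gs))))))
      ... | no a | yes refl = ⊥-elim (y≢ (q y s y∈ (there s∈) a s≢r (trans (sym (update-other g (f s) a)) (trans eq (trans (update-same g y′ (f s)) (sym gs))))))
      im′ : ∀ y → y ∈ y₀ ∷ ys → y ≢ s → g′ y ∈ map f ys
      im′ y y∈ _ with y ≟ r
      ... | yes refl = subst (_∈ map f ys) (sym (update-same g y (f s))) (∈-map⁺ f s∈)
      ... | no ne = subst (_∈ map f ys) (sym (update-other g (f s) ne)) (o y y∈ ne)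
      agree′ : ∀ y → y ∈ ys → y ∉ s ∷ R → g′ y ≡ f y
      agree′ y y∈ y∉ with y ≟ r
      ... | yes refl = ⊥-elim (excluded r∈)
        where
        excluded : y ∈ y₀ ∷ R → ⊥
        excluded (here refl) = y₀∉ y∈
        excluded (there z) = y∉ (there z)
      ... | no ne = trans (update-other g (f s) ne) (e y y∈ (λ z → y∉ (there z)))

    -- Hall's condition by counting mass: the rows `y₀ ∷ R` have total mass `|R| + 1`, which would
    -- have to lie in the at most `|R|` columns matched to `R`, each of mass 1.
    stuck : ∀ R → Unique (y₀ ∷ R) → ¬ (∀ r → r ∈ y₀ ∷ R → ∀ v → 0ℚ < M r v → v ∈ map f R)
    stuck R uniq closed = ℕ.1+n≰n (⟦⟧-cancel-≤ (
      ⟦ length (y₀ ∷ R) ⟧ ≡⟨ sym (trans (∑L-const (y₀ ∷ R) 1ℚ) (*-identityʳ _)) ⟩≤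
      ∑L (y₀ ∷ R) (λ _ → 1ℚ) ≡⟨ ∑L-cong (y₀ ∷ R) (λ r → sym (row r)) ⟩≤
      ∑L (y₀ ∷ R) (λ r → ∑ (M r)) ≤⟨ ∑L-mono (y₀ ∷ R) (λ r r∈ → ∑-mono (λ v → restrict r r∈ v)) ⟩
      ∑L (y₀ ∷ R) (λ r → ∑ (λ v → ind (mem v (map f R)) * M r v)) ≡⟨ ∑L-∑ (y₀ ∷ R) _ ⟩≤
      ∑ (λ v → ∑L (y₀ ∷ R) (λ r → ind (mem v (map f R)) * M r v)) ≡⟨ ∑-cong (λ v → ∑L-*ˡ (y₀ ∷ R) (ind (mem v (map f R))) (λ r → M r v)) ⟩≤
      ∑ (λ v → ind (mem v (map f R)) * ∑L (y₀ ∷ R) (λ r → M r v)) ≤⟨ ∑-mono (λ v → *-monoˡ (0≤ind (mem v (map f R))) (≤-trans (∑L-unique≤ (y₀ ∷ R) uniq (λ r → 0≤M r v)) (≡⇒≤ (col v)))) ⟩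
      ∑ (λ v → ind (mem v (map f R)) * 1ℚ) ≡⟨ ∑-cong (λ v → *-identityʳ _) ⟩≤
      ∑ (λ v → ind (mem v (map f R))) ≤⟨ ∑-mem≤ (map f R) ⟩
      ⟦ length (map f R) ⟧ ≡⟨ cong ⟦_⟧ (length-map f R) ⟩≤
      ⟦ length R ⟧ ■))
      where
      restrict : ∀ r → r ∈ y₀ ∷ R → ∀ v → M r v ≤ ind (mem v (map f R)) * M r v
      restrict r r∈ v with 0ℚ ℚ.<? M r v
      ... | yes p = ≡⇒≤ (sym (trans (cong (λ b → ind b * M r v) (∈⇒mem (closed r r∈ v p))) (*-identityˡ _)))
      ... | no ¬p = ≤-trans (≮⇒≥ ¬p) (0≤* (0≤ind (mem v (map f R))) (0≤M r v))

    Escape : List (Fin n) → Fin n → Set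
    Escape R r = ∃ λ v → 0ℚ < M r v × v ∉ map f R

    escape? : ∀ R r → Dec (Escape R r)
    escape? R r = Fin.any? λ v → dec v
      where
      dec : ∀ v → Dec (0ℚ < M r v × v ∉ map f R)
      dec v with 0ℚ ℚ.<? M r v | mem v (map f R) in eq
      ... | no p | _ = no λ q → p (proj₁ q)
      ... | yes p | true = no λ q → proj₂ q (mem⇒∈ eq)
      ... | yes p | false = yes (p , mem-false⇒∉ eq)

    -- `k` counts the rows outside `R`; every round either finishes or adds a new row to `R`.
    search : ∀ k R → n ≡ k ℕ.+ length R → Unique R → (∀ r → r ∈ R → r ∈ ys) → (∀ r → r ∈ y₀ ∷ R → Alt R r) → ∃ (Matched (y₀ ∷ ys))
    search k R fuel uniq R⊆ alts with Any.any? (escape? R) (y₀ ∷ R)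
    ... | no none = ⊥-elim (stuck R uniq′ closed)
      where
      uniq′ : Unique (y₀ ∷ R)
      uniq′ = All.tabulate (λ {x} x∈ y₀≡x → y₀∉ (subst (_∈ ys) (sym y₀≡x) (R⊆ x x∈))) ∷ uniq
      closed : ∀ r → r ∈ y₀ ∷ R → ∀ v → 0ℚ < M r v → v ∈ map f R
      closed r r∈ v p with mem v (map f R) in eq
      ... | true = mem⇒∈ eq
      ... | false = ⊥-elim (none (Any.map (λ { refl → v , p , mem-false⇒∉ eq }) r∈))
    ... | yes some with find some
      where
      find : ∀ {xs} → Any (Escape R) xs → ∃ λ r → r ∈ xs × Escape R r
      find (here p) = _ , here refl , p
      find (there p) with r , r∈ , q ← find p = r , there r∈ , q
    ... | r , r∈ , v , pos , v∉ with mem v (map f ys) in eq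
    ...   | false = finish (alts r r∈) pos (mem-false⇒∉ eq)
    ...   | true with s , s∈ , refl ← ∈-map⁻ f (mem⇒∈ {t = map f ys} eq) = continue k fuel
      where
      s∉R : s ∉ R
      s∉R z = v∉ (∈-map⁺ f z)
      s∉ : s ∉ y₀ ∷ R
      s∉ (here refl) = y₀∉ s∈
      s∉ (there z) = s∉R z
      s≢r : s ≢ r
      s≢r refl = s∉ r∈
      uniq″ : Unique (s ∷ R)
      uniq″ = All.tabulate (λ x∈ s≡x → s∉R (subst (_∈ R) (sym s≡x) x∈)) ∷ uniq
      continue : ∀ k → n ≡ k ℕ.+ length R → ∃ (Matched (y₀ ∷ ys))
      continue zero fuel′ = ⊥-elim (ℕ.1+n≰n (subst (λ m → suc (length R) ℕ.≤ m) fuel′ (length-unique (s ∷ R) uniq″)))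
      continue (suc k) fuel′ = search k (s ∷ R) (trans fuel′ (sym (ℕ.+-suc k (length R)))) uniq″
        (λ { x (here refl) → s∈ ; x (there z) → R⊆ x z })
        (λ { x (here refl) → weaken (alts x (here refl)) ; x (there (here refl)) → reach (alts r r∈) r∈ s∈ s∉ s≢r pos ; x (there (there z)) → weaken (alts x (there z)) })

    extend : ∃ (Matched (y₀ ∷ ys))
    extend = search n [] (sym (ℕ.+-identityʳ n)) [] (λ _ ()) (λ { r (here refl) → alt₀ })

  matching : ∀ ys → Unique ys → ∃ (Matched ys)
  matching [] _ = id , (λ _ ()) , (λ _ _ ())
  matching (y ∷ ys) (y∉ ∷ uniq) with f , m ← matching ys uniq = Augment.extend ys f m y (λ z → All.lookup y∉ z refl)

  permutation : ∃ λ τ → Injective _≡_ _≡_ τ × (∀ y → 0ℚ < M y (τ y))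
  permutation with τ , pos , inj ← matching (allFin n) (Unique.allFin⁺ n) =
    τ , (λ {x} {y} → inj x y (∈-allFin x) (∈-allFin y)) , λ y → pos y (∈-allFin y)

argmin : ∀ {n} (f : Fin (suc n) → ℚ) → ∃ λ i → ∀ j → f i ≤ f j
argmin {zero} f = zero , λ { zero → ≤-refl }
argmin {suc n} f with i , p ← argmin (λ j → f (suc j)) with ℚ.≤-total (f zero) (f (suc i))
... | inj₁ q = zero , λ { zero → ≤-refl ; (suc j) → ≤-trans q (p j) }
... | inj₂ q = suc i , λ { zero → q ; (suc j) → p j }

sumFin-mono : ∀ {n} {f g : Fin n → ℕ} → (∀ i → f i ℕ.≤ g i) → sumFin f ℕ.≤ sumFin g
sumFin-mono {zero} p = z≤n
sumFin-mono {suc n} p = ℕ.+-mono-≤ (p zero) (sumFin-mono (λ i → p (suc i)))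

sumFin-mono-< : ∀ {n} {f g : Fin n → ℕ} → (∀ i → f i ℕ.≤ g i) → ∀ i → f i ℕ.< g i → sumFin f ℕ.< sumFin g
sumFin-mono-< p zero q = ℕ.+-mono-<-≤ q (sumFin-mono (λ i → p (suc i)))
sumFin-mono-< p (suc i) q = ℕ.+-mono-≤-< (p zero) (sumFin-mono-< (λ i → p (suc i)) i q)

-- An injection of a finite set into itself is onto: the deficits `1 - c v` are non-negative and sum
-- to 0.
∑-preimage : ∀ {n} {τ : Fin n → Fin n} → Injective _≡_ _≡_ τ → ∀ v → ∑ (λ y → ind (eqF (τ y) v)) ≡ 1ℚ
∑-preimage {n} {τ} inj v = ℚ.≤-antisym (c≤1 v) (≤-trans (≡⇒≤ (sym lem)) (≤-trans (-monoʳ {1ℚ} (≤-trans (f≤∑ {f = λ v → 1ℚ - c v} (λ v → 0≤- (c≤1 v)) v) (≡⇒≤ total))) (≡⇒≤ (lem₀ (c v)))))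
  where
  c : Fin n → ℚ
  c v = ∑ (λ y → ind (eqF (τ y) v))
  c≤1 : ∀ v → c v ≤ 1ℚ
  c≤1 v = ∑-ind≤1 _ λ i j p q → inj (trans (eqF⇒≡ p) (sym (eqF⇒≡ q)))
  opaque
    unfolding _+_
    lem : 1ℚ - 0ℚ ≡ 1ℚ
    lem = refl
    lem₀ : ∀ x → 1ℚ - (1ℚ - x) ≡ x
    lem₀ = solve-∀ ringℚ
    lem₁ : ∀ x → 1ℚ - x ≡ 1ℚ + (- 1ℚ) * x
    lem₁ = solve-∀ ringℚ
    lem₂ : ∀ x → x + (- 1ℚ) * x ≡ 0ℚ
    lem₂ = solve-∀ ringℚ
  total : ∑ (λ v → 1ℚ - c v) ≡ 0ℚ
  total = begin
    ∑ (λ v → 1ℚ - c v) ≡⟨ ∑-cong (λ v → lem₁ (c v)) ⟩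
    ∑ (λ v → 1ℚ + (- 1ℚ) * c v) ≡⟨ trans (∑-+ _ _) (cong (∑ (λ _ → 1ℚ) +_) (∑-*ˡ (- 1ℚ) c)) ⟩
    ∑ (λ _ → 1ℚ) + (- 1ℚ) * ∑ c ≡⟨ cong (λ z → ∑ (λ _ → 1ℚ) + (- 1ℚ) * z) (trans (∑-swap (λ v y → ind (eqF (τ y) v))) (∑-cong λ y → ∑-at₁ (τ y))) ⟩
    ∑ {n} (λ _ → 1ℚ) + (- 1ℚ) * ∑ {n} (λ _ → 1ℚ) ≡⟨ lem₂ _ ⟩
    0ℚ ∎
    where open ≡-Reasoning

support : ∀ {n} → (Fin n → Fin n → ℚ) → ℕ
support M = sumFin (λ y → sumFin (λ v → b2n (not (M y v ≤ᵇ 0ℚ))))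

-- Either the matching found in the support is cheap enough, or removing a multiple of it from M lowers the average cost.
birkhoff : ∀ {n} k (M : Fin n → Fin n → ℚ) → DoublyStochastic M → support M ℕ.≤ k → (C : Fin n → Fin n → ℚ) → (∀ y v → 0ℚ ≤ C y v) →
  ∃ λ τ → Injective _≡_ _≡_ τ × (∀ y → 0ℚ < M y (τ y)) × ∑ (λ y → C y (τ y)) ≤ ∑ (λ y → ∑ (λ v → M y v * C y v))
birkhoff {zero} k M ds supp C 0≤C = (λ ()) , (λ {x} → λ { }) , (λ ()) , ≡⇒≤ (∑-cong λ ())
birkhoff {suc n} k M ds supp C 0≤C with τ , inj , pos ← Hall.permutation ds with ∑ (λ y → C y (τ y)) ℚ.≤? ∑ (λ y → ∑ (λ v → M y v * C y v))
... | yes cheap = τ , inj , pos , cheap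
... | no dear with y₀ , least ← argmin (λ y → M y (τ y)) = continue k supp
  where
  open DoublyStochastic ds
  -- Subtracting the least matched entry erases the position `(y₀ , τ y₀)` and creates no new
  -- positive entry, so the support shrinks. If `λ₀` were at least 1, the matching would cost at
  -- most `total`.
  λ₀ = M y₀ (τ y₀)
  total = ∑ (λ y → ∑ (λ v → M y v * C y v))
  cost = ∑ (λ y → C y (τ y))
  total≤cost : total ≤ cost
  total≤cost = <⇒≤ (ℚ.≰⇒> dear)
  λ₀<1 : λ₀ < 1ℚ
  λ₀<1 = ℚ.≰⇒> λ 1≤λ → dear (∑-mono λ y → ≤-trans (≡⇒≤ (sym (*-identityˡ _))) (≤-trans (*-monoʳ (0≤C y _) (≤-trans 1≤λ (least y))) (f≤∑ {f = λ v → M y v * C y v} (λ v → 0≤* (0≤M y v) (0≤C y v)) (τ y))))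
  0<1-λ : 0ℚ < 1ℚ - λ₀
  0<1-λ = 0<- λ₀<1
  i = inv (1ℚ - λ₀)
  M′ : Fin (suc n) → Fin (suc n) → ℚ
  M′ y v = (M y v + (- λ₀) * ind (eqF (τ y) v)) * i
  opaque
    unfolding _+_
    lem₁ : ∀ l → 1ℚ + (- l) * 1ℚ ≡ 1ℚ - l
    lem₁ = solve-∀ ringℚ
    lem₂ : ∀ m l → m + (- l) * 1ℚ ≡ m - l
    lem₂ = solve-∀ ringℚ
    lem₃ : ∀ m l → m + (- l) * 0ℚ ≡ m
    lem₃ = solve-∀ ringℚ
    lem₄ : ∀ m l e i c → (m + (- l) * e) * i * c ≡ i * (m * c + (- l) * (e * c))
    lem₄ = solve-∀ ringℚ
    lem₅ : ∀ t l → t + (- l) * t ≡ t * (1ℚ - l)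
    lem₅ = solve-∀ ringℚ
    lem₆ : ∀ t l c → t + (- l) * t ≡ t + (- l) * c + l * (c - t)
    lem₆ = solve-∀ ringℚ
  0≤M′ : ∀ y v → 0ℚ ≤ M′ y v
  0≤M′ y v = 0≤* lem (0≤inv _)
    where
    lem : 0ℚ ≤ M y v + (- λ₀) * ind (eqF (τ y) v)
    lem with eqF (τ y) v in eq
    ... | true = subst (0ℚ ≤_) (sym (lem₂ (M y v) λ₀)) (0≤- (subst (λ w → λ₀ ≤ M y w) (eqF⇒≡ eq) (least y)))
    ... | false = subst (0ℚ ≤_) (sym (lem₃ (M y v) λ₀)) (0≤M y v)
  ds′ : DoublyStochastic M′
  ds′ = record
    { 0≤M = 0≤M′
    ; row = λ y → trans (∑-*ʳ i _) (trans (cong (_* i) (trans (∑-+ (M y) _) (trans (cong₂ _+_ (row y) (trans (∑-*ˡ (- λ₀) _) (cong ((- λ₀) *_) (∑-at₁ (τ y))))) (lem₁ λ₀)))) (*-inv 0<1-λ))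
    ; col = λ v → trans (∑-*ʳ i _) (trans (cong (_* i) (trans (∑-+ (λ y → M y v) _) (trans (cong₂ _+_ (col v) (trans (∑-*ˡ (- λ₀) _) (cong ((- λ₀) *_) (∑-preimage inj v)))) (lem₁ λ₀)))) (*-inv 0<1-λ))
    }
  M′≤ : ∀ y v → M y v ≤ 0ℚ → M′ y v ≤ 0ℚ
  M′≤ y v p = ≤-trans (*-monoʳ (0≤inv _) (≤-trans (lem (eqF (τ y) v)) p)) (≡⇒≤ (*-zeroˡ i))
    where
    lem : ∀ b → M y v + (- λ₀) * ind b ≤ M y v
    lem true = ≤-trans (≡⇒≤ (lem₂ (M y v) λ₀)) (x-y≤x (<⇒≤ (pos y₀)))
    lem false = ≡⇒≤ (lem₃ (M y v) λ₀)
  pos⁻ : ∀ y v → 0ℚ < M′ y v → 0ℚ < M y v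
  pos⁻ y v p with 0ℚ ℚ.<? M y v
  ... | yes q = q
  ... | no ¬q = ⊥-elim (≤⇒≯ (M′≤ y v (≮⇒≥ ¬q)) p)
  entry≤ : ∀ y v → b2n (not (M′ y v ≤ᵇ 0ℚ)) ℕ.≤ b2n (not (M y v ≤ᵇ 0ℚ))
  entry≤ y v with M′ y v ≤ᵇ 0ℚ in p | M y v ≤ᵇ 0ℚ in q
  ... | true | _ = z≤n
  ... | false | false = ℕ.≤-refl
  ... | false | true = ⊥-elim (true≢false (≤⇒≤ᵇ (M′≤ y v (≤ᵇ⇒≤ q))) p)
  M′-zero : ¬ 0ℚ < M′ y₀ (τ y₀)
  M′-zero = ≤⇒≯ (≡⇒≤ (trans (cong (_* i) (trans (cong (λ b → λ₀ + (- λ₀) * ind b) (eqF-refl (τ y₀))) (trans (lem₂ λ₀ λ₀) (-‿inverse λ₀)))) (*-zeroˡ i)))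
  entry< : b2n (not (M′ y₀ (τ y₀) ≤ᵇ 0ℚ)) ℕ.< b2n (not (M y₀ (τ y₀) ≤ᵇ 0ℚ))
  entry< rewrite ≤⇒≤ᵇ (≮⇒≥ M′-zero) | ≰⇒≤ᵇ (λ q → ≤⇒≯ q (pos y₀)) = s≤s z≤n
  support< : support M′ ℕ.< support M
  support< = sumFin-mono-< (λ y → sumFin-mono (entry≤ y)) y₀ (sumFin-mono-< (entry≤ y₀) (τ y₀) entry<)
  cost′ : ∑ (λ y → ∑ (λ v → M′ y v * C y v)) ≤ total
  cost′ = ∑ (λ y → ∑ (λ v → M′ y v * C y v)) ≡⟨ trans (∑-cong λ y → trans (∑-cong λ v → lem₄ _ _ _ _ _) (trans (∑-*ˡ i _) (cong (i *_) (trans (∑-+ _ _) (cong (∑ (λ v → M y v * C y v) +_) (trans (∑-*ˡ (- λ₀) _) (cong ((- λ₀) *_) (∑-at (τ y) (C y))))))))) (trans (∑-*ˡ i _) (cong (i *_) (trans (∑-+ _ _) (cong (total +_) (∑-*ˡ (- λ₀) _))))) ⟩≤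
    i * (total + (- λ₀) * cost) ≤⟨ *-monoˡ (0≤inv _) (≤-by (λ₀ * (cost - total)) (0≤* (<⇒≤ (pos y₀)) (0≤- total≤cost)) (trans (sym (lem₅ total λ₀)) (lem₆ total λ₀ cost))) ⟩
    i * (total * (1ℚ - λ₀)) ≡⟨ trans (*-comm i _) (*-inv-cancel total 0<1-λ) ⟩≤
    total ■
  continue : ∀ k → support M ℕ.≤ k → ∃ λ τ → Injective _≡_ _≡_ τ × (∀ y → 0ℚ < M y (τ y)) × ∑ (λ y → C y (τ y)) ≤ total
  continue zero supp′ with () ← ℕ.<-≤-trans support< supp′
  continue (suc k) supp′ with τ′ , inj′ , pos′ , cheap ← birkhoff k M′ ds′ (ℕ.≤-pred (ℕ.<-≤-trans support< supp′)) C 0≤C =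
    τ′ , inj′ , (λ y → pos⁻ y (τ′ y) (pos′ y)) , ≤-trans cheap cost′

assignment : ∀ {n} (M C : Fin n → Fin n → ℚ) (act : Fin n → Bool) → (∀ y v → 0ℚ ≤ M y v) → (∀ y v → 0ℚ ≤ C y v) →
  (∀ y → act y ≡ true → ∑ (M y) ≡ 1ℚ) → (∀ v → ∑ (λ y → ind (act y) * M y v) ≤ 1ℚ) → ∑ (λ y → ind (act y)) < ⟦ n ⟧ →
  ∃ λ τ → Injective _≡_ _≡_ τ × (∀ y → act y ≡ true → 0ℚ < M y (τ y)) × ∑ (λ y → ind (act y) * C y (τ y)) ≤ ∑ (λ y → ind (act y) * ∑ (λ v → M y v * C y v))
assignment {n} M C act 0≤M 0≤C rows cols few =
  let τ , inj , pos , cheap = birkhoff _ M′ ds ℕ.≤-refl (λ y v → ind (act y) * C y v) (λ y v → 0≤* (0≤ind (act y)) (0≤C y v)) in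
  τ , inj , (λ y p → subst (0ℚ <_) (M′-act y (τ y) p) (pos y)) , ≤-trans cheap (≡⇒≤ (∑-cong λ y → cost y))
  where
  m = ∑ (λ y → ind (act y))
  c : Fin n → ℚ
  c v = ∑ (λ y → ind (act y) * M y v)
  i = inv (⟦ n ⟧ - m)
  pad : Fin n → ℚ
  pad v = (1ℚ - c v) * i
  M′ : Fin n → Fin n → ℚ
  M′ y v = if act y then M y v else pad v
  M′-act : ∀ y v → act y ≡ true → M′ y v ≡ M y v
  M′-act y v p rewrite p = refl
  M′-split : ∀ y v → M′ y v ≡ ind (act y) * M y v + ind (not (act y)) * pad v
  M′-split y v with act y
  ... | true = sym (trans (cong₂ _+_ (*-identityˡ _) (*-zeroˡ _)) (+-identityʳ _))
  ... | false = sym (trans (cong₂ _+_ (*-zeroˡ _) (*-identityˡ _)) (+-identityˡ _))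
  opaque
    unfolding _+_
    lem₁ : ∀ x → 1ℚ - x ≡ 1ℚ + (- 1ℚ) * x
    lem₁ = solve-∀ ringℚ
    lem₂ : ∀ n m → n * 1ℚ + (- 1ℚ) * m ≡ n - m
    lem₂ = solve-∀ ringℚ
    lem₃ : ∀ k c i → c + k * ((1ℚ - c) * i) ≡ c + k * i * (1ℚ - c)
    lem₃ = solve-∀ ringℚ
    lem₄ : ∀ c → c + 1ℚ * (1ℚ - c) ≡ 1ℚ
    lem₄ = solve-∀ ringℚ
    lem₅ : ∀ x y → x ≡ (y + x) - y
    lem₅ = solve-∀ ringℚ
  inactive : ∑ (λ y → ind (not (act y))) ≡ ⟦ n ⟧ - m
  inactive = trans (lem₅ _ m) (cong (_- m) (trans (sym (∑-+ _ _)) (trans (∑-cong λ y → ind-not (act y)) (trans (∑-const n 1ℚ) (*-identityʳ _)))))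
  pad-row : ∑ pad ≡ 1ℚ
  pad-row = trans (∑-*ʳ i _) (trans (cong (_* i) (trans (∑-cong λ v → lem₁ (c v)) (trans (∑-+ _ _) (trans (cong₂ _+_ (∑-const n 1ℚ) (trans (∑-*ˡ (- 1ℚ) c) (cong ((- 1ℚ) *_) ∑c))) (lem₂ ⟦ n ⟧ m))))) (*-inv (0<- few)))
    where
    ∑c : ∑ c ≡ m
    ∑c = trans (∑-swap (λ v y → ind (act y) * M y v)) (∑-cong λ y → trans (∑-*ˡ (ind (act y)) (M y)) (trans (ind-cong (act y) (rows y)) (*-identityʳ _)))
  ds : DoublyStochastic M′
  ds = record { 0≤M = nonneg ; row = row ; col = col }
    where
    nonneg : ∀ y v → 0ℚ ≤ M′ y v
    nonneg y v with act y
    ... | true = 0≤M y v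
    ... | false = 0≤* (0≤- (cols v)) (0≤inv _)
    row : ∀ y → ∑ (M′ y) ≡ 1ℚ
    row y with act y in eq
    ... | true = rows y eq
    ... | false = pad-row
    col : ∀ v → ∑ (λ y → M′ y v) ≡ 1ℚ
    col v = trans (∑-cong λ y → M′-split y v) (trans (∑-+ _ _) (trans (cong (c v +_) (trans (∑-*ʳ (pad v) _) (cong (_* pad v) inactive)))
      (trans (lem₃ (⟦ n ⟧ - m) (c v) i) (trans (cong (λ z → c v + z * (1ℚ - c v)) (*-inv (0<- few))) (lem₄ (c v))))))
  cost : ∀ y → ∑ (λ v → M′ y v * (ind (act y) * C y v)) ≡ ind (act y) * ∑ (λ v → M y v * C y v)
  cost y = trans (∑-cong λ v → lem y v) (∑-*ˡ (ind (act y)) _)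
    where
    lem : ∀ y v → M′ y v * (ind (act y) * C y v) ≡ ind (act y) * (M y v * C y v)
    lem y v with act y
    ... | true = *-swap _ _ _
    ... | false = trans (*-swap _ _ _) (trans (*-zeroˡ _) (sym (*-zeroˡ _)))

-- Common neighbourhoods and regularity

module _ {a b : ℕ} (G : BipGraph a b) where

  cn : List (Fin a) → Fin b → Bool
  cn [] v = true
  cn (u ∷ t) v = edge G u v ∧ cn t v

  N : List (Fin a) → ℚ
  N t = ∑ λ v → ind (cn t v)

  degB : Fin b → ℚ
  degB v = ∑ λ u → ind (edge G u v)

  degA : Fin a → ℚ
  degA u = ∑ λ v → ind (edge G u v)

  size : ℚ
  size = ∑ λ u → ∑ λ v → ind (edge G u v)

  cn⁺ : ∀ t v → (∀ u → u ∈ t → edge G u v ≡ true) → cn t v ≡ true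
  cn⁺ [] v p = refl
  cn⁺ (u ∷ t) v p rewrite p u (here refl) = cn⁺ t v (λ w q → p w (there q))

  cn⁻ : ∀ {t v} → cn t v ≡ true → ∀ {u} → u ∈ t → edge G u v ≡ true
  cn⁻ {u ∷ t} {v} p (here refl) with edge G u v
  ... | true = refl
  cn⁻ {u ∷ t} {v} p (there q) with edge G u v
  ... | true = cn⁻ {t} p q

  N-⊆ : ∀ {s t} → (∀ u → u ∈ s → u ∈ t) → N t ≤ N s
  N-⊆ {s} {t} s⊆t = ∑-mono λ v → ind-mono {cn t v} λ p → cn⁺ s v λ u u∈ → cn⁻ {t} p (s⊆t u u∈)

  0≤N : ∀ t → 0ℚ ≤ N t
  0≤N t = 0≤∑ λ v → 0≤ind (cn t v)

  N≤ : ∀ t → N t ≤ ⟦ b ⟧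
  N≤ t = ∑-ind≤ (cn t)

  ⟦bedges⟧ : ⟦ bedges G ⟧ ≡ size
  ⟦bedges⟧ = trans (⟦sumFin⟧ (bdegA G)) (∑-cong λ u → trans (⟦sumFin⟧ (λ v → b2n (edge G u v))) (∑-cong λ v → ⟦b2n⟧ (edge G u v)))

  ⟦bdegA⟧ : ∀ u → ⟦ bdegA G u ⟧ ≡ degA u
  ⟦bdegA⟧ u = trans (⟦sumFin⟧ (λ v → b2n (edge G u v))) (∑-cong λ v → ⟦b2n⟧ (edge G u v))

  ⟦bdegB⟧ : ∀ v → ⟦ bdegB G v ⟧ ≡ degB v
  ⟦bdegB⟧ v = trans (⟦sumFin⟧ (λ u → b2n (edge G u v))) (∑-cong λ u → ⟦b2n⟧ (edge G u v))

opaque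
  unfolding _+_ ⟦_⟧
  abs-lower : ∀ {e m y} → ℚ.∣ e ℚ.- m ∣ ≤ y → m - y ≤ e
  abs-lower {e} {m} {y} p with ℚ.∣p∣≡p∨∣p∣≡-p (e ℚ.- m)
  ... | inj₁ q = ≤-by ((e - m) + y) (0≤+ (subst (0ℚ ≤_) q (ℚ.0≤∣p∣ (e ℚ.- m))) (≤-trans (ℚ.0≤∣p∣ (e ℚ.- m)) p)) (lem e m y)
    where
    lem : ∀ e m y → e ≡ (m - y) + ((e - m) + y)
    lem = solve-∀ ringℚ
  ... | inj₂ q = ≤-by (y - - (e - m)) (0≤- (subst (_≤ y) q p)) (lem e m y)
    where
    lem : ∀ e m y → e ≡ (m - y) + (y - - (e - m))
    lem = solve-∀ ringℚ

  abs-upper : ∀ {e m y} → ℚ.∣ e ℚ.- m ∣ ≤ y → e ≤ m + y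
  abs-upper {e} {m} {y} p with ℚ.∣p∣≡p∨∣p∣≡-p (e ℚ.- m)
  ... | inj₁ q = ≤-by (y - (e - m)) (0≤- (subst (_≤ y) q p)) (lem e m y)
    where
    lem : ∀ e m y → m + y ≡ e + (y - (e - m))
    lem = solve-∀ ringℚ
  ... | inj₂ q = ≤-by (- (e - m) + y) (0≤+ (subst (0ℚ ≤_) q (ℚ.0≤∣p∣ (e ℚ.- m))) (≤-trans (ℚ.0≤∣p∣ (e ℚ.- m)) p)) (lem e m y)
    where
    lem : ∀ e m y → m + y ≡ e + (- (e - m) + y)
    lem = solve-∀ ringℚ

  regular-lower : ∀ {a b ε d} {G : BipGraph a b} → Regular ε d G → (A′ : Subset a) (B′ : Subset b) →
    ε * ⟦ a ⟧ < ⟦ Subset.∣ A′ ∣ ⟧ → ε * ⟦ b ⟧ < ⟦ Subset.∣ B′ ∣ ⟧ →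
    (d - ε) * ⟦ Subset.∣ A′ ∣ ℕ.* Subset.∣ B′ ∣ ⟧ ≤ ⟦ edgesBetween G A′ B′ ⟧
  regular-lower {ε = ε} {d} reg A′ B′ p q = ≤-trans (≡⇒≤ (lem d ε ⟦ Subset.∣ A′ ∣ ℕ.* Subset.∣ B′ ∣ ⟧)) (abs-lower (reg A′ B′ p q))
    where
    lem : ∀ d e m → (d - e) * m ≡ d * m - e * m
    lem = solve-∀ ringℚ

  degree-bounds : ∀ {ε d} n k → ℚ.∣ ℕtoℚ k ℚ.- d ℚ.* ℕtoℚ n ∣ ≤ ε ℚ.* ℕtoℚ n → (d - ε) * ⟦ n ⟧ ≤ ⟦ k ⟧ × ⟦ k ⟧ ≤ (d + ε) * ⟦ n ⟧
  degree-bounds {ε} {d} n k p = ≤-trans (≡⇒≤ (lem d ε ⟦ n ⟧)) (abs-lower p) , ≤-trans (abs-upper p) (≡⇒≤ (lem′ d ε ⟦ n ⟧))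
    where
    lem : ∀ d e m → (d - e) * m ≡ d * m - e * m
    lem = solve-∀ ringℚ
    lem′ : ∀ d e m → d * m + e * m ≡ (d + e) * m
    lem′ = solve-∀ ringℚ

∣tabulate∣ : ∀ {n} (P : Fin n → Bool) → ⟦ Subset.∣ Vec.tabulate P ∣ ⟧ ≡ ∑ (λ i → ind (P i))
∣tabulate∣ {n} P = trans (cong ⟦_⟧ (go P)) (trans (⟦sumFin⟧ (λ i → b2n (P i))) (∑-cong λ i → ⟦b2n⟧ (P i)))
  where
  go : ∀ {n} (P : Fin n → Bool) → Subset.∣ Vec.tabulate P ∣ ≡ sumFin (λ i → b2n (P i))
  go {zero} P = refl
  go {suc n} P with P zero
  ... | true = cong suc (go (λ i → P (suc i)))
  ... | false = go (λ i → P (suc i))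

⟦edgesBetween⟧ : ∀ {a b} (G : BipGraph a b) (P : Fin a → Bool) (C : Fin b → Bool) →
  ⟦ edgesBetween G (Vec.tabulate P) (Vec.tabulate C) ⟧ ≡ ∑ λ u → ind (P u) * ∑ λ v → ind (C v ∧ edge G u v)
⟦edgesBetween⟧ G P C = trans (⟦sumFin⟧ (λ u → sumFin (λ v → inS (Vec.tabulate P) u ℕ.* inS (Vec.tabulate C) v ℕ.* b2n (edge G u v))))
  (∑-cong λ u → trans (⟦sumFin⟧ (λ v → inS (Vec.tabulate P) u ℕ.* inS (Vec.tabulate C) v ℕ.* b2n (edge G u v)))
    (trans (∑-cong λ v → term u v) (∑-*ˡ (ind (P u)) _)))
  where
  term : ∀ u v → ⟦ inS (Vec.tabulate P) u ℕ.* inS (Vec.tabulate C) v ℕ.* b2n (edge G u v) ⟧ ≡ ind (P u) * ind (C v ∧ edge G u v)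
  term u v rewrite Vec.lookup∘tabulate P u | Vec.lookup∘tabulate C v =
    trans (⟦*⟧ (b2n (P u) ℕ.* b2n (C v)) _) (trans (cong₂ _*_ (trans (⟦*⟧ (b2n (P u)) (b2n (C v))) (cong₂ _*_ (⟦b2n⟧ (P u)) (⟦b2n⟧ (C v)))) (⟦b2n⟧ (edge G u v)))
      (trans (*-assoc _ _ _) (cong (ind (P u) *_) (sym (ind-∧ (C v) (edge G u v))))))

∃-true : ∀ {n} (P : Fin n → Bool) → 0ℚ < ∑ (λ i → ind (P i)) → ∃ λ i → P i ≡ true
∃-true {n} P p with anyF P in eq
... | true = anyF⁻ {P = P} eq
... | false = ⊥-elim (ℚ.<-irrefl refl (subst (0ℚ <_) (trans (∑-cong λ i → cong ind (anyF-false eq i)) (∑-0 {n})) p))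

module Regularity {a b : ℕ} (G : BipGraph a b) (ε d : ℚ) (0≤ε : 0ℚ ≤ ε) (reg : SuperRegular ε d G)
  (0<q : 0ℚ < d - ε) (q≤1 : d - ε ≤ 1ℚ) where

  q : ℚ
  q = d - ε

  nbC : (Fin b → Bool) → Fin a → ℚ
  nbC C u = ∑ λ v → ind (C v ∧ edge G u v)

  card : (Fin b → Bool) → ℚ
  card C = ∑ λ v → ind (C v)

  -- Otherwise the exceptional vertices and `C`, both large enough for regularity, form a pair of
  -- density below `d - ε`.
  few-atypical : ∀ C → ε * ⟦ b ⟧ < card C → ∑ (λ u → ind (not (q * card C ≤ᵇ nbC C u))) ≤ ε * ⟦ a ⟧
  few-atypical C big = ≮⇒≥ λ many → ≤⇒≯ (lower-bound many) (upper-bound many)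
    where
    P : Fin a → Bool
    P u = not (q * card C ≤ᵇ nbC C u)
    m = ∑ (λ u → ind (P u))
    lower-bound : ε * ⟦ a ⟧ < m → q * (m * card C) ≤ ∑ (λ u → ind (P u) * nbC C u)
    lower-bound many = subst₂ _≤_ (cong (q *_) (trans (⟦*⟧ _ _) (cong₂ _*_ (∣tabulate∣ P) (∣tabulate∣ C)))) (⟦edgesBetween⟧ G P C)
      (regular-lower (proj₁ reg) (Vec.tabulate P) (Vec.tabulate C) (subst (ε * ⟦ a ⟧ <_) (sym (∣tabulate∣ P)) many) (subst (ε * ⟦ b ⟧ <_) (sym (∣tabulate∣ C)) big))
    diff : Fin a → ℚ
    diff u = ind (P u) * (q * card C - nbC C u)
    0≤diff : ∀ u → 0ℚ ≤ diff u
    0≤diff u = cases (q * card C ≤ᵇ nbC C u) refl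
      where
      cases : ∀ o → (q * card C ≤ᵇ nbC C u) ≡ o → 0ℚ ≤ ind (not o) * (q * card C - nbC C u)
      cases true _ = ≡⇒≤ (sym (*-zeroˡ _))
      cases false eq = 0≤* 0≤1 (<⇒≤ (0<- (≤ᵇ⇒> eq)))
    0<diff : ∀ u → P u ≡ true → 0ℚ < diff u
    0<diff u p = subst (λ b → 0ℚ < ind b * (q * card C - nbC C u)) (sym p) (0<* 0<1 (0<- (≤ᵇ⇒> (not≡true p))))
    opaque
      unfolding _+_
      lem : ∀ p x n → p * x ≡ p * n + p * (x - n)
      lem = solve-∀ ringℚ
      lem₂ : ∀ q m c → q * (m * c) ≡ m * (q * c)
      lem₂ = solve-∀ ringℚ
    upper-bound : ε * ⟦ a ⟧ < m → ∑ (λ u → ind (P u) * nbC C u) < q * (m * card C)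
    upper-bound many =
      let u₀ , p = ∃-true P (ℚ.≤-<-trans (0≤* 0≤ε (0≤⟦⟧ a)) many) in
      subst₂ _<_ (+-identityʳ _) (sym (trans (lem₂ q m (card C)) (trans (sym (∑-*ʳ (q * card C) _)) (trans (∑-cong λ u → lem (ind (P u)) (q * card C) (nbC C u)) (∑-+ _ _)))))
        (+-mono-≤-< (≤-refl {∑ (λ u → ind (P u) * nbC C u)}) (ℚ.<-≤-trans (0<diff u₀ p) (f≤∑ 0≤diff u₀)))

  NC : (Fin b → Bool) → List (Fin a) → ℚ
  NC C t = ∑ λ v → ind (C v ∧ cn G t v)

  -- A tuple whose common neighbourhood is too small has a first entry that shrinks the set C of candidates too much.
  few-atypical-tuples : ∀ k C → ε * ⟦ b ⟧ < q ^ k * card C →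
    SumT k (λ t → ind (not (q ^ k * card C ≤ᵇ NC C t))) ≤ ⟦ k ⟧ * ε * ⟦ a ⟧ ^ k
  few-atypical-tuples zero C big = ≡⇒≤ (trans (cong (λ b → ind (not b)) (≤⇒≤ᵇ (≡⇒≤ (trans (*-identityˡ _) (∑-cong λ v → cong ind (lem (C v))))))) (sym (trans (cong (λ z → z * ε * 1ℚ) ⟦0⟧) (trans (cong (_* 1ℚ) (*-zeroˡ ε)) (*-zeroˡ 1ℚ)))))
    where
    lem : ∀ b → b ≡ b ∧ true
    lem true = refl
    lem false = refl
  few-atypical-tuples (suc k) C big =
    ∑ (λ u → SumT k (λ t → ind (not (q ^ suc k * card C ≤ᵇ NC C (u ∷ t))))) ≤⟨ ∑-mono split ⟩
    ∑ (λ u → ind (P u) * ⟦ a ⟧ ^ k + ⟦ k ⟧ * ε * ⟦ a ⟧ ^ k) ≡⟨ trans (∑-+ _ _) (cong₂ _+_ (∑-*ʳ (⟦ a ⟧ ^ k) _) (∑-const a _)) ⟩≤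
    ∑ (λ u → ind (P u)) * ⟦ a ⟧ ^ k + ⟦ a ⟧ * (⟦ k ⟧ * ε * ⟦ a ⟧ ^ k) ≤⟨ +-mono (*-monoʳ (0≤^ k (0≤⟦⟧ a)) (few-atypical C big₀)) ≤-refl ⟩
    ε * ⟦ a ⟧ * ⟦ a ⟧ ^ k + ⟦ a ⟧ * (⟦ k ⟧ * ε * ⟦ a ⟧ ^ k) ≡⟨ trans (lem ε ⟦ a ⟧ (⟦ a ⟧ ^ k) ⟦ k ⟧) (cong (λ z → z * ε * (⟦ a ⟧ * ⟦ a ⟧ ^ k)) (sym (⟦suc⟧ k))) ⟩≤
    ⟦ suc k ⟧ * ε * (⟦ a ⟧ * ⟦ a ⟧ ^ k) ■
    where
    opaque
      unfolding _+_
      lem : ∀ e a x k → e * a * x + a * (k * e * x) ≡ (1ℚ + k) * e * (a * x)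
      lem = solve-∀ ringℚ
    0≤card : 0ℚ ≤ card C
    0≤card = 0≤∑ λ v → 0≤ind (C v)
    big₀ : ε * ⟦ b ⟧ < card C
    big₀ = ℚ.<-≤-trans big (≤-trans (*-monoʳ 0≤card (^-≤1 (suc k) (<⇒≤ 0<q) q≤1)) (≡⇒≤ (*-identityˡ _)))
    P : Fin a → Bool
    P u = not (q * card C ≤ᵇ nbC C u)
    split : ∀ u → SumT k (λ t → ind (not (q ^ suc k * card C ≤ᵇ NC C (u ∷ t)))) ≤ ind (P u) * ⟦ a ⟧ ^ k + ⟦ k ⟧ * ε * ⟦ a ⟧ ^ k
    split u = cases (q * card C ≤ᵇ nbC C u) refl
      where
      C′ : Fin b → Bool
      C′ v = C v ∧ edge G u v
      cases : ∀ o → (q * card C ≤ᵇ nbC C u) ≡ o → SumT k (λ t → ind (not (q ^ suc k * card C ≤ᵇ NC C (u ∷ t)))) ≤ ind (not o) * ⟦ a ⟧ ^ k + ⟦ k ⟧ * ε * ⟦ a ⟧ ^ k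
      cases false _ = ≤-trans (SumT-mono k λ t _ → ind≤1 (not (q ^ suc k * card C ≤ᵇ NC C (u ∷ t)))) (≤-trans (≡⇒≤ (trans (SumT-const k 1ℚ) (*-comm _ _))) (x≤x+y (0≤* (0≤* (0≤⟦⟧ k) 0≤ε) (0≤^ k (0≤⟦⟧ a)))))
      cases true eq = ≤-trans (SumT-mono k λ t _ → ind-mono {not (q ^ suc k * card C ≤ᵇ NC C (u ∷ t))} λ p → cong not (≰⇒≤ᵇ λ r → ≤⇒≯ (≤-trans step (≤-trans r (≡⇒≤ (∑-cong λ v → cong ind (∧-assoc (C v) _ _))))) (≤ᵇ⇒> (not≡true p))))
            (≤-trans (few-atypical-tuples k C′ (ℚ.<-≤-trans big step)) (y≤x+y (≡⇒≤ (sym (*-zeroˡ _)))))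
        where
        step : q ^ suc k * card C ≤ q ^ k * card C′
        step = ≤-trans (≡⇒≤ (trans (cong (_* card C) (*-comm q (q ^ k))) (*-assoc _ _ _))) (*-monoˡ (0≤^ k (<⇒≤ 0<q)) (≤ᵇ⇒≤ eq))

  degA-lower : ∀ u → q * ⟦ b ⟧ ≤ degA G u
  degA-lower u = ≤-trans (proj₁ (degree-bounds b (bdegA G u) (proj₁ (proj₂ reg) u))) (≡⇒≤ (⟦bdegA⟧ G u))

  degA-upper : ∀ u → degA G u ≤ (d + ε) * ⟦ b ⟧
  degA-upper u = ≤-trans (≡⇒≤ (sym (⟦bdegA⟧ G u))) (proj₂ (degree-bounds b (bdegA G u) (proj₁ (proj₂ reg) u)))

  degB-lower : ∀ v → q * ⟦ a ⟧ ≤ degB G v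
  degB-lower v = ≤-trans (proj₁ (degree-bounds a (bdegB G v) (proj₂ (proj₂ reg) v))) (≡⇒≤ (⟦bdegB⟧ G v))

  size-lower : q * (⟦ a ⟧ * ⟦ b ⟧) ≤ size G
  size-lower = ≤-trans (≡⇒≤ (trans (lem q ⟦ a ⟧ ⟦ b ⟧) (sym (∑-const a _)))) (∑-mono degA-lower)
    where
    opaque
      unfolding _+_
      lem : ∀ q a b → q * (a * b) ≡ a * (q * b)
      lem = solve-∀ ringℚ

  size-upper : size G ≤ (d + ε) * (⟦ a ⟧ * ⟦ b ⟧)
  size-upper = ≤-trans (∑-mono degA-upper) (≡⇒≤ (trans (∑-const a _) (lem (d + ε) ⟦ a ⟧ ⟦ b ⟧)))
    where
    opaque
      unfolding _+_
      lem : ∀ q a b → a * (q * b) ≡ q * (a * b)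
      lem = solve-∀ ringℚ

  typ : List (Fin a) → Bool
  typ t = q ^ length t * ⟦ b ⟧ ≤ᵇ N G t

  typ-[] : typ [] ≡ true
  typ-[] = ≤⇒≤ᵇ (≡⇒≤ (trans (*-comm 1ℚ _) (sym (∑-const b 1ℚ))))

  -- Super-regularity enters here: the neighbourhood of each single `u` has at least `q b` vertices,
  -- and the recursion for tuples starts from it. So the bound holds for every `u`, not only for
  -- most.
  few-atypical-through : ∀ u k → ε * ⟦ b ⟧ < q ^ suc k * ⟦ b ⟧ → avg k (λ t → ind (not (typ (u ∷ t)))) ≤ ⟦ k ⟧ * ε
  few-atypical-through u k big = ≤-trans (*-monoˡ (0≤^ k (0≤inv _)) (≤-trans (SumT-mono k pointwise) (few-atypical-tuples k C (ℚ.<-≤-trans big step))))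
      (≤-trans (≡⇒≤ (lem (inv ⟦ a ⟧ ^ k) (⟦ k ⟧ * ε) (⟦ a ⟧ ^ k))) (≤-trans (*-monoˡ (0≤* (0≤⟦⟧ k) 0≤ε) (≡⇒≤ (trans (*-comm _ _) (inv-^ k (0<⟦⟧ (1≤a u)))))) (≡⇒≤ (*-identityʳ _))))
    where
    1≤a : ∀ {n} → Fin n → 1 ℕ.≤ n
    1≤a {suc n} _ = s≤s z≤n
    C : Fin b → Bool
    C v = edge G u v
    step : q ^ suc k * ⟦ b ⟧ ≤ q ^ k * card C
    step = ≤-trans (≡⇒≤ (trans (cong (_* ⟦ b ⟧) (*-comm q (q ^ k))) (*-assoc _ _ _))) (*-monoˡ (0≤^ k (<⇒≤ 0<q)) (degA-lower u))
    pointwise : ∀ t → length t ≡ k → ind (not (typ (u ∷ t))) ≤ ind (not (q ^ k * card C ≤ᵇ NC C t))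
    pointwise t refl = ind-mono {not (typ (u ∷ t))} λ p → cong not (≰⇒≤ᵇ λ r → ≤⇒≯ (≤-trans step r) (≤ᵇ⇒> (not≡true p)))
    opaque
      unfolding _+_
      lem : ∀ i k x → i * (k * x) ≡ k * (i * x)
      lem = solve-∀ ringℚ

  -- The exponent `i` is not tied to the length of `t`: it counts how often the common neighbourhood
  -- was allowed to shrink by the factor `τ`.
  lev : ℚ → ℕ → List (Fin a) → Bool
  lev τ i t = τ ^ i * ⟦ b ⟧ ≤ᵇ N G t

  few-nonextensions : ∀ {τ} → 0ℚ ≤ τ → τ ≤ q → ∀ i t → ε * ⟦ b ⟧ < τ ^ i * ⟦ b ⟧ → lev τ i t ≡ true →
    ∑ (λ u → ind (not (lev τ (suc i) (u ∷ t)))) ≤ ε * ⟦ a ⟧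
  few-nonextensions {τ} 0≤τ τ≤q i t big good = ≤-trans (∑-mono pointwise) (few-atypical (cn G t) (ℚ.<-≤-trans big (≤ᵇ⇒≤ good)))
    where
    step : τ ^ suc i * ⟦ b ⟧ ≤ q * N G t
    step = ≤-trans (≡⇒≤ (*-assoc τ _ _)) (*-mono 0≤τ (0≤N G t) τ≤q (≤ᵇ⇒≤ good))
    pointwise : ∀ u → ind (not (lev τ (suc i) (u ∷ t))) ≤ ind (not (q * N G t ≤ᵇ nbC (cn G t) u))
    pointwise u = ind-mono {not (lev τ (suc i) (u ∷ t))} λ p → cong not (≰⇒≤ᵇ λ r → ≤⇒≯ (≤-trans step (≤-trans r (≡⇒≤ (∑-cong λ v → cong ind (∧-comm (cn G t v) _))))) (≤ᵇ⇒> (not≡true p)))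

-- Jobs: the bipartite graphs to be embedded

∈-filterᵇ⁺ : ∀ {A : Set} (P : A → Bool) {xs x} → x ∈ xs → P x ≡ true → x ∈ filterᵇ P xs
∈-filterᵇ⁺ P {y ∷ xs} (here refl) p rewrite p = here refl
∈-filterᵇ⁺ P {y ∷ xs} (there q) p with P y
... | true = there (∈-filterᵇ⁺ P q p)
... | false = ∈-filterᵇ⁺ P q p

∈-filterᵇ⁻ : ∀ {A : Set} (P : A → Bool) {xs x} → x ∈ filterᵇ P xs → x ∈ xs × P x ≡ true
∈-filterᵇ⁻ P {y ∷ xs} q with P y in eq
∈-filterᵇ⁻ P {y ∷ xs} (here refl) | true = here refl , eq
∈-filterᵇ⁻ P {y ∷ xs} (there q) | true with r , s ← ∈-filterᵇ⁻ P q = there r , s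
∈-filterᵇ⁻ P {y ∷ xs} q | false with r , s ← ∈-filterᵇ⁻ P q = there r , s

filterᵇ-unique : ∀ {n} (P : Fin n → Bool) {xs} → Unique xs → Unique (filterᵇ P xs)
filterᵇ-unique P {[]} [] = []
filterᵇ-unique P {x ∷ xs} (x∉ ∷ uniq) with P x
... | true = All.tabulate (λ q → All.lookup x∉ (proj₁ (∈-filterᵇ⁻ P q))) ∷ filterᵇ-unique P uniq
... | false = filterᵇ-unique P uniq

length-filterᵇ-≤ : ∀ {n} {P Q : Fin n → Bool} xs → (∀ x → P x ≡ true → Q x ≡ true) → length (filterᵇ P xs) ℕ.≤ length (filterᵇ Q xs)
length-filterᵇ-≤ [] imp = z≤n
length-filterᵇ-≤ {P = P} {Q} (x ∷ xs) imp with P x in p | Q x in q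
... | true | true = s≤s (length-filterᵇ-≤ xs imp)
... | true | false = ⊥-elim (true≢false (imp x p) q)
... | false | true = ℕ.m≤n⇒m≤1+n (length-filterᵇ-≤ xs imp)
... | false | false = length-filterᵇ-≤ xs imp

length-filterᵇ-< : ∀ {n} {P Q : Fin n → Bool} xs → (∀ x → P x ≡ true → Q x ≡ true) → ∀ {x} → x ∈ xs → P x ≡ false → Q x ≡ true → length (filterᵇ P xs) ℕ.< length (filterᵇ Q xs)
length-filterᵇ-< (x ∷ xs) imp (here refl) p q rewrite p | q = s≤s (length-filterᵇ-≤ xs imp)
length-filterᵇ-< {P = P} {Q} (x ∷ xs) imp (there x∈) p q with P x in p′ | Q x in q′
... | true | true = s≤s (length-filterᵇ-< xs imp x∈ p q)
... | true | false = ⊥-elim (true≢false (imp x p′) q′)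
... | false | true = ℕ.m≤n⇒m≤1+n (length-filterᵇ-< xs imp x∈ p q)
... | false | false = length-filterᵇ-< xs imp x∈ p q

∧⁺ : ∀ {p q} → p ≡ true → q ≡ true → p ∧ q ≡ true
∧⁺ refl refl = refl

∧⁻ˡ : ∀ {p q} → p ∧ q ≡ true → p ≡ true
∧⁻ˡ {true} _ = refl

∧⁻ʳ : ∀ {p q} → p ∧ q ≡ true → q ≡ true
∧⁻ʳ {true} r = r

∨⁺ˡ : ∀ {p q} → p ≡ true → p ∨ q ≡ true
∨⁺ˡ refl = refl

∨⁺ʳ : ∀ {p q} → q ≡ true → p ∨ q ≡ true
∨⁺ʳ {true} _ = refl
∨⁺ʳ {false} r = r

∨⁻ : ∀ {p q} → p ∨ q ≡ true → p ≡ true ⊎ q ≡ true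
∨⁻ {true} _ = inj₁ refl
∨⁻ {false} r = inj₂ r

∨-falseˡ : ∀ {p q} → p ∨ q ≡ false → p ≡ false
∨-falseˡ {false} _ = refl

∨-falseʳ : ∀ {p q} → p ∨ q ≡ false → q ≡ false
∨-falseʳ {false} r = r

not-false : ∀ {p} → not p ≡ false → p ≡ true
not-false {true} _ = refl

record Bounded {a b : ℕ} (J : BipGraph a b) (Δ : ℕ) : Set where
  field
    degA≤ : ∀ x → degA J x ≤ ⟦ Δ ⟧
    degB≤ : ∀ y → degB J y ≤ ⟦ Δ ⟧

module Job {a b : ℕ} (J : BipGraph a b) (Δ : ℕ) (bounded : Bounded J Δ) where
  open Bounded bounded

  nb : Fin b → List (Fin a)
  nb y = filterᵇ (λ x → edge J x y) (allFin a)

  nb-unique : ∀ y → Unique (nb y)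
  nb-unique y = filterᵇ-unique (λ x → edge J x y) (Unique.allFin⁺ a)

  ∈nb⁺ : ∀ {x y} → edge J x y ≡ true → x ∈ nb y
  ∈nb⁺ {x} {y} = ∈-filterᵇ⁺ (λ x → edge J x y) (∈-allFin x)

  ∈nb⁻ : ∀ {x y} → x ∈ nb y → edge J x y ≡ true
  ∈nb⁻ {x} {y} p = proj₂ (∈-filterᵇ⁻ (λ x → edge J x y) {allFin a} p)

  ∑L-nb : ∀ y f → ∑L (nb y) f ≡ ∑ λ x → ind (edge J x y) * f x
  ∑L-nb y f = ∑L-filter (λ x → edge J x y) f

  ⟦length-nb⟧ : ∀ y → ⟦ length (nb y) ⟧ ≡ degB J y
  ⟦length-nb⟧ y = trans (sym (trans (∑L-const (nb y) 1ℚ) (*-identityʳ _))) (trans (∑L-nb y (λ _ → 1ℚ)) (∑-cong λ x → *-identityʳ _))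

  length-nb≤ : ∀ y → length (nb y) ℕ.≤ Δ
  length-nb≤ y = ⟦⟧-cancel-≤ (≤-trans (≡⇒≤ (⟦length-nb⟧ y)) (degB≤ y))

  ∑-degB : ∑ (degB J) ≡ size J
  ∑-degB = ∑-swap (λ y x → ind (edge J x y))

  -- Distance at most two in the job. If `x` and `r` are not near, no tuple contains the images of
  -- both, so exchanging these images alters each tuple in at most one entry.
  near : Fin a → Fin a → Bool
  near x z = eqF x z ∨ anyF (λ y → edge J x y ∧ edge J z y)

  near-refl : ∀ x → near x x ≡ true
  near-refl x = ∨⁺ˡ (eqF-refl x)

  near⁺ : ∀ {x z y} → edge J x y ≡ true → edge J z y ≡ true → near x z ≡ true
  near⁺ {x} {z} {y} p q = ∨⁺ʳ {eqF x z} (anyF⁺ {P = λ y → edge J x y ∧ edge J z y} y (∧⁺ p q))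

  near-sym : ∀ {x z} → near x z ≡ true → near z x ≡ true
  near-sym {x} {z} p with ∨⁻ {eqF x z} p
  ... | inj₁ q = ∨⁺ˡ (trans (eqF-sym z x) q)
  ... | inj₂ q with y , r ← anyF⁻ {P = λ y → edge J x y ∧ edge J z y} q = near⁺ (∧⁻ʳ {edge J x y} r) (∧⁻ˡ r)

  m : ℚ
  m = 1ℚ + ⟦ Δ ⟧ * ⟦ Δ ⟧

  0≤m : 0ℚ ≤ m
  0≤m = 0≤+ 0≤1 (0≤* (0≤⟦⟧ Δ) (0≤⟦⟧ Δ))

  ∑-near : ∀ x → ∑ (λ z → ind (near x z)) ≤ m
  ∑-near x =
    ∑ (λ z → ind (near x z)) ≤⟨ ∑-mono (λ z → ≤-trans (ind-∨ (eqF x z) _) (+-mono ≤-refl (≤-trans (ind-anyF _) (∑-mono λ y → ≡⇒≤ (ind-∧ (edge J x y) (edge J z y)))))) ⟩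
    ∑ (λ z → ind (eqF x z) + ∑ (λ y → ind (edge J x y) * ind (edge J z y))) ≡⟨ trans (∑-+ _ _) (cong₂ _+_ (∑-at₁ x) (trans (∑-swap _) (∑-cong λ y → ∑-*ˡ (ind (edge J x y)) _))) ⟩≤
    1ℚ + ∑ (λ y → ind (edge J x y) * degB J y) ≤⟨ +-mono ≤-refl (∑-mono λ y → *-monoˡ (0≤ind (edge J x y)) (degB≤ y)) ⟩
    1ℚ + ∑ (λ y → ind (edge J x y) * ⟦ Δ ⟧) ≤⟨ +-mono ≤-refl (≤-trans (≡⇒≤ (∑-*ʳ ⟦ Δ ⟧ _)) (*-monoʳ (0≤⟦⟧ Δ) (degA≤ x))) ⟩
    m ■

  nearS : (Fin a → Bool) → Fin a → Bool
  nearS D z = anyF (λ x → D x ∧ near x z)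

  nearS⁺ : ∀ {D x z} → D x ≡ true → near x z ≡ true → nearS D z ≡ true
  nearS⁺ {D} {x} {z} p q = anyF⁺ {P = λ x → D x ∧ near x z} x (∧⁺ p q)

  nearS⁻ : ∀ {D z} → nearS D z ≡ true → ∃ λ x → D x ≡ true × near x z ≡ true
  nearS⁻ {D} {z} p with x , q ← anyF⁻ {P = λ x → D x ∧ near x z} p = x , ∧⁻ˡ q , ∧⁻ʳ {D x} q

  nearS-false : ∀ {D x z} → nearS D z ≡ false → D x ≡ true → near x z ≡ true → ⊥
  nearS-false {D} p q r = true≢false (nearS⁺ {D} q r) p

  ∑-nearS : ∀ D → ∑ (λ z → ind (nearS D z)) ≤ ∑ (λ x → ind (D x)) * m
  ∑-nearS D =
    ∑ (λ z → ind (nearS D z)) ≤⟨ ∑-mono (λ z → ≤-trans (ind-anyF _) (∑-mono λ x → ≡⇒≤ (ind-∧ (D x) (near x z)))) ⟩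
    ∑ (λ z → ∑ (λ x → ind (D x) * ind (near x z))) ≡⟨ trans (∑-swap _) (∑-cong λ x → ∑-*ˡ (ind (D x)) _) ⟩≤
    ∑ (λ x → ind (D x) * ∑ (λ z → ind (near x z))) ≤⟨ ∑-mono (λ x → *-monoˡ (0≤ind (D x)) (∑-near x)) ⟩
    ∑ (λ x → ind (D x) * m) ≡⟨ ∑-*ʳ m _ ⟩≤
    ∑ (λ x → ind (D x)) * m ■

  except : Fin a → Fin b → List (Fin a)
  except r y = filterᵇ (λ x → edge J x y ∧ not (eqF x r)) (allFin a)

  forbidden : (typ : List (Fin a) → Bool) (σ : Fin a → Fin a) → Fin a → Fin a → Bool
  forbidden typ σ u r = anyF (λ y → edge J r y ∧ not (typ (u ∷ map σ (except r y))))

-- Vertices of U are moved one at a time to positions where the common neighbourhoods stay large; lev i bounds these from below,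
-- and i grows by one whenever a vertex is moved back into a tuple.
module Repair {a b : ℕ} (J : BipGraph a b) (Δ : ℕ) (bounded : Bounded J Δ)
  (typ : List (Fin a) → Bool) (lev : ℕ → List (Fin a) → Bool)
  (lev-⊆ : ∀ {i s t} → (∀ u → u ∈ s → u ∈ t) → lev i t ≡ true → lev i s ≡ true)
  (lev-mono : ∀ {i j t} → i ℕ.≤ j → lev i t ≡ true → lev j t ≡ true)
  (typ⇒lev : ∀ t → length t ℕ.≤ Δ → typ t ≡ true → lev Δ t ≡ true)
  (εa : ℚ) (0≤εa : 0ℚ ≤ εa)
  (ext : ∀ i t → i ℕ.< Δ ℕ.+ Δ → lev i t ≡ true → ∑ (λ u → ind (not (lev (suc i) (u ∷ t)))) ≤ εa)
  (σ₀ : Fin a → Fin a) (h : Fin a → ℚ) (0≤h : ∀ u → 0ℚ ≤ h u) (K F Hv Dmax Qmax : ℚ)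
  (forb≤ : ∀ u → ∑ (λ r → ind (Job.forbidden J Δ bounded typ σ₀ u r)) ≤ F)
  (heavy≤ : ∑ (λ r → ind (not (∑ (λ z → ind (Job.near J Δ bounded r z) * h (σ₀ z)) ≤ᵇ K))) ≤ Hv)
  (room : Dmax * Job.m J Δ bounded + ⟦ Δ ⟧ * εa + F + Hv < ⟦ a ⟧)
  where
  open Job J Δ bounded
  open Bounded bounded

  rest : List (Fin a) → Fin b → List (Fin a)
  rest U y = filterᵇ (λ x → edge J x y ∧ not (mem x U)) (allFin a)

  ∈rest⁺ : ∀ {U y x} → edge J x y ≡ true → x ∉ U → x ∈ rest U y
  ∈rest⁺ {U} {y} {x} p q = ∈-filterᵇ⁺ (λ x → edge J x y ∧ not (mem x U)) (∈-allFin x) (∧⁺ p (cong not (∉⇒mem q)))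

  ∈rest⁻ : ∀ {U y x} → x ∈ rest U y → edge J x y ≡ true × x ∉ U
  ∈rest⁻ {U} {y} {x} p with r ← proj₂ (∈-filterᵇ⁻ (λ x → edge J x y ∧ not (mem x U)) {allFin a} p) = ∧⁻ˡ r , mem-false⇒∉ (not≡true (∧⁻ʳ {edge J x y} r))

  -- `D` contains `U` and every vertex whose image differs from that under `σ₀`. A step takes one
  -- vertex from `U` and adds one to `D`, so `card≤` and `weight≤` reserve the budget of the
  -- remaining steps in advance.
  record State (U : List (Fin a)) (σ : Fin a → Fin a) (D : Fin a → Bool) : Set where
    field
      injective : Injective _≡_ _≡_ σ
      agree : ∀ x → D x ≡ false → σ x ≡ σ₀ x
      U⊆D : ∀ x → x ∈ U → D x ≡ true
      good : ∀ y → lev (Δ ℕ.+ length (rest U y)) (map σ (rest U y)) ≡ true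
      card≤ : ∑ (λ x → ind (D x)) + ⟦ length U ⟧ ≤ Dmax
      weight≤ : ∑ (λ z → ind (nearS D z) * h (σ z)) + ⟦ length U ⟧ * K ≤ Qmax

  module Step {x : Fin a} {us : List (Fin a)} {σ : Fin a → Fin a} {D : Fin a → Bool} (x∉ : x ∉ us) (state : State (x ∷ us) σ D) where
    open State state

    Dx : D x ≡ true
    Dx = U⊆D x (here refl)

    rest< : ∀ y → edge J x y ≡ true → length (rest (x ∷ us) y) ℕ.< length (rest us y)
    rest< y e = length-filterᵇ-< (allFin a) (λ z p → ∧⁺ (∧⁻ˡ p) (cong not (∨-falseʳ {eqF z x} (not≡true (∧⁻ʳ {edge J z y} p))))) (∈-allFin x)
      (trans (cong (λ b → edge J x y ∧ not (b ∨ mem x us)) (eqF-refl x)) (∧-zeroʳ (edge J x y))) (∧⁺ e (cong not (∉⇒mem x∉)))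

    rest≤ : ∀ U y → length (rest U y) ℕ.≤ Δ
    rest≤ U y = ℕ.≤-trans (length-filterᵇ-≤ (allFin a) (λ z p → ∧⁻ˡ p)) (length-nb≤ y)

    badExt : Fin a → Bool
    badExt r = anyF (λ y → edge J x y ∧ not (lev (suc (Δ ℕ.+ length (rest (x ∷ us) y))) (σ r ∷ map σ (rest (x ∷ us) y))))

    ∑-badExt : ∑ (λ r → ind (badExt r)) ≤ ⟦ Δ ⟧ * εa
    ∑-badExt =
      ∑ (λ r → ind (badExt r)) ≤⟨ ∑-mono (λ r → ≤-trans (ind-anyF _) (∑-mono λ y → ≡⇒≤ (ind-∧ (edge J x y) _))) ⟩
      ∑ (λ r → ∑ (λ y → ind (edge J x y) * ind (not (lev (suc (Δ ℕ.+ length (rest (x ∷ us) y))) (σ r ∷ map σ (rest (x ∷ us) y)))))) ≡⟨ trans (∑-swap _) (∑-cong λ y → ∑-*ˡ (ind (edge J x y)) _) ⟩≤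
      ∑ (λ y → ind (edge J x y) * ∑ (λ r → ind (not (lev (suc (Δ ℕ.+ length (rest (x ∷ us) y))) (σ r ∷ map σ (rest (x ∷ us) y)))))) ≤⟨ ∑-mono (λ y → ind-mono-* (edge J x y) λ e →
          ≤-trans (∑-injective injective (λ u → 0≤ind (not (lev (suc (Δ ℕ.+ length (rest (x ∷ us) y))) (u ∷ map σ (rest (x ∷ us) y))))))
            (ext _ _ (ℕ.+-monoʳ-< Δ (ℕ.<-≤-trans (rest< y e) (rest≤ us y))) (good y))) ⟩
      ∑ (λ y → ind (edge J x y) * εa) ≤⟨ ≤-trans (≡⇒≤ (∑-*ʳ εa _)) (*-monoʳ 0≤εa (degA≤ x)) ⟩
      ⟦ Δ ⟧ * εa ■

    heavy : Fin a → Bool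
    heavy r = not (∑ (λ z → ind (near r z) * h (σ₀ z)) ≤ᵇ K)

    -- The four reasons against exchanging `x` with `r`: `r` is near an earlier change, its image
    -- does not fit at `x`, the image of `x` does not fit at `r`, or too much weight lies around
    -- `r`.
    excluded : Fin a → Bool
    excluded r = nearS D r ∨ (badExt r ∨ (forbidden typ σ₀ (σ x) r ∨ heavy r))

    card-D≤ : ∑ (λ z → ind (D z)) ≤ Dmax
    card-D≤ = ≤-trans (x≤x+y (0≤⟦⟧ _)) card≤

    opaque
      found : ∃ λ r → excluded r ≡ false
      found = ∃-false excluded (ℚ.≤-<-trans (
        ∑ (λ r → ind (excluded r)) ≤⟨ ∑-mono (λ r → ≤-trans (ind-∨ (nearS D r) _) (+-mono ≤-refl (≤-trans (ind-∨ (badExt r) _) (+-mono ≤-refl (ind-∨ (forbidden typ σ₀ (σ x) r) _))))) ⟩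
        ∑ (λ r → ind (nearS D r) + (ind (badExt r) + (ind (forbidden typ σ₀ (σ x) r) + ind (heavy r)))) ≡⟨ trans (∑-+ _ _) (cong (∑ (λ r → ind (nearS D r)) +_) (trans (∑-+ _ _) (cong (∑ (λ r → ind (badExt r)) +_) (∑-+ _ _)))) ⟩≤
        ∑ (λ r → ind (nearS D r)) + (∑ (λ r → ind (badExt r)) + (∑ (λ r → ind (forbidden typ σ₀ (σ x) r)) + ∑ (λ r → ind (heavy r))))
          ≤⟨ +-mono (≤-trans (∑-nearS D) (*-monoʳ 0≤m card-D≤)) (+-mono ∑-badExt (+-mono (forb≤ (σ x)) heavy≤)) ⟩
        Dmax * m + (⟦ Δ ⟧ * εa + (F + Hv)) ≡⟨ trans (sym (+-assoc _ _ _)) (sym (+-assoc _ _ _)) ⟩≤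
        Dmax * m + ⟦ Δ ⟧ * εa + F + Hv ■) room)

    r : Fin a
    r = proj₁ found
    farD : nearS D r ≡ false
    farD = ∨-falseˡ (proj₂ found)
    extends : badExt r ≡ false
    extends = ∨-falseˡ (∨-falseʳ {nearS D r} (proj₂ found))
    allowed : forbidden typ σ₀ (σ x) r ≡ false
    allowed = ∨-falseˡ (∨-falseʳ {badExt r} (∨-falseʳ {nearS D r} (proj₂ found)))
    light : ∑ (λ z → ind (near r z) * h (σ₀ z)) ≤ K
    light = ≤ᵇ⇒≤ (not-false (∨-falseʳ {forbidden typ σ₀ (σ x) r} (∨-falseʳ {badExt r} (∨-falseʳ {nearS D r} (proj₂ found)))))

    σ₁ : Fin a → Fin a
    σ₁ z = σ (swapF x r z)
    D₁ : Fin a → Bool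
    D₁ z = D z ∨ eqF r z

    D⊆D₁ : ∀ z → D z ≡ true → D₁ z ≡ true
    D⊆D₁ z p = ∨⁺ˡ p

    σ₁-other : ∀ {z} → z ≢ x → z ≢ r → σ₁ z ≡ σ z
    σ₁-other p q = cong σ (swapF-other p q)

    σ₁-x : σ₁ x ≡ σ r
    σ₁-x = cong σ (swapF-l x r)

    σ₁-r : σ₁ r ≡ σ x
    σ₁-r = cong σ (swapF-r x r)

    near-r⇒∉D : ∀ {z} → near r z ≡ true → D z ≡ false
    near-r⇒∉D {z} p with D z in eq
    ... | false = refl
    ... | true = ⊥-elim (nearS-false {D} farD eq (near-sym p))

    good₁ : ∀ y → lev (Δ ℕ.+ length (rest us y)) (map σ₁ (rest us y)) ≡ true
    good₁ y with edge J x y in ex | edge J r y in er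
    ... | true | true = ⊥-elim (nearS-false {D} farD Dx (near⁺ ex er))
    -- Here `x` re-enters the tuple: the level rises by one, in step with the length of `rest`.
    ... | true | false = lev-mono (ℕ.≤-trans (ℕ.≤-reflexive (sym (ℕ.+-suc Δ _))) (ℕ.+-monoʳ-≤ Δ (rest< y ex))) (lev-⊆ incl
        (not-false (lem (edge J x y) ex (anyF-false extends y))))
      where
      lem : ∀ p {q} → p ≡ true → p ∧ q ≡ false → q ≡ false
      lem true _ s = s
      incl : ∀ u → u ∈ map σ₁ (rest us y) → u ∈ σ r ∷ map σ (rest (x ∷ us) y)
      incl u u∈ with z , z∈ , refl ← ∈-map⁻ σ₁ u∈ with ez , z∉ ← ∈rest⁻ {us} z∈ = cases (z ≟ x)
        where
        cases : Dec (z ≡ x) → σ₁ z ∈ σ r ∷ map σ (rest (x ∷ us) y)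
        cases (yes refl) = here σ₁-x
        cases (no z≢x) = there (subst (_∈ map σ (rest (x ∷ us) y)) (sym (σ₁-other z≢x λ { refl → true≢false ez er })) (∈-map⁺ σ (∈rest⁺ ez λ { (here p) → z≢x p ; (there p) → z∉ p })))
    -- `allowed` speaks about `σ₀`. It applies because the other vertices of this tuple are near
    -- `r`, hence outside `D` and still placed by `σ₀`; the new tuple is even at level `Δ`.
    ... | false | true = lev-mono (ℕ.m≤m+n Δ _) (lev-⊆ incl (typ⇒lev _ len (not-false (lem (edge J r y) er (anyF-false allowed y)))))
      where
      lem : ∀ p {q} → p ≡ true → p ∧ q ≡ false → q ≡ false
      lem true _ s = s
      len : length (σ x ∷ map σ₀ (except r y)) ℕ.≤ Δ
      len = ℕ.≤-trans (s≤s (ℕ.≤-reflexive (length-map σ₀ (except r y)))) (ℕ.≤-trans (length-filterᵇ-< (allFin a) (λ z p → ∧⁻ˡ p) (∈-allFin r) (trans (cong (λ b → edge J r y ∧ not b) (eqF-refl r)) (∧-zeroʳ (edge J r y))) er) (length-nb≤ y))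
      incl : ∀ u → u ∈ map σ₁ (rest us y) → u ∈ σ x ∷ map σ₀ (except r y)
      incl u u∈ with z , z∈ , refl ← ∈-map⁻ σ₁ u∈ with ez , z∉ ← ∈rest⁻ {us} z∈ = cases (z ≟ r)
        where
        cases : Dec (z ≡ r) → σ₁ z ∈ σ x ∷ map σ₀ (except r y)
        cases (yes z≡r) = here (trans (cong σ₁ z≡r) σ₁-r)
        cases (no z≢r) = there (subst (_∈ map σ₀ (except r y)) (sym (trans (σ₁-other (λ { refl → true≢false ez ex }) z≢r) (agree z (near-r⇒∉D (near⁺ er ez)))))
          (∈-map⁺ σ₀ (∈-filterᵇ⁺ (λ x → edge J x y ∧ not (eqF x r)) (∈-allFin z) (∧⁺ ez (cong not (≢⇒eqF z≢r))))))
    ... | false | false = lev-mono (ℕ.+-monoʳ-≤ Δ (length-filterᵇ-≤ (allFin a) (λ z p → ∧⁺ (∧⁻ˡ p) (cong not (∨-falseʳ {eqF z x} (not≡true (∧⁻ʳ {edge J z y} p))))))) (lev-⊆ incl (good y))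
      where
      incl : ∀ u → u ∈ map σ₁ (rest us y) → u ∈ map σ (rest (x ∷ us) y)
      incl u u∈ with z , z∈ , refl ← ∈-map⁻ σ₁ u∈ with ez , z∉ ← ∈rest⁻ {us} z∈ =
        subst (_∈ map σ (rest (x ∷ us) y)) (sym (σ₁-other z≢x λ { refl → true≢false ez er })) (∈-map⁺ σ (∈rest⁺ ez λ { (here p) → z≢x p ; (there p) → z∉ p }))
        where
        z≢x : z ≢ x
        z≢x refl = true≢false ez ex

    card₁ : ∑ (λ z → ind (D₁ z)) + ⟦ length us ⟧ ≤ Dmax
    card₁ = ≤-trans (+-mono (≤-trans (∑-mono λ z → ind-∨ (D z) (eqF r z)) (≡⇒≤ (trans (∑-+ _ _) (cong (∑ (λ z → ind (D z)) +_) (∑-at₁ r))))) ≤-refl)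
      (≤-trans (≡⇒≤ (trans (+-assoc _ _ _) (cong (∑ (λ z → ind (D z)) +_) (sym (⟦suc⟧ _))))) card≤)

    weight₁ : ∑ (λ z → ind (nearS D₁ z) * h (σ₁ z)) + ⟦ length us ⟧ * K ≤ Qmax
    weight₁ = ≤-trans (+-mono (
        ∑ (λ z → ind (nearS D₁ z) * h (σ₁ z)) ≡⟨ ∑-cong (λ z → cong (λ w → ind (nearS D₁ w) * h (σ₁ z)) (sym (swapF-involutive x r z))) ⟩≤
        ∑ (λ z → ind (nearS D₁ (swapF x r (swapF x r z))) * h (σ (swapF x r z))) ≡⟨ ∑-involution (swapF-involutive x r) {λ z → ind (nearS D₁ (swapF x r z)) * h (σ z)} ⟩≤
        ∑ (λ z → ind (nearS D₁ (swapF x r z)) * h (σ z)) ≤⟨ ∑-mono pointwise ⟩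
        ∑ (λ z → ind (nearS D z) * h (σ z) + ind (near r z) * h (σ₀ z)) ≡⟨ ∑-+ _ _ ⟩≤
        ∑ (λ z → ind (nearS D z) * h (σ z)) + ∑ (λ z → ind (near r z) * h (σ₀ z)) ≤⟨ +-mono ≤-refl light ⟩
        ∑ (λ z → ind (nearS D z) * h (σ z)) + K ■) ≤-refl)
      (≤-trans (≡⇒≤ (trans (lem (∑ (λ z → ind (nearS D z) * h (σ z))) K ⟦ length us ⟧) (cong (λ l → ∑ (λ z → ind (nearS D z) * h (σ z)) + l * K) (sym (⟦suc⟧ _))))) weight≤)
      where
      opaque
        unfolding _+_
        lem : ∀ s k l → s + k + l * k ≡ s + (1ℚ + l) * k
        lem = solve-∀ ringℚ
      D₁r : D₁ r ≡ true
      D₁r = ∨⁺ʳ {D r} (eqF-refl r)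
      -- Both `x` and `r` are near `D₁`, so exchanging them maps the vertices near `D₁` to each
      -- other, and the new weight can be read off from the old images.
      sw : ∀ z → nearS D₁ (swapF x r z) ≡ true → nearS D₁ z ≡ true
      sw z p = cases (z ≟ x) (z ≟ r)
        where
        cases : Dec (z ≡ x) → Dec (z ≡ r) → nearS D₁ z ≡ true
        cases (yes z≡x) _ = subst (λ z → nearS D₁ z ≡ true) (sym z≡x) (nearS⁺ {D₁} (D⊆D₁ x Dx) (near-refl x))
        cases (no _) (yes z≡r) = subst (λ z → nearS D₁ z ≡ true) (sym z≡r) (nearS⁺ {D₁} D₁r (near-refl r))
        cases (no z≢x) (no z≢r) = trans (cong (nearS D₁) (sym (swapF-other z≢x z≢r))) p
      split : ∀ z → nearS D₁ z ≡ true → nearS D z ≡ true ⊎ near r z ≡ true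
      split z p with w , q , n ← nearS⁻ {D₁} p with ∨⁻ {D w} q
      ... | inj₁ Dw = inj₁ (nearS⁺ {D} Dw n)
      ... | inj₂ e = inj₂ (subst (λ w → near w z ≡ true) (sym (eqF⇒≡ e)) n)
      pointwise : ∀ z → ind (nearS D₁ (swapF x r z)) * h (σ z) ≤ ind (nearS D z) * h (σ z) + ind (near r z) * h (σ₀ z)
      pointwise z = ind*≤ (nearS D₁ (swapF x r z)) (0≤+ (0≤* (0≤ind (nearS D z)) (0≤h _)) (0≤* (0≤ind (near r z)) (0≤h _))) λ p → cases (split z (sw z p))
        where
        cases : nearS D z ≡ true ⊎ near r z ≡ true → h (σ z) ≤ ind (nearS D z) * h (σ z) + ind (near r z) * h (σ₀ z)
        cases (inj₁ q) = ≤-trans (≡⇒≤ (sym (trans (cong (λ b → ind b * h (σ z)) q) (*-identityˡ _)))) (x≤x+y (0≤* (0≤ind (near r z)) (0≤h _)))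
        cases (inj₂ q) = ≤-trans (≡⇒≤ (trans (cong h (agree z (near-r⇒∉D q))) (sym (trans (cong (λ b → ind b * h (σ₀ z)) q) (*-identityˡ _))))) (y≤x+y (0≤* (0≤ind (nearS D z)) (0≤h _)))

    agree₁ : ∀ z → D₁ z ≡ false → σ₁ z ≡ σ₀ z
    agree₁ z p = trans (σ₁-other (λ { refl → true≢false Dx (∨-falseˡ p) }) (λ { refl → true≢false (eqF-refl z) (∨-falseʳ {D z} p) })) (agree z (∨-falseˡ p))

    next : State us σ₁ D₁
    next = record
      { injective = λ p → swapF-injective x r (injective p)
      ; agree = agree₁
      ; U⊆D = λ z z∈ → D⊆D₁ z (U⊆D z (there z∈))
      ; good = good₁
      ; card≤ = card₁
      ; weight≤ = weight₁
      }

  run : ∀ U σ D → Unique U → State U σ D → ∃ λ σ′ → ∃ λ D′ → State [] σ′ D′ × (∀ x → D x ≡ true → D′ x ≡ true)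
  run [] σ D _ state = σ , D , state , λ _ p → p
  run (x ∷ us) σ D (x∉ ∷ uniq) state = 
    let open Step (λ p → All.lookup x∉ p refl) state
        σ′ , D′ , state′ , incl = run us σ₁ D₁ uniq next
    in σ′ , D′ , state′ , λ z p → incl z (D⊆D₁ z p)

-- Moments of sums over the vertices of a job

avg-mono : ∀ {a} k {f g : List (Fin a) → ℚ} → (∀ t → length t ≡ k → f t ≤ g t) → avg k f ≤ avg k g
avg-mono k p = *-monoˡ (0≤^ k (0≤inv _)) (SumT-mono k p)

avg-cong : ∀ {a} k {f g : List (Fin a) → ℚ} → (∀ t → length t ≡ k → f t ≡ g t) → avg k f ≡ avg k g
avg-cong {a} k p = cong (inv ⟦ a ⟧ ^ k *_) (SumT-cong k p)

0≤avg : ∀ {a} k {f : List (Fin a) → ℚ} → (∀ t → 0ℚ ≤ f t) → 0ℚ ≤ avg k f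
0≤avg k p = 0≤* (0≤^ k (0≤inv _)) (0≤SumT k p)

avg-*ˡ : ∀ {a} k c (f : List (Fin a) → ℚ) → avg k (λ t → c * f t) ≡ c * avg k f
avg-*ˡ k c f = trans (cong (_ *_) (SumT-*ˡ k c f)) (*-swap _ _ _)

avg-+ : ∀ {a} k (f g : List (Fin a) → ℚ) → avg k (λ t → f t + g t) ≡ avg k f + avg k g
avg-+ k f g = trans (cong (_ *_) (SumT-+ k f g)) (*-distribˡ-+ _ _ _)

avg-∑ : ∀ {a n} k (f : Fin n → List (Fin a) → ℚ) → avg k (λ t → ∑ λ i → f i t) ≡ ∑ λ i → avg k (f i)
avg-∑ k f = trans (cong (_ *_) (SumT-∑ k f)) (sym (∑-*ˡ _ _))

avg-const : ∀ {a} → 1 ℕ.≤ a → ∀ k c → avg {a} k (λ _ → c) ≡ c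
avg-const {a} 1≤a k c = trans (cong (_ *_) (SumT-const {a} k c)) (trans (sym (*-assoc _ _ _)) (trans (cong (_* c) (trans (*-comm _ _) (inv-^ k (0<⟦⟧ 1≤a)))) (*-identityˡ c)))

avg-suc : ∀ {a} k (f : List (Fin a) → ℚ) → avg (suc k) f ≡ inv ⟦ a ⟧ * ∑ λ u → avg k (λ t → f (u ∷ t))
avg-suc k f = trans (*-assoc _ _ _) (cong (_ *_) (sym (∑-*ˡ _ _)))

prefix suffix : ∀ {A : Set} → ℕ → List A → List A
prefix zero t = []
prefix (suc j) [] = []
prefix (suc j) (x ∷ t) = x ∷ prefix j t
suffix zero t = t
suffix (suc j) [] = []
suffix (suc j) (x ∷ t) = suffix j t

prefix-++ : ∀ {A : Set} (t s : List A) → prefix (length t) (t ++ s) ≡ t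
prefix-++ [] s = refl
prefix-++ (x ∷ t) s = cong (x ∷_) (prefix-++ t s)

suffix-++ : ∀ {A : Set} (t s : List A) → suffix (length t) (t ++ s) ≡ s
suffix-++ [] s = refl
suffix-++ (x ∷ t) s = suffix-++ t s

avg-product : ∀ {a} j k (f g : List (Fin a) → ℚ) → avg (j ℕ.+ k) (λ t → f (prefix j t) * g (suffix j t)) ≡ avg j f * avg k g
avg-product {a} j k f g = begin
  i ^ (j ℕ.+ k) * SumT (j ℕ.+ k) (λ t → f (prefix j t) * g (suffix j t)) ≡⟨ cong₂ _*_ (^-+ i j k) (SumT-++ j k _) ⟩
  i ^ j * i ^ k * SumT j (λ t → SumT k (λ s → f (prefix j (t ++ s)) * g (suffix j (t ++ s)))) ≡⟨ cong (i ^ j * i ^ k *_) (SumT-cong j λ { t refl → trans (SumT-cong k λ s _ → cong₂ (λ x y → f x * g y) (prefix-++ t s) (suffix-++ t s)) (trans (SumT-*ˡ k (f t) g) (*-comm _ _)) }) ⟩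
  i ^ j * i ^ k * SumT j (λ t → SumT k g * f t) ≡⟨ cong (i ^ j * i ^ k *_) (SumT-*ˡ j (SumT k g) f) ⟩
  i ^ j * i ^ k * (SumT k g * SumT j f) ≡⟨ lem (i ^ j) (i ^ k) (SumT k g) (SumT j f) ⟩
  i ^ j * SumT j f * (i ^ k * SumT k g) ∎
  where
  open ≡-Reasoning
  i = inv ⟦ a ⟧
  opaque
    unfolding _+_
    lem : ∀ x y s t → x * y * (s * t) ≡ x * t * (y * s)
    lem = solve-∀ ringℚ

dels : ∀ {A : Set} → List A → List (List A)
dels [] = []
dels (x ∷ xs) = xs ∷ map (x ∷_) (dels xs)

length-dels : ∀ {A : Set} (xs : List A) → length (dels xs) ≡ length xs
length-dels [] = refl
length-dels (x ∷ xs) = cong suc (trans (length-map (x ∷_) (dels xs)) (length-dels xs))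

avg-dels : ∀ {a} → 1 ℕ.≤ a → ∀ k (φ : List (Fin a) → ℚ) → avg k (λ t → ∑L (dels t) φ) ≡ ⟦ k ⟧ * avg (k ℕ.∸ 1) φ
avg-dels 1≤a zero φ = trans (*-zeroʳ _) (sym (trans (cong (_* avg 0 φ) ⟦0⟧) (*-zeroˡ _)))
avg-dels {a} 1≤a (suc k) φ = begin
  avg (suc k) (λ t → ∑L (dels t) φ) ≡⟨ avg-suc k (λ t → ∑L (dels t) φ) ⟩
  i * ∑ (λ u → avg k (λ t → φ t + ∑L (map (u ∷_) (dels t)) φ)) ≡⟨ cong (i *_) (∑-cong λ u → trans (avg-+ k φ _) (cong (avg k φ +_) (trans (avg-cong k λ t _ → ∑L-map (u ∷_) (dels t) φ) (avg-dels 1≤a k (λ t → φ (u ∷ t)))))) ⟩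
  i * ∑ (λ u → avg k φ + ⟦ k ⟧ * avg (k ℕ.∸ 1) (λ t → φ (u ∷ t))) ≡⟨ cong (i *_) (trans (∑-+ _ _) (cong₂ _+_ (∑-const a _) (∑-*ˡ ⟦ k ⟧ _))) ⟩
  i * (⟦ a ⟧ * avg k φ + ⟦ k ⟧ * ∑ (λ u → avg (k ℕ.∸ 1) (λ t → φ (u ∷ t)))) ≡⟨ lem i ⟦ a ⟧ (avg k φ) ⟦ k ⟧ _ ⟩
  ⟦ a ⟧ * i * avg k φ + ⟦ k ⟧ * (i * ∑ (λ u → avg (k ℕ.∸ 1) (λ t → φ (u ∷ t)))) ≡⟨ cong₂ (λ x y → x * avg k φ + y) (*-inv (0<⟦⟧ 1≤a)) (last k) ⟩
  1ℚ * avg k φ + ⟦ k ⟧ * avg k φ ≡⟨ trans (sym (*-distribʳ-+ (avg k φ) 1ℚ ⟦ k ⟧)) (cong (_* avg k φ) (sym (⟦suc⟧ k))) ⟩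
  ⟦ suc k ⟧ * avg k φ ∎
  where
  open ≡-Reasoning
  i = inv ⟦ a ⟧
  opaque
    unfolding _+_
    lem : ∀ i a x k s → i * (a * x + k * s) ≡ a * i * x + k * (i * s)
    lem = solve-∀ ringℚ
  last : ∀ k → ⟦ k ⟧ * (i * ∑ (λ u → avg (k ℕ.∸ 1) (λ t → φ (u ∷ t)))) ≡ ⟦ k ⟧ * avg k φ
  last zero = trans (trans (cong (_* (i * ∑ (λ u → avg 0 (λ t → φ (u ∷ t))))) ⟦0⟧) (*-zeroˡ _)) (sym (trans (cong (_* avg 0 φ) ⟦0⟧) (*-zeroˡ _)))
  last (suc k) = cong (⟦ suc k ⟧ *_) (sym (avg-suc k φ))

-- Deleting a vertex `r` becomes deleting a position, the form that `avg-dels` can average.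
∑L-dels : ∀ {n} {B : Set} (σ : Fin n → B) (xs : List (Fin n)) → Unique xs → (φ : List B → ℚ) →
  ∑L xs (λ r → φ (map σ (filterᵇ (λ x → not (eqF x r)) xs))) ≡ ∑L (dels (map σ xs)) φ
∑L-dels σ [] _ φ = refl
∑L-dels σ (x ∷ xs) (x∉ ∷ uniq) φ = cong₂ _+_ (cong (λ l → φ (map σ l)) head)
  (trans (∑L-cong∈ xs (λ r r∈ → cong (λ l → φ (map σ l)) (tail r r∈))) (trans (∑L-dels σ xs uniq (λ t → φ (σ x ∷ t))) (sym (∑L-map (σ x ∷_) (dels (map σ xs)) φ))))
  where
  keep : ∀ {r} ys → (∀ y → y ∈ ys → y ≢ r) → filterᵇ (λ x → not (eqF x r)) ys ≡ ys
  keep [] p = refl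
  keep {r} (y ∷ ys) p rewrite ≢⇒eqF (p y (here refl)) = cong (y ∷_) (keep ys (λ z q → p z (there q)))
  head : filterᵇ (λ z → not (eqF z x)) (x ∷ xs) ≡ xs
  head rewrite eqF-refl x = keep xs λ y y∈ y≡x → All.lookup x∉ y∈ (sym y≡x)
  tail : ∀ r → r ∈ xs → filterᵇ (λ z → not (eqF z r)) (x ∷ xs) ≡ x ∷ filterᵇ (λ z → not (eqF z r)) xs
  tail r r∈ rewrite ≢⇒eqF {i = x} {r} (All.lookup x∉ r∈) = refl

-- `κ` bounds all powers of `κ₀` that occur. Its excess over 1 is of order `1 / a`, with constant
-- `Cκ`, which is small enough to multiply squares of sums of order `a`.
module Moments {a b : ℕ} (1≤a : 1 ℕ.≤ a) (b≤2a : ⟦ b ⟧ ≤ 2ℚ * ⟦ a ⟧) (J : BipGraph a b) (Δ : ℕ) (1≤Δ : 1 ℕ.≤ Δ) (bounded : Bounded J Δ)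
  (κ₀ κ Cκ : ℚ) (0≤κ₀ : 0ℚ ≤ κ₀) (κ₀-bound : ∀ j → j ℕ.≤ Δ ℕ.+ Δ → ⟦ a ⟧ ≤ κ₀ * (⟦ a ⟧ - ⟦ j ⟧))
  (κ₀^≤κ : ∀ j → j ℕ.≤ Δ ℕ.+ Δ → κ₀ ^ j ≤ κ) (1≤κ : 1ℚ ≤ κ) (κ≤2 : κ ≤ 2ℚ) (κ-1≤ : (κ - 1ℚ) * ⟦ a ⟧ ≤ Cκ) where
  open Averages 1≤a
  open Marginals 0≤κ₀ (Δ ℕ.+ Δ) κ₀-bound
  open Job J Δ bounded
  open Bounded bounded

  0≤κ : 0ℚ ≤ κ
  0≤κ = ≤-trans 0≤1 1≤κ

  E≤avg : ∀ xs → Unique xs → length xs ℕ.≤ Δ ℕ.+ Δ → (g : List (Fin a) → ℚ) → (∀ t → 0ℚ ≤ g t) → E (λ v → g (v !! xs)) ≤ κ * avg (length xs) g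
  E≤avg xs uniq len g 0≤g = ≤-trans (upper xs uniq (ℕ.m≤n⇒m≤1+n len) g 0≤g) (*-monoʳ (0≤avg (length xs) 0≤g) (κ₀^≤κ (length xs) len))

  C₂ : ℚ
  C₂ = 2ℚ * Cκ + (4ℚ + 2ℚ) * (⟦ Δ ⟧ * ⟦ Δ ⟧)

  module Variance (f : List (Fin a) → ℚ) (0≤f : ∀ t → 0ℚ ≤ f t) (f≤1 : ∀ t → length t ℕ.≤ Δ → f t ≤ 1ℚ) where

    ℓ : Vec (Fin a) a → ℚ
    ℓ v = ∑ λ y → f (v !! nb y)

    e : Fin b → ℚ
    e y = avg (length (nb y)) f

    0≤e : ∀ y → 0ℚ ≤ e y
    0≤e y = 0≤avg (length (nb y)) 0≤f

    e≤1 : ∀ y → e y ≤ 1ℚ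
    e≤1 y = ≤-trans (avg-mono (length (nb y)) λ t q → f≤1 t (ℕ.≤-trans (ℕ.≤-reflexive q) (length-nb≤ y))) (≡⇒≤ (avg-const 1≤a (length (nb y)) 1ℚ))

    μ : ℚ
    μ = ∑ e

    0≤μ : 0ℚ ≤ μ
    0≤μ = 0≤∑ 0≤e

    Δ² : ℚ
    Δ² = ⟦ Δ ⟧ * ⟦ Δ ⟧
    0≤Δ² : 0ℚ ≤ Δ²
    0≤Δ² = 0≤* (0≤⟦⟧ Δ) (0≤⟦⟧ Δ)

    conflict : Fin b → Fin b → Bool
    conflict y y′ = anyF (λ x → edge J x y ∧ edge J x y′)

    ∑-conflict : ∀ y → ∑ (λ y′ → ind (conflict y y′)) ≤ Δ²
    ∑-conflict y =
      ∑ (λ y′ → ind (conflict y y′)) ≤⟨ ∑-mono (λ y′ → ≤-trans (ind-anyF _) (∑-mono λ x → ≡⇒≤ (ind-∧ (edge J x y) _))) ⟩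
      ∑ (λ y′ → ∑ (λ x → ind (edge J x y) * ind (edge J x y′))) ≡⟨ trans (∑-swap _) (∑-cong λ x → ∑-*ˡ (ind (edge J x y)) _) ⟩≤
      ∑ (λ x → ind (edge J x y) * degA J x) ≤⟨ ∑-mono (λ x → *-monoˡ (0≤ind (edge J x y)) (degA≤ x)) ⟩
      ∑ (λ x → ind (edge J x y) * ⟦ Δ ⟧) ≤⟨ ≤-trans (≡⇒≤ (∑-*ʳ ⟦ Δ ⟧ _)) (*-monoʳ (0≤⟦⟧ Δ) (degB≤ y)) ⟩
      Δ² ■

    single : ∀ y → E (λ v → f (v !! nb y)) ≤ κ * e y
    single y = E≤avg (nb y) (nb-unique y) (ℕ.≤-trans (length-nb≤ y) (ℕ.m≤m+n Δ Δ)) f 0≤f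

    -- Rows without a common neighbour read disjoint sets of images and are independent up to the
    -- factor `κ`. A row conflicts with at most `Δ²` rows, and for these `f ≤ 1` is enough.
    pair : ∀ y y′ → E (λ v → f (v !! nb y) * f (v !! nb y′)) ≤ κ * (e y * e y′) + ind (conflict y y′) * (κ * e y)
    pair y y′ with conflict y y′ in eq
    ... | true = ≤-trans (E-mono λ v _ → ≤-trans (*-monoˡ (0≤f _) (f≤1 _ (ℕ.≤-trans (ℕ.≤-reflexive (length-map (v !_) (nb y′))) (length-nb≤ y′)))) (≡⇒≤ (*-identityʳ _)))
          (≤-trans (single y) (≤-trans (≡⇒≤ (sym (*-identityˡ _))) (y≤x+y (0≤* 0≤κ (0≤* (0≤e y) (0≤e y′))))))
    ... | false = ≤-trans (≡⇒≤ (E-cong λ v _ → sym (cong₂ (λ s t → f s * f t) (trans (cong₂ prefix (sym (length-map (v !_) (nb y))) (map-++ (v !_) (nb y) (nb y′))) (prefix-++ (v !! nb y) _))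
            (trans (cong₂ suffix (sym (length-map (v !_) (nb y))) (map-++ (v !_) (nb y) (nb y′))) (suffix-++ (v !! nb y) _)))))
          (≤-trans (E≤avg (nb y ++ nb y′) (Unique.++⁺ (nb-unique y) (nb-unique y′) disjoint)
              (ℕ.≤-trans (ℕ.≤-reflexive (length-++ (nb y))) (ℕ.+-mono-≤ (length-nb≤ y) (length-nb≤ y′)))
              (λ t → f (prefix (length (nb y)) t) * f (suffix (length (nb y)) t)) (λ t → 0≤* (0≤f _) (0≤f _)))
            (≤-trans (≡⇒≤ (cong (κ *_) (trans (cong (λ k → avg k (λ t → f (prefix (length (nb y)) t) * f (suffix (length (nb y)) t))) (length-++ (nb y))) (avg-product (length (nb y)) (length (nb y′)) f f)))) (x≤x+y (≡⇒≤ (sym (*-zeroˡ _))))))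
      where
      disjoint : ∀ {x} → ¬ (x ∈ nb y × x ∈ nb y′)
      disjoint {x} (p , q) = true≢false (anyF⁺ {P = λ x → edge J x y ∧ edge J x y′} x (∧⁺ (∈nb⁻ p) (∈nb⁻ q))) eq

    second : E (λ v → ℓ v * ℓ v) ≤ κ * (μ * μ) + Δ² * (κ * μ)
    second =
      E (λ v → ℓ v * ℓ v) ≡⟨ E-cong (λ v _ → trans (sym (∑-*ʳ (ℓ v) _)) (∑-cong λ y → sym (∑-*ˡ (f (v !! nb y)) _))) ⟩≤
      E (λ v → ∑ λ y → ∑ λ y′ → f (v !! nb y) * f (v !! nb y′)) ≡⟨ trans (E-∑ (λ y v → ∑ λ y′ → f (v !! nb y) * f (v !! nb y′))) (∑-cong λ y → E-∑ (λ y′ v → f (v !! nb y) * f (v !! nb y′))) ⟩≤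
      ∑ (λ y → ∑ λ y′ → E (λ v → f (v !! nb y) * f (v !! nb y′))) ≤⟨ ∑-mono (λ y → ∑-mono λ y′ → pair y y′) ⟩
      ∑ (λ y → ∑ λ y′ → κ * (e y * e y′) + ind (conflict y y′) * (κ * e y)) ≡⟨ ∑-cong (λ y → trans (∑-+ _ _) (cong₂ _+_ (trans (∑-*ˡ κ _) (cong (κ *_) (∑-*ˡ (e y) _))) (∑-*ʳ (κ * e y) _))) ⟩≤
      ∑ (λ y → κ * (e y * μ) + ∑ (λ y′ → ind (conflict y y′)) * (κ * e y)) ≤⟨ ∑-mono (λ y → +-mono ≤-refl (*-monoʳ (0≤* 0≤κ (0≤e y)) (∑-conflict y))) ⟩
      ∑ (λ y → κ * (e y * μ) + Δ² * (κ * e y)) ≡⟨ trans (∑-+ _ _) (cong₂ _+_ (trans (∑-*ˡ κ _) (cong (κ *_) (∑-*ʳ μ _))) (trans (∑-*ˡ Δ² _) (cong (Δ² *_) (∑-*ˡ κ _)))) ⟩≤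
      κ * (μ * μ) + Δ² * (κ * μ) ■

    b/a≤2 : ⟦ b ⟧ * inv ⟦ a ⟧ ≤ 2ℚ
    b/a≤2 = ÷-≤ 0<a b≤2a

    first : μ ≤ E ℓ + 2ℚ * Δ²
    first =
      ∑ e ≤⟨ ∑-mono (λ y → lower (nb y) (nb-unique y) f 0≤f λ t q → f≤1 t (ℕ.≤-trans (ℕ.≤-reflexive q) (length-nb≤ y))) ⟩
      ∑ (λ y → E (λ v → f (v !! nb y)) + ⟦ length (nb y) ℕ.* length (nb y) ⟧ * inv ⟦ a ⟧) ≡⟨ trans (∑-+ _ _) (cong (_+ _) (sym (E-∑ (λ y v → f (v !! nb y))))) ⟩≤
      E ℓ + ∑ (λ y → ⟦ length (nb y) ℕ.* length (nb y) ⟧ * inv ⟦ a ⟧) ≤⟨ +-mono ≤-refl (∑-mono λ y → *-monoʳ (0≤inv _) (≤-trans (⟦⟧-mono (ℕ.*-mono-≤ (length-nb≤ y) (length-nb≤ y))) (≡⇒≤ (⟦*⟧ Δ Δ)))) ⟩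
      E ℓ + ∑ {b} (λ y → Δ² * inv ⟦ a ⟧) ≡⟨ cong (E ℓ +_) (trans (∑-const b _) (trans (cong (⟦ b ⟧ *_) (*-comm Δ² _)) (sym (*-assoc _ _ _)))) ⟩≤
      E ℓ + ⟦ b ⟧ * inv ⟦ a ⟧ * Δ² ≤⟨ +-mono ≤-refl (*-monoʳ 0≤Δ² b/a≤2) ⟩
      E ℓ + 2ℚ * Δ² ■

    μ≤b : μ ≤ 2ℚ * ⟦ a ⟧
    μ≤b = ≤-trans (∑-mono e≤1) (≤-trans (≡⇒≤ (trans (∑-const b 1ℚ) (*-identityʳ _))) b≤2a)

    -- The squares of `μ` cancel up to `(κ - 1) μ²`, and `μ ≤ 2a` turns this into `2 Cκ μ`.
    -- Conflicting pairs give `2 Δ² μ`, the error in `first` gives `4 Δ² μ`.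
    variance : E (λ v → (ℓ v - μ) * (ℓ v - μ)) ≤ C₂ * μ
    variance =
      E (λ v → (ℓ v - μ) * (ℓ v - μ)) ≡⟨ trans (E-cong λ v _ → lem₁ (ℓ v) μ) (trans (E-+ _ _) (cong₂ _+_ (E-+ (λ v → ℓ v * ℓ v) _) (E-const _))) ⟩≤
      E (λ v → ℓ v * ℓ v) + E (λ v → (- (2ℚ * μ)) * ℓ v) + μ * μ ≡⟨ cong (λ z → E (λ v → ℓ v * ℓ v) + z + μ * μ) (E-*ˡ (- (2ℚ * μ)) ℓ) ⟩≤
      E (λ v → ℓ v * ℓ v) + (- (2ℚ * μ)) * E ℓ + μ * μ ≤⟨ ≤-by (2ℚ * (μ * ((E ℓ + 2ℚ * Δ²) - μ))) (0≤* 0≤2 (0≤* 0≤μ (0≤- first))) (lem₂ (E (λ v → ℓ v * ℓ v)) μ (E ℓ) Δ²) ⟩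
      E (λ v → ℓ v * ℓ v) - μ * μ + 4ℚ * (Δ² * μ) ≤⟨ +-mono (+-mono second ≤-refl) ≤-refl ⟩
      κ * (μ * μ) + Δ² * (κ * μ) - μ * μ + 4ℚ * (Δ² * μ) ≤⟨ ≤-by _ (0≤+ (0≤+ (0≤* 0≤μ (0≤* (0≤- 1≤κ) (0≤- μ≤b))) (0≤* (0≤* 0≤2 0≤μ) (0≤- κ-1≤))) (0≤* (0≤* 0≤Δ² 0≤μ) (0≤- κ≤2))) (lem₃ κ μ Δ² Cκ ⟦ a ⟧) ⟩
      C₂ * μ ■
      where
      opaque
        unfolding _+_
        lem₁ : ∀ l m → (l - m) * (l - m) ≡ l * l + (- ((1ℚ + 1ℚ) * m)) * l + m * m
        lem₁ = solve-∀ ringℚ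
        lem₂ : ∀ s m l d → s - m * m + ((1ℚ + 1ℚ) + (1ℚ + 1ℚ)) * (d * m) ≡ s + (- ((1ℚ + 1ℚ) * m)) * l + m * m + (1ℚ + 1ℚ) * (m * ((l + (1ℚ + 1ℚ) * d) - m))
        lem₂ = solve-∀ ringℚ
        lem₃ : ∀ k m d c a → ((1ℚ + 1ℚ) * c + (((1ℚ + 1ℚ) + (1ℚ + 1ℚ)) + (1ℚ + 1ℚ)) * d) * m ≡
          (k * (m * m) + d * (k * m) - m * m + ((1ℚ + 1ℚ) + (1ℚ + 1ℚ)) * (d * m)) + (m * ((k - 1ℚ) * ((1ℚ + 1ℚ) * a - m)) + (1ℚ + 1ℚ) * m * (c - (k - 1ℚ) * a) + d * m * ((1ℚ + 1ℚ) - k))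
        lem₃ = solve-∀ ringℚ

-- A random placement of one side of a job

-- What a random placement uses of the current host: degrees in B bounded below relative to the
-- density `p`, a predicate `typ` that holds for most tuples through any given vertex, and the edge
-- weight `w`. The precision to which the total weight is controlled is `ν`.
record Setting {a b : ℕ} (G J : BipGraph a b) (Δ : ℕ) : Set where
  field
    1≤a : 1 ℕ.≤ a
    1≤b : 1 ℕ.≤ b
    b≤2a : ⟦ b ⟧ ≤ 2ℚ * ⟦ a ⟧
    1≤Δ : 1 ℕ.≤ Δ
    bounded : Bounded J Δ
    0<e : 0ℚ < size J
    κ₀ κ Cκ : ℚ
    0≤κ₀ : 0ℚ ≤ κ₀
    κ₀-bound : ∀ j → j ℕ.≤ Δ ℕ.+ Δ → ⟦ a ⟧ ≤ κ₀ * (⟦ a ⟧ - ⟦ j ⟧)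
    κ₀^≤κ : ∀ j → j ℕ.≤ Δ ℕ.+ Δ → κ₀ ^ j ≤ κ
    1≤κ : 1ℚ ≤ κ
    κ≤2 : κ ≤ 2ℚ
    κ-1≤ : (κ - 1ℚ) * ⟦ a ⟧ ≤ Cκ
    p η : ℚ
    0<p : 0ℚ < p
    0≤η : 0ℚ ≤ η
    deg-lower : ∀ v → p * ⟦ a ⟧ ≤ (1ℚ + η) * degB G v
    K : ℚ
    0<K : 0ℚ < K
    K-bound : ∀ v k → k ℕ.≤ Δ → (⟦ a ⟧ * inv (degB G v)) ^ k ≤ K
    typ : List (Fin a) → Bool
    typ-[] : typ [] ≡ true
    typ-mono : ∀ {s t} → (∀ u → u ∈ s → u ∈ t) → length t ℕ.≤ length s → typ t ≡ true → typ s ≡ true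
    ε₁ : ℚ
    0<ε₁ : 0ℚ < ε₁
    through : ∀ u k → suc k ℕ.≤ Δ → avg k (λ t → ind (not (typ (u ∷ t)))) ≤ ε₁
    w : Fin a → Fin b → ℚ
    0≤w : ∀ u v → 0ℚ ≤ w u v
    w-edge : ∀ u v → edge G u v ≡ false → w u v ≡ 0ℚ
    0<W : 0ℚ < ∑ (λ u → ∑ (w u))
    ν : ℚ
    0<ν : 0ℚ < ν
    4ν≤1 : 4ℚ * ν ≤ 1ℚ

module Selection {a b : ℕ} {G J : BipGraph a b} {Δ : ℕ} (setting : Setting G J Δ) where
  open Setting setting
  open Averages 1≤a
  open Moments 1≤a b≤2a J Δ 1≤Δ bounded κ₀ κ Cκ 0≤κ₀ κ₀-bound κ₀^≤κ 1≤κ κ≤2 κ-1≤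
  open Job J Δ bounded
  open Bounded bounded

  ia ib : ℚ
  ia = inv ⟦ a ⟧
  ib = inv ⟦ b ⟧

  0<b : 0ℚ < ⟦ b ⟧
  0<b = 0<⟦⟧ 1≤b

  0≤1+η : 0ℚ ≤ 1ℚ + η
  0≤1+η = 0≤+ 0≤1 0≤η

  0<pa : 0ℚ < p * ⟦ a ⟧
  0<pa = 0<* 0<p 0<a

  0<deg : ∀ v → 0ℚ < degB G v
  0<deg v = ℚ.≰⇒> λ q → ≤⇒≯ (≤-trans (deg-lower v) (≤-trans (*-monoˡ 0≤1+η q) (≡⇒≤ (*-zeroʳ _)))) 0<pa

  r : Fin b → ℚ
  r v = ⟦ a ⟧ * inv (degB G v)

  0≤r : ∀ v → 0ℚ ≤ r v
  0≤r v = 0≤* (0≤⟦⟧ a) (0≤inv _)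

  W : ℚ
  W = ∑ (λ u → ∑ (w u))

  hA : Fin a → ℚ
  hA u = ∑ (w u)

  0≤hA : ∀ u → 0ℚ ≤ hA u
  0≤hA u = 0≤∑ (0≤w u)

  wB : Fin b → ℚ
  wB v = ∑ λ u → w u v

  -- The fractional row of a vertex whose neighbours sit on `t`. The power of `r v` balances every
  -- column exactly on average (`avg-cn`). Rows are not normalised: for typical `t` their sums are
  -- close to 1, and they are divided out at the end.
  M : List (Fin a) → Fin b → ℚ
  M t v = ind (cn G t v) * r v ^ length t * ib

  0≤M : ∀ t v → 0ℚ ≤ M t v
  0≤M t v = 0≤* (0≤* (0≤ind (cn G t v)) (0≤^ (length t) (0≤r v))) (0≤inv _)

  price : List (Fin a) → Fin b → ℚ
  price t v = ∑L t (λ u → w u v)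

  0≤price : ∀ t v → 0ℚ ≤ price t v
  0≤price t v = 0≤∑L t (λ u → 0≤w u v)

  c : List (Fin a) → ℚ
  c t = ∑ λ v → M t v * price t v

  0≤c : ∀ t → 0ℚ ≤ c t
  0≤c t = 0≤∑ λ v → 0≤* (0≤M t v) (0≤price t v)

  SumT-cn : ∀ k v → SumT k (λ t → ind (cn G t v)) ≡ degB G v ^ k
  SumT-cn zero v = refl
  SumT-cn (suc k) v = trans (∑-cong λ u → trans (SumT-cong k λ t _ → ind-∧ (edge G u v) (cn G t v)) (trans (SumT-*ˡ k (ind (edge G u v)) _) (cong (ind (edge G u v) *_) (SumT-cn k v)))) (∑-*ʳ (degB G v ^ k) _)

  w-ind : ∀ u v → ind (edge G u v) * w u v ≡ w u v
  w-ind u v with edge G u v in eq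
  ... | true = *-identityˡ _
  ... | false = trans (*-zeroˡ _) (sym (w-edge u v eq))

  -- Each of the `k` positions contributes `wB v` once while the other `k - 1` run freely over the
  -- neighbourhood of `v`; multiplying by the degree avoids the exponent `k - 1`.
  SumT-price : ∀ k v → SumT k (λ t → ind (cn G t v) * price t v) * degB G v ≡ ⟦ k ⟧ * degB G v ^ k * wB v
  SumT-price zero v = trans (cong (_* degB G v) (*-zeroʳ 1ℚ)) (trans (*-zeroˡ _) (sym (trans (cong (λ z → z * 1ℚ * wB v) ⟦0⟧) (trans (cong (_* wB v) (*-zeroˡ 1ℚ)) (*-zeroˡ _)))))
  SumT-price (suc k) v = begin
    ∑ (λ u → SumT k (λ t → ind (edge G u v ∧ cn G t v) * (w u v + price t v))) * D ≡⟨ cong (_* D) (∑-cong split) ⟩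
    ∑ (λ u → w u v * D ^ k + ind (edge G u v) * A) * D ≡⟨ cong (_* D) (trans (∑-+ _ _) (cong₂ _+_ (∑-*ʳ (D ^ k) _) (∑-*ʳ A _))) ⟩
    (wB v * D ^ k + D * A) * D ≡⟨ lem₁ (wB v) (D ^ k) D A ⟩
    wB v * D ^ k * D + D * (A * D) ≡⟨ cong (λ z → wB v * D ^ k * D + D * z) (SumT-price k v) ⟩
    wB v * D ^ k * D + D * (⟦ k ⟧ * D ^ k * wB v) ≡⟨ trans (lem₂ (wB v) (D ^ k) D ⟦ k ⟧) (cong (λ z → z * (D * D ^ k) * wB v) (sym (⟦suc⟧ k))) ⟩
    ⟦ suc k ⟧ * (D * D ^ k) * wB v ∎
    where
    open ≡-Reasoning
    D = degB G v
    A = SumT k (λ t → ind (cn G t v) * price t v)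
    opaque
      unfolding _+_
      lem₁ : ∀ w x d s → (w * x + d * s) * d ≡ w * x * d + d * (s * d)
      lem₁ = solve-∀ ringℚ
      lem₂ : ∀ w x d k → w * x * d + d * (k * x * w) ≡ (1ℚ + k) * (d * x) * w
      lem₂ = solve-∀ ringℚ
      lem₃ : ∀ e c w s → e * c * (w + s) ≡ e * w * c + e * (c * s)
      lem₃ = solve-∀ ringℚ
    split : ∀ u → SumT k (λ t → ind (edge G u v ∧ cn G t v) * (w u v + price t v)) ≡ w u v * D ^ k + ind (edge G u v) * A
    split u = trans (SumT-cong k λ t _ → trans (cong (_* (w u v + price t v)) (ind-∧ (edge G u v) (cn G t v))) (trans (lem₃ (ind (edge G u v)) (ind (cn G t v)) (w u v) (price t v)) (cong (λ z → z * ind (cn G t v) + ind (edge G u v) * (ind (cn G t v) * price t v)) (w-ind u v))))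
      (trans (SumT-+ k _ _) (cong₂ _+_ (trans (SumT-*ˡ k (w u v) _) (cong (w u v *_) (SumT-cn k v))) (SumT-*ˡ k (ind (edge G u v)) _)))

  ia^ : ∀ k → ia ^ k * ⟦ a ⟧ ^ k ≡ 1ℚ
  ia^ k = trans (*-comm _ _) (inv-^ k 0<a)

  r^ : ∀ v k → r v ^ k ≡ ⟦ a ⟧ ^ k * inv (degB G v) ^ k
  r^ v k = ^-distrib-* ⟦ a ⟧ (inv (degB G v)) k

  avg-cn : ∀ k v → avg k (λ t → ind (cn G t v) * r v ^ length t) ≡ 1ℚ
  avg-cn k v = begin
    avg k (λ t → ind (cn G t v) * r v ^ length t) ≡⟨ avg-cong k (λ { t refl → *-comm _ _ }) ⟩
    avg k (λ t → r v ^ length t * ind (cn G t v)) ≡⟨ avg-cong k (λ { t refl → refl }) ⟩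
    avg k (λ t → r v ^ k * ind (cn G t v)) ≡⟨ avg-*ˡ k (r v ^ k) _ ⟩
    r v ^ k * (ia ^ k * SumT k (λ t → ind (cn G t v))) ≡⟨ cong₂ (λ x y → x * (ia ^ k * y)) (r^ v k) (SumT-cn k v) ⟩
    ⟦ a ⟧ ^ k * inv (degB G v) ^ k * (ia ^ k * degB G v ^ k) ≡⟨ lem (⟦ a ⟧ ^ k) (inv (degB G v) ^ k) (ia ^ k) (degB G v ^ k) ⟩
    ia ^ k * ⟦ a ⟧ ^ k * (degB G v ^ k * inv (degB G v) ^ k) ≡⟨ cong₂ _*_ (ia^ k) (inv-^ k (0<deg v)) ⟩
    1ℚ * 1ℚ ≡⟨ *-identityˡ 1ℚ ⟩
    1ℚ ∎
    where
    open ≡-Reasoning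
    opaque
      unfolding _+_
      lem : ∀ x y s t → x * y * (s * t) ≡ s * x * (t * y)
      lem = solve-∀ ringℚ

  avg-c : ∀ k → avg k c ≡ ∑ λ v → ib * (⟦ k ⟧ * (wB v * inv (degB G v)))
  avg-c k = trans (avg-∑ k (λ v t → M t v * price t v)) (∑-cong λ v → term v)
    where
    opaque
      unfolding _+_
      lem₁ : ∀ i x b s → i * x * b * s ≡ x * b * (i * s)
      lem₁ = solve-∀ ringℚ
      lem₂ : ∀ x y b i s → x * y * b * (i * s) ≡ b * (i * x) * (y * s)
      lem₂ = solve-∀ ringℚ
      lem₃ : ∀ y k x w d → y * (k * x * w * d) ≡ x * y * (k * (w * d))
      lem₃ = solve-∀ ringℚ
    term : ∀ v → avg k (λ t → M t v * price t v) ≡ ib * (⟦ k ⟧ * (wB v * inv (degB G v)))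
    term v = begin
      avg k (λ t → M t v * price t v) ≡⟨ avg-cong k (λ { t refl → lem₁ (ind (cn G t v)) (r v ^ length t) ib (price t v) }) ⟩
      avg k (λ t → r v ^ length t * ib * (ind (cn G t v) * price t v)) ≡⟨ avg-cong k (λ { t refl → refl }) ⟩
      avg k (λ t → r v ^ k * ib * (ind (cn G t v) * price t v)) ≡⟨ avg-*ˡ k (r v ^ k * ib) _ ⟩
      r v ^ k * ib * (ia ^ k * A) ≡⟨ cong (λ x → x * ib * (ia ^ k * A)) (r^ v k) ⟩
      ⟦ a ⟧ ^ k * d ^ k * ib * (ia ^ k * A) ≡⟨ lem₂ (⟦ a ⟧ ^ k) (d ^ k) ib (ia ^ k) A ⟩
      ib * (ia ^ k * ⟦ a ⟧ ^ k) * (d ^ k * A) ≡⟨ cong₂ _*_ (trans (cong (ib *_) (ia^ k)) (*-identityʳ ib)) (cong (d ^ k *_) (sym (*-inv-cancel A (0<deg v)))) ⟩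
      ib * (d ^ k * (A * degB G v * d)) ≡⟨ cong (λ z → ib * (d ^ k * (z * d))) (SumT-price k v) ⟩
      ib * (d ^ k * (⟦ k ⟧ * degB G v ^ k * wB v * d)) ≡⟨ cong (ib *_) (trans (lem₃ (d ^ k) ⟦ k ⟧ (degB G v ^ k) (wB v) d) (trans (cong (_* (⟦ k ⟧ * (wB v * d))) (inv-^ k (0<deg v))) (*-identityˡ _))) ⟩
      ib * (⟦ k ⟧ * (wB v * d)) ∎
      where
      open ≡-Reasoning
      d = inv (degB G v)
      A = SumT k (λ t → ind (cn G t v) * price t v)

  -- The average weight `W / (p a b)` per edge of a graph of density `p`, times the factor `1 + η`
  -- lost when `1 / deg v` is bounded.
  β : ℚ
  β = (1ℚ + η) * inv (p * ⟦ a ⟧) * ib * W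

  avg-c≤ : ∀ k → avg k c ≤ ⟦ k ⟧ * β
  avg-c≤ k =
    avg k c ≡⟨ avg-c k ⟩≤
    ∑ (λ v → ib * (⟦ k ⟧ * (wB v * inv (degB G v)))) ≤⟨ ∑-mono (λ v → *-monoˡ (0≤inv _) (*-monoˡ (0≤⟦⟧ k) (*-monoˡ (0≤∑ λ u → 0≤w u v) (inv-deg v)))) ⟩
    ∑ (λ v → ib * (⟦ k ⟧ * (wB v * B))) ≡⟨ trans (∑-cong λ v → lem ib ⟦ k ⟧ (wB v) B) (trans (∑-*ˡ _ _) (cong (ib * ⟦ k ⟧ * B *_) (∑-swap (λ v u → w u v)))) ⟩≤
    ib * ⟦ k ⟧ * B * W ≡⟨ lem₂ ib ⟦ k ⟧ B W ⟩≤
    ⟦ k ⟧ * (B * ib * W) ■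
    where
    B = (1ℚ + η) * inv (p * ⟦ a ⟧)
    opaque
      unfolding _+_
      lem : ∀ i k w b → i * (k * (w * b)) ≡ i * k * b * w
      lem = solve-∀ ringℚ
      lem₂ : ∀ i k b w → i * k * b * w ≡ k * (b * i * w)
      lem₂ = solve-∀ ringℚ
    inv-deg : ∀ v → inv (degB G v) ≤ B
    inv-deg v = ≤-÷ 0<pa (≤-trans (≡⇒≤ (*-comm _ _)) (÷-≤ (0<deg v) (deg-lower v)))

  e : ℚ
  e = size J

  ∑-lengths : ∀ x → ∑ (λ y → ⟦ length (nb y) ⟧ * x) ≡ e * x
  ∑-lengths x = trans (∑-*ʳ x _) (cong (_* x) (trans (∑-cong ⟦length-nb⟧) ∑-degB))

  nb-len : ∀ y → length (nb y) ℕ.≤ Δ ℕ.+ Δ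
  nb-len y = ℕ.≤-trans (length-nb≤ y) (ℕ.m≤m+n Δ Δ)

  E-tuples : ∀ g x → (∀ t → 0ℚ ≤ g t) → (∀ k → k ℕ.≤ Δ → avg k g ≤ ⟦ k ⟧ * x) → E (λ v → ∑ λ y → g (v !! nb y)) ≤ κ * (e * x)
  E-tuples g x 0≤g bound = ≤-trans (≡⇒≤ (E-∑ (λ y v → g (v !! nb y)))) (≤-trans (∑-mono λ y → ≤-trans (E≤avg (nb y) (nb-unique y) (nb-len y) g 0≤g) (*-monoˡ 0≤κ (bound _ (length-nb≤ y))))
    (≡⇒≤ (trans (∑-*ˡ κ _) (cong (κ *_) (∑-lengths x)))))

  cost : Vec (Fin a) a → ℚ
  cost v = ∑ λ y → c (v !! nb y)

  E-cost : E cost ≤ κ * (e * β)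
  E-cost = E-tuples c β 0≤c (λ k _ → avg-c≤ k)

  atyp : List (Fin a) → ℚ
  atyp t = ind (not (typ t))

  0≤atyp : ∀ t → 0ℚ ≤ atyp t
  0≤atyp t = 0≤ind (not (typ t))

  avg-atyp : ∀ k → k ℕ.≤ Δ → avg k atyp ≤ ⟦ k ⟧ * ε₁
  avg-atyp zero _ = ≡⇒≤ (trans (*-identityˡ _) (trans (cong (λ b → ind (not b)) typ-[]) (sym (trans (cong (_* ε₁) ⟦0⟧) (*-zeroˡ ε₁)))))
  avg-atyp (suc k) k<Δ = ≤-trans (≡⇒≤ (avg-suc k atyp)) (≤-trans (*-monoˡ (0≤inv _) (≤-trans (∑-mono λ u → through u k k<Δ) (≡⇒≤ (∑-const a ε₁))))
    (≤-trans (≡⇒≤ (trans (sym (*-assoc _ _ _)) (trans (cong (_* ε₁) (trans (*-comm _ _) (*-inv 0<a))) refl))) (*-monoʳ (<⇒≤ 0<ε₁) (1≤⟦⟧ (s≤s z≤n)))))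

  bads : Vec (Fin a) a → ℚ
  bads v = ∑ λ y → atyp (v !! nb y)

  E-bads : E bads ≤ κ * (e * ε₁)
  E-bads = E-tuples atyp ε₁ 0≤atyp avg-atyp

  iΔ : ℚ
  iΔ = inv ⟦ Δ ⟧
  0<Δ : 0ℚ < ⟦ Δ ⟧
  0<Δ = 0<⟦⟧ 1≤Δ

  -- Counts the positions of `t` that `u` must not take. Division by `Δ`, the largest possible
  -- number of positions, puts it into [0, 1] as `Variance` requires.
  fF : Fin a → List (Fin a) → ℚ
  fF u t = iΔ * ∑L (dels t) (λ s → atyp (u ∷ s))

  0≤fF : ∀ u t → 0ℚ ≤ fF u t
  0≤fF u t = 0≤* (0≤inv _) (0≤∑L (dels t) λ s → 0≤atyp (u ∷ s))

  fF≤1 : ∀ u t → length t ℕ.≤ Δ → fF u t ≤ 1ℚ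
  fF≤1 u t len = ≤-trans (≡⇒≤ (*-comm _ _)) (÷-≤ 0<Δ (≤-trans (∑L-mono (dels t) λ s _ → ind≤1 (not (typ (u ∷ s)))) (≤-trans (≡⇒≤ (trans (∑L-const (dels t) 1ℚ) (*-comm _ 1ℚ))) (*-monoˡ 0≤1 (⟦⟧-mono (ℕ.≤-trans (ℕ.≤-reflexive (length-dels t)) len))))))

  module VF (u : Fin a) = Variance (fF u) (0≤fF u) (fF≤1 u)

  avg-fF : ∀ u k → k ℕ.≤ Δ → avg k (fF u) ≤ ⟦ k ⟧ * (iΔ * ε₁)
  avg-fF u k k≤Δ = ≤-trans (≡⇒≤ (trans (avg-*ˡ k iΔ _) (cong (iΔ *_) (avg-dels 1≤a k (λ s → atyp (u ∷ s)))))) (≤-trans (*-monoˡ (0≤inv _) (lem k k≤Δ)) (≡⇒≤ (*-swap _ _ _)))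
    where
    lem : ∀ k → k ℕ.≤ Δ → ⟦ k ⟧ * avg (k ℕ.∸ 1) (λ s → atyp (u ∷ s)) ≤ ⟦ k ⟧ * ε₁
    lem zero _ = ≡⇒≤ (trans (trans (cong (_* avg 0 (λ s → atyp (u ∷ s))) ⟦0⟧) (*-zeroˡ _)) (sym (trans (cong (_* ε₁) ⟦0⟧) (*-zeroˡ _))))
    lem (suc k) k<Δ = *-monoˡ (0≤⟦⟧ (suc k)) (through u k k<Δ)

  μF≤ : ∀ u → VF.μ u ≤ e * (iΔ * ε₁)
  μF≤ u = ≤-trans (∑-mono λ y → avg-fF u _ (length-nb≤ y)) (≡⇒≤ (∑-lengths _))

  0≤Cκ : 0ℚ ≤ Cκ
  0≤Cκ = ≤-trans (0≤* (0≤- 1≤κ) (0≤⟦⟧ a)) κ-1≤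

  0<C₂ : 0ℚ < C₂
  0<C₂ = subst (0ℚ <_) (+-comm _ _) (0<+ (0<* (0<+ 0<4 0≤2) (0<* 0<Δ 0<Δ)) (0≤* 0≤2 0≤Cκ))

  -- Summing the squares over all `u` lets one expectation serve every `u`: the sum is of order
  -- `ε₁ a²`, so each deviation is a small multiple of `a`, without exceptions.
  devF : Vec (Fin a) a → ℚ
  devF v = ∑ λ u → (VF.ℓ u v - VF.μ u) * (VF.ℓ u v - VF.μ u)

  E-devF : E devF ≤ ⟦ a ⟧ * (C₂ * (e * (iΔ * ε₁)))
  E-devF = ≤-trans (≡⇒≤ (E-∑ (λ u v → (VF.ℓ u v - VF.μ u) * (VF.ℓ u v - VF.μ u)))) (≤-trans (∑-mono λ u → ≤-trans (VF.variance u) (*-monoˡ (<⇒≤ 0<C₂) (μF≤ u))) (≡⇒≤ (∑-const a _)))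

  forbidden≤ : ∀ v u → ∑ (λ z → ind (forbidden typ (v !_) u z)) ≤ ⟦ Δ ⟧ * VF.ℓ u v
  forbidden≤ v u =
    ∑ (λ z → ind (forbidden typ (v !_) u z)) ≤⟨ ∑-mono (λ z → ≤-trans (ind-anyF _) (∑-mono λ y → ≡⇒≤ (ind-∧ (edge J z y) _))) ⟩
    ∑ (λ z → ∑ λ y → ind (edge J z y) * atyp (u ∷ v !! except z y)) ≡⟨ trans (∑-swap _) (∑-cong λ y → sym (∑L-nb y (λ z → atyp (u ∷ v !! except z y)))) ⟩≤
    ∑ (λ y → ∑L (nb y) (λ z → atyp (u ∷ v !! except z y))) ≡⟨ ∑-cong (λ y → trans (∑L-cong (nb y) λ z → cong (λ l → atyp (u ∷ v !! l)) (except≡ z y (allFin a))) (∑L-dels (v !_) (nb y) (nb-unique y) (λ s → atyp (u ∷ s)))) ⟩≤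
    ∑ (λ y → ∑L (dels (v !! nb y)) (λ s → atyp (u ∷ s))) ≡⟨ ∑-cong (λ y → trans (sym (*-identityˡ _)) (trans (cong (_* ∑L (dels (v !! nb y)) (λ s → atyp (u ∷ s))) (sym (*-inv 0<Δ))) (*-assoc _ _ _))) ⟩≤
    ∑ (λ y → ⟦ Δ ⟧ * fF u (v !! nb y)) ≡⟨ ∑-*ˡ ⟦ Δ ⟧ _ ⟩≤
    ⟦ Δ ⟧ * VF.ℓ u v ■
    where
    except≡ : ∀ z y xs → filterᵇ (λ x → edge J x y ∧ not (eqF x z)) xs ≡ filterᵇ (λ x → not (eqF x z)) (filterᵇ (λ x → edge J x y) xs)
    except≡ z y [] = refl
    except≡ z y (x ∷ xs) with edge J x y
    ... | false = except≡ z y xs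
    ... | true with eqF x z
    ...   | true = except≡ z y xs
    ...   | false = cong (x ∷_) (except≡ z y xs)

  nearY : Fin b → Fin a → Bool
  nearY y z = anyF (λ x → edge J x y ∧ near x z)

  ∑-nearY : ∀ y → ∑ (λ z → ind (nearY y z)) ≤ ⟦ length (nb y) ⟧ * m
  ∑-nearY y =
    ∑ (λ z → ind (nearY y z)) ≤⟨ ∑-mono (λ z → ≤-trans (ind-anyF _) (∑-mono λ x → ≡⇒≤ (ind-∧ (edge J x y) (near x z)))) ⟩
    ∑ (λ z → ∑ (λ x → ind (edge J x y) * ind (near x z))) ≡⟨ trans (∑-swap _) (∑-cong λ x → ∑-*ˡ (ind (edge J x y)) _) ⟩≤
    ∑ (λ x → ind (edge J x y) * ∑ (λ z → ind (near x z))) ≤⟨ ∑-mono (λ x → *-monoˡ (0≤ind (edge J x y)) (∑-near x)) ⟩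
    ∑ (λ x → ind (edge J x y) * m) ≡⟨ trans (∑-*ʳ m _) (cong (_* m) (sym (⟦length-nb⟧ y))) ⟩≤
    ⟦ length (nb y) ⟧ * m ■

  -- Weight placed around rows that start atypical. These places are repaired, and afterwards only a
  -- crude bound on the entries of their rows is available, so this weight has to be small.
  badWeight : Vec (Fin a) a → ℚ
  badWeight v = ∑ λ y → ∑ λ z → ind (nearY y z) * (hA (v ! z) * atyp (v !! nb y))

  ∑-hA-const : ∀ x → ia * ∑ (λ u → hA u * x) ≡ ia * (W * x)
  ∑-hA-const x = cong (ia *_) (∑-*ʳ x hA)

  E-badWeight₁ : ∀ y z → edge J z y ≡ false → E (λ v → hA (v ! z) * atyp (v !! nb y)) ≤ κ * (ia * (W * (⟦ length (nb y) ⟧ * ε₁)))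
  E-badWeight₁ y z ez = ≤-trans (E≤avg (z ∷ nb y) (All.tabulate (λ x∈ z≡x → true≢false (∈nb⁻ x∈) (subst (λ z → edge J z y ≡ false) z≡x ez)) ∷ nb-unique y)
      (ℕ.≤-trans (s≤s (length-nb≤ y)) (ℕ.≤-trans (ℕ.≤-reflexive (sym (ℕ.+-comm Δ 1))) (ℕ.+-monoʳ-≤ Δ 1≤Δ))) g 0≤g)
    (*-monoˡ 0≤κ (≤-trans (≡⇒≤ (avg-suc (length (nb y)) g)) (≤-trans (*-monoˡ (0≤inv _) (∑-mono λ u → ≤-trans (≡⇒≤ (avg-*ˡ (length (nb y)) (hA u) atyp)) (*-monoˡ (0≤hA u) (avg-atyp _ (length-nb≤ y))))) (≡⇒≤ (∑-hA-const _)))))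
    where
    g : List (Fin a) → ℚ
    g [] = 0ℚ
    g (u ∷ t) = hA u * atyp t
    0≤g : ∀ t → 0ℚ ≤ g t
    0≤g [] = ≤-refl
    0≤g (u ∷ t) = 0≤* (0≤hA u) (0≤atyp t)

  except-len : ∀ z y → edge J z y ≡ true → suc (length (except z y)) ℕ.≤ length (nb y)
  except-len z y ez = length-filterᵇ-< (allFin a) (λ x p → ∧⁻ˡ p) (∈-allFin z) (trans (cong (λ b → edge J z y ∧ not b) (eqF-refl z)) (∧-zeroʳ (edge J z y))) ez

  -- Now the image of `z` belongs to the tuple and is correlated with its typicality. It is moved to
  -- the front, which `typ-mono` permits, and fixed; `through` then bounds the atypical tuples for
  -- each of its values.
  E-badWeight₂ : ∀ y z → edge J z y ≡ true → E (λ v → hA (v ! z) * atyp (v !! nb y)) ≤ κ * (ia * (W * (⟦ length (nb y) ⟧ * ε₁)))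
  E-badWeight₂ y z ez = ≤-trans (E-mono λ v _ → *-monoˡ (0≤hA _) (ind-mono {not (typ (v !! nb y))} λ p → cong not (untyp v (not≡true p))))
    (≤-trans (E≤avg (z ∷ except z y) (All.tabulate (λ {x} x∈ z≡x → z∉ (subst (_∈ except z y) (sym z≡x) x∈)) ∷ filterᵇ-unique _ (Unique.allFin⁺ a))
      (ℕ.≤-trans (except-len z y ez) (nb-len y)) g 0≤g)
    (*-monoˡ 0≤κ (≤-trans (≡⇒≤ (avg-suc k g)) (≤-trans (*-monoˡ (0≤inv _) (∑-mono λ u → ≤-trans (≡⇒≤ (avg-*ˡ k (hA u) (λ t → atyp (u ∷ t)))) (*-monoˡ (0≤hA u) (≤-trans (through u k (ℕ.≤-trans (except-len z y ez) (length-nb≤ y))) (≤-trans (≡⇒≤ (sym (*-identityˡ _))) (*-monoʳ (<⇒≤ 0<ε₁) (1≤⟦⟧ (ℕ.≤-trans (s≤s z≤n) (except-len z y ez))))))))) (≡⇒≤ (∑-hA-const _))))))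
    where
    k = length (except z y)
    z∉ : z ∉ except z y
    z∉ p = true≢false (eqF-refl z) (not≡true (∧⁻ʳ {edge J z y} (proj₂ (∈-filterᵇ⁻ (λ x → edge J x y ∧ not (eqF x z)) {allFin a} p))))
    g : List (Fin a) → ℚ
    g [] = 0ℚ
    g (u ∷ t) = hA u * atyp (u ∷ t)
    0≤g : ∀ t → 0ℚ ≤ g t
    0≤g [] = ≤-refl
    0≤g (u ∷ t) = 0≤* (0≤hA u) (0≤atyp (u ∷ t))
    untyp : ∀ v → typ (v !! nb y) ≡ false → typ (v ! z ∷ v !! except z y) ≡ false
    untyp v p with typ (v ! z ∷ v !! except z y) in q
    ... | false = refl
    ... | true = ⊥-elim (true≢false (typ-mono incl (ℕ.≤-trans (s≤s (ℕ.≤-reflexive (length-map (v !_) (except z y)))) (ℕ.≤-trans (except-len z y ez) (ℕ.≤-reflexive (sym (length-map (v !_) (nb y)))))) q) p)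
      where
      incl : ∀ u → u ∈ v !! nb y → u ∈ v ! z ∷ v !! except z y
      incl u u∈ with x , x∈ , refl ← ∈-map⁻ (v !_) u∈ = cases (x ≟ z)
        where
        cases : Dec (x ≡ z) → v ! x ∈ v ! z ∷ v !! except z y
        cases (yes x≡z) = here (cong (v !_) x≡z)
        cases (no x≢z) = there (∈-map⁺ (v !_) (∈-filterᵇ⁺ (λ x → edge J x y ∧ not (eqF x z)) (∈-allFin x) (∧⁺ (∈nb⁻ x∈) (cong not (≢⇒eqF x≢z)))))

  E-badWeight₀ : ∀ y z → E (λ v → hA (v ! z) * atyp (v !! nb y)) ≤ κ * (ia * (W * (⟦ Δ ⟧ * ε₁)))
  E-badWeight₀ y z = ≤-trans (cases (edge J z y) refl) (*-monoˡ 0≤κ (*-monoˡ (0≤inv _) (*-monoˡ (<⇒≤ 0<W) (*-monoʳ (<⇒≤ 0<ε₁) (⟦⟧-mono (length-nb≤ y))))))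
    where
    cases : ∀ b → edge J z y ≡ b → E (λ v → hA (v ! z) * atyp (v !! nb y)) ≤ κ * (ia * (W * (⟦ length (nb y) ⟧ * ε₁)))
    cases true p = E-badWeight₂ y z p
    cases false p = E-badWeight₁ y z p

  E-badWeight : E badWeight ≤ e * (m * (κ * (ia * (W * (⟦ Δ ⟧ * ε₁)))))
  E-badWeight =
    E badWeight ≡⟨ trans (E-∑ (λ y v → ∑ λ z → ind (nearY y z) * (hA (v ! z) * atyp (v !! nb y)))) (∑-cong λ y → trans (E-∑ (λ z v → ind (nearY y z) * (hA (v ! z) * atyp (v !! nb y)))) (∑-cong λ z → E-*ˡ (ind (nearY y z)) _)) ⟩≤
    ∑ (λ y → ∑ λ z → ind (nearY y z) * E (λ v → hA (v ! z) * atyp (v !! nb y))) ≤⟨ ∑-mono (λ y → ∑-mono λ z → *-monoˡ (0≤ind (nearY y z)) (E-badWeight₀ y z)) ⟩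
    ∑ (λ y → ∑ λ z → ind (nearY y z) * X) ≤⟨ ∑-mono (λ y → ≤-trans (≡⇒≤ (∑-*ʳ X _)) (≤-trans (*-monoʳ 0≤X (∑-nearY y)) (≡⇒≤ (*-assoc _ _ _)))) ⟩
    ∑ (λ y → ⟦ length (nb y) ⟧ * (m * X)) ≡⟨ ∑-lengths (m * X) ⟩≤
    e * (m * X) ■
    where
    X = κ * (ia * (W * (⟦ Δ ⟧ * ε₁)))
    0≤X : 0ℚ ≤ X
    0≤X = 0≤* 0≤κ (0≤* (0≤inv _) (0≤* (<⇒≤ 0<W) (0≤* (0≤⟦⟧ Δ) (<⇒≤ 0<ε₁))))

  iK : ℚ
  iK = inv K

  nonempty : List (Fin a) → Bool
  nonempty [] = false
  nonempty (_ ∷ _) = true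

  -- The load that a row puts on column `v`, scaled by `1 / K` into [0, 1]. Rows without neighbours
  -- count as 0, since any place suits them.
  fL : Fin b → List (Fin a) → ℚ
  fL v t = ind (nonempty t) * iK * (ind (cn G t v) * r v ^ length t)

  0≤fL : ∀ v t → 0ℚ ≤ fL v t
  0≤fL v t = 0≤* (0≤* (0≤ind (nonempty t)) (0≤inv _)) (0≤* (0≤ind (cn G t v)) (0≤^ (length t) (0≤r v)))

  fL≤1 : ∀ v t → length t ℕ.≤ Δ → fL v t ≤ 1ℚ
  fL≤1 v t len = ≤-trans (*-mono (0≤* (0≤ind (nonempty t)) (0≤inv _)) (<⇒≤ 0<K) (≤-trans (*-monoʳ (0≤inv _) (ind≤1 (nonempty t))) (≡⇒≤ (*-identityˡ iK))) (≤-trans (ind*≤′ (cn G t v) (0≤^ (length t) (0≤r v))) (K-bound v (length t) len)))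
    (≡⇒≤ (trans (*-comm _ _) (*-inv 0<K)))

  module VL (v : Fin b) = Variance (fL v) (0≤fL v) (fL≤1 v)

  active : Fin b → Bool
  active y = nonempty (nb y)

  nonempty-length : ∀ s t → length s ≡ length t → nonempty s ≡ nonempty t
  nonempty-length [] [] _ = refl
  nonempty-length (_ ∷ _) (_ ∷ _) _ = refl

  μL≡ : ∀ v → VL.μ v ≡ ∑ (λ y → ind (active y)) * iK
  μL≡ v = trans (∑-cong λ y → trans (avg-cong (length (nb y)) λ t q → cong (λ b → ind b * iK * (ind (cn G t v) * r v ^ length t)) (nonempty-length t (nb y) q))
      (trans (avg-*ˡ (length (nb y)) (ind (active y) * iK) _) (trans (cong (ind (active y) * iK *_) (avg-cn (length (nb y)) v)) (*-identityʳ _)))) (∑-*ʳ iK _)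

  active≤ : ∑ (λ y → ind (active y)) ≤ e
  active≤ = ≤-trans (∑-mono λ y → lem (nb y)) (≡⇒≤ (trans (∑-cong ⟦length-nb⟧) ∑-degB))
    where
    lem : ∀ xs → ind (nonempty xs) ≤ ⟦ length xs ⟧
    lem [] = 0≤⟦⟧ 0
    lem (x ∷ xs) = 1≤⟦⟧ (s≤s z≤n)

  -- Unlike `devF` this sum has no small factor: it is of order `b²`, so a bounded number of columns
  -- may deviate by a multiple of `b`. They are given up later.
  devL : Vec (Fin a) a → ℚ
  devL v = ∑ λ u → (VL.ℓ u v - VL.μ u) * (VL.ℓ u v - VL.μ u)

  E-devL : E devL ≤ ⟦ b ⟧ * (C₂ * (e * iK))
  E-devL = ≤-trans (≡⇒≤ (E-∑ (λ u v → (VL.ℓ u v - VL.μ u) * (VL.ℓ u v - VL.μ u)))) (≤-trans (∑-mono λ u → ≤-trans (VL.variance u) (*-monoˡ (<⇒≤ 0<C₂) (≤-trans (≡⇒≤ (μL≡ u)) (*-monoʳ (0≤inv _) active≤)))) (≡⇒≤ (∑-const b _)))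

  record Selected : Set where
    field
      v : Vec (Fin a) a
      inj : Inj v
      cost≤ : cost v ≤ (1ℚ + 4ℚ * ν) * (κ * (e * β))
      bads≤ : bads v ≤ 2ℚ * inv ν * (κ * (e * ε₁))
      devF≤ : devF v ≤ 2ℚ * inv ν * (⟦ a ⟧ * (C₂ * (e * (iΔ * ε₁))))
      badWeight≤ : badWeight v ≤ 2ℚ * inv ν * (e * (m * (κ * (ia * (W * (⟦ Δ ⟧ * ε₁))))))
      devL≤ : devL v ≤ 2ℚ * inv ν * (⟦ b ⟧ * (C₂ * (e * iK)))

  0<1+η : 0ℚ < 1ℚ + η
  0<1+η = 0<+ 0<1 0≤η

  0<κ : 0ℚ < κ
  0<κ = ℚ.<-≤-trans 0<1 1≤κ

  0<ia : 0ℚ < ia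
  0<ia = 0<inv 0<a

  0<m : 0ℚ < m
  0<m = 0<+ 0<1 (0≤* (0≤⟦⟧ Δ) (0≤⟦⟧ Δ))

  0<β : 0ℚ < β
  0<β = 0<* (0<* (0<* 0<1+η (0<inv 0<pa)) (0<inv 0<b)) 0<W

  opaque
    selected : Selected
    selected = build (select {total} E-total)
      where
      B₀ B₁ B₂ B₃ B₄ : ℚ
      B₀ = κ * (e * β)
      B₁ = κ * (e * ε₁)
      B₂ = ⟦ a ⟧ * (C₂ * (e * (iΔ * ε₁)))
      B₃ = e * (m * (κ * (ia * (W * (⟦ Δ ⟧ * ε₁)))))
      B₄ = ⟦ b ⟧ * (C₂ * (e * iK))
      0<B₀ : 0ℚ < B₀
      0<B₀ = 0<* 0<κ (0<* 0<e 0<β)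
      0<B₁ : 0ℚ < B₁
      0<B₁ = 0<* 0<κ (0<* 0<e 0<ε₁)
      0<B₂ : 0ℚ < B₂
      0<B₂ = 0<* 0<a (0<* 0<C₂ (0<* 0<e (0<* (0<inv 0<Δ) 0<ε₁)))
      0<B₃ : 0ℚ < B₃
      0<B₃ = 0<* 0<e (0<* 0<m (0<* 0<κ (0<* 0<ia (0<* 0<W (0<* 0<Δ 0<ε₁)))))
      0<B₄ : 0ℚ < B₄
      0<B₄ = 0<* 0<b (0<* 0<C₂ (0<* 0<e (0<inv 0<K)))
      tail total : Vec (Fin a) a → ℚ
      tail v = (inv B₁ * bads v + inv B₂ * devF v) + (inv B₃ * badWeight v + inv B₄ * devL v)
      -- The cost has to stay within `1 + 4ν` of the bound on its mean, while constant factors are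
      -- harmless in the other four terms. These enter with the small weight `ν`, and each ends up
      -- at most `(1 + 4ν) / ν ≤ 2 / ν` times its bound.
      total v = inv B₀ * cost v + ν * tail v
      norm : ∀ {B F} → 0ℚ < B → E F ≤ B → E (λ v → inv B * F v) ≤ 1ℚ
      norm {B} {F} 0<B p = ≤-trans (≡⇒≤ (trans (E-*ˡ (inv B) F) (*-comm _ _))) (÷-≤ 0<B (≤-trans p (≡⇒≤ (sym (*-identityˡ B)))))
      E-total : E total ≤ 1ℚ + 4ℚ * ν
      E-total = ≤-trans (≡⇒≤ (trans (E-+ (λ v → inv B₀ * cost v) (λ v → ν * tail v)) (cong (E (λ v → inv B₀ * cost v) +_) (E-*ˡ ν tail))))
        (+-mono (norm 0<B₀ E-cost) (≤-trans (*-monoˡ (<⇒≤ 0<ν) (≤-trans (≡⇒≤ (trans (E-+ (λ v → inv B₁ * bads v + inv B₂ * devF v) (λ v → inv B₃ * badWeight v + inv B₄ * devL v)) (cong₂ _+_ (E-+ (λ v → inv B₁ * bads v) (λ v → inv B₂ * devF v)) (E-+ (λ v → inv B₃ * badWeight v) (λ v → inv B₄ * devL v)))))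
          (+-mono (+-mono (norm 0<B₁ E-bads) (norm 0<B₂ E-devF)) (+-mono (norm 0<B₃ E-badWeight) (norm 0<B₄ E-devL))))) (≡⇒≤ (*-comm ν 4ℚ))))
      build : (∃ λ v → Inj v × total v ≤ 1ℚ + 4ℚ * ν) → Selected
      build (v , inj , le) = record
        { v = v ; inj = inj
        ; cost≤ = ÷-≤⁻¹ 0<B₀ (≤-trans (≡⇒≤ (*-comm _ _)) (≤-trans (x≤x+y (0≤* (<⇒≤ 0<ν) (0≤+ (0≤+ (0≤t B₁ 0≤bads) (0≤t B₂ 0≤devF)) (0≤+ (0≤t B₃ 0≤badWeight) (0≤t B₄ 0≤devL))))) le))
        ; bads≤ = part 0<B₁ (≤-trans (x≤x+y (0≤t B₂ 0≤devF)) (x≤x+y (0≤+ (0≤t B₃ 0≤badWeight) (0≤t B₄ 0≤devL))))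
        ; devF≤ = part 0<B₂ (≤-trans (y≤x+y (0≤t B₁ 0≤bads)) (x≤x+y (0≤+ (0≤t B₃ 0≤badWeight) (0≤t B₄ 0≤devL))))
        ; badWeight≤ = part 0<B₃ (≤-trans (x≤x+y (0≤t B₄ 0≤devL)) (y≤x+y (0≤+ (0≤t B₁ 0≤bads) (0≤t B₂ 0≤devF))))
        ; devL≤ = part 0<B₄ (≤-trans (y≤x+y (0≤t B₃ 0≤badWeight)) (y≤x+y (0≤+ (0≤t B₁ 0≤bads) (0≤t B₂ 0≤devF))))
        }
        where
        0≤t : ∀ B {x} → 0ℚ ≤ x → 0ℚ ≤ inv B * x
        0≤t B p = 0≤* (0≤inv B) p
        0≤cost : 0ℚ ≤ cost v
        0≤cost = 0≤∑ λ y → 0≤c (v !! nb y)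
        0≤bads : 0ℚ ≤ bads v
        0≤bads = 0≤∑ λ y → 0≤atyp _
        0≤devF : 0ℚ ≤ devF v
        0≤devF = 0≤∑ λ u → 0≤square _
        0≤devL : 0ℚ ≤ devL v
        0≤devL = 0≤∑ λ u → 0≤square _
        0≤badWeight : 0ℚ ≤ badWeight v
        0≤badWeight = 0≤∑ λ y → 0≤∑ λ z → 0≤* (0≤ind (nearY y z)) (0≤* (0≤hA _) (0≤atyp _))
        tail≤ : tail v ≤ 2ℚ * inv ν
        tail≤ = ≤-÷ 0<ν (≤-trans (≡⇒≤ (*-comm _ _)) (≤-trans (≤-trans (y≤x+y (0≤t B₀ 0≤cost)) le) (+-mono ≤-refl 4ν≤1)))
        part : ∀ {B x} → 0ℚ < B → inv B * x ≤ tail v → x ≤ 2ℚ * inv ν * B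
        part {B} {x} 0<B q = ÷-≤⁻¹ 0<B (≤-trans (≡⇒≤ (*-comm _ _)) (≤-trans q tail≤))

-- Embedding one job

-- `ξ` bounds the number of atypical rows per edge of the job. `ω` is the weight around repairs in
-- units of `e W / a`; its summands are the initial `badWeight` and the budget of the swaps.
module Numbers (Δ : ℕ) (ν κ Cκ ε₁ : ℚ) where
  ξ C₂ m ω : ℚ
  ξ = 2ℚ * inv ν * (κ * ε₁)
  C₂ = 2ℚ * Cκ + (4ℚ + 2ℚ) * (⟦ Δ ⟧ * ⟦ Δ ⟧)
  m = 1ℚ + ⟦ Δ ⟧ * ⟦ Δ ⟧
  ω = 2ℚ * inv ν * (m * (κ * (⟦ Δ ⟧ * ε₁))) + ⟦ Δ ⟧ * ξ * (4ℚ * m)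

-- `lev` describes tuples after the repairs and `ζ` the size of their common neighbourhoods relative
-- to `b`; `c₀` is the share of B left free, `Omax` a bound on the number of discarded columns.
record Completion {a b : ℕ} {G J : BipGraph a b} {Δ : ℕ} (setting : Setting G J Δ) : Set where
  open Setting setting
  field
    a≤b : ⟦ a ⟧ ≤ ⟦ b ⟧
    p≤1 : p ≤ 1ℚ
    size≤ : size G ≤ p * (⟦ a ⟧ * ⟦ b ⟧)
    typ-N : ∀ t → length t ℕ.≤ Δ → typ t ≡ true → p ^ length t * ⟦ b ⟧ ≤ (1ℚ + η) * N G t
    lev : ℕ → List (Fin a) → Bool
    lev-⊆ : ∀ {i s t} → (∀ u → u ∈ s → u ∈ t) → lev i t ≡ true → lev i s ≡ true
    lev-mono : ∀ {i j t} → i ℕ.≤ j → lev i t ≡ true → lev j t ≡ true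
    typ⇒lev : ∀ t → length t ℕ.≤ Δ → typ t ≡ true → lev Δ t ≡ true
    ε : ℚ
    0≤ε : 0ℚ ≤ ε
    ext : ∀ i t → i ℕ.< Δ ℕ.+ Δ → lev i t ≡ true → ∑ (λ u → ind (not (lev (suc i) (u ∷ t)))) ≤ ε * ⟦ a ⟧
    ζ : ℚ
    0<ζ : 0ℚ < ζ
    lev-N : ∀ t → length t ℕ.≤ Δ → lev (Δ ℕ.+ Δ) t ≡ true → ζ * ⟦ b ⟧ ≤ N G t
    c₀ : ℚ
    0<c₀ : 0ℚ < c₀
    few-active : ∑ (λ y → ind (Selection.active setting y)) ≤ (1ℚ - c₀) * ⟦ b ⟧
  open Numbers Δ ν κ Cκ ε₁
  field
    C₁ C₅ ρ Omax : ℚ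
    C₁-bound : (1ℚ + ⟦ Δ ⟧) * inv p ^ Δ ≤ C₁
    0≤ρ : 0ℚ ≤ ρ
    ε₁≤ρ : ε₁ ≤ ρ
    devF-small : 2ℚ * inv ν * (C₂ * ε₁) ≤ ρ * ρ
    room : 2ℚ * (⟦ Δ ⟧ * ξ * ⟦ Δ ⟧) * m + ⟦ Δ ⟧ * ε + ⟦ Δ ⟧ * (2ℚ * ρ) + inv 4ℚ < 1ℚ
    Omax-bound : 2ℚ * inv ν * (C₂ * ⟦ Δ ⟧) * K ≤ Omax * (c₀ * inv 2ℚ * (c₀ * inv 2ℚ))
    Omax-small₁ : Omax * (K * inv ⟦ b ⟧) ≤ C₁ * η
    Omax-small₂ : Omax * (K * inv ⟦ b ⟧) ≤ ζ * inv 2ℚ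
    0<ζ₁ : 0ℚ < 1ℚ - (C₁ * η + C₁ * η)
    columns : inv (1ℚ - (C₁ * η + C₁ * η)) * (1ℚ - c₀ * inv 2ℚ) + inv (ζ * inv 2ℚ) * (K * (⟦ Δ ⟧ * (2ℚ * (⟦ Δ ⟧ * ξ * ⟦ Δ ⟧)))) ≤ 1ℚ
    total-bound : inv (1ℚ - (C₁ * η + C₁ * η)) * ((1ℚ + 4ℚ * ν) * (κ * (1ℚ + η))) + inv (ζ * inv 2ℚ) * (K * (⟦ Δ ⟧ * ω)) ≤ 1ℚ + C₅ * η
  ζ₁ ζ₂ : ℚ
  ζ₁ = 1ℚ - (C₁ * η + C₁ * η)
  ζ₂ = ζ * inv 2ℚ

record Embedding {a b : ℕ} (G J : BipGraph a b) (w : Fin a → Fin b → ℚ) (bound : ℚ) : Set where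
  field
    σ : Fin a → Fin a
    τ : Fin b → Fin b
    σ-injective : Injective _≡_ _≡_ σ
    τ-injective : Injective _≡_ _≡_ τ
    edges-to-edges : ∀ x y → edge J x y ≡ true → edge G (σ x) (τ y) ≡ true
    weight≤ : ∑ (λ y → ∑ λ x → ind (edge J x y) * w (σ x) (τ y)) ≤ bound

inv-* : ∀ {x y} → 0ℚ < x → 0ℚ < y → inv (x * y) ≡ inv x * inv y
inv-* {x} {y} 0<x 0<y = begin
  inv (x * y) ≡⟨ sym (trans (cong₂ (λ s t → inv (x * y) * (s * t)) (*-inv 0<x) (*-inv 0<y)) (trans (cong (inv (x * y) *_) (*-identityˡ 1ℚ)) (*-identityʳ _))) ⟩
  inv (x * y) * (x * inv x * (y * inv y)) ≡⟨ lem (inv (x * y)) x y (inv x) (inv y) ⟩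
  x * y * inv (x * y) * (inv x * inv y) ≡⟨ trans (cong (_* (inv x * inv y)) (*-inv (0<* 0<x 0<y))) (*-identityˡ _) ⟩
  inv x * inv y ∎
  where
  open ≡-Reasoning
  opaque
    unfolding _+_
    lem : ∀ z x y i j → z * (x * i * (y * j)) ≡ x * y * z * (i * j)
    lem = solve-∀ ringℚ

square-≤ : ∀ {x y} → 0ℚ ≤ y → x * x ≤ y * y → x ≤ y
square-≤ {x} {y} 0≤y p = ≮⇒≥ λ y<x → ≤⇒≯ p (ℚ.≤-<-trans (*-monoˡ 0≤y (<⇒≤ y<x)) (*-mono-< (ℚ.≤-<-trans 0≤y y<x) y<x))

map-⊆ : ∀ {A B : Set} (f : A → B) {xs ys} → (∀ x → x ∈ xs → x ∈ ys) → ∀ u → u ∈ map f xs → u ∈ map f ys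
map-⊆ f incl u u∈ with x , x∈ , refl ← ∈-map⁻ f u∈ = ∈-map⁺ f (incl x x∈)

x-y<x : ∀ {x y} → 0ℚ < y → x - y < x
x-y<x {x} {y} 0<y = ℚ.≰⇒> λ q → ≤⇒≯ (≤-trans (+-mono q ≤-refl) (≡⇒≤ (lem x y))) (subst (_< x + y) (+-identityʳ x) (+-mono-≤-< (≤-refl {x}) 0<y))
  where
  opaque
    unfolding _+_
    lem : ∀ x y → x - y + y ≡ x
    lem = solve-∀ ringℚ

module Embed {a b : ℕ} {G J : BipGraph a b} {Δ : ℕ} (setting : Setting G J Δ) (completion : Completion setting) where
  open Setting setting
  open Selection setting
  open Completion completion
  open Numbers Δ ν κ Cκ ε₁ using (ξ; ω)
  open Averages 1≤a using (0<a)
  open Moments 1≤a b≤2a J Δ 1≤Δ bounded κ₀ κ Cκ 0≤κ₀ κ₀-bound κ₀^≤κ 1≤κ κ≤2 κ-1≤ using (C₂; 0≤κ)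
  open Job J Δ bounded
  open Bounded bounded

  Z : List (Fin a) → ℚ
  Z t = ∑ (M t)

  rel relDeg : Fin b → ℚ
  rel v = p * r v
  relDeg v = degB G v * inv (p * ⟦ a ⟧)

  rel-relDeg : ∀ v → rel v * relDeg v ≡ 1ℚ
  rel-relDeg v = trans (lem p ⟦ a ⟧ (inv (degB G v)) (degB G v) (inv (p * ⟦ a ⟧))) (trans (cong₂ _*_ (*-inv 0<pa) (*-inv (0<deg v))) (*-identityˡ 1ℚ))
    where
    opaque
      unfolding _+_
      lem : ∀ p a i d j → p * (a * i) * (d * j) ≡ p * a * j * (d * i)
      lem = solve-∀ ringℚ

  0≤relDeg : ∀ v → 0ℚ ≤ relDeg v
  0≤relDeg v = 0≤* (<⇒≤ (0<deg v)) (0≤inv _)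

  -- Bernoulli's inequality together with x + 1/x ≥ 2.
  tangent : ∀ v k → 1ℚ + ⟦ k ⟧ * (1ℚ - relDeg v) ≤ rel v ^ k
  tangent v k = ≤-trans (+-mono ≤-refl (*-monoˡ (0≤⟦⟧ k) (≤-by (relDeg v * ((rel v - 1ℚ) * (rel v - 1ℚ))) (0≤* (0≤relDeg v) (0≤square _))
      (trans (lem₁ (rel v)) (trans (cong (λ s → s * rel v - 2ℚ * s + 1ℚ) (sym (rel-relDeg v))) (lem₂ (rel v) (relDeg v))))))) (bernoulli k (0≤* (<⇒≤ 0<p) (0≤r v)))
    where
    opaque
      unfolding _+_
      lem₁ : ∀ x → x - 1ℚ ≡ 1ℚ * x - (1ℚ + 1ℚ) * 1ℚ + 1ℚ
      lem₁ = solve-∀ ringℚ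
      lem₂ : ∀ x y → x * y * x - (1ℚ + 1ℚ) * (x * y) + 1ℚ ≡ (1ℚ - y) + y * ((x - 1ℚ) * (x - 1ℚ))
      lem₂ = solve-∀ ringℚ

  1-relDeg≤η : ∀ v → 1ℚ - relDeg v ≤ η
  1-relDeg≤η v with ℚ.≤-total (relDeg v) 1ℚ
  ... | inj₂ q = -≤⇒ (≤-trans q (y≤x+y 0≤η))
  ... | inj₁ q = -≤⇒ (≤-trans (≡⇒≤ (sym (rel-relDeg v))) (≤-trans (*-monoʳ (0≤relDeg v) rel≤) (≤-trans (≡⇒≤ (trans (*-distribʳ-+ (relDeg v) 1ℚ η) (+-comm _ _))) (+-mono (≤-trans (*-monoˡ 0≤η q) (≡⇒≤ (*-identityʳ η))) (≡⇒≤ (*-identityˡ _))))))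
    where
    rel≤ : rel v ≤ 1ℚ + η
    rel≤ = ≤-trans (≡⇒≤ (sym (*-assoc p ⟦ a ⟧ _))) (÷-≤ (0<deg v) (deg-lower v))

  ∑-relDeg≤ : ∑ relDeg ≤ ⟦ b ⟧
  ∑-relDeg≤ = ≤-trans (≡⇒≤ (trans (∑-*ʳ (inv (p * ⟦ a ⟧)) (degB G)) (cong (_* inv (p * ⟦ a ⟧)) (∑-swap (λ v u → ind (edge G u v)))))) (÷-≤ 0<pa (≤-trans size≤ (≡⇒≤ (lem p ⟦ a ⟧ ⟦ b ⟧))))
    where
    opaque
      unfolding _+_
      lem : ∀ p a b → p * (a * b) ≡ b * (p * a)
      lem = solve-∀ ringℚ

  -- Every vertex of B has degree at least the average up to the factor 1 + η, so no subset of B has a much larger average degree.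
  cn-sum : ∀ t → 0ℚ ≤ ∑ (λ v → ind (cn G t v) * (1ℚ - relDeg v)) + η * ⟦ b ⟧
  cn-sum t = ≤-trans (≤-trans (0≤- ∑-relDeg≤) (≡⇒≤ (sym total)))
    (≤-trans (∑-mono λ v → split (cn G t v) v) (≡⇒≤ (trans (∑-+ _ _) (cong (∑ (λ v → ind (cn G t v) * (1ℚ - relDeg v)) +_) (trans (∑-const b η) (*-comm _ _))))))
    where
    split : ∀ q v → 1ℚ - relDeg v ≤ ind q * (1ℚ - relDeg v) + η
    split true v = ≤-trans (≡⇒≤ (sym (*-identityˡ _))) (x≤x+y 0≤η)
    split false v = ≤-trans (1-relDeg≤η v) (y≤x+y (≡⇒≤ (sym (*-zeroˡ _))))
    opaque
      unfolding _+_
      lem : ∀ x → 1ℚ - x ≡ 1ℚ + (- 1ℚ) * x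
      lem = solve-∀ ringℚ
      lem₂ : ∀ b x → b * 1ℚ + (- 1ℚ) * x ≡ b - x
      lem₂ = solve-∀ ringℚ
    total : ∑ (λ v → 1ℚ - relDeg v) ≡ ⟦ b ⟧ - ∑ relDeg
    total = trans (∑-cong λ v → lem (relDeg v)) (trans (∑-+ _ _) (trans (cong₂ _+_ (∑-const b 1ℚ) (∑-*ˡ (- 1ℚ) relDeg)) (lem₂ ⟦ b ⟧ (∑ relDeg))))

  -- The right-hand side sums `rel v ^ k` over the common neighbourhood. `tangent` bounds this below
  -- by a linear function of the degrees, `typ-N` supplies the constant term and `cn-sum` the linear
  -- one.
  p^k≤bZ : ∀ t → length t ℕ.≤ Δ → typ t ≡ true → p ^ length t * ⟦ b ⟧ - (η * ⟦ b ⟧ + ⟦ length t ⟧ * (η * ⟦ b ⟧)) ≤ p ^ length t * (⟦ b ⟧ * Z t)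
  p^k≤bZ t len ty =
    p ^ k * ⟦ b ⟧ - (η * ⟦ b ⟧ + ⟦ k ⟧ * (η * ⟦ b ⟧)) ≤⟨ ≤-by _ (0≤+ (0≤- (≤-trans (typ-N t len ty) (≡⇒≤ (trans (*-distribʳ-+ _ 1ℚ η) (cong (_+ η * N G t) (*-identityˡ _)))))) (0≤+ (0≤* 0≤η (0≤- (N≤ G t))) (0≤* (0≤⟦⟧ k) (cn-sum t)))) (lem₁ (p ^ k * ⟦ b ⟧) η ⟦ b ⟧ ⟦ k ⟧ (N G t) X) ⟩
    N G t + ⟦ k ⟧ * X ≡⟨ trans (cong (N G t +_) (sym (∑-*ˡ ⟦ k ⟧ _))) (trans (sym (∑-+ _ _)) (∑-cong λ v → lem₂ (ind (cn G t v)) ⟦ k ⟧ (1ℚ - relDeg v))) ⟩≤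
    ∑ (λ v → ind (cn G t v) * (1ℚ + ⟦ k ⟧ * (1ℚ - relDeg v))) ≤⟨ ∑-mono (λ v → *-monoˡ (0≤ind (cn G t v)) (tangent v k)) ⟩
    ∑ (λ v → ind (cn G t v) * rel v ^ k) ≡⟨ trans (∑-cong λ v → term v) (trans (∑-*ˡ (p ^ k * ⟦ b ⟧) (M t)) (*-assoc _ _ _)) ⟩≤
    p ^ k * (⟦ b ⟧ * Z t) ■
    where
    k = length t
    X = ∑ (λ v → ind (cn G t v) * (1ℚ - relDeg v))
    opaque
      unfolding _+_
      lem₁ : ∀ s h b k n x → n + k * x ≡ (s - (h * b + k * (h * b))) + ((n + h * n - s) + (h * (b - n) + k * (x + h * b)))
      lem₁ = solve-∀ ringℚ
      lem₂ : ∀ i k y → i + k * (i * y) ≡ i * (1ℚ + k * y)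
      lem₂ = solve-∀ ringℚ
      lem₃ : ∀ i p r b j → i * (p * r) * (b * j) ≡ p * b * (i * r * j)
      lem₃ = solve-∀ ringℚ
    term : ∀ v → ind (cn G t v) * rel v ^ k ≡ p ^ k * ⟦ b ⟧ * M t v
    term v = trans (cong (ind (cn G t v) *_) (^-distrib-* p (r v) k)) (trans (sym (trans (cong (ind (cn G t v) * (p ^ k * r v ^ k) *_) (*-inv 0<b)) (*-identityʳ _))) (lem₃ (ind (cn G t v)) (p ^ k) (r v ^ k) ⟦ b ⟧ ib))

  Z-typical : ∀ t → length t ℕ.≤ Δ → typ t ≡ true → 1ℚ - C₁ * η ≤ Z t
  Z-typical t len ty = *-cancelˡ (0<* (0<^ k 0<p) 0<b) (
    p ^ k * ⟦ b ⟧ * (1ℚ - C₁ * η) ≤⟨ ≤-by (⟦ b ⟧ * (η * (p ^ k * C₁ - (1ℚ + ⟦ k ⟧)))) (0≤* (<⇒≤ 0<b) (0≤* 0≤η (0≤- key))) (lem (p ^ k) ⟦ b ⟧ η ⟦ k ⟧ C₁) ⟩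
    p ^ k * ⟦ b ⟧ - (η * ⟦ b ⟧ + ⟦ k ⟧ * (η * ⟦ b ⟧)) ≤⟨ p^k≤bZ t len ty ⟩
    p ^ k * (⟦ b ⟧ * Z t) ≡⟨ sym (*-assoc _ _ _) ⟩≤
    p ^ k * ⟦ b ⟧ * Z t ■)
    where
    k = length t
    opaque
      unfolding _+_
      lem : ∀ s b h k c → s * b - (h * b + k * (h * b)) ≡ s * b * (1ℚ - c * h) + b * (h * (s * c - (1ℚ + k)))
      lem = solve-∀ ringℚ
    key : 1ℚ + ⟦ k ⟧ ≤ p ^ k * C₁
    key = ≤-trans (+-mono ≤-refl (⟦⟧-mono len)) (≤-trans (≡⇒≤ (trans (sym (*-identityˡ _)) (cong (_* (1ℚ + ⟦ Δ ⟧)) (sym (inv-^ Δ 0<p))))) (≤-trans (*-monoʳ (0≤+ 0≤1 (0≤⟦⟧ Δ)) (*-monoʳ (0≤^ Δ (0≤inv p)) (^-anti (<⇒≤ 0<p) p≤1 len)))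
      (≤-trans (≡⇒≤ (trans (*-assoc _ _ _) (cong (p ^ k *_) (*-comm _ _)))) (*-monoˡ (0≤^ k (<⇒≤ 0<p)) C₁-bound))))

  1≤r : ∀ v → 1ℚ ≤ r v
  1≤r v = ≤-÷ (0<deg v) (≤-trans (≡⇒≤ (*-identityˡ _)) (∑-ind≤ (λ u → edge G u v)))

  Z-lower : ∀ t → N G t * ib ≤ Z t
  Z-lower t = ≤-trans (≡⇒≤ (sym (∑-*ʳ ib _))) (∑-mono λ v → *-monoʳ (0≤inv _) (≤-trans (≡⇒≤ (sym (*-identityʳ _))) (*-monoˡ (0≤ind (cn G t v)) (1≤^ (length t) (1≤r v)))))

  M≤ : ∀ t v → length t ℕ.≤ Δ → M t v ≤ K * ib
  M≤ t v len = *-monoʳ (0≤inv _) (≤-trans (ind*≤′ (cn G t v) (0≤^ (length t) (0≤r v))) (K-bound v (length t) len))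

  e≤Δa : e ≤ ⟦ Δ ⟧ * ⟦ a ⟧
  e≤Δa = ≤-trans (∑-mono degA≤) (≡⇒≤ (trans (∑-const a ⟦ Δ ⟧) (*-comm _ _)))

  e*iΔ≤a : e * iΔ ≤ ⟦ a ⟧
  e*iΔ≤a = ÷-≤ 0<Δ (≤-trans e≤Δa (≡⇒≤ (*-comm _ _)))

  module Chosen (sel : Selected) where
    open Selected sel

    σ₀ : Fin a → Fin a
    σ₀ = v !_

    badX : Fin a → Bool
    badX x = anyF (λ y → edge J x y ∧ not (typ (v !! nb y)))

    U : List (Fin a)
    U = filterᵇ badX (allFin a)

    ⟦length-U⟧ : ⟦ length U ⟧ ≡ ∑ (λ x → ind (badX x))
    ⟦length-U⟧ = trans (sym (trans (∑L-const U 1ℚ) (*-identityʳ _))) (trans (∑L-filter badX (λ _ → 1ℚ)) (∑-cong λ x → *-identityʳ _))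

    0≤2/ν : 0ℚ ≤ 2ℚ * inv ν
    0≤2/ν = 0≤* 0≤2 (0≤inv _)

    0≤ξ : 0ℚ ≤ ξ
    0≤ξ = 0≤* 0≤2/ν (0≤* 0≤κ (<⇒≤ 0<ε₁))

    bads≤′ : bads v ≤ ξ * e
    bads≤′ = ≤-trans bads≤ (≡⇒≤ (lem (2ℚ * inv ν) κ e ε₁))
      where
      opaque
        unfolding _+_
        lem : ∀ s k e x → s * (k * (e * x)) ≡ s * (k * x) * e
        lem = solve-∀ ringℚ

    badX≤ : ∑ (λ x → ind (badX x)) ≤ ⟦ Δ ⟧ * ξ * e
    badX≤ =
      ∑ (λ x → ind (badX x)) ≤⟨ ∑-mono (λ x → ≤-trans (ind-anyF _) (∑-mono λ y → ≡⇒≤ (ind-∧ (edge J x y) _))) ⟩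
      ∑ (λ x → ∑ λ y → ind (edge J x y) * atyp (v !! nb y)) ≡⟨ trans (∑-swap _) (∑-cong λ y → ∑-*ʳ (atyp (v !! nb y)) _) ⟩≤
      ∑ (λ y → degB J y * atyp (v !! nb y)) ≤⟨ ∑-mono (λ y → *-monoʳ (0≤atyp _) (degB≤ y)) ⟩
      ∑ (λ y → ⟦ Δ ⟧ * atyp (v !! nb y)) ≡⟨ ∑-*ˡ ⟦ Δ ⟧ _ ⟩≤
      ⟦ Δ ⟧ * bads v ≤⟨ ≤-trans (*-monoˡ (0≤⟦⟧ Δ) bads≤′) (≡⇒≤ (sym (*-assoc _ _ _))) ⟩
      ⟦ Δ ⟧ * ξ * e ■

    -- `U` has at most `Δ ξ Δ a` vertices; the factor 2 adds their exchange partners.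
    dmax : ℚ
    dmax = 2ℚ * (⟦ Δ ⟧ * ξ * ⟦ Δ ⟧)
    Dmax : ℚ
    Dmax = dmax * ⟦ a ⟧
    -- Four times a bound for the mean weight near a vertex, so that Markov's inequality leaves at
    -- most a quarter of the vertices heavy.
    Kh : ℚ
    Kh = 4ℚ * m * (W * ia)
    Qmax : ℚ
    Qmax = ω * (e * (W * ia))

    0≤dmax : 0ℚ ≤ dmax
    0≤dmax = 0≤* 0≤2 (0≤* (0≤* (0≤⟦⟧ Δ) 0≤ξ) (0≤⟦⟧ Δ))

    forb≤ : ∀ u → ∑ (λ z → ind (forbidden typ σ₀ u z)) ≤ ⟦ Δ ⟧ * (2ℚ * ρ) * ⟦ a ⟧
    forb≤ u = ≤-trans (forbidden≤ v u) (≤-trans (*-monoˡ (0≤⟦⟧ Δ) (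
      VF.ℓ u v ≡⟨ sym (x+y-x (VF.μ u) (VF.ℓ u v)) ⟩≤
      VF.μ u + (VF.ℓ u v - VF.μ u) ≤⟨ +-mono μ≤ diff≤ ⟩
      ρ * ⟦ a ⟧ + ρ * ⟦ a ⟧ ■)) (≡⇒≤ (lem ⟦ Δ ⟧ ρ ⟦ a ⟧)))
      where
      opaque
        unfolding _+_
        lem : ∀ d r a → d * (r * a + r * a) ≡ d * ((1ℚ + 1ℚ) * r) * a
        lem = solve-∀ ringℚ
        lem₂ : ∀ i x e → e * (i * x) ≡ e * i * x
        lem₂ = solve-∀ ringℚ
        lem₃ : ∀ s a c e i x → s * (a * (c * (e * (i * x)))) ≡ s * (c * x) * (a * (e * i))
        lem₃ = solve-∀ ringℚ
        lem₄ : ∀ r a → r * r * (a * a) ≡ r * a * (r * a)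
        lem₄ = solve-∀ ringℚ
      μ≤ : VF.μ u ≤ ρ * ⟦ a ⟧
      μ≤ = ≤-trans (μF≤ u) (≤-trans (≡⇒≤ (lem₂ iΔ ε₁ e)) (≤-trans (*-mono (0≤* (<⇒≤ 0<e) (0≤inv _)) 0≤ρ e*iΔ≤a ε₁≤ρ) (≡⇒≤ (*-comm _ _))))
      diff≤ : VF.ℓ u v - VF.μ u ≤ ρ * ⟦ a ⟧
      diff≤ = square-≤ (0≤* 0≤ρ (0≤⟦⟧ a)) (≤-trans (f≤∑ {f = λ u → (VF.ℓ u v - VF.μ u) * (VF.ℓ u v - VF.μ u)} (λ u → 0≤square _) u) (≤-trans devF≤ (≤-trans (≡⇒≤ (lem₃ (2ℚ * inv ν) ⟦ a ⟧ C₂ e iΔ ε₁))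
        (≤-trans (*-mono (0≤* 0≤2/ν (0≤* (<⇒≤ 0<C₂) (<⇒≤ 0<ε₁))) (0≤* (0≤⟦⟧ a) (0≤⟦⟧ a)) devF-small (*-monoˡ (0≤⟦⟧ a) e*iΔ≤a)) (≡⇒≤ (lem₄ ρ ⟦ a ⟧))))))

    heavy≤ : ∑ (λ z → ind (not (∑ (λ x → ind (near z x) * hA (σ₀ x)) ≤ᵇ Kh))) ≤ inv 4ℚ * ⟦ a ⟧
    heavy≤ = *-cancelʳ 0<Kh (
      ∑ (λ z → ind (heavy z)) * Kh ≡⟨ sym (∑-*ʳ Kh _) ⟩≤
      ∑ (λ z → ind (heavy z) * Kh) ≤⟨ ∑-mono (λ z → ind*≤ (heavy z) (0≤load z) λ q → <⇒≤ (≤ᵇ⇒> (not≡true q))) ⟩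
      ∑ load ≡⟨ trans (∑-swap _) (∑-cong λ x → ∑-*ʳ (hA (σ₀ x)) _) ⟩≤
      ∑ (λ x → ∑ (λ z → ind (near z x)) * hA (σ₀ x)) ≤⟨ ∑-mono (λ x → *-monoʳ (0≤hA _) (≤-trans (∑-mono λ z → ind-mono {near z x} near-sym) (∑-near x))) ⟩
      ∑ (λ x → m * hA (σ₀ x)) ≡⟨ ∑-*ˡ m _ ⟩≤
      m * ∑ (λ x → hA (σ₀ x)) ≤⟨ *-monoˡ 0≤m (∑-injective inj 0≤hA) ⟩
      m * W ≡⟨ sym (trans (lem (inv 4ℚ) ⟦ a ⟧ 4ℚ m W ia) (trans (cong₂ (λ s t → s * t * (m * W)) (*-inv 0<4) (*-inv 0<a)) (trans (cong (_* (m * W)) (*-identityˡ 1ℚ)) (*-identityˡ _)))) ⟩≤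
      inv 4ℚ * ⟦ a ⟧ * Kh ■)
      where
      load : Fin a → ℚ
      load z = ∑ (λ x → ind (near z x) * hA (σ₀ x))
      0≤load : ∀ z → 0ℚ ≤ load z
      0≤load z = 0≤∑ λ x → 0≤* (0≤ind (near z x)) (0≤hA _)
      heavy : Fin a → Bool
      heavy z = not (load z ≤ᵇ Kh)
      0<Kh : 0ℚ < Kh
      0<Kh = 0<* (0<* 0<4 0<m) (0<* 0<W 0<ia)
      opaque
        unfolding _+_
        lem : ∀ i a f m w j → i * a * (f * m * (w * j)) ≡ f * i * (a * j) * (m * w)
        lem = solve-∀ ringℚ

    room′ : Dmax * m + ⟦ Δ ⟧ * (ε * ⟦ a ⟧) + ⟦ Δ ⟧ * (2ℚ * ρ) * ⟦ a ⟧ + inv 4ℚ * ⟦ a ⟧ < ⟦ a ⟧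
    room′ = subst₂ _<_ (lem dmax m ⟦ Δ ⟧ ε (2ℚ * ρ) (inv 4ℚ) ⟦ a ⟧) (*-identityˡ _) (*-mono-< 0<a room)
      where
      opaque
        unfolding _+_
        lem : ∀ d m D e r q a → (d * m + D * e + D * r + q) * a ≡ d * a * m + D * (e * a) + D * r * a + q * a
        lem = solve-∀ ringℚ

    module R = Repair J Δ bounded typ lev lev-⊆ lev-mono typ⇒lev (ε * ⟦ a ⟧) (0≤* 0≤ε (0≤⟦⟧ a)) ext σ₀ hA 0≤hA Kh (⟦ Δ ⟧ * (2ℚ * ρ) * ⟦ a ⟧) (inv 4ℚ * ⟦ a ⟧) Dmax Qmax forb≤ heavy≤ room′

    start : R.State U σ₀ badX
    start = record
      { injective = inj
      ; agree = λ _ _ → refl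
      ; U⊆D = λ x x∈ → proj₂ (∈-filterᵇ⁻ badX {allFin a} x∈)
      ; good = λ y → lev-mono (ℕ.m≤m+n Δ _) (good y (typ (v !! nb y)) refl)
      ; card≤ = ≤-trans (+-mono ≤-refl (≡⇒≤ ⟦length-U⟧)) (≤-trans (+-mono badX≤ badX≤) (≤-trans (≡⇒≤ (sym (2*≡ _))) (≤-trans (*-monoˡ 0≤2 (*-monoˡ (0≤* (0≤⟦⟧ Δ) 0≤ξ) e≤Δa)) (≡⇒≤ (lem₁ 2ℚ (⟦ Δ ⟧ * ξ) ⟦ Δ ⟧ ⟦ a ⟧)))))
      ; weight≤ = ≤-trans (+-mono (≤-trans near≤ badWeight≤) (*-monoʳ (0≤* (0≤* 0≤4 0≤m) (0≤* (<⇒≤ 0<W) (0≤inv _))) (≤-trans (≡⇒≤ ⟦length-U⟧) badX≤))) (≡⇒≤ (lem₂ (2ℚ * inv ν) e m κ ia W ⟦ Δ ⟧ ε₁ ξ 4ℚ))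
      }
      where
      opaque
        unfolding _+_
        lem₁ : ∀ t x d a → t * (x * (d * a)) ≡ t * (x * d) * a
        lem₁ = solve-∀ ringℚ
        lem₂ : ∀ s e m k i w d x z f → s * (e * (m * (k * (i * (w * (d * x)))))) + d * z * e * (f * m * (w * i)) ≡ (s * (m * (k * (d * x))) + d * z * (f * m)) * (e * (w * i))
        lem₂ = solve-∀ ringℚ
      good : ∀ y q → typ (v !! nb y) ≡ q → lev Δ (map σ₀ (R.rest U y)) ≡ true
      good y true ty = lev-⊆ incl (typ⇒lev (v !! nb y) (ℕ.≤-trans (ℕ.≤-reflexive (length-map σ₀ (nb y))) (length-nb≤ y)) ty)
        where
        incl : ∀ u → u ∈ map σ₀ (R.rest U y) → u ∈ v !! nb y
        incl u u∈ with x , x∈ , refl ← ∈-map⁻ σ₀ u∈ = ∈-map⁺ σ₀ (∈nb⁺ (proj₁ (R.∈rest⁻ {U} x∈)))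
      -- All neighbours of an atypical `y` lie in `U`, so nothing of its tuple is left to check.
      good y false ty = lev-⊆ {t = []} incl (typ⇒lev [] z≤n typ-[])
        where
        incl : ∀ u → u ∈ map σ₀ (R.rest U y) → u ∈ []
        incl u u∈ with x , x∈ , refl ← ∈-map⁻ σ₀ u∈ with ex , x∉ ← R.∈rest⁻ {U} x∈ =
          ⊥-elim (x∉ (∈-filterᵇ⁺ badX (∈-allFin x) (anyF⁺ {P = λ y → edge J x y ∧ not (typ (v !! nb y))} y (∧⁺ ex (cong not ty)))))
      near≤ : ∑ (λ z → ind (nearS badX z) * hA (σ₀ z)) ≤ badWeight v
      near≤ = ≤-trans (∑-mono pointwise) (≡⇒≤ (∑-swap (λ z y → ind (nearY y z) * (hA (v ! z) * atyp (v !! nb y)))))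
        where
        pointwise : ∀ z → ind (nearS badX z) * hA (σ₀ z) ≤ ∑ (λ y → ind (nearY y z) * (hA (v ! z) * atyp (v !! nb y)))
        pointwise z = ind*≤ (nearS badX z) (0≤∑ λ y → 0≤term y) λ q → found (nearS⁻ {badX} q)
          where
          0≤term : ∀ y → 0ℚ ≤ ind (nearY y z) * (hA (v ! z) * atyp (v !! nb y))
          0≤term y = 0≤* (0≤ind (nearY y z)) (0≤* (0≤hA _) (0≤atyp _))
          found : (∃ λ x → badX x ≡ true × near x z ≡ true) → hA (σ₀ z) ≤ ∑ (λ y → ind (nearY y z) * (hA (v ! z) * atyp (v !! nb y)))
          found (x , bx , nx) with y , q ← anyF⁻ {P = λ y → edge J x y ∧ not (typ (v !! nb y))} bx =
            ≤-trans (≡⇒≤ (sym (trans (cong₂ (λ s t → ind s * (hA (σ₀ z) * ind t)) (anyF⁺ {P = λ x → edge J x y ∧ near x z} x (∧⁺ (∧⁻ˡ q) nx)) (∧⁻ʳ {edge J x y} q)) (trans (*-identityˡ _) (*-identityʳ _)))))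
              (f≤∑ {f = λ y → ind (nearY y z) * (hA (v ! z) * atyp (v !! nb y))} 0≤term y)

    opaque
      repaired : ∃ λ σ′ → ∃ λ D′ → R.State [] σ′ D′ × (∀ x → badX x ≡ true → D′ x ≡ true)
      repaired = R.run U σ₀ badX (filterᵇ-unique badX (Unique.allFin⁺ a)) start

    module Final (σ : Fin a → Fin a) (D : Fin a → Bool) (state : R.State [] σ D) (bad⊆D : ∀ x → badX x ≡ true → D x ≡ true) where
      open R.State state using (injective; agree; good; card≤; weight≤)

      t : Fin b → List (Fin a)
      t y = map σ (nb y)

      length-t : ∀ y → length (t y) ℕ.≤ Δ
      length-t y = ℕ.≤-trans (ℕ.≤-reflexive (length-map σ (nb y))) (length-nb≤ y)

      lev-t : ∀ y → lev (Δ ℕ.+ Δ) (t y) ≡ true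
      lev-t y = lev-mono (ℕ.+-monoʳ-≤ Δ (ℕ.≤-trans (length-filterᵇ-≤ (allFin a) (λ z q → ∧⁻ˡ q)) (length-nb≤ y))) (lev-⊆ (map-⊆ σ λ x x∈ → R.∈rest⁺ {[]} (∈nb⁻ x∈) (λ ())) (good y))

      aff : Fin b → Bool
      aff y = anyF (λ x → edge J x y ∧ D x)

      aff⁺ : ∀ {x y} → edge J x y ≡ true → D x ≡ true → aff y ≡ true
      aff⁺ {x} {y} p q = anyF⁺ {P = λ x → edge J x y ∧ D x} x (∧⁺ p q)

      untouched : ∀ {y} → aff y ≡ false → ∀ {x} → x ∈ nb y → D x ≡ false
      untouched {y} na {x} x∈ = caseᵇ (D x) (λ q → ⊥-elim (true≢false (aff⁺ (∈nb⁻ x∈) q) na)) id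

      t≡ : ∀ y → aff y ≡ false → t y ≡ v !! nb y
      t≡ y na = lem (nb y) (λ {x} → untouched na {x})
        where
        lem : ∀ xs → (∀ {x} → x ∈ xs → D x ≡ false) → map σ xs ≡ map σ₀ xs
        lem [] q = refl
        lem (x ∷ xs) q = cong₂ _∷_ (agree x (q (here refl))) (lem xs (λ z → q (there z)))

      typ-t : ∀ y → aff y ≡ false → typ (t y) ≡ true
      typ-t y na = caseᵇ (typ (v !! nb y)) (λ q → trans (cong typ (t≡ y na)) q) (λ q → empty q (nb y) refl)
        where
        empty : typ (v !! nb y) ≡ false → ∀ xs → nb y ≡ xs → typ (t y) ≡ true
        empty q [] eq = trans (cong (λ l → typ (map σ l)) eq) typ-[]
        empty q (x ∷ xs) eq = ⊥-elim (true≢false (bad⊆D x (anyF⁺ {P = λ y → edge J x y ∧ not (typ (v !! nb y))} y (∧⁺ (∈nb⁻ x∈) (cong not q)))) (untouched na x∈))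
          where
          x∈ : x ∈ nb y
          x∈ = subst (x ∈_) (sym eq) (here refl)

      h₀ : ℚ
      h₀ = c₀ * inv 2ℚ

      0<h₀ : 0ℚ < h₀
      0<h₀ = 0<* 0<c₀ (0<inv 0<2)

      c₀≡ : c₀ ≡ h₀ + h₀
      c₀≡ = trans (sym (*-inv-cancel′ c₀ 0<2)) (trans (*-comm _ _) (2*≡ h₀))

      O : Fin b → Bool
      O u = not (VL.ℓ u v ≤ᵇ (1ℚ - h₀) * ⟦ b ⟧ * iK)

      -- Chebyshev: a column in `O` deviates by at least `g`, which is of order `b`, while `devL` is
      -- of order `b²`.
      ∑-O : ∑ (λ u → ind (O u)) ≤ Omax
      ∑-O = *-cancelʳ (0<* 0<g 0<g) (
        ∑ (λ u → ind (O u)) * (g * g) ≡⟨ sym (∑-*ʳ (g * g) _) ⟩≤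
        ∑ (λ u → ind (O u) * (g * g)) ≤⟨ ∑-mono (λ u → ind*≤ (O u) (0≤square _) λ q → over u (<⇒≤ (≤ᵇ⇒> (not≡true q)))) ⟩
        devL v ≤⟨ devL≤ ⟩
        2ℚ * inv ν * (⟦ b ⟧ * (C₂ * (e * iK))) ≤⟨ *-monoˡ 0≤2/ν (*-monoˡ (<⇒≤ 0<b) (*-monoˡ (<⇒≤ 0<C₂) (*-monoʳ (0≤inv _) (≤-trans e≤Δa (*-monoˡ (0≤⟦⟧ Δ) a≤b))))) ⟩
        2ℚ * inv ν * (⟦ b ⟧ * (C₂ * (⟦ Δ ⟧ * ⟦ b ⟧ * iK))) ≡⟨ trans (lem₁ (2ℚ * inv ν) ⟦ b ⟧ C₂ ⟦ Δ ⟧ iK) (cong (_* (⟦ b ⟧ * ⟦ b ⟧ * iK)) (sym (*-inv-cancel (2ℚ * inv ν * (C₂ * ⟦ Δ ⟧)) 0<K))) ⟩≤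
        2ℚ * inv ν * (C₂ * ⟦ Δ ⟧) * K * iK * (⟦ b ⟧ * ⟦ b ⟧ * iK) ≤⟨ *-monoʳ (0≤* (0≤* (<⇒≤ 0<b) (<⇒≤ 0<b)) (0≤inv _)) (*-monoʳ (0≤inv _) Omax-bound) ⟩
        Omax * (h₀ * h₀) * iK * (⟦ b ⟧ * ⟦ b ⟧ * iK) ≡⟨ lem₂ Omax h₀ iK ⟦ b ⟧ ⟩≤
        Omax * (g * g) ■)
        where
        g = h₀ * (⟦ b ⟧ * iK)
        0<g : 0ℚ < g
        0<g = 0<* 0<h₀ (0<* 0<b (0<inv 0<K))
        opaque
          unfolding _+_
          lem₁ : ∀ s b c d k → s * (b * (c * (d * b * k))) ≡ s * (c * d) * (b * b * k)
          lem₁ = solve-∀ ringℚ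
          lem₂ : ∀ o h k b → o * (h * h) * k * (b * b * k) ≡ o * (h * (b * k) * (h * (b * k)))
          lem₂ = solve-∀ ringℚ
          lem₃ : ∀ h b k → (1ℚ - h) * b * k ≡ h * (b * k) + (1ℚ - (h + h)) * b * k
          lem₃ = solve-∀ ringℚ
        over : ∀ u → (1ℚ - h₀) * ⟦ b ⟧ * iK ≤ VL.ℓ u v → g * g ≤ (VL.ℓ u v - VL.μ u) * (VL.ℓ u v - VL.μ u)
        over u q = *-mono (<⇒≤ 0<g) (≤-trans (<⇒≤ 0<g) g≤) g≤ g≤
          where
          g≤ : g ≤ VL.ℓ u v - VL.μ u
          g≤ = ≤-trans (≡⇒≤ (sym (+-cancelʳ′ g (VL.μ u)))) (+-mono (≤-trans (+-mono ≤-refl (≤-trans (≡⇒≤ (μL≡ u)) (*-monoʳ (0≤inv _) (≤-trans few-active (≡⇒≤ (cong (λ z → (1ℚ - z) * ⟦ b ⟧) c₀≡)))))) (≤-trans (≡⇒≤ (sym (lem₃ h₀ ⟦ b ⟧ iK))) q)) ≤-refl)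

      z : Fin b → ℚ
      z y = ∑ λ u → ind (not (O u)) * M (t y) u

      -- The discarded columns take from a row at most `Omax` times the largest entry, `K / b`.
      z-lower : ∀ y {x o} → x + o ≤ Z (t y) → Omax * (K * ib) ≤ o → x ≤ z y
      z-lower y {x} {o} le small = ≤-trans (≡⇒≤ (sym (+-cancelʳ′ x o))) (-≤⇒ (≤-trans le (≤-trans (≤-trans (∑-mono λ u → split (O u) u) (≡⇒≤ (∑-+ _ _))) (+-mono ≤-refl (≤-trans (≡⇒≤ (∑-*ʳ (K * ib) _)) (≤-trans (*-monoʳ (0≤* (<⇒≤ 0<K) (0≤inv _)) ∑-O) small))))))
        where
        split : ∀ q u → M (t y) u ≤ ind (not q) * M (t y) u + ind q * (K * ib)
        split true u = ≤-trans (M≤ (t y) u (length-t y)) (≤-trans (≡⇒≤ (sym (*-identityˡ _))) (y≤x+y (≡⇒≤ (sym (*-zeroˡ _)))))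
        split false u = ≤-trans (≡⇒≤ (sym (*-identityˡ _))) (x≤x+y (≡⇒≤ (sym (*-zeroˡ _))))

      z-unaff : ∀ y → aff y ≡ false → ζ₁ ≤ z y
      z-unaff y na = z-lower y {o = C₁ * η} (≤-trans (≡⇒≤ (lem (C₁ * η))) (Z-typical (t y) (length-t y) (typ-t y na))) Omax-small₁
        where
        opaque
          unfolding _+_
          lem : ∀ s → 1ℚ - (s + s) + s ≡ 1ℚ - s
          lem = solve-∀ ringℚ

      z-aff : ∀ y → ζ₂ ≤ z y
      z-aff y = z-lower y {o = ζ₂} (≤-trans (≡⇒≤ (trans (sym (2*≡ ζ₂)) (trans (*-comm 2ℚ ζ₂) (*-inv-cancel′ ζ 0<2)))) (≤-trans (≤-÷ 0<b (lev-N (t y) (length-t y) (lev-t y))) (Z-lower (t y)))) Omax-small₂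

      0<ζ₂ : 0ℚ < ζ₂
      0<ζ₂ = 0<* 0<ζ (0<inv 0<2)

      0<z : ∀ y → 0ℚ < z y
      0<z y = ℚ.<-≤-trans 0<ζ₂ (z-aff y)

      M′ : Fin b → Fin b → ℚ
      M′ y u = ind (not (O u)) * M (t y) u * inv (z y)

      0≤M′ : ∀ y u → 0ℚ ≤ M′ y u
      0≤M′ y u = 0≤* (0≤* (0≤ind (not (O u))) (0≤M (t y) u)) (0≤inv _)

      rows : ∀ y → ∑ (M′ y) ≡ 1ℚ
      rows y = trans (∑-*ʳ (inv (z y)) _) (*-inv (0<z y))

      M′-unaff : ∀ y u → aff y ≡ false → M′ y u ≤ inv ζ₁ * (ind (not (O u)) * M (v !! nb y) u)
      M′-unaff y u na = ≤-trans (*-monoˡ (0≤* (0≤ind (not (O u))) (0≤M (t y) u)) (inv-anti 0<ζ₁ (z-unaff y na))) (≡⇒≤ (trans (*-comm _ _) (cong (λ l → inv ζ₁ * (ind (not (O u)) * M l u)) (t≡ y na))))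

      M′-aff : ∀ y u → M′ y u ≤ inv ζ₂ * M (t y) u
      M′-aff y u = ≤-trans (*-mono (0≤* (0≤ind (not (O u))) (0≤M (t y) u)) (0≤inv _) (ind*≤′ (not (O u)) (0≤M (t y) u)) (inv-anti 0<ζ₂ (z-aff y))) (≡⇒≤ (*-comm _ _))

      -- Rows untouched by the repairs keep their entries up to the factor `1 / ζ₁`, close to 1; for
      -- the others only the large constant `1 / ζ₂` is left, which their small number makes
      -- affordable.
      M′-split : ∀ y u → M′ y u ≤ inv ζ₁ * (ind (not (O u)) * M (v !! nb y) u) + ind (aff y) * (inv ζ₂ * M (t y) u)
      M′-split y u = cases (aff y) refl
        where
        cases : ∀ q → aff y ≡ q → M′ y u ≤ inv ζ₁ * (ind (not (O u)) * M (v !! nb y) u) + ind q * (inv ζ₂ * M (t y) u)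
        cases false q = ≤-trans (M′-unaff y u q) (x≤x+y (≡⇒≤ (sym (*-zeroˡ _))))
        cases true q = ≤-trans (M′-aff y u) (≤-trans (≡⇒≤ (sym (*-identityˡ _))) (y≤x+y (0≤* (0≤inv _) (0≤* (0≤ind (not (O u))) (0≤M (v !! nb y) u)))))

      ∑-aff : ∑ (λ y → ind (aff y)) ≤ ⟦ Δ ⟧ * Dmax
      ∑-aff =
        ∑ (λ y → ind (aff y)) ≤⟨ ∑-mono (λ y → ≤-trans (ind-anyF _) (∑-mono λ x → ≡⇒≤ (ind-∧ (edge J x y) (D x)))) ⟩
        ∑ (λ y → ∑ λ x → ind (edge J x y) * ind (D x)) ≡⟨ trans (∑-swap _) (∑-cong λ x → ∑-*ʳ (ind (D x)) _) ⟩≤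
        ∑ (λ x → degA J x * ind (D x)) ≤⟨ ∑-mono (λ x → *-monoʳ (0≤ind (D x)) (degA≤ x)) ⟩
        ∑ (λ x → ⟦ Δ ⟧ * ind (D x)) ≡⟨ ∑-*ˡ ⟦ Δ ⟧ _ ⟩≤
        ⟦ Δ ⟧ * ∑ (λ x → ind (D x)) ≤⟨ *-monoˡ (0≤⟦⟧ Δ) (≤-trans (x≤x+y (0≤⟦⟧ 0)) card≤) ⟩
        ⟦ Δ ⟧ * Dmax ■

      -- On active rows the entries of M are those of fL up to the scaling K / b.
      M-fL : ∀ s u → ind (nonempty s) * M s u ≡ K * ib * fL u s
      M-fL s u = trans (sym (*-identityˡ _)) (trans (cong (_* (ind (nonempty s) * M s u)) (sym (*-inv 0<K))) (lem K iK (ind (nonempty s)) (ind (cn G s u)) (r u ^ length s) ib))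
        where
        opaque
          unfolding _+_
          lem : ∀ K k n i x b → K * k * (n * (i * x * b)) ≡ K * b * (n * k * (i * x))
          lem = solve-∀ ringℚ

      nonempty-map : ∀ y → nonempty (v !! nb y) ≡ active y
      nonempty-map y = nonempty-length _ _ (length-map σ₀ (nb y))

      -- Untouched rows load a retained column by at most `(1 - c₀ / 2) / ζ₁`. The gap `c₀ / 2`, due
      -- to the free part of B, pays for the factor `1 / ζ₁` and for the affected rows.
      cols : ∀ u → ∑ (λ y → ind (active y) * M′ y u) ≤ 1ℚ
      cols u = caseᵇ (O u) zeros bound
        where
        opaque
          unfolding _+_
          lem₀ : ∀ c m i → c * (0ℚ * m * i) ≡ 0ℚ
          lem₀ = solve-∀ ringℚ
          lem₁ : ∀ c i m x → c * (i * m + x) ≡ i * (c * m) + c * x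
          lem₁ = solve-∀ ringℚ
          lem₂ : ∀ i K k h b j → i * (K * k * (h * b * j)) ≡ i * h * (K * j * (b * k))
          lem₂ = solve-∀ ringℚ
          lem₃ : ∀ d x b i K k → d * (x * b) * (i * (K * k)) ≡ i * (K * (d * x)) * (b * k)
          lem₃ = solve-∀ ringℚ
        zeros : O u ≡ true → ∑ (λ y → ind (active y) * M′ y u) ≤ 1ℚ
        zeros q = ≤-trans (≡⇒≤ (trans (∑-cong λ y → trans (cong (λ o → ind (active y) * (ind (not o) * M (t y) u * inv (z y))) q) (lem₀ (ind (active y)) (M (t y) u) (inv (z y)))) (∑-0 {b}))) 0≤1
        bound : O u ≡ false → ∑ (λ y → ind (active y) * M′ y u) ≤ 1ℚ
        bound q =
          ∑ (λ y → ind (active y) * M′ y u) ≤⟨ ∑-mono (λ y → ≤-trans (*-monoˡ (0≤ind (active y)) (≤-trans (M′-split y u) (+-mono (*-monoˡ (0≤inv _) (ind*≤′ (not (O u)) (0≤M (v !! nb y) u))) (*-monoˡ (0≤ind (aff y)) (*-monoˡ (0≤inv _) (M≤ (t y) u (length-t y))))))) (≤-trans (≡⇒≤ (lem₁ (ind (active y)) (inv ζ₁) (M (v !! nb y) u) (ind (aff y) * (inv ζ₂ * (K * ib))))) (+-mono (≡⇒≤ (cong (inv ζ₁ *_) (trans (cong (λ o → ind o * M (v !! nb y) u) (sym (nonempty-map y))) (M-fL (v !! nb y) u)))) (ind*≤′ (active y) (0≤* (0≤ind (aff y)) (0≤* (0≤inv _) (0≤* (<⇒≤ 0<K) (0≤inv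 _)))))))) ⟩
          ∑ (λ y → inv ζ₁ * (K * ib * fL u (v !! nb y)) + ind (aff y) * (inv ζ₂ * (K * ib))) ≡⟨ trans (∑-+ _ _) (cong₂ _+_ (trans (∑-*ˡ (inv ζ₁) _) (cong (inv ζ₁ *_) (∑-*ˡ (K * ib) _))) (∑-*ʳ (inv ζ₂ * (K * ib)) _)) ⟩≤
          inv ζ₁ * (K * ib * VL.ℓ u v) + ∑ (λ y → ind (aff y)) * (inv ζ₂ * (K * ib)) ≤⟨ +-mono (*-monoˡ (0≤inv _) (*-monoˡ (0≤* (<⇒≤ 0<K) (0≤inv _)) (≤ᵇ⇒≤ (not-false q)))) (*-monoʳ (0≤* (0≤inv _) (0≤* (<⇒≤ 0<K) (0≤inv _))) (≤-trans ∑-aff (*-monoˡ (0≤⟦⟧ Δ) (*-monoˡ 0≤dmax a≤b)))) ⟩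
          inv ζ₁ * (K * ib * ((1ℚ - h₀) * ⟦ b ⟧ * iK)) + ⟦ Δ ⟧ * (dmax * ⟦ b ⟧) * (inv ζ₂ * (K * ib)) ≡⟨ cong₂ _+_ (trans (lem₂ (inv ζ₁) K ib (1ℚ - h₀) ⟦ b ⟧ iK) (trans (cong₂ (λ s t → inv ζ₁ * (1ℚ - h₀) * (s * t)) (*-inv 0<K) (*-inv 0<b)) (trans (cong (inv ζ₁ * (1ℚ - h₀) *_) (*-identityˡ 1ℚ)) (*-identityʳ _)))) (trans (lem₃ ⟦ Δ ⟧ dmax ⟦ b ⟧ (inv ζ₂) K ib) (trans (cong (inv ζ₂ * (K * (⟦ Δ ⟧ * dmax)) *_) (*-inv 0<b)) (*-identityʳ _))) ⟩≤
          inv ζ₁ * (1ℚ - h₀) + inv ζ₂ * (K * (⟦ Δ ⟧ * dmax)) ≤⟨ columns ⟩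
          1ℚ ■

      few : ∑ (λ y → ind (active y)) < ⟦ b ⟧
      few = ℚ.≤-<-trans few-active (subst ((1ℚ - c₀) * ⟦ b ⟧ <_) (*-identityˡ _) (*-mono-< 0<b (x-y<x 0<c₀)))

      price-active : ∀ y u → price (t y) u ≡ ind (active y) * price (t y) u
      price-active y u = lem (nb y)
        where
        lem : ∀ xs → price (map σ xs) u ≡ ind (nonempty xs) * price (map σ xs) u
        lem [] = sym (*-zeroˡ _)
        lem (x ∷ xs) = sym (*-identityˡ _)

      ∑-price : ∀ l → ∑ (price l) ≡ ∑L l hA
      ∑-price l = sym (∑L-∑ l w)

      row-cost : ∀ y → ∑ (λ u → M′ y u * price (t y) u) ≤ inv ζ₁ * c (v !! nb y) + ind (aff y) * (inv ζ₂ * (K * ib * ∑L (t y) hA))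
      row-cost y = cases (aff y) refl
        where
        cases : ∀ q → aff y ≡ q → ∑ (λ u → M′ y u * price (t y) u) ≤ inv ζ₁ * c (v !! nb y) + ind q * (inv ζ₂ * (K * ib * ∑L (t y) hA))
        cases false na = ≤-trans (∑-mono λ u → ≤-trans (*-monoʳ (0≤price (t y) u) (≤-trans (M′-unaff y u na) (*-monoˡ (0≤inv _) (ind*≤′ (not (O u)) (0≤M (v !! nb y) u))))) (≡⇒≤ (trans (*-assoc _ _ _) (cong (λ l → inv ζ₁ * (M (v !! nb y) u * price l u)) (t≡ y na)))))
          (≤-trans (≡⇒≤ (∑-*ˡ (inv ζ₁) _)) (x≤x+y (≡⇒≤ (sym (*-zeroˡ _)))))
        cases true _ = ≤-trans (∑-mono λ u → ≤-trans (*-monoʳ (0≤price (t y) u) (≤-trans (M′-aff y u) (*-monoˡ (0≤inv _) (M≤ (t y) u (length-t y))))) (≡⇒≤ (*-assoc _ _ _)))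
          (≤-trans (≡⇒≤ (trans (∑-*ˡ (inv ζ₂) _) (cong (inv ζ₂ *_) (trans (∑-*ˡ (K * ib) _) (cong (K * ib *_) (∑-price (t y))))))) (≤-trans (≡⇒≤ (sym (*-identityˡ _))) (y≤x+y (0≤* (0≤inv _) (0≤c (v !! nb y))))))

      -- Every vertex in the neighbourhood of an affected row is near `D`, so the weight bounded
      -- during the repairs covers it; it is counted at most `Δ` times.
      aff-weight : ∑ (λ y → ind (aff y) * ∑L (t y) hA) ≤ ⟦ Δ ⟧ * Qmax
      aff-weight =
        ∑ (λ y → ind (aff y) * ∑L (t y) hA) ≡⟨ ∑-cong (λ y → trans (cong (ind (aff y) *_) (trans (∑L-map σ (nb y) hA) (∑L-nb y (λ x → hA (σ x))))) (sym (∑-*ˡ (ind (aff y)) _))) ⟩≤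
        ∑ (λ y → ∑ λ x → ind (aff y) * (ind (edge J x y) * hA (σ x))) ≤⟨ ∑-mono (λ y → ∑-mono λ x → pointwise x y) ⟩
        ∑ (λ y → ∑ λ x → ind (edge J x y) * (ind (nearS D x) * hA (σ x))) ≡⟨ trans (∑-swap _) (∑-cong λ x → ∑-*ʳ (ind (nearS D x) * hA (σ x)) _) ⟩≤
        ∑ (λ x → degA J x * (ind (nearS D x) * hA (σ x))) ≤⟨ ∑-mono (λ x → *-monoʳ (0≤* (0≤ind (nearS D x)) (0≤hA _)) (degA≤ x)) ⟩
        ∑ (λ x → ⟦ Δ ⟧ * (ind (nearS D x) * hA (σ x))) ≤⟨ ≤-trans (≡⇒≤ (∑-*ˡ ⟦ Δ ⟧ _)) (*-monoˡ (0≤⟦⟧ Δ) (≤-trans (x≤x+y (0≤* (0≤⟦⟧ 0) (0≤* (0≤* 0≤4 0≤m) (0≤* (<⇒≤ 0<W) (0≤inv _))))) weight≤)) ⟩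
        ⟦ Δ ⟧ * Qmax ■
        where
        pointwise : ∀ x y → ind (aff y) * (ind (edge J x y) * hA (σ x)) ≤ ind (edge J x y) * (ind (nearS D x) * hA (σ x))
        pointwise x y = ≤-trans (≡⇒≤ (*-swap _ _ _)) (ind-mono-* (edge J x y) λ ex → *-monoʳ (0≤hA _) (ind-mono {aff y} λ q → near-aff ex (anyF⁻ {P = λ x → edge J x y ∧ D x} q)))
          where
          near-aff : edge J x y ≡ true → (∃ λ x′ → (edge J x′ y ∧ D x′) ≡ true) → nearS D x ≡ true
          near-aff ex (x′ , q) = nearS⁺ {D} (∧⁻ʳ {edge J x′ y} q) (near⁺ (∧⁻ˡ q) ex)

      unit : ℚ
      unit = inv p * (e * (W * (ia * ib)))

      1≤inv-p : 1ℚ ≤ inv p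
      1≤inv-p = ≤-trans (≤-÷ 0<p (≤-trans (≡⇒≤ (*-identityˡ p)) p≤1)) (≡⇒≤ (*-identityˡ _))

      total-cost : ∑ (λ y → ind (active y) * ∑ (λ u → M′ y u * price (t y) u)) ≤ (1ℚ + C₅ * η) * unit
      total-cost =
        ∑ (λ y → ind (active y) * ∑ (λ u → M′ y u * price (t y) u)) ≤⟨ ∑-mono (λ y → ≤-trans (ind*≤′ (active y) (0≤∑ λ u → 0≤* (0≤M′ y u) (0≤price (t y) u))) (row-cost y)) ⟩
        ∑ (λ y → inv ζ₁ * c (v !! nb y) + ind (aff y) * (inv ζ₂ * (K * ib * ∑L (t y) hA))) ≡⟨ trans (∑-+ _ _) (cong₂ _+_ (∑-*ˡ (inv ζ₁) _) (trans (∑-cong λ y → lem₁ (ind (aff y)) (inv ζ₂) (K * ib) (∑L (t y) hA)) (∑-*ˡ (inv ζ₂ * (K * ib)) _))) ⟩≤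
        inv ζ₁ * cost v + inv ζ₂ * (K * ib) * ∑ (λ y → ind (aff y) * ∑L (t y) hA) ≤⟨ +-mono (*-monoˡ (0≤inv _) cost≤) (*-monoˡ (0≤* (0≤inv _) (0≤* (<⇒≤ 0<K) (0≤inv _))) aff-weight) ⟩
        inv ζ₁ * ((1ℚ + 4ℚ * ν) * (κ * (e * β))) + inv ζ₂ * (K * ib) * (⟦ Δ ⟧ * Qmax) ≡⟨ cong₂ _+_ (trans (cong (λ q → inv ζ₁ * ((1ℚ + 4ℚ * ν) * (κ * (e * ((1ℚ + η) * q * ib * W))))) (inv-* 0<p 0<a)) (lem₂ (inv ζ₁) (1ℚ + 4ℚ * ν) κ e (1ℚ + η) (inv p) ia ib W)) (lem₃ (inv ζ₂) K ib ⟦ Δ ⟧ ω e W ia) ⟩≤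
        inv ζ₁ * ((1ℚ + 4ℚ * ν) * (κ * (1ℚ + η))) * unit + inv ζ₂ * (K * (⟦ Δ ⟧ * ω)) * (1ℚ * (e * (W * (ia * ib)))) ≤⟨ +-mono ≤-refl (*-monoˡ (0≤* (0≤inv _) (0≤* (<⇒≤ 0<K) (0≤* (0≤⟦⟧ Δ) 0≤ω))) (*-monoʳ (0≤* (<⇒≤ 0<e) (0≤* (<⇒≤ 0<W) (0≤* (0≤inv _) (0≤inv _)))) 1≤inv-p)) ⟩
        inv ζ₁ * ((1ℚ + 4ℚ * ν) * (κ * (1ℚ + η))) * unit + inv ζ₂ * (K * (⟦ Δ ⟧ * ω)) * unit ≡⟨ sym (*-distribʳ-+ _ _ _) ⟩≤
        (inv ζ₁ * ((1ℚ + 4ℚ * ν) * (κ * (1ℚ + η))) + inv ζ₂ * (K * (⟦ Δ ⟧ * ω))) * unit ≤⟨ *-monoʳ (0≤* (0≤inv p) (0≤* (<⇒≤ 0<e) (0≤* (<⇒≤ 0<W) (0≤* (0≤inv _) (0≤inv _))))) total-bound ⟩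
        (1ℚ + C₅ * η) * unit ■
        where
        0≤ω : 0ℚ ≤ ω
        0≤ω = 0≤+ (0≤* 0≤2/ν (0≤* 0≤m (0≤* 0≤κ (0≤* (0≤⟦⟧ Δ) (<⇒≤ 0<ε₁))))) (0≤* (0≤* (0≤⟦⟧ Δ) 0≤ξ) (0≤* 0≤4 0≤m))
        opaque
          unfolding _+_
          lem₁ : ∀ i z k s → i * (z * (k * s)) ≡ z * k * (i * s)
          lem₁ = solve-∀ ringℚ
          lem₂ : ∀ z n k e h q i j w → z * (n * (k * (e * (h * (q * i) * j * w)))) ≡ z * (n * (k * h)) * (q * (e * (w * (i * j))))
          lem₂ = solve-∀ ringℚ
          lem₃ : ∀ z k j d o e w i → z * (k * j) * (d * (o * (e * (w * i)))) ≡ z * (k * (d * o)) * (1ℚ * (e * (w * (i * j))))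
          lem₃ = solve-∀ ringℚ

      embedding : Embedding G J w ((1ℚ + C₅ * η) * unit)
      embedding = conclude (assignment M′ (λ y u → price (t y) u) active 0≤M′ (λ y u → 0≤price (t y) u) (λ y _ → rows y) cols few)
        where
        conclude : (∃ λ τ → Injective _≡_ _≡_ τ × (∀ y → active y ≡ true → 0ℚ < M′ y (τ y)) × ∑ (λ y → ind (active y) * price (t y) (τ y)) ≤ ∑ (λ y → ind (active y) * ∑ (λ u → M′ y u * price (t y) u))) → Embedding G J w ((1ℚ + C₅ * η) * unit)
        conclude (τ , inj-τ , pos , cheap) = record
          { σ = σ ; τ = τ ; σ-injective = injective ; τ-injective = inj-τ
          ; edges-to-edges = to-edge
          ; weight≤ = ≤-trans (≡⇒≤ (∑-cong λ y → trans (sym (trans (∑L-map σ (nb y) (λ u → w u (τ y))) (∑L-nb y (λ x → w (σ x) (τ y))))) (price-active y (τ y)))) (≤-trans cheap total-cost)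
          }
          where
          common : ∀ y → active y ≡ true → cn G (t y) (τ y) ≡ true
          common y ay = caseᵇ (cn G (t y) (τ y)) id λ q → ⊥-elim (ℚ.<-irrefl refl (subst (0ℚ <_) (zero′ q) (pos y ay)))
            where
            zero′ : cn G (t y) (τ y) ≡ false → M′ y (τ y) ≡ 0ℚ
            zero′ q = trans (cong (λ s → ind (not (O (τ y))) * (ind s * r (τ y) ^ length (t y) * ib) * inv (z y)) q) (lem (ind (not (O (τ y)))) (r (τ y) ^ length (t y)) ib (inv (z y)))
              where
              opaque
                unfolding _+_
                lem : ∀ i x j k → i * (0ℚ * x * j) * k ≡ 0ℚ
                lem = solve-∀ ringℚ
          to-edge : ∀ x y → edge J x y ≡ true → edge G (σ x) (τ y) ≡ true
          to-edge x y ex = cn⁻ G {t y} (common y (∈⇒nonempty (∈nb⁺ ex))) (∈-map⁺ σ (∈nb⁺ ex))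
            where
            ∈⇒nonempty : ∀ {x xs} → x ∈ xs → nonempty xs ≡ true
            ∈⇒nonempty (here _) = refl
            ∈⇒nonempty (there _) = refl

    embedding : Embedding G J w ((1ℚ + C₅ * η) * (inv p * (e * (W * (ia * ib)))))
    embedding = Final.embedding (proj₁ repaired) (proj₁ (proj₂ repaired)) (proj₁ (proj₂ (proj₂ repaired))) (proj₂ (proj₂ (proj₂ repaired)))

  embedding : Embedding G J w ((1ℚ + C₅ * η) * (inv p * (e * (W * (ia * ib)))))
  embedding = Chosen.embedding selected

-- The potential function

-- Here s is the proportion of the statistic that is lost and θ the proportion of the edges of the host.
module Ratio (Λ k : ℕ) {s θ δ : ℚ} (0≤s : 0ℚ ≤ s) (s<1 : s < 1ℚ) (0≤θ : 0ℚ ≤ θ) (θ≤1 : θ ≤ 1ℚ) (δ≤1 : δ ≤ 1ℚ)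
  (2Λs≤δ : 2ℚ * (⟦ Λ ⟧ * s) ≤ δ) (Λkθ≤δ : ⟦ Λ ⟧ * (⟦ k ⟧ * θ) ≤ δ) where

  α β A : ℚ
  α = ⟦ Λ ⟧ * s
  β = ⟦ Λ ⟧ * (⟦ k ⟧ * θ)
  A = ((1ℚ - θ) ^ k * inv (1ℚ - s)) ^ Λ

  0≤α : 0ℚ ≤ α
  0≤α = 0≤* (0≤⟦⟧ Λ) 0≤s
  0≤β : 0ℚ ≤ β
  0≤β = 0≤* (0≤⟦⟧ Λ) (0≤* (0≤⟦⟧ k) 0≤θ)

  α+α≤δ : α + α ≤ δ
  α+α≤δ = ≤-trans (≡⇒≤ (sym (2*≡ α))) 2Λs≤δ

  α<1 : α < 1ℚ
  α<1 = ℚ.≰⇒> λ q → ≤⇒≯ (≤-trans (+-mono q q) (≤-trans α+α≤δ δ≤1)) (subst (_< 1ℚ + 1ℚ) (+-identityʳ 1ℚ) (+-mono-≤-< (≤-refl {1ℚ}) 0<1))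

  0≤A : 0ℚ ≤ A
  0≤A = 0≤^ Λ (0≤* (0≤^ k (0≤- θ≤1)) (0≤inv _))

  -- Bernoulli bounds `1 - α` and `1 + β` by `(1 - s) ^ Λ` and `((1 + θ) ^ k) ^ Λ`. The first
  -- cancels against `A`, and the second is absorbed because `(1 - θ) (1 + θ) ≤ 1`.
  A-bound : A * ((1ℚ - α) * (1ℚ + β)) ≤ 1ℚ
  A-bound =
    A * ((1ℚ - α) * (1ℚ + β)) ≤⟨ *-monoˡ 0≤A (*-mono (<⇒≤ (0<- α<1)) (0≤^ Λ (0≤^ k (0≤+ 0≤1 0≤θ))) (bernoulli⁻ Λ (<⇒≤ s<1)) (≤-trans (+-mono ≤-refl (*-monoˡ (0≤⟦⟧ Λ) (≤-by _ (≤-trans (0≤- (bernoulli⁺ k 0≤θ)) ≤-refl) (lem₀ ((1ℚ + θ) ^ k) (⟦ k ⟧ * θ))))) (≤-trans (bernoulli⁺ Λ (0≤- (1≤^ k (x≤x+y 0≤θ)))) (≡⇒≤ (cong (_^ Λ) (lem₁ ((1ℚ + θ) ^ k))))))) ⟩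
    A * ((1ℚ - s) ^ Λ * ((1ℚ + θ) ^ k) ^ Λ) ≡⟨ trans (cong (A *_) (sym (^-distrib-* (1ℚ - s) ((1ℚ + θ) ^ k) Λ))) (sym (^-distrib-* _ _ Λ)) ⟩≤
    ((1ℚ - θ) ^ k * inv (1ℚ - s) * ((1ℚ - s) * (1ℚ + θ) ^ k)) ^ Λ ≤⟨ ^-≤1 Λ (0≤* (0≤* (0≤^ k (0≤- θ≤1)) (0≤inv _)) (0≤* (<⇒≤ (0<- s<1)) (0≤^ k (0≤+ 0≤1 0≤θ)))) inner ⟩
    1ℚ ■
    where
    opaque
      unfolding _+_
      lem₀ : ∀ x y → x - 1ℚ ≡ y + (x - (1ℚ + y))
      lem₀ = solve-∀ ringℚ
      lem₁ : ∀ x → 1ℚ + (x - 1ℚ) ≡ x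
      lem₁ = solve-∀ ringℚ
      lem₂ : ∀ x i s y → x * i * (s * y) ≡ s * i * (x * y)
      lem₂ = solve-∀ ringℚ
      lem₃ : ∀ θ → 1ℚ ≡ (1ℚ - θ) * (1ℚ + θ) + θ * θ
      lem₃ = solve-∀ ringℚ
    inner : (1ℚ - θ) ^ k * inv (1ℚ - s) * ((1ℚ - s) * (1ℚ + θ) ^ k) ≤ 1ℚ
    inner = ≤-trans (≡⇒≤ (trans (lem₂ _ _ _ _) (trans (cong (_* ((1ℚ - θ) ^ k * (1ℚ + θ) ^ k)) (*-inv (0<- s<1))) (trans (*-identityˡ _) (sym (^-distrib-* (1ℚ - θ) (1ℚ + θ) k))))))
      (^-≤1 k (0≤* (0≤- θ≤1) (0≤+ 0≤1 0≤θ)) (≤-by (θ * θ) (0≤square θ) (lem₃ θ)))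

  0≤δ : 0ℚ ≤ δ
  0≤δ = ≤-trans 0≤β Λkθ≤δ

  -- Linearises the factor by which a summand of the potential changes, with relative error `δ` in
  -- either term; this is what forces `Λ` times a single loss to be small.
  ratio : A ≤ 1ℚ + (1ℚ + δ) * α - (1ℚ - δ) * β
  ratio = *-cancelʳ (0<* (0<- α<1) (0<+ 0<1 0≤β)) (≤-trans A-bound (≤-by _
    (0≤+ (0≤+ (0≤* 0≤α (0≤- 1+δ)) (0≤* 0≤β (0≤- 1-δ))) (0≤* (0≤* 0≤α 0≤β) (0≤+ (0≤- (≤-trans 1+δ δ≤1)) (0≤* (0≤- δ≤1) 0≤β))))
    (lem α β δ)))
    where
    opaque
      unfolding _+_
      lem : ∀ α β δ → (1ℚ + (1ℚ + δ) * α - (1ℚ - δ) * β) * ((1ℚ - α) * (1ℚ + β)) ≡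
        1ℚ + (α * (δ - (1ℚ + δ) * α) + β * (δ - (1ℚ - δ) * β) + α * β * ((1ℚ - (1ℚ + δ) * α) + (1ℚ - δ) * β))
      lem = solve-∀ ringℚ
      lem₂ : ∀ α δ → α + α ≡ (1ℚ + δ) * α + (1ℚ - δ) * α
      lem₂ = solve-∀ ringℚ
      lem₃ : ∀ β δ → β ≡ (1ℚ - δ) * β + δ * β
      lem₃ = solve-∀ ringℚ
    1+δ : (1ℚ + δ) * α ≤ δ
    1+δ = ≤-trans (≤-by ((1ℚ - δ) * α) (0≤* (0≤- δ≤1) 0≤α) (lem₂ α δ)) α+α≤δ
    1-δ : (1ℚ - δ) * β ≤ δ
    1-δ = ≤-trans (≤-by (δ * β) (0≤* 0≤δ 0≤β) (lem₃ β δ)) Λkθ≤δ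

module PotentialStep {I : Set} (L : List I) (Λ Δ : ℕ) (k : I → ℕ) (T Q Q′ C : I → ℚ) (θ δ χ : ℚ)
  (0≤θ : 0ℚ ≤ θ) (θ≤1 : θ ≤ 1ℚ) (0≤δ : 0ℚ ≤ δ) (δ≤1 : δ ≤ 1ℚ) (δ≤χ : δ ≤ χ)
  (k≤Δ : ∀ i → i ∈ L → k i ℕ.≤ Δ) (0≤T : ∀ i → 0ℚ ≤ T i) (0<Q : ∀ i → i ∈ L → 0ℚ < Q i) (0≤C : ∀ i → 0ℚ ≤ C i) (C<Q : ∀ i → i ∈ L → C i < Q i)
  (Q-C≤Q′ : ∀ i → i ∈ L → Q i - C i ≤ Q′ i) (small : ∀ i → i ∈ L → 2ℚ * (⟦ Λ ⟧ * C i) ≤ δ * Q i) (Λθ≤δ : ⟦ Λ ⟧ * (⟦ Δ ⟧ * θ) ≤ δ)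
  (weight : ∑L L (λ i → (T i * inv (Q i)) ^ Λ * (C i * inv (Q i))) ≤ (1ℚ + χ) * (θ * ∑L L (λ i → (T i * inv (Q i)) ^ Λ * ⟦ k i ⟧))) where

  Φ : I → ℚ
  Φ i = (T i * inv (Q i)) ^ Λ

  0≤Φ : ∀ i → 0ℚ ≤ Φ i
  0≤Φ i = 0≤^ Λ (0≤* (0≤T i) (0≤inv _))

  Ψ : ℚ
  Ψ = ∑L L Φ

  term : ∀ i → i ∈ L → (T i * (1ℚ - θ) ^ k i * inv (Q′ i)) ^ Λ ≤ Φ i * (1ℚ + (1ℚ + δ) * (⟦ Λ ⟧ * (C i * inv (Q i))) - (1ℚ - δ) * (⟦ Λ ⟧ * (⟦ k i ⟧ * θ)))
  term i i∈ = ≤-trans (^-mono Λ (0≤* (0≤* (0≤T i) (0≤^ (k i) (0≤- θ≤1))) (0≤inv _)) (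
      T i * (1ℚ - θ) ^ k i * inv (Q′ i) ≤⟨ *-monoˡ (0≤* (0≤T i) (0≤^ (k i) (0≤- θ≤1))) (inv-anti 0<Q1-s (≤-trans (≡⇒≤ Q1-s) (Q-C≤Q′ i i∈))) ⟩
      T i * (1ℚ - θ) ^ k i * inv (Q i * (1ℚ - s)) ≡⟨ trans (cong (T i * (1ℚ - θ) ^ k i *_) (inv-* (0<Q i i∈) (0<- s<1))) (*-middle _ _ _ _) ⟩≤
      T i * inv (Q i) * ((1ℚ - θ) ^ k i * inv (1ℚ - s)) ■))
    (≤-trans (≡⇒≤ (^-distrib-* _ _ Λ)) (*-monoˡ (0≤Φ i) (Ratio.ratio Λ (k i) 0≤s s<1 0≤θ θ≤1 δ≤1 2Λs≤δ (≤-trans (*-monoˡ (0≤⟦⟧ Λ) (*-monoʳ 0≤θ (⟦⟧-mono (k≤Δ i i∈)))) Λθ≤δ))))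
    where
    s = C i * inv (Q i)
    0≤s : 0ℚ ≤ s
    0≤s = 0≤* (0≤C i) (0≤inv _)
    s<1 : s < 1ℚ
    s<1 = subst (s <_) (*-inv (0<Q i i∈)) (*-mono-< (0<inv (0<Q i i∈)) (C<Q i i∈))
    Q1-s : Q i * (1ℚ - s) ≡ Q i - C i
    Q1-s = trans (lem (Q i) (C i) (inv (Q i))) (cong (λ z → Q i - z) (trans (cong (C i *_) (*-inv (0<Q i i∈))) (*-identityʳ _)))
      where
      opaque
        unfolding _+_
        lem : ∀ q c i → q * (1ℚ - c * i) ≡ q - c * (q * i)
        lem = solve-∀ ringℚ
    0<Q1-s : 0ℚ < Q i * (1ℚ - s)
    0<Q1-s = 0<* (0<Q i i∈) (0<- s<1)
    2Λs≤δ : 2ℚ * (⟦ Λ ⟧ * s) ≤ δ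
    2Λs≤δ = ≤-trans (≡⇒≤ (lem 2ℚ ⟦ Λ ⟧ (C i) (inv (Q i)))) (÷-≤ (0<Q i i∈) (small i i∈))
      where
      opaque
        unfolding _+_
        lem : ∀ t l c i → t * (l * (c * i)) ≡ t * (l * c) * i
        lem = solve-∀ ringℚ

  -- By `weight`, the rise caused by lost edges and the fall of the predictions cancel up to a
  -- relative error of order `χ`. Bernoulli turns the remainder into a `Λ`-th power, the form in
  -- which the potential is bounded.
  Ψ-step : ∑L L (λ i → (T i * (1ℚ - θ) ^ k i * inv (Q′ i)) ^ Λ) ≤ Ψ * (1ℚ + 4ℚ * (⟦ Δ ⟧ * χ) * θ) ^ Λ
  Ψ-step =
    ∑L L (λ i → (T i * (1ℚ - θ) ^ k i * inv (Q′ i)) ^ Λ) ≤⟨ ∑L-mono L term ⟩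
    ∑L L (λ i → Φ i * (1ℚ + (1ℚ + δ) * (⟦ Λ ⟧ * (C i * inv (Q i))) - (1ℚ - δ) * (⟦ Λ ⟧ * (⟦ k i ⟧ * θ)))) ≡⟨ trans (∑L-cong L λ i → lem₁ (Φ i) δ ⟦ Λ ⟧ (C i * inv (Q i)) ⟦ k i ⟧ θ) (trans (∑L-+ L _ _) (cong₂ _+_ (trans (∑L-+ L Φ _) (cong (Ψ +_) (∑L-*ˡ L ((1ℚ + δ) * ⟦ Λ ⟧) _))) (∑L-*ˡ L (- ((1ℚ - δ) * (⟦ Λ ⟧ * θ))) _))) ⟩≤
    Ψ + (1ℚ + δ) * ⟦ Λ ⟧ * S + (- ((1ℚ - δ) * (⟦ Λ ⟧ * θ))) * W ≤⟨ +-mono (+-mono ≤-refl (*-monoˡ (0≤* (0≤+ 0≤1 0≤δ) (0≤⟦⟧ Λ)) weight)) ≤-refl ⟩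
    Ψ + (1ℚ + δ) * ⟦ Λ ⟧ * ((1ℚ + χ) * (θ * W)) + (- ((1ℚ - δ) * (⟦ Λ ⟧ * θ))) * W ≤⟨ ≤-by (⟦ Λ ⟧ * (θ * W) * (2ℚ * (χ - δ) + χ * (1ℚ - δ))) (0≤* (0≤* (0≤⟦⟧ Λ) (0≤* 0≤θ 0≤W)) (0≤+ (0≤* 0≤2 (0≤- δ≤χ)) (0≤* 0≤χ (0≤- δ≤1)))) (lem₂ Ψ δ ⟦ Λ ⟧ χ θ W) ⟩
    Ψ + ⟦ Λ ⟧ * (4ℚ * χ * θ) * W ≤⟨ +-mono ≤-refl (*-monoˡ (0≤* (0≤⟦⟧ Λ) (0≤* (0≤* 0≤4 0≤χ) 0≤θ)) W≤) ⟩
    Ψ + ⟦ Λ ⟧ * (4ℚ * χ * θ) * (⟦ Δ ⟧ * Ψ) ≡⟨ lem₃ Ψ ⟦ Λ ⟧ 4ℚ χ θ ⟦ Δ ⟧ ⟩≤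
    Ψ * (1ℚ + ⟦ Λ ⟧ * (4ℚ * (⟦ Δ ⟧ * χ) * θ)) ≤⟨ *-monoˡ (0≤∑L L 0≤Φ) (bernoulli⁺ Λ (0≤* (0≤* 0≤4 (0≤* (0≤⟦⟧ Δ) 0≤χ)) 0≤θ)) ⟩
    Ψ * (1ℚ + 4ℚ * (⟦ Δ ⟧ * χ) * θ) ^ Λ ■
    where
    S = ∑L L (λ i → Φ i * (C i * inv (Q i)))
    W = ∑L L (λ i → Φ i * ⟦ k i ⟧)
    0≤χ : 0ℚ ≤ χ
    0≤χ = ≤-trans 0≤δ δ≤χ
    0≤W : 0ℚ ≤ W
    0≤W = 0≤∑L L λ i → 0≤* (0≤Φ i) (0≤⟦⟧ _)
    W≤ : W ≤ ⟦ Δ ⟧ * Ψ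
    W≤ = ≤-trans (∑L-mono L λ i i∈ → ≤-trans (≡⇒≤ (*-comm _ _)) (*-monoʳ (0≤Φ i) (⟦⟧-mono (k≤Δ i i∈)))) (≡⇒≤ (∑L-*ˡ L ⟦ Δ ⟧ Φ))
    opaque
      unfolding _+_
      lem₁ : ∀ f δ l c k θ → f * (1ℚ + (1ℚ + δ) * (l * c) - (1ℚ - δ) * (l * (k * θ))) ≡ f + (1ℚ + δ) * l * (f * c) + (- ((1ℚ - δ) * (l * θ))) * (f * k)
      lem₁ = solve-∀ ringℚ
      lem₂ : ∀ p δ l χ θ w → p + l * (((1ℚ + 1ℚ) + (1ℚ + 1ℚ)) * χ * θ) * w ≡ (p + (1ℚ + δ) * l * ((1ℚ + χ) * (θ * w)) + (- ((1ℚ - δ) * (l * θ))) * w) + l * (θ * w) * ((1ℚ + 1ℚ) * (χ - δ) + χ * (1ℚ - δ))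
      lem₂ = solve-∀ ringℚ
      lem₃ : ∀ p l f χ θ d → p + l * (f * χ * θ) * (d * p) ≡ p * (1ℚ + l * (f * (d * χ) * θ))
      lem₃ = solve-∀ ringℚ

-- Removing an embedded job from the host

Stat : ℕ → ℕ → Set
Stat a b = List (Fin a) ⊎ Fin b

order : ∀ {a b} → Stat a b → ℕ
order (inj₁ t) = length t
order (inj₂ v) = 1

module _ {a b : ℕ} (G : BipGraph a b) where

  value : Stat a b → ℚ
  value (inj₁ t) = N G t
  value (inj₂ v) = degB G v

  occ : Fin a → List (Fin a) → ℚ
  occ u t = ∑L t (λ x → ind (eqF x u))

  -- The drop of the statistic, to first order, when the edge `u v` is deleted. Repeated entries of
  -- `t` count with multiplicity, so that the total in `∑-share` has exactly the factor `order i` at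
  -- which the predictions fall.
  share : Stat a b → Fin a → Fin b → ℚ
  share (inj₁ t) u v = ind (cn G t v) * occ u t
  share (inj₂ v₀) u v = ind (eqF v₀ v) * ind (edge G u v)

  0≤occ : ∀ u t → 0ℚ ≤ occ u t
  0≤occ u t = 0≤∑L t (λ x → 0≤ind (eqF x u))

  0≤share : ∀ i u v → 0ℚ ≤ share i u v
  0≤share (inj₁ t) u v = 0≤* (0≤ind (cn G t v)) (0≤occ u t)
  0≤share (inj₂ v₀) u v = 0≤* (0≤ind (eqF v₀ v)) (0≤ind (edge G u v))

  ∑-occ : ∀ t (f : Fin a → ℚ) → ∑ (λ u → occ u t * f u) ≡ ∑L t f
  ∑-occ t f = trans (∑-cong λ u → trans (*-comm _ _) (sym (∑L-*ˡ t (f u) _))) (trans (sym (∑L-∑ t (λ x u → f u * ind (eqF x u)))) (∑L-cong t λ x → trans (∑-cong λ u → *-comm _ _) (∑-at x f)))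

  ∑-share : ∀ i → ∑ (λ u → ∑ (share i u)) ≡ ⟦ order i ⟧ * value i
  ∑-share (inj₁ t) = trans (∑-swap (share (inj₁ t))) (trans (∑-cong λ v → trans (∑-*ˡ (ind (cn G t v)) _) (cong (ind (cn G t v) *_) (trans (∑-cong λ u → sym (*-identityʳ _)) (trans (∑-occ t (λ _ → 1ℚ)) (trans (∑L-const t 1ℚ) (*-identityʳ _)))))) (trans (∑-*ʳ ⟦ length t ⟧ _) (*-comm _ _)))
  ∑-share (inj₂ v₀) = trans (∑-cong λ u → ∑-at v₀ (λ v → ind (edge G u v))) (sym (trans (cong (_* degB G v₀) ⟦1⟧) (*-identityˡ _)))

  share-edge : ∀ i u v → edge G u v ≡ false → share i u v ≡ 0ℚ
  share-edge (inj₁ t) u v ne with cn G t v in q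
  ... | false = *-zeroˡ _
  ... | true = trans (*-identityˡ _) (∑L-zero t λ x x∈ → cong ind (≢⇒eqF {i = x} {u} λ { refl → true≢false (cn⁻ G {t} q x∈) ne }))
  share-edge (inj₂ v₀) u v ne = trans (cong (λ o → ind (eqF v₀ v) * ind o) ne) (*-zeroʳ _)

module Removal {a b : ℕ} (G J : BipGraph a b) (Δ : ℕ) (1≤Δ : 1 ℕ.≤ Δ) (bounded : Bounded J Δ)
  (σ : Fin a → Fin a) (τ : Fin b → Fin b) (σ-inj : Injective _≡_ _≡_ σ) (τ-inj : Injective _≡_ _≡_ τ)
  (to-edge : ∀ x y → edge J x y ≡ true → edge G (σ x) (τ y) ≡ true) where
  open Bounded bounded

  hit : Fin a → Fin b → Bool
  hit u v = anyF λ x → anyF λ y → edge J x y ∧ (eqF (σ x) u ∧ eqF (τ y) v)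

  hit⁺ : ∀ x y → edge J x y ≡ true → hit (σ x) (τ y) ≡ true
  hit⁺ x y e = anyF⁺ {P = λ x′ → anyF λ y′ → edge J x′ y′ ∧ (eqF (σ x′) (σ x) ∧ eqF (τ y′) (τ y))} x (anyF⁺ {P = λ y′ → edge J x y′ ∧ (eqF (σ x) (σ x) ∧ eqF (τ y′) (τ y))} y (∧⁺ e (∧⁺ (eqF-refl (σ x)) (eqF-refl (τ y)))))

  hit⁻ : ∀ {u v} → hit u v ≡ true → ∃ λ x → ∃ λ y → edge J x y ≡ true × σ x ≡ u × τ y ≡ v
  hit⁻ {u} {v} h with x , h₁ ← anyF⁻ {P = λ x → anyF λ y → edge J x y ∧ (eqF (σ x) u ∧ eqF (τ y) v)} h
    with y , h₂ ← anyF⁻ {P = λ y → edge J x y ∧ (eqF (σ x) u ∧ eqF (τ y) v)} h₁ =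
    x , y , ∧⁻ˡ h₂ , eqF⇒≡ (∧⁻ˡ (∧⁻ʳ {edge J x y} h₂)) , eqF⇒≡ (∧⁻ʳ {eqF (σ x) u} (∧⁻ʳ {edge J x y} h₂))

  G′ : BipGraph a b
  G′ = record { edge = λ u v → edge G u v ∧ not (hit u v) }

  lost : (Fin a → Fin b → ℚ) → ℚ
  lost w = ∑ λ y → ∑ λ x → ind (edge J x y) * w (σ x) (τ y)

  ∑-hit≤lost : ∀ {w} → (∀ u v → 0ℚ ≤ w u v) → ∑ (λ u → ∑ λ v → ind (hit u v) * w u v) ≤ lost w
  ∑-hit≤lost {w} 0≤w =
    ∑ (λ u → ∑ λ v → ind (hit u v) * w u v) ≤⟨ ∑-mono (λ u → ∑-mono λ v → *-monoʳ (0≤w u v) (≤-trans (ind-anyF _) (∑-mono λ x → ≤-trans (ind-anyF _) (∑-mono λ y → ≡⇒≤ (trans (ind-∧ (edge J x y) _) (cong (ind (edge J x y) *_) (ind-∧ (eqF (σ x) u) (eqF (τ y) v)))))))) ⟩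
    ∑ (λ u → ∑ λ v → ∑ (λ x → ∑ λ y → ind (edge J x y) * (ind (eqF (σ x) u) * ind (eqF (τ y) v))) * w u v) ≡⟨ ∑-cong (λ u → trans (∑-cong λ v → trans (sym (∑-*ʳ (w u v) _)) (∑-cong λ x → sym (∑-*ʳ (w u v) _))) (trans (∑-swap _) (∑-cong λ x → ∑-swap _))) ⟩≤
    ∑ (λ u → ∑ λ x → ∑ λ y → ∑ λ v → ind (edge J x y) * (ind (eqF (σ x) u) * ind (eqF (τ y) v)) * w u v) ≡⟨ ∑-cong (λ u → ∑-cong λ x → ∑-cong λ y → trans (∑-cong λ v → lem (ind (edge J x y)) (ind (eqF (σ x) u)) (ind (eqF (τ y) v)) (w u v)) (∑-at (τ y) (λ v → ind (eqF (σ x) u) * (ind (edge J x y) * w u v)))) ⟩≤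
    ∑ (λ u → ∑ λ x → ∑ λ y → ind (eqF (σ x) u) * (ind (edge J x y) * w u (τ y))) ≡⟨ trans (∑-swap _) (∑-cong λ x → trans (∑-swap _) (∑-cong λ y → ∑-at (σ x) (λ u → ind (edge J x y) * w u (τ y)))) ⟩≤
    ∑ (λ x → ∑ λ y → ind (edge J x y) * w (σ x) (τ y)) ≡⟨ ∑-swap _ ⟩≤
    lost w ■
    where
    opaque
      unfolding _+_
      lem : ∀ e s t w → e * (s * t) * w ≡ t * (s * (e * w))
      lem = solve-∀ ringℚ

  lost-∑L : ∀ {I : Set} (L : List I) (φ : I → ℚ) (c : I → Fin a → Fin b → ℚ) → lost (λ u v → ∑L L λ i → φ i * c i u v) ≡ ∑L L λ i → φ i * lost (c i)
  lost-∑L L φ c = trans (∑-cong λ y → trans (∑-cong λ x → sym (∑L-*ˡ L (ind (edge J x y)) _)) (sym (∑L-∑ L _))) (trans (sym (∑L-∑ L _)) (∑L-cong L λ i → trans (∑-cong λ y → trans (∑-cong λ x → *-swap _ _ _) (∑-*ˡ (φ i) _)) (∑-*ˡ (φ i) _)))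

  0≤lost : ∀ {w} → (∀ u v → 0ℚ ≤ w u v) → 0ℚ ≤ lost w
  0≤lost 0≤w = 0≤∑ λ y → 0≤∑ λ x → 0≤* (0≤ind (edge J x y)) (0≤w _ _)

  edge-split : ∀ u v → ind (edge G u v) ≤ ind (edge G′ u v) + ind (hit u v) * ind (edge G u v)
  edge-split u v with edge G u v | hit u v
  ... | true | true = ≤-trans (≡⇒≤ (sym (*-identityˡ 1ℚ))) (y≤x+y ≤-refl)
  ... | true | false = x≤x+y (≡⇒≤ (sym (*-zeroˡ _)))
  ... | false | h = 0≤+ ≤-refl (0≤* (0≤ind h) ≤-refl)

  cn-split : ∀ t v → ind (cn G t v) ≤ ind (cn G′ t v) + ind (cn G t v) * ∑L t (λ u → ind (hit u v))
  cn-split t v = cases (cn G t v) (cn G′ t v) refl refl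
    where
    missing : ∀ t → cn G t v ≡ true → cn G′ t v ≡ false → 1ℚ ≤ ∑L t (λ u → ind (hit u v))
    missing (u ∷ t) p q with edge G u v | hit u v
    ... | true | true = x≤x+y (0≤∑L t λ u → 0≤ind (hit u v))
    ... | true | false = ≤-trans (missing t p q) (y≤x+y ≤-refl)
    cases : ∀ x y → cn G t v ≡ x → cn G′ t v ≡ y → ind x ≤ ind y + ind x * ∑L t (λ u → ind (hit u v))
    cases false y p q = 0≤+ (0≤ind y) (≡⇒≤ (sym (*-zeroˡ _)))
    cases true true p q = x≤x+y (0≤* 0≤1 (0≤∑L t λ u → 0≤ind (hit u v)))
    cases true false p q = ≤-trans (missing t p q) (≤-trans (≡⇒≤ (sym (*-identityˡ _))) (y≤x+y ≤-refl))

  -- A union bound: a vertex leaves a common neighbourhood only if one of its edges to the tuple is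
  -- removed.
  value-lost : ∀ i → value G i - lost (share G i) ≤ value G′ i
  value-lost (inj₁ t) = -≤⇒ (≤-trans (∑-mono (cn-split t)) (≤-trans (≡⇒≤ (∑-+ _ _)) (+-mono ≤-refl (≤-trans (≡⇒≤ (trans (∑-cong λ v → trans (cong (ind (cn G t v) *_) (sym (∑-occ G t (λ u → ind (hit u v))))) (trans (sym (∑-*ˡ (ind (cn G t v)) _)) (∑-cong λ u → lem (ind (cn G t v)) (occ G u t) (ind (hit u v))))) (∑-swap _))) (∑-hit≤lost (0≤share G (inj₁ t)))))))
    where
    opaque
      unfolding _+_
      lem : ∀ c o h → c * (o * h) ≡ h * (c * o)
      lem = solve-∀ ringℚ
  value-lost (inj₂ v₀) = -≤⇒ (≤-trans (∑-mono λ u → edge-split u v₀) (≤-trans (≡⇒≤ (∑-+ _ _)) (+-mono ≤-refl (≤-trans (≡⇒≤ (∑-cong λ u → sym (trans (∑-cong λ v → *-swap _ _ _) (∑-at v₀ (λ v → ind (hit u v) * ind (edge G u v)))))) (∑-hit≤lost (0≤share G (inj₂ v₀)))))))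

  -- An embedded job uses at most `Δ` edges at each vertex, and a statistic concerns at most `Δ`
  -- vertices; a step changes it by a constant, whatever the size of the graph.
  lost-share≤ : ∀ i → order i ℕ.≤ Δ → lost (share G i) ≤ ⟦ Δ ⟧ * ⟦ Δ ⟧
  lost-share≤ (inj₁ t) len =
    lost (share G (inj₁ t)) ≤⟨ ∑-mono (λ y → ∑-mono λ x → *-monoˡ (0≤ind (edge J x y)) (ind*≤′ (cn G t (τ y)) (0≤occ G (σ x) t))) ⟩
    ∑ (λ y → ∑ λ x → ind (edge J x y) * occ G (σ x) t) ≡⟨ trans (∑-swap _) (∑-cong λ x → ∑-*ʳ (occ G (σ x) t) _) ⟩≤
    ∑ (λ x → degA J x * occ G (σ x) t) ≤⟨ ∑-mono (λ x → *-monoʳ (0≤occ G (σ x) t) (degA≤ x)) ⟩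
    ∑ (λ x → ⟦ Δ ⟧ * occ G (σ x) t) ≤⟨ ≤-trans (≡⇒≤ (∑-*ˡ ⟦ Δ ⟧ _)) (*-monoˡ (0≤⟦⟧ Δ) (≤-trans (∑-injective σ-inj {λ u → occ G u t} (λ u → 0≤occ G u t)) (≤-trans (≡⇒≤ (trans (∑-cong λ u → sym (*-identityʳ _)) (trans (∑-occ G t (λ _ → 1ℚ)) (trans (∑L-const t 1ℚ) (*-identityʳ _))))) (⟦⟧-mono len)))) ⟩
    ⟦ Δ ⟧ * ⟦ Δ ⟧ ■
  lost-share≤ (inj₂ v₀) _ =
    lost (share G (inj₂ v₀)) ≤⟨ ∑-mono (λ y → ∑-mono λ x → *-monoˡ (0≤ind (edge J x y)) (≤-trans (*-monoˡ (0≤ind (eqF v₀ (τ y))) (ind≤1 (edge G (σ x) (τ y)))) (≡⇒≤ (*-identityʳ _)))) ⟩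
    ∑ (λ y → ∑ λ x → ind (edge J x y) * ind (eqF v₀ (τ y))) ≡⟨ ∑-cong (λ y → ∑-*ʳ (ind (eqF v₀ (τ y))) _) ⟩≤
    ∑ (λ y → degB J y * ind (eqF v₀ (τ y))) ≤⟨ ∑-mono (λ y → *-monoʳ (0≤ind (eqF v₀ (τ y))) (degB≤ y)) ⟩
    ∑ (λ y → ⟦ Δ ⟧ * ind (eqF v₀ (τ y))) ≤⟨ ≤-trans (≡⇒≤ (∑-*ˡ ⟦ Δ ⟧ _)) (*-monoˡ (0≤⟦⟧ Δ) (≤-trans (∑-injective τ-inj {λ v → ind (eqF v₀ v)} (λ v → 0≤ind (eqF v₀ v))) (≤-trans (≡⇒≤ (∑-at₁ v₀)) (1≤⟦⟧ 1≤Δ)))) ⟩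
    ⟦ Δ ⟧ * ⟦ Δ ⟧ ■

  size-removed : size G′ ≤ size G - size J
  size-removed = ≤-trans (≡⇒≤ (sym (+-cancelʳ′ (size G′) (size J)))) (+-mono (≤-trans (+-mono ≤-refl size-J≤) (≤-trans (≡⇒≤ (trans (sym (∑-+ _ _)) (∑-cong λ u → sym (∑-+ _ _)))) (∑-mono λ u → ∑-mono λ v → disjoint u v))) ≤-refl)
    where
    size-J≤ : size J ≤ ∑ (λ u → ∑ λ v → ind (hit u v))
    size-J≤ = ≤-trans (∑-mono λ x → ≤-trans (∑-mono λ y → ind-mono {edge J x y} (hit⁺ x y)) (∑-injective τ-inj {λ v → ind (hit (σ x) v)} (λ v → 0≤ind (hit (σ x) v)))) (∑-injective σ-inj {λ u → ∑ λ v → ind (hit u v)} (λ u → 0≤∑ λ v → 0≤ind (hit u v)))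
    disjoint : ∀ u v → ind (edge G′ u v) + ind (hit u v) ≤ ind (edge G u v)
    disjoint u v with hit u v in h
    ... | false = ≤-trans (≡⇒≤ (trans (+-identityʳ _) (ind-∧ (edge G u v) true))) (≡⇒≤ (*-identityʳ _))
    ... | true with x , y , e , refl , refl ← hit⁻ h rewrite to-edge x y e = ≡⇒≤ (+-identityˡ 1ℚ)

-- Packing the jobs one after another

8ℚ : ℚ
8ℚ = 4ℚ + 4ℚ

0<8 : 0ℚ < 8ℚ
0<8 = 0<+ 0<4 0≤4

-- `pm` bounds the density from below at all times. `ζ` multiplies the threshold of level `2Δ`, the
-- largest loss `α` of density for each entry, and 1/2 for the error. `C₁` is `(1 + Δ) / p ^ Δ` at
-- the least density; `C₅` comes from `total-factor` and `c₀` from the bipartitions of the graphs.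
module Derived (Δ : ℕ) (α τ : ℚ) where
  pm R K ζ C₁ C₅ c₀ : ℚ
  pm = α * τ
  R = 2ℚ * inv pm
  K = R ^ Δ
  ζ = τ ^ (Δ ℕ.+ Δ) * α ^ Δ * inv 2ℚ
  C₁ = (1ℚ + ⟦ Δ ⟧) * inv pm ^ Δ
  C₅ = 4ℚ * C₁ + ⟦ 40 ⟧
  c₀ = inv (2ℚ * (1ℚ + ⟦ Δ ⟧))

record Numeric (a b Δ : ℕ) (ε d α : ℚ) : Set where
  field
    1≤a : 1 ℕ.≤ a
    1≤b : 1 ℕ.≤ b
    1≤Δ : 1 ℕ.≤ Δ
    a≤b : ⟦ a ⟧ ≤ ⟦ b ⟧
    b≤2a : ⟦ b ⟧ ≤ 2ℚ * ⟦ a ⟧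
    0<ε : 0ℚ < ε
    0<α : 0ℚ < α
    α≤1 : α ≤ 1ℚ
    τ : ℚ
    0<τ : 0ℚ < τ
    τ≤1 : τ ≤ 1ℚ
    τ≤q : τ ≤ d - ε
    ε<τ^ : ε < τ ^ (Δ ℕ.+ Δ)
    κ₀ κ Cκ : ℚ
    0≤κ₀ : 0ℚ ≤ κ₀
    κ₀-bound : ∀ j → j ℕ.≤ Δ ℕ.+ Δ → ⟦ a ⟧ ≤ κ₀ * (⟦ a ⟧ - ⟦ j ⟧)
    κ₀^≤κ : ∀ j → j ℕ.≤ Δ ℕ.+ Δ → κ₀ ^ j ≤ κ
    1≤κ : 1ℚ ≤ κ
    κ≤2 : κ ≤ 2ℚ
    κ-1≤ : (κ - 1ℚ) * ⟦ a ⟧ ≤ Cκ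
    h₀ hmax : ℚ
    0<h₀ : 0ℚ < h₀
    4h₀≤1 : 4ℚ * h₀ ≤ 1ℚ
    κ≤1+h₀ : κ ≤ 1ℚ + h₀
    ratio : ∀ k → k ℕ.≤ Δ → (d + ε) ^ k ≤ (1ℚ + h₀) * (d - ε) ^ k
    Λ′ M : ℕ
  open Derived Δ α τ
  open Numbers Δ h₀ κ Cκ (⟦ Δ ⟧ * ε)
  field
    h₀≤ : h₀ ≤ hmax * pm ^ M
    3hmax≤1 : ⟦ 3 ⟧ * hmax ≤ 1ℚ
    C₁-small : 4ℚ * (C₁ * (⟦ 3 ⟧ * hmax)) ≤ c₀ * inv 8ℚ
    M-bound : ⟦ 24 ⟧ * (⟦ Δ ⟧ * C₅) ≤ ⟦ M ⟧
    -- `Λ-small` and `Λθ-small` limit the exponent from above, so that one step may be linearised;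
    -- `initial` limits it from below, so that all statistics together fit under `(1 + h₀) ^ Λ`. A
    -- small multiple of `a` satisfies both.
    Λ-small : 2ℚ * (⟦ suc Λ′ ⟧ * (⟦ Δ ⟧ * ⟦ Δ ⟧)) ≤ h₀ * (ζ * ⟦ a ⟧)
    Δ²<ζa : ⟦ Δ ⟧ * ⟦ Δ ⟧ < ζ * ⟦ a ⟧
    Λθ-small : ⟦ suc Λ′ ⟧ * (⟦ Δ ⟧ * (⟦ Δ ⟧ * (inv pm * inv ⟦ b ⟧))) ≤ h₀
    initial : (1ℚ + ⟦ a ⟧) ^ Δ + ⟦ b ⟧ ≤ (1ℚ + h₀) ^ suc Λ′
    ρ Omax : ℚ
    0≤ρ : 0ℚ ≤ ρ
    ε₁≤ρ : ⟦ Δ ⟧ * ε ≤ ρ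
    devF-small : 2ℚ * inv h₀ * (C₂ * (⟦ Δ ⟧ * ε)) ≤ ρ * ρ
    room : 2ℚ * (⟦ Δ ⟧ * ξ * ⟦ Δ ⟧) * m + ⟦ Δ ⟧ * ε + ⟦ Δ ⟧ * (2ℚ * ρ) + inv 4ℚ < 1ℚ
    Omax-bound : 2ℚ * inv h₀ * (C₂ * ⟦ Δ ⟧) * K ≤ Omax * (c₀ * inv 2ℚ * (c₀ * inv 2ℚ))
    Omax-h₀ : Omax * (K * inv ⟦ b ⟧) ≤ h₀
    Omax-ζ : Omax * (K * inv ⟦ b ⟧) ≤ ζ * inv 2ℚ
    small-columns : inv (ζ * inv 2ℚ) * (K * (⟦ Δ ⟧ * (2ℚ * (⟦ Δ ⟧ * ξ * ⟦ Δ ⟧)))) ≤ c₀ * inv 4ℚ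
    small-total : inv (ζ * inv 2ℚ) * (K * (⟦ Δ ⟧ * ω)) ≤ h₀

inv-ζ₁ : ∀ {x} → 0ℚ ≤ x → 4ℚ * x ≤ 1ℚ → 0ℚ < 1ℚ - (x + x) × inv (1ℚ - (x + x)) ≤ 1ℚ + 4ℚ * x
inv-ζ₁ {x} 0≤x 4x≤1 = pos , ≤-trans (≡⇒≤ (sym (*-identityˡ _))) (÷-≤ pos (≤-by (2ℚ * x * (1ℚ - 4ℚ * x)) (0≤* (0≤* 0≤2 0≤x) (0≤- 4x≤1)) (lem x)))
  where
  opaque
    unfolding _+_
    lem : ∀ x → (1ℚ + 4ℚ * x) * (1ℚ - (x + x)) ≡ 1ℚ + 2ℚ * x * (1ℚ - 4ℚ * x)
    lem = solve-∀ ringℚ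
  pos : 0ℚ < 1ℚ - (x + x)
  pos = 0<- (ℚ.≰⇒> λ q → ≤⇒≯ (≤-trans (+-mono q q) (≤-trans (≡⇒≤ (lem₃ x)) 4x≤1)) (subst (_< 1ℚ + 1ℚ) (+-identityʳ 1ℚ) (+-mono-≤-< (≤-refl {1ℚ}) 0<1)))
    where
    opaque
      unfolding _+_
      lem₃ : ∀ x → x + x + (x + x) ≡ 4ℚ * x
      lem₃ = solve-∀ ringℚ

-- For `η ≤ 1` the product `(1 + 4η) (1 + η)²` is at most `1 + 19η`; the factor `1 + u ≤ 2` and the
-- summand `s ≤ η` raise 19 to 39, which 40 covers.
total-factor : ∀ {u κ h η s} → 0ℚ ≤ u → u ≤ 1ℚ → 0ℚ ≤ κ → 0ℚ ≤ h → h ≤ η → η ≤ 1ℚ → κ ≤ 1ℚ + h → s ≤ h →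
  (1ℚ + u) * ((1ℚ + 4ℚ * h) * (κ * (1ℚ + η))) + s ≤ 1ℚ + (u + ⟦ 40 ⟧ * η)
total-factor {u} {κ} {h} {η} {s} 0≤u u≤1 0≤κ 0≤h h≤η η≤1 κ≤ s≤ =
  ≤-trans (+-mono (*-monoˡ (0≤+ 0≤1 0≤u) (*-mono (0≤+ 0≤1 (0≤* 0≤4 0≤h)) (0≤* (0≤+ 0≤1 0≤η) (0≤+ 0≤1 0≤η)) (+-mono ≤-refl (*-monoˡ 0≤4 h≤η)) (*-monoʳ (0≤+ 0≤1 0≤η) (≤-trans κ≤ (+-mono ≤-refl h≤η))))) (≤-trans s≤ h≤η))
    (≤-by _ (0≤+ (0≤* (0≤- u≤1) (0≤+ (0≤+ (0≤* 6≥0 0≤η) (0≤* 9≥0 (0≤square η))) (0≤* 0≤4 (0≤* 0≤η (0≤square η))))) (0≤* 0≤η (0≤+ (0≤+ 0≤1 (0≤* 18≥0 (0≤- η≤1))) (0≤* 8≥0 (0≤* (0≤- η≤1) (0≤+ 0≤1 0≤η)))))) (lem u η))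
  where
  0≤η : 0ℚ ≤ η
  0≤η = ≤-trans 0≤h h≤η
  6≥0 : 0ℚ ≤ ⟦ 6 ⟧
  6≥0 = 0≤⟦⟧ 6
  9≥0 : 0ℚ ≤ ⟦ 9 ⟧
  9≥0 = 0≤⟦⟧ 9
  18≥0 : 0ℚ ≤ ⟦ 18 ⟧
  18≥0 = 0≤⟦⟧ 18
  8≥0 : 0ℚ ≤ ⟦ 8 ⟧
  8≥0 = 0≤⟦⟧ 8
  opaque
    unfolding _+_ ⟦_⟧
    lem : ∀ u η → 1ℚ + (u + ⟦ 40 ⟧ * η) ≡ ((1ℚ + u) * ((1ℚ + 4ℚ * η) * ((1ℚ + η) * (1ℚ + η))) + η) + ((1ℚ - u) * (⟦ 6 ⟧ * η + ⟦ 9 ⟧ * (η * η) + 4ℚ * (η * (η * η))) + η * (1ℚ + ⟦ 18 ⟧ * (1ℚ - η) + ⟦ 8 ⟧ * ((1ℚ - η) * (1ℚ + η))))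
    lem = solve-∀ ringℚ

prepend : ∀ {A : Set} → List A → List (List A) → List (List A)
prepend [] ls = []
prepend (u ∷ us) ls = map (u ∷_) ls ++ prepend us ls

tuples : ∀ a → ℕ → List (List (Fin a))
tuples a zero = [] ∷ []
tuples a (suc k) = [] ∷ prepend (allFin a) (tuples a k)

∈-prepend : ∀ {A : Set} {u : A} {us t ls} → u ∈ us → t ∈ ls → u ∷ t ∈ prepend us ls
∈-prepend {u = u} (here refl) t∈ = ∈-++⁺ˡ (∈-map⁺ (u ∷_) t∈)
∈-prepend {us = x ∷ us} {ls = ls} (there u∈) t∈ = ∈-++⁺ʳ (map (x ∷_) ls) (∈-prepend u∈ t∈)

prepend-∈ : ∀ {A : Set} (us : List A) {ls s} → s ∈ prepend us ls → ∃ λ u → ∃ λ t → s ≡ u ∷ t × t ∈ ls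
prepend-∈ (u ∷ us) {ls} s∈ with ∈-++⁻ (map (u ∷_) ls) s∈
... | inj₁ p with t , t∈ , eq ← ∈-map⁻ (u ∷_) p = u , t , eq , t∈
... | inj₂ p = prepend-∈ us p

∈-tuples : ∀ {a} k (t : List (Fin a)) → length t ℕ.≤ k → t ∈ tuples a k
∈-tuples zero [] z≤n = here refl
∈-tuples (suc k) [] z≤n = here refl
∈-tuples (suc k) (u ∷ t) (s≤s len) = there (∈-prepend (∈-allFin u) (∈-tuples k t len))

tuples-length : ∀ {a} k {t : List (Fin a)} → t ∈ tuples a k → length t ℕ.≤ k
tuples-length zero (here refl) = z≤n
tuples-length (suc k) (here refl) = z≤n
tuples-length {a} (suc k) (there p) with u , t , refl , t∈ ← prepend-∈ (allFin a) p = s≤s (tuples-length k t∈)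

length-prepend : ∀ {A : Set} (us : List A) ls → length (prepend us ls) ≡ length us ℕ.* length ls
length-prepend [] ls = refl
length-prepend (u ∷ us) ls = trans (length-++ (map (u ∷_) ls)) (cong₂ ℕ._+_ (length-map (u ∷_) ls) (length-prepend us ls))

length-allFin : ∀ n → length (allFin n) ≡ n
length-allFin n = length-tabulate {n = n} id

length-tuples : ∀ a k → ⟦ length (tuples a k) ⟧ ≤ (1ℚ + ⟦ a ⟧) ^ k
length-tuples a zero = ≡⇒≤ ⟦1⟧
length-tuples a (suc k) =
  ⟦ suc (length (prepend (allFin a) (tuples a k))) ⟧ ≡⟨ trans (⟦suc⟧ _) (cong (1ℚ +_) (trans (cong ⟦_⟧ (trans (length-prepend (allFin a) (tuples a k)) (cong (ℕ._* length (tuples a k)) (length-allFin a)))) (⟦*⟧ a (length (tuples a k))))) ⟩≤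
  1ℚ + ⟦ a ⟧ * ⟦ length (tuples a k) ⟧ ≤⟨ +-mono (1≤^ k (x≤x+y (0≤⟦⟧ a))) (*-monoˡ (0≤⟦⟧ a) (length-tuples a k)) ⟩
  (1ℚ + ⟦ a ⟧) ^ k + ⟦ a ⟧ * (1ℚ + ⟦ a ⟧) ^ k ≡⟨ trans (cong (_+ ⟦ a ⟧ * (1ℚ + ⟦ a ⟧) ^ k) (sym (*-identityˡ _))) (sym (*-distribʳ-+ _ 1ℚ ⟦ a ⟧)) ⟩≤
  (1ℚ + ⟦ a ⟧) * (1ℚ + ⟦ a ⟧) ^ k ■

length-filterᵇ : ∀ {A : Set} (P : A → Bool) xs → length (filterᵇ P xs) ℕ.≤ length xs
length-filterᵇ P [] = z≤n
length-filterᵇ P (x ∷ xs) with P x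
... | true = s≤s (length-filterᵇ P xs)
... | false = ℕ.m≤n⇒m≤1+n (length-filterᵇ P xs)

nonisolated : ∀ {a b} → BipGraph a b → Fin b → Bool
nonisolated J y = anyF (λ x → edge J x y)

record JobFits {a b : ℕ} (J : BipGraph a b) (Δ : ℕ) (c₀ : ℚ) : Set where
  field
    bounded : Bounded J Δ
    slack : ∑ (λ y → ind (nonisolated J y)) ≤ (1ℚ - c₀) * ⟦ b ⟧

record Packing {a b s : ℕ} (J : Fin s → BipGraph a b) (G : BipGraph a b) : Set where
  field
    σ : Fin s → Fin a → Fin a
    τ : Fin s → Fin b → Fin b
    σ-injective : ∀ i → Injective _≡_ _≡_ (σ i)
    τ-injective : ∀ i → Injective _≡_ _≡_ (τ i)
    to-edge : ∀ i x y → edge (J i) x y ≡ true → edge G (σ i x) (τ i y) ≡ true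
    disjoint : ∀ i j → i ≢ j → ∀ x y x′ y′ → edge (J i) x y ≡ true → edge (J j) x′ y′ ≡ true → ¬ (σ i x ≡ σ j x′ × τ i y ≡ τ j y′)

module Iteration {a b Δ : ℕ} {ε d α : ℚ} (num : Numeric a b Δ ε d α) (G₀ : BipGraph a b) (reg : SuperRegular ε d G₀) where
  open Numeric num
  open Derived Δ α τ
  open Numbers Δ h₀ κ Cκ (⟦ Δ ⟧ * ε)

  ia ib : ℚ
  ia = inv ⟦ a ⟧
  ib = inv ⟦ b ⟧
  0<a : 0ℚ < ⟦ a ⟧
  0<a = 0<⟦⟧ 1≤a
  0<b : 0ℚ < ⟦ b ⟧
  0<b = 0<⟦⟧ 1≤b
  0<Δ : 0ℚ < ⟦ Δ ⟧
  0<Δ = 0<⟦⟧ 1≤Δ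
  0≤ε : 0ℚ ≤ ε
  0≤ε = <⇒≤ 0<ε
  0<q : 0ℚ < d - ε
  0<q = ℚ.<-≤-trans 0<τ τ≤q

  q≤1 : d - ε ≤ 1ℚ
  q≤1 = *-cancelʳ 0<b (≤-trans (proj₁ (degree-bounds b (bdegA G₀ u) (proj₁ (proj₂ reg) u))) (≤-trans (≡⇒≤ (⟦bdegA⟧ G₀ u)) (≤-trans (∑-ind≤ (edge G₀ u)) (≡⇒≤ (sym (*-identityˡ _))))))
    where
    u : Fin a
    u = fromℕ< 1≤a

  open Regularity G₀ ε d 0≤ε reg 0<q q≤1

  0<pm : 0ℚ < pm
  0<pm = 0<* 0<α 0<τ
  pm≤1 : pm ≤ 1ℚ
  pm≤1 = ≤-trans (*-mono (<⇒≤ 0<α) 0≤1 α≤1 τ≤1) (≡⇒≤ (*-identityˡ 1ℚ))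
  0<ζ : 0ℚ < ζ
  0<ζ = 0<* (0<* (0<^ (Δ ℕ.+ Δ) 0<τ) (0<^ Δ 0<α)) (0<inv 0<2)
  0≤C₁ : 0ℚ ≤ C₁
  0≤C₁ = 0≤* (0≤+ 0≤1 (0≤⟦⟧ Δ)) (0≤^ Δ (0≤inv _))
  1≤inv-pm : 1ℚ ≤ inv pm
  1≤inv-pm = ≤-trans (≤-÷ 0<pm (≤-trans (≡⇒≤ (*-identityˡ pm)) pm≤1)) (≡⇒≤ (*-identityˡ _))
  1≤C₁ : 1ℚ ≤ C₁
  1≤C₁ = ≤-trans (≡⇒≤ (sym (*-identityˡ 1ℚ))) (*-mono 0≤1 (0≤^ Δ (0≤inv _)) (x≤x+y (0≤⟦⟧ Δ)) (1≤^ Δ 1≤inv-pm))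
  0≤C₅ : 0ℚ ≤ C₅
  0≤C₅ = 0≤+ (0≤* 0≤4 0≤C₁) (0≤⟦⟧ 40)
  1≤R : 1ℚ ≤ R
  1≤R = ≤-trans (≡⇒≤ (sym (*-identityˡ 1ℚ))) (*-mono 0≤1 (0≤inv _) (x≤x+y 0≤1) 1≤inv-pm)
  0<K : 0ℚ < K
  0<K = 0<^ Δ (ℚ.<-≤-trans 0<1 1≤R)
  0<c₀ : 0ℚ < c₀
  0<c₀ = 0<inv (0<* 0<2 (0<+ 0<1 (0≤⟦⟧ Δ)))
  c₀≤1 : c₀ ≤ 1ℚ
  c₀≤1 = ≤-trans (≡⇒≤ (sym (*-identityˡ _))) (÷-≤ (0<* 0<2 (0<+ 0<1 (0≤⟦⟧ Δ))) (≤-trans (≤-trans (≡⇒≤ (sym (*-identityˡ 1ℚ))) (*-mono 0≤1 (0≤+ 0≤1 (0≤⟦⟧ Δ)) (x≤x+y 0≤1) (x≤x+y (0≤⟦⟧ Δ)))) (≡⇒≤ (sym (*-identityˡ _)))))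

  -- The actual density of `G₀` instead of `d`: the bound `size≤` then holds with equality at the
  -- start.
  p₀ : ℚ
  p₀ = size G₀ * (ia * ib)

  ab-cancel : ∀ x → x * (⟦ a ⟧ * ⟦ b ⟧) * (ia * ib) ≡ x
  ab-cancel x = trans (lem x ⟦ a ⟧ ⟦ b ⟧ ia ib) (trans (cong₂ (λ s t → x * (s * t)) (*-inv 0<a) (*-inv 0<b)) (trans (cong (x *_) (*-identityˡ 1ℚ)) (*-identityʳ x)))
    where
    opaque
      unfolding _+_
      lem : ∀ x a b i j → x * (a * b) * (i * j) ≡ x * ((a * i) * (b * j))
      lem = solve-∀ ringℚ

  0≤iab : 0ℚ ≤ ia * ib
  0≤iab = 0≤* (0≤inv _) (0≤inv _)

  q≤p₀ : d - ε ≤ p₀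
  q≤p₀ = ≤-trans (≡⇒≤ (sym (ab-cancel _))) (*-monoʳ 0≤iab size-lower)
  p₀≤d+ε : p₀ ≤ d + ε
  p₀≤d+ε = ≤-trans (*-monoʳ 0≤iab size-upper) (≡⇒≤ (ab-cancel _))
  0<p₀ : 0ℚ < p₀
  0<p₀ = ℚ.<-≤-trans 0<q q≤p₀
  p₀≤1 : p₀ ≤ 1ℚ
  p₀≤1 = ≤-trans (*-monoʳ 0≤iab (≤-trans (∑-mono λ u → ∑-ind≤ (edge G₀ u)) (≡⇒≤ (trans (∑-const a ⟦ b ⟧) (sym (*-identityˡ _)))))) (≡⇒≤ (ab-cancel 1ℚ))
  size-G₀ : size G₀ ≡ p₀ * (⟦ a ⟧ * ⟦ b ⟧)
  size-G₀ = trans (sym (ab-cancel (size G₀))) (*-swap₂₃ _ _ _)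

  -- The last repair level. All tuples used by an embedding have it, and their common neighbourhoods
  -- in `G₀` are linear in `b`, so the predictions for them stay linear too.
  thick : List (Fin a) → Bool
  thick t = lev τ (Δ ℕ.+ Δ) t

  L : List (Stat a b)
  L = map inj₁ (filterᵇ thick (tuples a Δ)) ++ map inj₂ (allFin b)

  ∈L₁ : ∀ {t} → length t ℕ.≤ Δ → thick t ≡ true → inj₁ t ∈ L
  ∈L₁ {t} len th = ∈-++⁺ˡ (∈-map⁺ inj₁ (∈-filterᵇ⁺ thick (∈-tuples Δ t len) th))

  ∈L₂ : ∀ v → inj₂ v ∈ L
  ∈L₂ v = ∈-++⁺ʳ (map inj₁ (filterᵇ thick (tuples a Δ))) (∈-map⁺ inj₂ (∈-allFin v))

  L-elim : ∀ {P : Stat a b → Set} → (∀ t → length t ℕ.≤ Δ → thick t ≡ true → P (inj₁ t)) → (∀ v → P (inj₂ v)) → ∀ i → i ∈ L → P i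
  L-elim {P} f g i i∈ = cases (∈-++⁻ (map inj₁ (filterᵇ thick (tuples a Δ))) i∈)
    where
    cases : i ∈ map inj₁ (filterᵇ thick (tuples a Δ)) ⊎ i ∈ map inj₂ (allFin b) → P i
    cases (inj₁ p) = let t , t∈ , eq = ∈-map⁻ inj₁ p in
      subst P (sym eq) (f t (tuples-length Δ (proj₁ (∈-filterᵇ⁻ thick {tuples a Δ} t∈))) (proj₂ (∈-filterᵇ⁻ thick {tuples a Δ} t∈)))
    cases (inj₂ p) = let v , _ , eq = ∈-map⁻ inj₂ p in subst P (sym eq) (g v)

  length-L : ⟦ length L ⟧ ≤ (1ℚ + ⟦ a ⟧) ^ Δ + ⟦ b ⟧
  length-L = ≤-trans (≡⇒≤ (trans (cong ⟦_⟧ (trans (length-++ (map inj₁ (filterᵇ thick (tuples a Δ)))) (cong₂ ℕ._+_ (length-map inj₁ (filterᵇ thick (tuples a Δ))) (trans (length-map inj₂ (allFin b)) (length-allFin b))))) (⟦+⟧ _ b)))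
    (+-mono (≤-trans (⟦⟧-mono (length-filterᵇ thick (tuples a Δ))) (length-tuples a Δ)) ≤-refl)

  order≤Δ : ∀ i → i ∈ L → order i ℕ.≤ Δ
  order≤Δ = L-elim (λ t len _ → len) (λ _ → 1≤Δ)

  Λ : ℕ
  Λ = suc Λ′

  target : ℚ → Stat a b → ℚ
  target p i = value G₀ i * (p * inv p₀) ^ order i

  Φ : BipGraph a b → ℚ → Stat a b → ℚ
  Φ G p i = (target p i * inv (value G i)) ^ Λ

  -- `h` is the current relative error. It may grow as the density falls, but `h-bound` limits this
  -- growth to a power of `1 / p`, and with `p ≥ pm` it yields `h ≤ hmax` throughout.
  record State (G : BipGraph a b) (p h : ℚ) : Set where
    field
      αp₀≤p : α * p₀ ≤ p
      p≤1 : p ≤ 1ℚ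
      h₀≤h : h₀ ≤ h
      h-bound : h * p ^ M ≤ hmax * pm ^ M
      size≤ : size G ≤ p * (⟦ a ⟧ * ⟦ b ⟧)
      positive : ∀ i → i ∈ L → 0ℚ < value G i
      potential : ∑L L (Φ G p) ≤ (1ℚ + h) ^ Λ

  0≤value : ∀ (G : BipGraph a b) (i : Stat a b) → 0ℚ ≤ value G i
  0≤value G (inj₁ t) = 0≤N G t
  0≤value G (inj₂ v) = 0≤∑ λ u → 0≤ind (edge G u v)

  τ^b : ∀ i → i ℕ.≤ Δ ℕ.+ Δ → ε * ⟦ b ⟧ < τ ^ i * ⟦ b ⟧
  τ^b i i≤ = *-mono-< 0<b (ℚ.<-≤-trans ε<τ^ (^-anti (<⇒≤ 0<τ) τ≤1 i≤))

  0<τ^b : ∀ i → 0ℚ < τ ^ i * ⟦ b ⟧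
  0<τ^b i = 0<* (0<^ i 0<τ) 0<b

  start : State G₀ p₀ h₀
  start = record
    { αp₀≤p = ≤-trans (*-monoʳ (<⇒≤ 0<p₀) α≤1) (≡⇒≤ (*-identityˡ p₀))
    ; p≤1 = p₀≤1
    ; h₀≤h = ≤-refl
    ; h-bound = ≤-trans (≤-trans (*-monoˡ (<⇒≤ 0<h₀) (^-≤1 M (<⇒≤ 0<p₀) p₀≤1)) (≡⇒≤ (*-identityʳ _))) h₀≤
    ; size≤ = ≡⇒≤ size-G₀
    ; positive = positive₀
    ; potential = ≤-trans (≤-trans (∑L-mono L λ i i∈ → ≡⇒≤ (one i i∈)) (≡⇒≤ (trans (∑L-const L 1ℚ) (*-identityʳ _)))) (≤-trans length-L initial)
    }
    where
    positive₀ : ∀ i → i ∈ L → 0ℚ < value G₀ i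
    positive₀ = L-elim (λ t _ th → ℚ.<-≤-trans (0<τ^b (Δ ℕ.+ Δ)) (≤ᵇ⇒≤ th)) (λ v → ℚ.<-≤-trans (0<* 0<q 0<a) (degB-lower v))
    one : ∀ i → i ∈ L → Φ G₀ p₀ i ≡ 1ℚ
    one i i∈ = trans (cong (_^ Λ) (trans (cong (λ z → value G₀ i * z ^ order i * inv (value G₀ i)) (*-inv 0<p₀)) (trans (cong (λ z → value G₀ i * z * inv (value G₀ i)) (1^ (order i))) (trans (cong (_* inv (value G₀ i)) (*-identityʳ _)) (*-inv (positive₀ i i∈)))))) (1^ Λ)

  module Facts {G : BipGraph a b} {p h : ℚ} (state : State G p h) where
    open State state

    τ≤p₀ : τ ≤ p₀
    τ≤p₀ = ≤-trans τ≤q q≤p₀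
    pm≤p : pm ≤ p
    pm≤p = ≤-trans (*-monoˡ (<⇒≤ 0<α) τ≤p₀) αp₀≤p
    0<p : 0ℚ < p
    0<p = ℚ.<-≤-trans 0<pm pm≤p
    0<h : 0ℚ < h
    0<h = ℚ.<-≤-trans 0<h₀ h₀≤h
    0≤h : 0ℚ ≤ h
    0≤h = <⇒≤ 0<h
    h≤hmax : h ≤ hmax
    h≤hmax = *-cancelʳ (0<^ M 0<p) (≤-trans h-bound (*-monoˡ 0≤hmax (^-mono M (<⇒≤ 0<pm) pm≤p)))
      where
      0≤hmax : 0ℚ ≤ hmax
      0≤hmax = <⇒≤ (ℚ.≰⇒> λ q → ≤⇒≯ (≤-trans h₀≤ (≤-trans (*-monoʳ (0≤^ M (<⇒≤ 0<pm)) q) (≡⇒≤ (*-zeroˡ _)))) 0<h₀)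

    η : ℚ
    η = ⟦ 3 ⟧ * h
    0≤η : 0ℚ ≤ η
    0≤η = 0≤* (0≤⟦⟧ 3) 0≤h
    η≤1 : η ≤ 1ℚ
    η≤1 = ≤-trans (*-monoˡ (0≤⟦⟧ 3) h≤hmax) 3hmax≤1
    h≤η : h ≤ η
    h≤η = ≤-trans (≡⇒≤ (sym (*-identityˡ h))) (*-monoʳ 0≤h (1≤⟦⟧ (s≤s z≤n)))
    h≤1 : h ≤ 1ℚ
    h≤1 = ≤-trans h≤η η≤1

    0≤p/p₀ : 0ℚ ≤ p * inv p₀
    0≤p/p₀ = 0≤* (<⇒≤ 0<p) (0≤inv _)
    0≤target : ∀ i → 0ℚ ≤ target p i
    0≤target i = 0≤* (0≤value G₀ i) (0≤^ (order i) 0≤p/p₀)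

    0≤Φ : ∀ i → 0ℚ ≤ Φ G p i
    0≤Φ i = 0≤^ Λ (0≤* (0≤target i) (0≤inv _))

    -- A single non-negative summand is at most the whole potential; its `Λ`-th root is the claim.
    -- Taking the root needs a positive exponent, hence the form `suc Λ′`.
    target≤ : ∀ i → i ∈ L → target p i ≤ (1ℚ + h) * value G i
    target≤ i i∈ = ÷-≤⁻¹ (positive i i∈) (^-cancel Λ′ (0≤+ 0≤1 0≤h) (≤-trans (f≤∑L {f = Φ G p} 0≤Φ i∈) potential))

    -- (1 + h₀)(1 + h) ≤ 1 + 3h
    1+3h : ∀ {x y z} → 0ℚ ≤ z → x ≤ (1ℚ + h₀) * y → y ≤ (1ℚ + h) * z → x ≤ (1ℚ + η) * z
    1+3h {x} {y} {z} 0≤z p₁ p₂ = ≤-trans p₁ (≤-trans (*-monoˡ (0≤+ 0≤1 (<⇒≤ 0<h₀)) p₂) (≤-trans (≡⇒≤ (sym (*-assoc _ _ _))) (*-monoʳ 0≤z (≤-trans (*-monoʳ (0≤+ 0≤1 0≤h) (+-mono ≤-refl h₀≤h))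
      (≤-by (h * (1ℚ - h)) (0≤* 0≤h (0≤- h≤1)) (lem h))))))
      where
      opaque
        unfolding _+_ ⟦_⟧
        lem : ∀ h → 1ℚ + ⟦ 3 ⟧ * h ≡ (1ℚ + h) * (1ℚ + h) + h * (1ℚ - h)
        lem = solve-∀ ringℚ

    p₀^≤ : ∀ k → k ℕ.≤ Δ → p₀ ^ k ≤ (1ℚ + h₀) * (d - ε) ^ k
    p₀^≤ k k≤Δ = ≤-trans (^-mono k (<⇒≤ 0<p₀) p₀≤d+ε) (ratio k k≤Δ)

    p^k : ∀ k → p ^ k ≡ (p * inv p₀) ^ k * p₀ ^ k
    p^k k = trans (cong (_^ k) (sym (*-inv-cancel′ p 0<p₀))) (^-distrib-* (p * inv p₀) p₀ k)

    -- Of the two factors of `p ^ k = (p / p₀) ^ k * p₀ ^ k` the first belongs to `target`, and the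
    -- second is replaced by `(d - ε) ^ k` at the price of `1 + h₀`.
    scaled : ∀ i n → i ∈ L → order i ℕ.≤ Δ → (d - ε) ^ order i * n ≤ value G₀ i → 0ℚ ≤ n → p ^ order i * n ≤ (1ℚ + η) * value G i
    scaled i n i∈ k≤Δ le 0≤n = 1+3h (0≤value G i) (
      p ^ k * n ≡⟨ cong (_* n) (p^k k) ⟩≤
      (p * inv p₀) ^ k * p₀ ^ k * n ≤⟨ *-monoʳ 0≤n (*-monoˡ (0≤^ k 0≤p/p₀) (p₀^≤ k k≤Δ)) ⟩
      (p * inv p₀) ^ k * ((1ℚ + h₀) * (d - ε) ^ k) * n ≡⟨ lem ((p * inv p₀) ^ k) (1ℚ + h₀) ((d - ε) ^ k) n ⟩≤
      (1ℚ + h₀) * ((d - ε) ^ k * n * (p * inv p₀) ^ k) ≤⟨ *-monoˡ (0≤+ 0≤1 (<⇒≤ 0<h₀)) (*-monoʳ (0≤^ k 0≤p/p₀) le) ⟩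
      (1ℚ + h₀) * target p i ■) (target≤ i i∈)
      where
      k = order i
      opaque
        unfolding _+_
        lem : ∀ x h q n → x * (h * q) * n ≡ h * (q * n * x)
        lem = solve-∀ ringℚ

    deg-lower : ∀ v → p * ⟦ a ⟧ ≤ (1ℚ + η) * degB G v
    deg-lower v = ≤-trans (≡⇒≤ (cong (_* ⟦ a ⟧) (sym (*-identityʳ p)))) (scaled (inj₂ v) ⟦ a ⟧ (∈L₂ v) 1≤Δ (≤-trans (≡⇒≤ (cong (_* ⟦ a ⟧) (*-identityʳ (d - ε)))) (degB-lower v)) (0≤⟦⟧ a))

    typ⇒lev : ∀ t → length t ℕ.≤ Δ → typ t ≡ true → lev τ Δ t ≡ true
    typ⇒lev t len ty = ≤⇒≤ᵇ (≤-trans (*-monoʳ (0≤⟦⟧ b) (≤-trans (^-anti (<⇒≤ 0<τ) τ≤1 len) (^-mono (length t) (<⇒≤ 0<τ) τ≤q))) (≤ᵇ⇒≤ ty))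

    lev-mono : ∀ {i j t} → i ℕ.≤ j → lev τ i t ≡ true → lev τ j t ≡ true
    lev-mono i≤j l = ≤⇒≤ᵇ (≤-trans (*-monoʳ (0≤⟦⟧ b) (^-anti (<⇒≤ 0<τ) τ≤1 i≤j)) (≤ᵇ⇒≤ l))

    lev-⊆ : ∀ {i s t} → (∀ u → u ∈ s → u ∈ t) → lev τ i t ≡ true → lev τ i s ≡ true
    lev-⊆ {t = t} s⊆t l = ≤⇒≤ᵇ (≤-trans (≤ᵇ⇒≤ l) (N-⊆ G₀ {t = t} s⊆t))

    typ-N : ∀ t → length t ℕ.≤ Δ → typ t ≡ true → p ^ length t * ⟦ b ⟧ ≤ (1ℚ + η) * N G t
    typ-N t len ty = scaled (inj₁ t) ⟦ b ⟧ (∈L₁ len (lev-mono {t = t} (ℕ.m≤m+n Δ Δ) (typ⇒lev t len ty))) len (≤ᵇ⇒≤ ty) (0≤⟦⟧ b)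

    typ-mono : ∀ {s t} → (∀ u → u ∈ s → u ∈ t) → length t ℕ.≤ length s → typ t ≡ true → typ s ≡ true
    typ-mono {t = t} s⊆t len ty = ≤⇒≤ᵇ (≤-trans (*-monoʳ (0≤⟦⟧ b) (^-anti (<⇒≤ 0<q) q≤1 len)) (≤-trans (≤ᵇ⇒≤ ty) (N-⊆ G₀ {t = t} s⊆t)))

    through : ∀ u k → suc k ℕ.≤ Δ → avg k (λ t → ind (not (typ (u ∷ t)))) ≤ ⟦ Δ ⟧ * ε
    through u k k<Δ = ≤-trans (few-atypical-through u k (ℚ.<-≤-trans (τ^b (suc k) (ℕ.≤-trans k<Δ (ℕ.m≤m+n Δ Δ))) (*-monoʳ (0≤⟦⟧ b) (^-mono (suc k) (<⇒≤ 0<τ) τ≤q)))) (*-monoʳ 0≤ε (⟦⟧-mono (ℕ.<⇒≤ k<Δ)))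

    ext : ∀ i t → i ℕ.< Δ ℕ.+ Δ → lev τ i t ≡ true → ∑ (λ u → ind (not (lev τ (suc i) (u ∷ t)))) ≤ ε * ⟦ a ⟧
    ext i t i< l = few-nonextensions (<⇒≤ 0<τ) τ≤q i t (τ^b i (ℕ.<⇒≤ i<)) l

    α≤p/p₀ : α ≤ p * inv p₀
    α≤p/p₀ = ≤-÷ 0<p₀ αp₀≤p

    halve : ∀ {x y} → 0ℚ ≤ y → x ≤ (1ℚ + h) * y → x * inv 2ℚ ≤ y
    halve {x} {y} 0≤y le = ÷-≤ 0<2 (≤-trans le (≤-trans (*-monoʳ 0≤y (+-mono ≤-refl h≤1)) (≡⇒≤ (*-comm _ _))))

    lev-N : ∀ t → length t ℕ.≤ Δ → lev τ (Δ ℕ.+ Δ) t ≡ true → ζ * ⟦ b ⟧ ≤ N G t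
    lev-N t len l = ≤-trans (≡⇒≤ (lem (τ ^ (Δ ℕ.+ Δ)) (α ^ Δ) (inv 2ℚ) ⟦ b ⟧)) (halve (0≤N G t) (≤-trans (*-mono (<⇒≤ (0<τ^b (Δ ℕ.+ Δ))) (0≤^ (length t) 0≤p/p₀) (≤ᵇ⇒≤ l) (≤-trans (^-anti (<⇒≤ 0<α) α≤1 len) (^-mono (length t) (<⇒≤ 0<α) α≤p/p₀))) (target≤ (inj₁ t) (∈L₁ len l))))
      where
      opaque
        unfolding _+_
        lem : ∀ x y i b → x * y * i * b ≡ x * b * y * i
        lem = solve-∀ ringℚ

    deg-pm : ∀ v → pm * ⟦ a ⟧ * inv 2ℚ ≤ degB G v
    deg-pm v = ÷-≤ 0<2 (≤-trans (*-monoʳ (0≤⟦⟧ a) pm≤p) (≤-trans (deg-lower v) (≤-trans (*-monoʳ (0≤value G (inj₂ v)) (+-mono ≤-refl η≤1)) (≡⇒≤ (*-comm _ _)))))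

    0<pm/2 : 0ℚ < pm * ⟦ a ⟧ * inv 2ℚ
    0<pm/2 = 0<* (0<* 0<pm 0<a) (0<inv 0<2)

    K-bound : ∀ v k → k ℕ.≤ Δ → (⟦ a ⟧ * inv (degB G v)) ^ k ≤ K
    K-bound v k k≤Δ = ≤-trans (^-mono k (0≤* (0≤⟦⟧ a) (0≤inv _)) a/deg≤R) (^-monoʳ 1≤R k≤Δ)
      where
      opaque
        unfolding _+_
        lem : ∀ t i x a j → t * i * (x * a * j) ≡ t * j * (x * i) * a
        lem = solve-∀ ringℚ
      a/deg≤R : ⟦ a ⟧ * inv (degB G v) ≤ R
      a/deg≤R = ÷-≤ (ℚ.<-≤-trans 0<pm/2 (deg-pm v)) (≤-trans (≡⇒≤ (sym (trans (lem 2ℚ (inv pm) pm ⟦ a ⟧ (inv 2ℚ)) (trans (cong₂ (λ s t → s * t * ⟦ a ⟧) (*-inv 0<2) (*-inv 0<pm)) (trans (cong (_* ⟦ a ⟧) (*-identityˡ 1ℚ)) (*-identityˡ _))))))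
        (*-monoˡ (≤-trans 0≤1 1≤R) (deg-pm v)))

    ζ≤pm/2 : ζ ≤ pm * inv 2ℚ
    ζ≤pm/2 = *-monoʳ (0≤inv _) (≤-trans (≡⇒≤ (*-comm _ _)) (*-mono (0≤^ Δ (<⇒≤ 0<α)) (<⇒≤ 0<τ) (≤-trans (^-anti (<⇒≤ 0<α) α≤1 1≤Δ) (≡⇒≤ (*-identityʳ α))) (≤-trans (^-anti (<⇒≤ 0<τ) τ≤1 (ℕ.≤-trans 1≤Δ (ℕ.m≤m+n Δ Δ))) (≡⇒≤ (*-identityʳ τ)))))

    ζa≤value : ∀ i → i ∈ L → ζ * ⟦ a ⟧ ≤ value G i
    ζa≤value = L-elim (λ t len th → ≤-trans (*-monoˡ (<⇒≤ 0<ζ) a≤b) (lev-N t len th)) (λ v → ≤-trans (*-monoʳ (0≤⟦⟧ a) ζ≤pm/2) (≤-trans (≡⇒≤ (*-swap₂₃ pm (inv 2ℚ) ⟦ a ⟧)) (deg-pm v)))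

    C₁-bound : (1ℚ + ⟦ Δ ⟧) * inv p ^ Δ ≤ C₁
    C₁-bound = *-monoˡ (0≤+ 0≤1 (0≤⟦⟧ Δ)) (^-mono Δ (0≤inv p) (inv-anti 0<pm pm≤p))

    4C₁η≤ : 4ℚ * (C₁ * η) ≤ c₀ * inv 8ℚ
    4C₁η≤ = ≤-trans (*-monoˡ 0≤4 (*-monoˡ 0≤C₁ (*-monoˡ (0≤⟦⟧ 3) h≤hmax))) C₁-small

    4C₁η≤1 : 4ℚ * (C₁ * η) ≤ 1ℚ
    4C₁η≤1 = ≤-trans 4C₁η≤ (÷-≤ 0<8 (≤-trans c₀≤1 (≤-trans (x≤x+y 0≤1) (≤-trans (x≤x+y 0≤2) (≤-trans (x≤x+y 0≤4) (≡⇒≤ (sym (*-identityˡ 8ℚ))))))))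

    ζ₁-facts : 0ℚ < 1ℚ - (C₁ * η + C₁ * η) × inv (1ℚ - (C₁ * η + C₁ * η)) ≤ 1ℚ + 4ℚ * (C₁ * η)
    ζ₁-facts = inv-ζ₁ (0≤* 0≤C₁ 0≤η) 4C₁η≤1

    columns : inv (1ℚ - (C₁ * η + C₁ * η)) * (1ℚ - c₀ * inv 2ℚ) + inv (ζ * inv 2ℚ) * (K * (⟦ Δ ⟧ * (2ℚ * (⟦ Δ ⟧ * ξ * ⟦ Δ ⟧)))) ≤ 1ℚ
    -- `(1 + c₀ / 4) (1 - c₀ / 2) + c₀ / 4 = 1 - c₀² / 8`.
    columns = ≤-trans (+-mono (*-monoʳ 0≤1-c₀/2 (≤-trans (proj₂ ζ₁-facts) (+-mono ≤-refl 4C₁η≤))) small-columns) (≤-trans (+-mono (*-mono (0≤+ 0≤1 (0≤* (<⇒≤ 0<c₀) (0≤inv _))) 0≤1-c₀/2 (+-mono ≤-refl (*-monoˡ (<⇒≤ 0<c₀) inv8≤inv4)) ≤-refl) ≤-refl) (≤-by (c₀ * c₀ * (inv 4ℚ * inv 2ℚ)) (0≤* (0≤square c₀) (0≤* (0≤inv _) (0≤inv _))) (trans (trans (lem₀ c₀ (inv 4ℚ)) (cong (λ z → 1ℚ + (c₀ * (inv 4ℚ + inv 4ℚ) - c₀ * z)) inv2≡)) (lem c₀ (inv 4ℚ) (inv 2ℚ)))))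
      where
      0≤1-c₀/2 : 0ℚ ≤ 1ℚ - c₀ * inv 2ℚ
      0≤1-c₀/2 = 0≤- (÷-≤ 0<2 (≤-trans c₀≤1 (≤-trans (x≤x+y 0≤1) (≡⇒≤ (sym (*-identityˡ 2ℚ))))))
      inv8≤inv4 : inv 8ℚ ≤ inv 4ℚ
      inv8≤inv4 = inv-anti 0<4 (x≤x+y 0≤4)
      opaque
        unfolding _+_
        lem₀ : ∀ c q → 1ℚ ≡ 1ℚ + (c * (q + q) - c * (q + q))
        lem₀ = solve-∀ ringℚ
        lem : ∀ c q t → 1ℚ + (c * (q + q) - c * t) ≡ (1ℚ + c * q) * (1ℚ - c * t) + c * q + c * c * (q * t)
        lem = solve-∀ ringℚ
        lem₂ : ∀ q → q * (2ℚ + 2ℚ) ≡ (q + q) * 2ℚ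
        lem₂ = solve-∀ ringℚ
      inv2≡ : inv 4ℚ + inv 4ℚ ≡ inv 2ℚ
      inv2≡ = trans (sym (*-inv-cancel (inv 4ℚ + inv 4ℚ) 0<2)) (trans (cong (_* inv 2ℚ) (trans (sym (lem₂ (inv 4ℚ))) (trans (*-comm _ _) (*-inv 0<4)))) (*-identityˡ _))

    total-bound : inv (1ℚ - (C₁ * η + C₁ * η)) * ((1ℚ + 4ℚ * h₀) * (κ * (1ℚ + η))) + inv (ζ * inv 2ℚ) * (K * (⟦ Δ ⟧ * ω)) ≤ 1ℚ + C₅ * η
    total-bound = ≤-trans (+-mono (*-monoʳ (0≤* (0≤+ 0≤1 (0≤* 0≤4 (<⇒≤ 0<h₀))) (0≤* 0≤κ (0≤+ 0≤1 0≤η))) (proj₂ ζ₁-facts)) ≤-refl)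
      (≤-trans (total-factor (0≤* 0≤4 (0≤* 0≤C₁ 0≤η)) 4C₁η≤1 0≤κ (<⇒≤ 0<h₀) (≤-trans h₀≤h h≤η) η≤1 κ≤1+h₀ small-total) (≡⇒≤ (cong (1ℚ +_) (trans (cong (_+ ⟦ 40 ⟧ * η) (sym (*-assoc 4ℚ C₁ η))) (sym (*-distribʳ-+ η (4ℚ * C₁) ⟦ 40 ⟧))))))
      where
      0≤κ : 0ℚ ≤ κ
      0≤κ = ≤-trans 0≤1 1≤κ

    -- Up to the factor `Λ`, minus the derivative of `Φ` with respect to `value G i`.
    φ : Stat a b → ℚ
    φ i = Φ G p i * inv (value G i)

    0≤φ : ∀ i → 0ℚ ≤ φ i
    0≤φ i = 0≤* (0≤Φ i) (0≤inv _)

    w : Fin a → Fin b → ℚ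
    w u v = ∑L L λ i → φ i * share G i u v

    -- The right-hand side is, up to `Λ`, the rate at which the falling predictions lower the
    -- potential. Removing a random edge set therefore leaves the potential unchanged to first
    -- order.
    ∑w : ∑ (λ u → ∑ (w u)) ≡ ∑L L (λ i → Φ G p i * ⟦ order i ⟧)
    ∑w = trans (∑-cong λ u → sym (∑L-∑ L (λ i v → φ i * share G i u v))) (trans (sym (∑L-∑ L (λ i u → ∑ λ v → φ i * share G i u v))) (∑L-cong∈ L λ i i∈ →
      trans (∑-cong λ u → ∑-*ˡ (φ i) (share G i u)) (trans (∑-*ˡ (φ i) _) (trans (cong (φ i *_) (∑-share G i)) (trans (lem (Φ G p i) (inv (value G i)) ⟦ order i ⟧ (value G i)) (trans (cong (Φ G p i * ⟦ order i ⟧ *_) (*-inv (positive i i∈))) (*-identityʳ _)))))))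
      where
      opaque
        unfolding _+_
        lem : ∀ f i k v → f * i * (k * v) ≡ f * k * (v * i)
        lem = solve-∀ ringℚ

    0<W : 0ℚ < ∑ (λ u → ∑ (w u))
    0<W = ℚ.<-≤-trans (0<* 0<Φv (0<⟦suc⟧ 0)) (≤-trans (f≤∑L {f = λ i → Φ G p i * ⟦ order i ⟧} (λ i → 0≤* (0≤Φ i) (0≤⟦⟧ _)) (∈L₂ v₀)) (≡⇒≤ (sym ∑w)))
      where
      v₀ : Fin b
      v₀ = fromℕ< 1≤b
      0<Φv : 0ℚ < Φ G p (inj₂ v₀)
      0<Φv = 0<^ Λ (0<* (0<* (ℚ.<-≤-trans (0<* 0<q 0<a) (degB-lower v₀)) (0<^ 1 (0<* 0<p (0<inv 0<p₀)))) (0<inv (positive (inj₂ v₀) (∈L₂ v₀))))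

  module Advance {G : BipGraph a b} {p h : ℚ} (state : State G p h) (J : BipGraph a b) (fits : JobFits J Δ c₀)
    (0<e : 0ℚ < size J) (enough : α * p₀ ≤ p - size J * (ia * ib)) where
    open State state
    open Facts state
    open JobFits fits

    setting : Setting G J Δ
    setting = record
      { 1≤a = 1≤a ; 1≤b = 1≤b ; b≤2a = b≤2a ; 1≤Δ = 1≤Δ ; bounded = bounded ; 0<e = 0<e
      ; κ₀ = κ₀ ; κ = κ ; Cκ = Cκ ; 0≤κ₀ = 0≤κ₀ ; κ₀-bound = κ₀-bound ; κ₀^≤κ = κ₀^≤κ ; 1≤κ = 1≤κ ; κ≤2 = κ≤2 ; κ-1≤ = κ-1≤
      ; p = p ; η = η ; 0<p = 0<p ; 0≤η = 0≤η ; deg-lower = deg-lower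
      ; K = K ; 0<K = 0<K ; K-bound = K-bound
      ; typ = typ ; typ-[] = typ-[] ; typ-mono = λ {s} {t} → typ-mono {s} {t}
      ; ε₁ = ⟦ Δ ⟧ * ε ; 0<ε₁ = 0<* 0<Δ 0<ε ; through = through
      ; w = w ; 0≤w = λ u v → 0≤∑L L λ i → 0≤* (0≤φ i) (0≤share G i u v)
      ; w-edge = λ u v ne → ∑L-zero L λ i _ → trans (cong (φ i *_) (share-edge G i u v ne)) (*-zeroʳ _)
      ; 0<W = 0<W
      ; ν = h₀ ; 0<ν = 0<h₀ ; 4ν≤1 = 4h₀≤1
      }

    few-active : ∑ (λ y → ind (Selection.active setting y)) ≤ (1ℚ - c₀) * ⟦ b ⟧
    few-active = ≤-trans (∑-mono λ y → ind-mono {Selection.active setting y} λ q → lem y (Job.nb J Δ bounded y) refl q) slack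
      where
      lem : ∀ y xs → Job.nb J Δ bounded y ≡ xs → Selection.nonempty setting (Job.nb J Δ bounded y) ≡ true → nonisolated J y ≡ true
      lem y [] eq q = ⊥-elim (true≢false q (cong (Selection.nonempty setting) eq))
      lem y (x ∷ xs) eq _ = anyF⁺ {P = λ x → edge J x y} x (Job.∈nb⁻ J Δ bounded (subst (x ∈_) (sym eq) (here refl)))

    completion : Completion setting
    completion = record
      { a≤b = a≤b ; p≤1 = p≤1 ; size≤ = size≤ ; typ-N = typ-N
      ; lev = lev τ ; lev-⊆ = λ {i} {s} {t} → lev-⊆ {i} {s} {t} ; lev-mono = λ {i} {j} {t} → lev-mono {i} {j} {t} ; typ⇒lev = typ⇒lev
      ; ε = ε ; 0≤ε = 0≤ε ; ext = ext
      ; ζ = ζ ; 0<ζ = 0<ζ ; lev-N = lev-N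
      ; c₀ = c₀ ; 0<c₀ = 0<c₀ ; few-active = few-active
      ; C₁ = C₁ ; C₅ = C₅ ; ρ = ρ ; Omax = Omax ; C₁-bound = C₁-bound
      ; 0≤ρ = 0≤ρ ; ε₁≤ρ = ε₁≤ρ ; devF-small = devF-small ; room = room
      ; Omax-bound = Omax-bound
      ; Omax-small₁ = ≤-trans Omax-h₀ (≤-trans (≤-trans h₀≤h h≤η) (≤-trans (≡⇒≤ (sym (*-identityˡ η))) (*-monoʳ 0≤η 1≤C₁)))
      ; Omax-small₂ = Omax-ζ
      ; 0<ζ₁ = proj₁ ζ₁-facts ; columns = columns ; total-bound = total-bound
      }

    W e θ p′ h′ : ℚ
    W = ∑ (λ u → ∑ (w u))
    e = size J
    θ = e * (ia * ib) * inv p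
    p′ = p - e * (ia * ib)
    h′ = h * (1ℚ + ⟦ M ⟧ * θ)

    opaque
      embedding : Embedding G J w ((1ℚ + C₅ * η) * (inv p * (e * (W * (ia * ib)))))
      embedding = Embed.embedding setting completion

    module Em = Embedding embedding
    module Rm = Removal G J Δ 1≤Δ bounded Em.σ Em.τ Em.σ-injective Em.τ-injective Em.edges-to-edges

    G′ : BipGraph a b
    G′ = Rm.G′

    0≤θ : 0ℚ ≤ θ
    0≤θ = 0≤* (0≤* (<⇒≤ 0<e) 0≤iab) (0≤inv p)

    e*ia≤Δ : e * ia ≤ ⟦ Δ ⟧
    e*ia≤Δ = ÷-≤ 0<a (≤-trans (∑-mono (Bounded.degA≤ bounded)) (≡⇒≤ (trans (∑-const a ⟦ Δ ⟧) (*-comm _ _))))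

    θ≤ : θ ≤ ⟦ Δ ⟧ * (inv pm * ib)
    θ≤ = ≤-trans (≡⇒≤ (lem e ia ib (inv p))) (*-mono (0≤* (<⇒≤ 0<e) (0≤inv _)) (0≤* (0≤inv _) (0≤inv _)) e*ia≤Δ (*-monoʳ (0≤inv _) (inv-anti 0<pm pm≤p)))
      where
      opaque
        unfolding _+_
        lem : ∀ e i j q → e * (i * j) * q ≡ e * i * (q * j)
        lem = solve-∀ ringℚ

    Λθ≤ : ⟦ Λ ⟧ * (⟦ Δ ⟧ * θ) ≤ h₀
    Λθ≤ = ≤-trans (*-monoˡ (0≤⟦⟧ Λ) (*-monoˡ (0≤⟦⟧ Δ) θ≤)) Λθ-small

    h₀≤1 : h₀ ≤ 1ℚ
    h₀≤1 = ≤-trans h₀≤h h≤1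

    θ≤1 : θ ≤ 1ℚ
    θ≤1 = ≤-trans (≤-trans (≡⇒≤ (trans (sym (*-identityˡ θ)) (sym (*-identityˡ _)))) (*-mono 0≤1 (0≤* (0≤⟦⟧ Δ) 0≤θ) (1≤⟦⟧ (s≤s z≤n)) (*-monoʳ 0≤θ (1≤⟦⟧ 1≤Δ)))) (≤-trans Λθ≤ h₀≤1)

    p*θ : p * θ ≡ e * (ia * ib)
    p*θ = trans (*-comm p θ) (*-inv-cancel′ _ 0<p)

    p′≡ : p′ ≡ p * (1ℚ - θ)
    p′≡ = trans (cong (λ z → p - z) (sym p*θ)) (lem p θ)
      where
      opaque
        unfolding _+_
        lem : ∀ p t → p - p * t ≡ p * (1ℚ - t)
        lem = solve-∀ ringℚ

    C : Stat a b → ℚ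
    C i = Rm.lost (share G i)

    C≤ : ∀ i → i ∈ L → C i ≤ ⟦ Δ ⟧ * ⟦ Δ ⟧
    C≤ i i∈ = Rm.lost-share≤ i (order≤Δ i i∈)

    C<value : ∀ i → i ∈ L → C i < value G i
    C<value i i∈ = ℚ.≤-<-trans (C≤ i i∈) (ℚ.<-≤-trans Δ²<ζa (ζa≤value i i∈))

    weight : ∑L L (λ i → Φ G p i * (C i * inv (value G i))) ≤ (1ℚ + C₅ * η) * (θ * ∑L L (λ i → Φ G p i * ⟦ order i ⟧))
    weight = ≤-trans (≡⇒≤ (trans (∑L-cong L λ i → lem₁ (Φ G p i) (C i) (inv (value G i))) (sym (Rm.lost-∑L L φ (share G)))))
      (≤-trans Em.weight≤ (≡⇒≤ (cong ((1ℚ + C₅ * η) *_) (trans (lem₂ (inv p) e W ia ib) (cong (θ *_) ∑w)))))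
      where
      opaque
        unfolding _+_
        lem₁ : ∀ f c i → f * (c * i) ≡ f * i * c
        lem₁ = solve-∀ ringℚ
        lem₂ : ∀ q e w i j → q * (e * (w * (i * j))) ≡ e * (i * j) * q * w
        lem₂ = solve-∀ ringℚ

    1≤C₅ : 1ℚ ≤ C₅
    1≤C₅ = ≤-trans (1≤⟦⟧ (s≤s z≤n)) (y≤x+y (0≤* 0≤4 0≤C₁))

    module PS = PotentialStep L Λ Δ order (target p) (value G) (value G′) C θ h₀ (C₅ * η)
      0≤θ θ≤1 (<⇒≤ 0<h₀) h₀≤1 (≤-trans (≤-trans h₀≤h h≤η) (≤-trans (≡⇒≤ (sym (*-identityˡ η))) (*-monoʳ 0≤η 1≤C₅)))
      order≤Δ 0≤target positive (λ i → Rm.0≤lost (0≤share G i)) C<value (λ i _ → Rm.value-lost i)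
      (λ i i∈ → ≤-trans (*-monoˡ 0≤2 (*-monoˡ (0≤⟦⟧ Λ) (C≤ i i∈))) (≤-trans Λ-small (*-monoˡ (<⇒≤ 0<h₀) (ζa≤value i i∈))))
      Λθ≤ weight

    potential′ : ∑L L (Φ G′ p′) ≤ (1ℚ + h′) ^ Λ
    potential′ =
      ∑L L (Φ G′ p′) ≡⟨ ∑L-cong L (λ i → cong (λ z → (z * inv (value G′ i)) ^ Λ) (target′ i)) ⟩≤
      ∑L L (λ i → (target p i * (1ℚ - θ) ^ order i * inv (value G′ i)) ^ Λ) ≤⟨ PS.Ψ-step ⟩
      ∑L L (Φ G p) * (1ℚ + X) ^ Λ ≤⟨ *-monoʳ (0≤^ Λ (0≤+ 0≤1 0≤X)) potential ⟩
      (1ℚ + h) ^ Λ * (1ℚ + X) ^ Λ ≡⟨ sym (^-distrib-* (1ℚ + h) (1ℚ + X) Λ) ⟩≤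
      ((1ℚ + h) * (1ℚ + X)) ^ Λ ≤⟨ ^-mono Λ (0≤* (0≤+ 0≤1 0≤h) (0≤+ 0≤1 0≤X)) grow ⟩
      (1ℚ + h′) ^ Λ ■
      where
      X = 4ℚ * (⟦ Δ ⟧ * (C₅ * η)) * θ
      0≤X : 0ℚ ≤ X
      0≤X = 0≤* (0≤* 0≤4 (0≤* (0≤⟦⟧ Δ) (0≤* 0≤C₅ 0≤η))) 0≤θ
      opaque
        unfolding _+_ ⟦_⟧
        lem₂ : ∀ h x → 1ℚ + (h + 2ℚ * x) ≡ (1ℚ + h) * (1ℚ + x) + x * (1ℚ - h)
        lem₂ = solve-∀ ringℚ
        lem₃ : ∀ h d c θ m → h * (1ℚ + m * θ) ≡ h + 2ℚ * (4ℚ * (d * (c * (⟦ 3 ⟧ * h))) * θ) + h * θ * (m - ⟦ 24 ⟧ * (d * c))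
        lem₃ = solve-∀ ringℚ
      target′ : ∀ i → target p′ i ≡ target p i * (1ℚ - θ) ^ order i
      target′ i = trans (cong (λ z → value G₀ i * z ^ order i) (trans (cong (_* inv p₀) p′≡) (*-swap₂₃ p (1ℚ - θ) (inv p₀)))) (trans (cong (value G₀ i *_) (^-distrib-* (p * inv p₀) (1ℚ - θ) (order i))) (sym (*-assoc _ _ _)))
      -- `2X = 24 Δ C₅ h θ` is the origin of the constant in `M-bound`: 4 comes from `Ψ-step`, 3
      -- from `η`, and 2 from using `h ≤ 1` here.
      grow : (1ℚ + h) * (1ℚ + X) ≤ 1ℚ + h′
      grow = ≤-trans (≤-by (X * (1ℚ - h)) (0≤* 0≤X (0≤- h≤1)) (lem₂ h X)) (+-mono ≤-refl (≤-by (h * θ * (⟦ M ⟧ - ⟦ 24 ⟧ * (⟦ Δ ⟧ * C₅))) (0≤* (0≤* 0≤h 0≤θ) (0≤- M-bound)) (lem₃ h ⟦ Δ ⟧ C₅ θ ⟦ M ⟧)))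

    -- By Bernoulli `(1 + M θ) (1 - θ) ^ M ≤ ((1 + θ) (1 - θ)) ^ M ≤
    -- 1`, so the growth of `h` is offset by the decrease of `p`.
    h-bound′ : h′ * p′ ^ M ≤ hmax * pm ^ M
    h-bound′ = ≤-trans (
      h * (1ℚ + ⟦ M ⟧ * θ) * p′ ^ M ≡⟨ trans (cong (λ z → h * (1ℚ + ⟦ M ⟧ * θ) * z) (trans (cong (_^ M) p′≡) (^-distrib-* p (1ℚ - θ) M))) (lem h (1ℚ + ⟦ M ⟧ * θ) (p ^ M) ((1ℚ - θ) ^ M)) ⟩≤
      h * p ^ M * ((1ℚ + ⟦ M ⟧ * θ) * (1ℚ - θ) ^ M) ≤⟨ *-monoˡ (0≤* 0≤h (0≤^ M (<⇒≤ 0<p))) (≤-trans (*-monoʳ (0≤^ M (0≤- θ≤1)) (bernoulli⁺ M 0≤θ)) (≤-trans (≡⇒≤ (sym (^-distrib-* (1ℚ + θ) (1ℚ - θ) M))) (^-≤1 M (0≤* (0≤+ 0≤1 0≤θ) (0≤- θ≤1)) (≤-by (θ * θ) (0≤square θ) (lem₂ θ))))) ⟩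
      h * p ^ M * 1ℚ ≡⟨ *-identityʳ _ ⟩≤
      h * p ^ M ■) h-bound
      where
      opaque
        unfolding _+_
        lem : ∀ h x p t → h * x * (p * t) ≡ h * p * (x * t)
        lem = solve-∀ ringℚ
        lem₂ : ∀ θ → 1ℚ ≡ (1ℚ + θ) * (1ℚ - θ) + θ * θ
        lem₂ = solve-∀ ringℚ

    next : State G′ p′ h′
    next = record
      { αp₀≤p = enough
      ; p≤1 = ≤-trans (x-y≤x (0≤* (<⇒≤ 0<e) 0≤iab)) p≤1
      ; h₀≤h = ≤-trans h₀≤h (≤-trans (≡⇒≤ (sym (*-identityʳ h))) (*-monoˡ 0≤h (x≤x+y (0≤* (0≤⟦⟧ M) 0≤θ))))
      ; h-bound = h-bound′
      ; size≤ = ≤-trans Rm.size-removed (≤-trans (+-mono size≤ ≤-refl) (≡⇒≤ (trans (cong (λ z → p * (⟦ a ⟧ * ⟦ b ⟧) - z) (trans (sym (ab-cancel e)) (*-swap₂₃ _ _ _))) (lem p (⟦ a ⟧ * ⟦ b ⟧) (e * (ia * ib))))))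
      ; positive = λ i i∈ → ℚ.<-≤-trans (0<- (C<value i i∈)) (Rm.value-lost i)
      ; potential = potential′
      }
      where
      opaque
        unfolding _+_
        lem : ∀ p x y → p * x - y * x ≡ (p - y) * x
        lem = solve-∀ ringℚ

  pack : ∀ s (J : Fin s → BipGraph a b) → (∀ i → JobFits (J i) Δ c₀) → ∀ {G p h} → State G p h → α * p₀ ≤ p - ∑ (λ i → size (J i)) * (ia * ib) → Packing J G
  pack zero J fits state enough = record { σ = λ () ; τ = λ () ; σ-injective = λ () ; τ-injective = λ () ; to-edge = λ () ; disjoint = λ () }
  pack (suc s) J fits {G} {p} {h} state enough = cases (0ℚ ℚ.<? e₀)
    where
    e₀ = size (J zero)
    rest = ∑ (λ i → size (J (suc i)))
    0≤size : ∀ (H : BipGraph a b) → 0ℚ ≤ size H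
    0≤size H = 0≤∑ λ u → 0≤∑ λ v → 0≤ind (edge H u v)
    0≤rest : 0ℚ ≤ rest
    0≤rest = 0≤∑ λ i → 0≤size (J (suc i))
    opaque
      unfolding _+_
      lem : ∀ p e r i → p - (e + r) * i ≡ p - e * i - r * i
      lem = solve-∀ ringℚ
    opaque
      unfolding ∑
      ∑-suc : ∑ (λ i → size (J i)) ≡ e₀ + rest
      ∑-suc = refl
    enough′ : α * p₀ ≤ p - e₀ * (ia * ib) - rest * (ia * ib)
    enough′ = ≤-trans enough (≡⇒≤ (trans (cong (λ z → p - z * (ia * ib)) ∑-suc) (lem p e₀ rest (ia * ib))))
    add : (σ₁ : Fin a → Fin a) (τ₁ : Fin b → Fin b) → Injective _≡_ _≡_ σ₁ → Injective _≡_ _≡_ τ₁ → (∀ x y → edge (J zero) x y ≡ true → edge G (σ₁ x) (τ₁ y) ≡ true) →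
      (G₁ : BipGraph a b) → (∀ u v → edge G₁ u v ≡ true → edge G u v ≡ true) → (∀ x y → edge (J zero) x y ≡ true → ¬ edge G₁ (σ₁ x) (τ₁ y) ≡ true) → Packing (λ i → J (suc i)) G₁ → Packing J G
    add σ₁ τ₁ i₁ i₂ e₁ G₁ G₁⊆G avoid P = record { σ = σ′ ; τ = τ′ ; σ-injective = σi ; τ-injective = τi ; to-edge = te ; disjoint = dj }
      where
      module P = Packing P
      σ′ : Fin (suc s) → Fin a → Fin a
      σ′ zero = σ₁
      σ′ (suc i) = P.σ i
      τ′ : Fin (suc s) → Fin b → Fin b
      τ′ zero = τ₁
      τ′ (suc i) = P.τ i
      σi : ∀ i → Injective _≡_ _≡_ (σ′ i)
      σi zero = i₁
      σi (suc i) = P.σ-injective i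
      τi : ∀ i → Injective _≡_ _≡_ (τ′ i)
      τi zero = i₂
      τi (suc i) = P.τ-injective i
      te : ∀ i x y → edge (J i) x y ≡ true → edge G (σ′ i x) (τ′ i y) ≡ true
      te zero = e₁
      te (suc i) x y q = G₁⊆G _ _ (P.to-edge i x y q)
      apart : ∀ j x y x′ y′ → edge (J zero) x y ≡ true → edge (J (suc j)) x′ y′ ≡ true → σ₁ x ≡ P.σ j x′ → τ₁ y ≡ P.τ j y′ → ⊥
      apart j x y x′ y′ q q′ r r′ = avoid x y q (subst₂ (λ u v → edge G₁ u v ≡ true) (sym r) (sym r′) (P.to-edge j x′ y′ q′))
      dj : ∀ i j → i ≢ j → ∀ x y x′ y′ → edge (J i) x y ≡ true → edge (J j) x′ y′ ≡ true → ¬ (σ′ i x ≡ σ′ j x′ × τ′ i y ≡ τ′ j y′)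
      dj zero zero i≢j = ⊥-elim (i≢j refl)
      dj zero (suc j) _ x y x′ y′ q q′ (r , r′) = apart j x y x′ y′ q q′ r r′
      dj (suc i) zero _ x y x′ y′ q q′ (r , r′) = apart i x′ y′ x y q′ q (sym r) (sym r′)
      dj (suc i) (suc j) i≢j = P.disjoint i j (λ { refl → i≢j refl })
    cases : Dec (0ℚ < e₀) → Packing J G
    cases (yes 0<e₀) = add Em.σ Em.τ Em.σ-injective Em.τ-injective Em.edges-to-edges G′ (λ u v q → ∧⁻ˡ q)
        (λ x y q r → true≢false (Rm.hit⁺ x y q) (not≡true (∧⁻ʳ {edge G (Em.σ x) (Em.τ y)} r)))
        (pack s (λ i → J (suc i)) (λ i → fits (suc i)) next enough′)
      where
      open Advance state (J zero) (fits zero) 0<e₀ (≤-trans enough′ (x-y≤x (0≤* 0≤rest 0≤iab)))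
    -- A job without edges fits anywhere and leaves the host as it is.
    cases (no ¬0<e₀) = add id id id id (λ x y q → ⊥-elim (none x y q)) G (λ u v q → q) (λ x y q → ⊥-elim (none x y q))
        (pack s (λ i → J (suc i)) (λ i → fits (suc i)) state (≤-trans enough′ (+-mono (x-y≤x (0≤* (0≤size (J zero)) 0≤iab)) ≤-refl)))
      where
      none : ∀ x y → edge (J zero) x y ≡ true → ⊥
      none x y q = ¬0<e₀ (ℚ.<-≤-trans 0<1 (≤-trans (≡⇒≤ (cong ind (sym q))) (≤-trans (f≤∑ {f = λ y → ind (edge (J zero) x y)} (λ y → 0≤ind (edge (J zero) x y)) y) (f≤∑ {f = λ x → ∑ λ y → ind (edge (J zero) x y)} (λ x → 0≤∑ λ y → 0≤ind (edge (J zero) x y)) x))))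

  packing : ∀ s (J : Fin s → BipGraph a b) → (∀ i → JobFits (J i) Δ c₀) → ∑ (λ i → size (J i)) ≤ (1ℚ - α) * size G₀ → Packing J G₀
  packing s J fits le = pack s J fits start (≤-trans (≡⇒≤ (lem α p₀)) (-monoʳ (≤-trans (*-monoʳ 0≤iab le) (≡⇒≤ (*-assoc _ _ _)))))
    where
    opaque
      unfolding _+_
      lem : ∀ α p → α * p ≡ p - (1ℚ - α) * p
      lem = solve-∀ ringℚ

-- The choice of constants

÷-linear : ∀ {x y z} → 0ℚ < z → x * (y * inv z) ≤ 1ℚ → y * x ≤ z
÷-linear {x} {y} {z} 0<z le = ≤-trans (÷-≤⁻¹ 0<z (≤-trans (≡⇒≤ (trans (cong (_* inv z) (*-comm y x)) (*-assoc _ _ _))) le)) (≡⇒≤ (*-identityˡ z))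

-- The sum of non-negative numbers bounds each of them, so one number meets finitely many
-- requirements.
sumL : List ℚ → ℚ
sumL L = ∑L L id

≤sumL : ∀ {L} → (∀ {y} → y ∈ L → 0ℚ ≤ y) → ∀ {y} → y ∈ L → y ≤ sumL L
≤sumL {z ∷ L} nonneg (here refl) = x≤x+y (go (λ y∈ → nonneg (there y∈)))
  where
  go : ∀ {L} → (∀ {y} → y ∈ L → 0ℚ ≤ y) → 0ℚ ≤ sumL L
  go {[]} _ = ≤-refl
  go {z ∷ L} p = 0≤+ (p (here refl)) (go (λ y∈ → p (there y∈)))
≤sumL {z ∷ L} nonneg (there y∈) = ≤-trans (≤sumL (λ w∈ → nonneg (there w∈)) y∈) (y≤x+y (nonneg (here refl)))

-- Outside `Instance` the choices depend on `α`, `d₁` and `Δ` only: `hmax` and `M` come first, then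
-- `h₀`, which in turn determines `ε₀` and, separately, the least order `A₀`.
module Constants (α d d₁ : ℚ) (Δ : ℕ) (0<α : 0ℚ < α) (α≤1 : α ≤ 1ℚ) (0<d₁ : 0ℚ < d₁) (d₁≤1 : d₁ ≤ 1ℚ) (d₁≤d : d₁ ≤ d) (1≤Δ : 1 ℕ.≤ Δ) where

  τ : ℚ
  τ = d₁ * inv 2ℚ
  open Derived Δ α τ

  0<½ : 0ℚ < inv 2ℚ
  0<½ = 0<inv 0<2
  0<τ : 0ℚ < τ
  0<τ = 0<* 0<d₁ 0<½
  ½≤1 : inv 2ℚ ≤ 1ℚ
  ½≤1 = ≤-trans (≡⇒≤ (sym (*-identityˡ _))) (÷-≤ 0<2 (≤-trans (x≤x+y 0≤1) (≡⇒≤ (sym (*-identityˡ _)))))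
  τ≤1 : τ ≤ 1ℚ
  τ≤1 = ≤-trans (*-mono (<⇒≤ 0<d₁) 0≤1 d₁≤1 ½≤1) (≡⇒≤ (*-identityˡ 1ℚ))
  0<Δ : 0ℚ < ⟦ Δ ⟧
  0<Δ = 0<⟦⟧ 1≤Δ
  0≤Δ : 0ℚ ≤ ⟦ Δ ⟧
  0≤Δ = 0≤⟦⟧ Δ
  0<pm : 0ℚ < pm
  0<pm = 0<* 0<α 0<τ
  pm≤1 : pm ≤ 1ℚ
  pm≤1 = ≤-trans (*-mono (<⇒≤ 0<α) 0≤1 α≤1 τ≤1) (≡⇒≤ (*-identityˡ 1ℚ))
  0<1+Δ : 0ℚ < 1ℚ + ⟦ Δ ⟧
  0<1+Δ = 0<+ 0<1 0≤Δ
  0<C₁ : 0ℚ < C₁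
  0<C₁ = 0<* 0<1+Δ (0<^ Δ (0<inv 0<pm))
  0<c₀ : 0ℚ < c₀
  0<c₀ = 0<inv (0<* 0<2 0<1+Δ)
  0<R : 0ℚ < R
  0<R = 0<* 0<2 (0<inv 0<pm)
  0<K : 0ℚ < K
  0<K = 0<^ Δ 0<R
  0<ζ : 0ℚ < ζ
  0<ζ = 0<* (0<* (0<^ (Δ ℕ.+ Δ) 0<τ) (0<^ Δ 0<α)) 0<½
  0<ζ/2 : 0ℚ < ζ * inv 2ℚ
  0<ζ/2 = 0<* 0<ζ 0<½
  ζ≤pm : ζ ≤ pm
  ζ≤pm = ≤-trans (*-mono (0≤* (0≤^ (Δ ℕ.+ Δ) (<⇒≤ 0<τ)) (0≤^ Δ (<⇒≤ 0<α))) 0≤1 (≤-trans (≡⇒≤ (*-comm _ _)) (*-mono (0≤^ Δ (<⇒≤ 0<α)) (<⇒≤ 0<τ) (≤-trans (^-anti (<⇒≤ 0<α) α≤1 1≤Δ) (≡⇒≤ (*-identityʳ α))) (≤-trans (^-anti (<⇒≤ 0<τ) τ≤1 (ℕ.≤-trans 1≤Δ (ℕ.m≤m+n Δ Δ))) (≡⇒≤ (*-identityʳ τ))))) ½≤1) (≡⇒≤ (*-identityʳ pm))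

  opaque
    M : ℕ
    M = proj₁ (archimedean (⟦ 24 ⟧ * (⟦ Δ ⟧ * C₅)))
    M-bound : ⟦ 24 ⟧ * (⟦ Δ ⟧ * C₅) ≤ ⟦ M ⟧
    M-bound = proj₂ (archimedean (⟦ 24 ⟧ * (⟦ Δ ⟧ * C₅)))

  -- 96 = 4 · 3 · 8 makes `C₁-small` an equality. `h₀` is the precision from which an error growing
  -- like a power `M` of `1 / p` is still at most `hmax` at density `pm`.
  hmax h₀ : ℚ
  hmax = c₀ * inv (⟦ 96 ⟧ * C₁)
  h₀ = hmax * pm ^ M

  0<96C₁ : 0ℚ < ⟦ 96 ⟧ * C₁
  0<96C₁ = 0<* (0<⟦suc⟧ 95) 0<C₁
  0<hmax : 0ℚ < hmax
  0<hmax = 0<* 0<c₀ (0<inv 0<96C₁)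
  0<h₀ : 0ℚ < h₀
  0<h₀ = 0<* 0<hmax (0<^ M 0<pm)
  h₀≤hmax : h₀ ≤ hmax
  h₀≤hmax = ≤-trans (*-monoˡ (<⇒≤ 0<hmax) (^-≤1 M (<⇒≤ 0<pm) pm≤1)) (≡⇒≤ (*-identityʳ _))

  C₁-small : 4ℚ * (C₁ * (⟦ 3 ⟧ * hmax)) ≤ c₀ * inv 8ℚ
  C₁-small = ≤-÷ 0<8 (≡⇒≤ (trans (lem C₁ c₀ (inv (⟦ 96 ⟧ * C₁))) (trans (cong (c₀ *_) (*-inv 0<96C₁)) (*-identityʳ _))))
    where
    opaque
      unfolding _+_ ⟦_⟧
      lem : ∀ C c i → 4ℚ * (C * (⟦ 3 ⟧ * (c * i))) * 8ℚ ≡ c * (⟦ 96 ⟧ * C * i)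
      lem = solve-∀ ringℚ

  1≤C₁ : 1ℚ ≤ C₁
  1≤C₁ = ≤-trans (≡⇒≤ (sym (*-identityˡ 1ℚ))) (*-mono 0≤1 (0≤^ Δ (0≤inv _)) (x≤x+y 0≤Δ) (1≤^ Δ (≤-trans (≤-÷ 0<pm (≤-trans (≡⇒≤ (*-identityˡ pm)) pm≤1)) (≡⇒≤ (*-identityˡ _)))))
  c₀≤1 : c₀ ≤ 1ℚ
  c₀≤1 = ≤-trans (≡⇒≤ (sym (*-identityˡ _))) (÷-≤ (0<* 0<2 0<1+Δ) (≤-trans (≤-trans (≡⇒≤ (sym (*-identityˡ 1ℚ))) (*-mono 0≤1 (<⇒≤ 0<1+Δ) (x≤x+y 0≤1) (x≤x+y 0≤Δ))) (≡⇒≤ (sym (*-identityˡ _)))))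

  nhmax≤1 : ∀ n → n ℕ.≤ 96 → ⟦ n ⟧ * hmax ≤ 1ℚ
  nhmax≤1 n n≤ = ≤-trans (≡⇒≤ (sym (*-assoc _ _ _))) (÷-≤ 0<96C₁ (≤-trans (*-mono (0≤⟦⟧ n) (<⇒≤ 0<C₁) (⟦⟧-mono n≤) (≤-trans c₀≤1 1≤C₁)) (≡⇒≤ (sym (*-identityˡ _)))))

  4h₀≤1 : 4ℚ * h₀ ≤ 1ℚ
  4h₀≤1 = ≤-trans (*-monoˡ 0≤4 h₀≤hmax) (≤-trans (≡⇒≤ (cong (_* hmax) lem)) (nhmax≤1 4 (s≤s (s≤s (s≤s (s≤s z≤n))))))
    where
    opaque
      unfolding _+_ ⟦_⟧
      lem : 4ℚ ≡ ⟦ 4 ⟧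
      lem = refl

  h₀≤1 : h₀ ≤ 1ℚ
  h₀≤1 = ≤-trans (≤-trans (≡⇒≤ (sym (*-identityˡ _))) (*-monoʳ (<⇒≤ 0<h₀) (≤-trans (x≤x+y 0≤1) (x≤x+y 0≤2)))) 4h₀≤1

  -- `Cκ` comes from the chord bound for powers of `1 + 4Δ / a` up to `2Δ`, and `ρ` from `room`;
  -- `ξ′` and `ω′` are `ξ` and `ω` with `κ` replaced by 2 and `ε` split off.
  4Δ Cκ C₂ m ρ ξ′ ω′ Omax g : ℚ
  4Δ = 4ℚ * ⟦ Δ ⟧
  Cκ = 2ℚ ^ (Δ ℕ.+ Δ) * 4Δ
  C₂ = 2ℚ * Cκ + (4ℚ + 2ℚ) * (⟦ Δ ⟧ * ⟦ Δ ⟧)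
  m = 1ℚ + ⟦ Δ ⟧ * ⟦ Δ ⟧
  ρ = inv (⟦ 16 ⟧ * ⟦ Δ ⟧)
  ξ′ = 2ℚ * inv h₀ * (2ℚ * ⟦ Δ ⟧)
  ω′ = 2ℚ * inv h₀ * (m * (2ℚ * (⟦ Δ ⟧ * ⟦ Δ ⟧))) + ⟦ Δ ⟧ * ξ′ * (4ℚ * m)
  g = c₀ * inv 2ℚ * (c₀ * inv 2ℚ)
  Omax = 2ℚ * inv h₀ * (C₂ * ⟦ Δ ⟧) * K * inv g

  0<4Δ : 0ℚ < 4Δ
  0<4Δ = 0<* 0<4 0<Δ
  0<Cκ : 0ℚ < Cκ
  0<Cκ = 0<* (0<^ (Δ ℕ.+ Δ) 0<2) 0<4Δ
  0≤C₂ : 0ℚ ≤ C₂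
  0≤C₂ = 0≤+ (0≤* 0≤2 (<⇒≤ 0<Cκ)) (0≤* (0≤+ 0≤4 0≤2) (0≤* 0≤Δ 0≤Δ))
  0≤m : 0ℚ ≤ m
  0≤m = 0≤+ 0≤1 (0≤* 0≤Δ 0≤Δ)
  0<16Δ : 0ℚ < ⟦ 16 ⟧ * ⟦ Δ ⟧
  0<16Δ = 0<* (0<⟦suc⟧ 15) 0<Δ
  0<ρ : 0ℚ < ρ
  0<ρ = 0<inv 0<16Δ
  0≤2/h : 0ℚ ≤ 2ℚ * inv h₀
  0≤2/h = 0≤* 0≤2 (0≤inv _)
  0≤ξ′ : 0ℚ ≤ ξ′
  0≤ξ′ = 0≤* 0≤2/h (0≤* 0≤2 0≤Δ)
  0≤ω′ : 0ℚ ≤ ω′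
  0≤ω′ = 0≤+ (0≤* 0≤2/h (0≤* 0≤m (0≤* 0≤2 (0≤* 0≤Δ 0≤Δ)))) (0≤* (0≤* 0≤Δ 0≤ξ′) (0≤* 0≤4 0≤m))
  0<g : 0ℚ < g
  0<g = 0<* (0<* 0<c₀ 0<½) (0<* 0<c₀ 0<½)
  0≤Omax : 0ℚ ≤ Omax
  0≤Omax = 0≤* (0≤* (0≤* 0≤2/h (0≤* 0≤C₂ 0≤Δ)) (<⇒≤ 0<K)) (0≤inv _)

  -- Each stands for one condition `ε * B ≤ 1`: it is the coefficient of `ε` in an estimate divided
  -- by what that estimate allows.
  B₁ B₂ B₃ B₄ B₅ B₆ B₇ : ℚ
  B₁ = 1ℚ * inv (τ ^ (Δ ℕ.+ Δ) * inv 2ℚ)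
  B₂ = 2ℚ ^ Δ * (2ℚ * inv τ) * inv h₀
  B₃ = ⟦ Δ ⟧ * inv ρ
  B₄ = 2ℚ * inv h₀ * (C₂ * ⟦ Δ ⟧) * inv (ρ * ρ)
  B₅ = 2ℚ * (⟦ Δ ⟧ * ξ′ * ⟦ Δ ⟧) * m * inv (inv 8ℚ)
  B₆ = inv (ζ * inv 2ℚ) * (K * (⟦ Δ ⟧ * (2ℚ * (⟦ Δ ⟧ * ξ′ * ⟦ Δ ⟧)))) * inv (c₀ * inv 4ℚ)
  B₇ = inv (ζ * inv 2ℚ) * (K * (⟦ Δ ⟧ * ω′)) * inv h₀

  Bs : List ℚ
  Bs = B₁ ∷ B₂ ∷ B₃ ∷ B₄ ∷ B₅ ∷ B₆ ∷ B₇ ∷ []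

  0≤Bs : ∀ {y} → y ∈ Bs → 0ℚ ≤ y
  0≤Bs (here refl) = 0≤* 0≤1 (0≤inv _)
  0≤Bs (there (here refl)) = 0≤* (0≤* (0≤^ Δ 0≤2) (0≤* 0≤2 (0≤inv _))) (0≤inv _)
  0≤Bs (there (there (here refl))) = 0≤* 0≤Δ (0≤inv _)
  0≤Bs (there (there (there (here refl)))) = 0≤* (0≤* 0≤2/h (0≤* 0≤C₂ 0≤Δ)) (0≤inv _)
  0≤Bs (there (there (there (there (here refl))))) = 0≤* (0≤* (0≤* 0≤2 (0≤* (0≤* 0≤Δ 0≤ξ′) 0≤Δ)) 0≤m) (0≤inv _)
  0≤Bs (there (there (there (there (there (here refl)))))) = 0≤* (0≤* (0≤inv _) (0≤* (<⇒≤ 0<K) (0≤* 0≤Δ (0≤* 0≤2 (0≤* (0≤* 0≤Δ 0≤ξ′) 0≤Δ))))) (0≤inv _)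
  0≤Bs (there (there (there (there (there (there (here refl))))))) = 0≤* (0≤* (0≤inv _) (0≤* (<⇒≤ 0<K) (0≤* 0≤Δ 0≤ω′))) (0≤inv _)

  0<B : 0ℚ < sumL Bs
  0<B = ℚ.<-≤-trans (0<* 0<1 (0<inv (0<* (0<^ (Δ ℕ.+ Δ) 0<τ) 0<½))) (≤sumL 0≤Bs (here refl))

  ε₀ : ℚ
  ε₀ = inv (sumL Bs)

  0<ε₀ : 0ℚ < ε₀
  0<ε₀ = 0<inv 0<B

  opaque
    -- `Λ` will be `2 Δ k` with `k` the integer part of `a / D`; the bound on `D` is what `Λ-small`
    -- asks for.
    D : ℕ
    D = suc (proj₁ (archimedean (4ℚ * (⟦ Δ ⟧ * (⟦ Δ ⟧ * ⟦ Δ ⟧)) * inv (h₀ * ζ))))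
    1≤D : 1 ℕ.≤ D
    1≤D = s≤s z≤n
    D-bound : 4ℚ * (⟦ Δ ⟧ * (⟦ Δ ⟧ * ⟦ Δ ⟧)) ≤ ⟦ D ⟧ * (h₀ * ζ)
    D-bound = ÷-≤⁻¹ (0<* 0<h₀ 0<ζ) (≤-trans (proj₂ (archimedean (4ℚ * (⟦ Δ ⟧ * (⟦ Δ ⟧ * ⟦ Δ ⟧)) * inv (h₀ * ζ)))) (⟦⟧-mono (ℕ.n≤1+n _)))

  -- Lower bounds for the order of A, one for each condition that needs a large graph.
  As : List ℚ
  As = 4Δ ∷ Cκ ∷ Cκ * inv h₀ ∷ (1ℚ + ⟦ Δ ⟧ * ⟦ Δ ⟧) * inv ζ ∷ Omax * K * inv h₀ ∷ Omax * K * inv (ζ * inv 2ℚ) ∷ ⟦ D ⟧ ∷ ⟦ 24 ⟧ * (⟦ D ⟧ * ⟦ D ⟧) * inv (h₀ * h₀) ∷ []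

  0≤As : ∀ {y} → y ∈ As → 0ℚ ≤ y
  0≤As (here refl) = <⇒≤ 0<4Δ
  0≤As (there (here refl)) = <⇒≤ 0<Cκ
  0≤As (there (there (here refl))) = 0≤* (<⇒≤ 0<Cκ) (0≤inv _)
  0≤As (there (there (there (here refl)))) = 0≤* 0≤m (0≤inv _)
  0≤As (there (there (there (there (here refl))))) = 0≤* (0≤* 0≤Omax (<⇒≤ 0<K)) (0≤inv _)
  0≤As (there (there (there (there (there (here refl)))))) = 0≤* (0≤* 0≤Omax (<⇒≤ 0<K)) (0≤inv _)
  0≤As (there (there (there (there (there (there (here refl))))))) = 0≤⟦⟧ D
  0≤As (there (there (there (there (there (there (there (here refl)))))))) = 0≤* (0≤* (0≤⟦⟧ 24) (0≤* (0≤⟦⟧ D) (0≤⟦⟧ D))) (0≤inv _)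

  opaque
    A₀ : ℕ
    A₀ = proj₁ (archimedean (sumL As))
    A₀-bound : sumL As ≤ ⟦ A₀ ⟧
    A₀-bound = proj₂ (archimedean (sumL As))

  module Instance (a b : ℕ) (ε : ℚ) (0<ε : 0ℚ < ε) (ε≤ε₀ : ε ≤ ε₀) (1≤a : 1 ℕ.≤ a) (A₀≤a : A₀ ℕ.≤ a) (a≤b : a ℕ.≤ b) (b≤2a : b ℕ.≤ a ℕ.+ a) where

    ia ib : ℚ
    ia = inv ⟦ a ⟧
    ib = inv ⟦ b ⟧
    0<a : 0ℚ < ⟦ a ⟧
    0<a = 0<⟦⟧ 1≤a
    0<b : 0ℚ < ⟦ b ⟧
    0<b = 0<⟦⟧ (ℕ.≤-trans 1≤a a≤b)
    ⟦a⟧≤⟦b⟧ : ⟦ a ⟧ ≤ ⟦ b ⟧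
    ⟦a⟧≤⟦b⟧ = ⟦⟧-mono a≤b
    ⟦b⟧≤2⟦a⟧ : ⟦ b ⟧ ≤ 2ℚ * ⟦ a ⟧
    ⟦b⟧≤2⟦a⟧ = ≤-trans (⟦⟧-mono b≤2a) (≡⇒≤ (trans (⟦+⟧ a a) (sym (2*≡ _))))

    big : ∀ {y} → y ∈ As → y ≤ ⟦ a ⟧
    big y∈ = ≤-trans (≤sumL 0≤As y∈) (≤-trans A₀-bound (⟦⟧-mono A₀≤a))

    εB≤1 : ∀ {y} → y ∈ Bs → ε * y ≤ 1ℚ
    εB≤1 {y} y∈ = ≤-trans (*-mono (<⇒≤ 0<ε) (<⇒≤ 0<B) ε≤ε₀ (≤sumL 0≤Bs y∈)) (≡⇒≤ (trans (*-comm _ _) (*-inv 0<B)))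

    0<τ^ : 0ℚ < τ ^ (Δ ℕ.+ Δ)
    0<τ^ = 0<^ (Δ ℕ.+ Δ) 0<τ
    ε≤τ^/2 : ε ≤ τ ^ (Δ ℕ.+ Δ) * inv 2ℚ
    ε≤τ^/2 = ≤-trans (≡⇒≤ (sym (*-identityˡ ε))) (÷-linear (0<* 0<τ^ 0<½) (εB≤1 (here refl)))
    ε<τ^ : ε < τ ^ (Δ ℕ.+ Δ)
    ε<τ^ = ℚ.≤-<-trans ε≤τ^/2 (subst₂ _<_ (*-comm _ _) (*-identityˡ _) (*-mono-< 0<τ^ ½<1))
      where
      ½<1 : inv 2ℚ < 1ℚ
      ½<1 = ℚ.≰⇒> λ q → ≤⇒≯ (≤-trans (*-monoˡ 0≤2 q) (≡⇒≤ (*-inv 0<2))) (subst₂ _<_ (+-identityʳ 1ℚ) (sym (*-identityʳ 2ℚ)) (+-mono-≤-< (≤-refl {1ℚ}) 0<1))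
    ε≤τ : ε ≤ τ
    ε≤τ = ≤-trans (<⇒≤ ε<τ^) (≤-trans (^-anti (<⇒≤ 0<τ) τ≤1 (ℕ.≤-trans 1≤Δ (ℕ.m≤m+n Δ Δ))) (≡⇒≤ (*-identityʳ τ)))
    τ≤q : τ ≤ d - ε
    τ≤q = ≤-trans (≡⇒≤ (sym (+-cancelʳ′ τ ε))) (+-mono (≤-trans (+-mono (≤-refl {τ}) ε≤τ) (≤-trans (≡⇒≤ (trans (sym (2*≡ τ)) (trans (*-comm _ _) (*-inv-cancel′ d₁ 0<2)))) d₁≤d)) ≤-refl)

    x : ℚ
    x = 2ℚ * inv τ * ε
    0≤x : 0ℚ ≤ x
    0≤x = 0≤* (0≤* 0≤2 (0≤inv _)) (<⇒≤ 0<ε)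
    2^x≤h₀ : 2ℚ ^ Δ * x ≤ h₀
    2^x≤h₀ = ≤-trans (≡⇒≤ (sym (*-assoc _ _ _))) (÷-linear 0<h₀ (εB≤1 (there (here refl))))
    x≤1 : x ≤ 1ℚ
    x≤1 = ≤-trans (≤-trans (≡⇒≤ (sym (*-identityˡ x))) (*-monoʳ 0≤x (1≤^ Δ (x≤x+y 0≤1)))) (≤-trans 2^x≤h₀ h₀≤1)

    ratio : ∀ k → k ℕ.≤ Δ → (d + ε) ^ k ≤ (1ℚ + h₀) * (d - ε) ^ k
    ratio k k≤Δ =
      (d + ε) ^ k ≤⟨ ^-mono k (0≤+ (≤-trans (<⇒≤ 0<d₁) d₁≤d) (<⇒≤ 0<ε)) step ⟩
      ((1ℚ + x) * (d - ε)) ^ k ≡⟨ ^-distrib-* _ _ k ⟩≤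
      (1ℚ + x) ^ k * (d - ε) ^ k ≤⟨ *-monoʳ (0≤^ k 0≤q) (≤-trans (1+x^≤ k 0≤x x≤1) (+-mono ≤-refl (≤-trans (*-monoʳ 0≤x (≤-trans (x-y≤x 0≤1) (^-monoʳ (x≤x+y 0≤1) k≤Δ))) 2^x≤h₀))) ⟩
      (1ℚ + h₀) * (d - ε) ^ k ■
      where
      0≤q : 0ℚ ≤ d - ε
      0≤q = ≤-trans (<⇒≤ 0<τ) τ≤q
      opaque
        unfolding _+_
        lem : ∀ d e s i → (1ℚ + 2ℚ * i * e) * (d - e) ≡ (d + e) + 2ℚ * e * (i * ((d - e) - s)) + 2ℚ * e * (s * i - 1ℚ)
        lem = solve-∀ ringℚ
      step : d + ε ≤ (1ℚ + x) * (d - ε)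
      step = ≤-by (2ℚ * ε * (inv τ * ((d - ε) - τ))) (0≤* (0≤* 0≤2 (<⇒≤ 0<ε)) (0≤* (0≤inv _) (0≤- τ≤q)))
        (trans (lem d ε τ (inv τ)) (trans (cong (λ z → (d + ε) + 2ℚ * ε * (inv τ * ((d - ε) - τ)) + 2ℚ * ε * (z - 1ℚ)) (*-inv 0<τ)) (lem₂ _ (2ℚ * ε))))
        where
        opaque
          unfolding _+_
          lem₂ : ∀ s t → s + t * (1ℚ - 1ℚ) ≡ s
          lem₂ = solve-∀ ringℚ

    κ₀ κ y : ℚ
    y = 4Δ * ia
    κ₀ = 1ℚ + y
    κ = 1ℚ + Cκ * ia
    0≤y : 0ℚ ≤ y
    0≤y = 0≤* (<⇒≤ 0<4Δ) (0≤inv _)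
    y≤1 : y ≤ 1ℚ
    y≤1 = ÷-≤ 0<a (≤-trans (big (here refl)) (≡⇒≤ (sym (*-identityˡ _))))
    κ₀-bound : ∀ j → j ℕ.≤ Δ ℕ.+ Δ → ⟦ a ⟧ ≤ κ₀ * (⟦ a ⟧ - ⟦ j ⟧)
    κ₀-bound j j≤ = ≤-by (⟦ j ⟧ * (1ℚ - y) + 2ℚ * (⟦ Δ ⟧ + ⟦ Δ ⟧ - ⟦ j ⟧)) (0≤+ (0≤* (0≤⟦⟧ j) (0≤- y≤1)) (0≤* 0≤2 (0≤- (≤-trans (⟦⟧-mono j≤) (≡⇒≤ (⟦+⟧ Δ Δ))))))
      (trans (lem ⟦ a ⟧ ⟦ Δ ⟧ ia ⟦ j ⟧) (trans (cong (λ z → ⟦ a ⟧ + (⟦ j ⟧ * (1ℚ - y) + 2ℚ * (⟦ Δ ⟧ + ⟦ Δ ⟧ - ⟦ j ⟧)) + 4Δ * (z - 1ℚ)) (*-inv 0<a)) (lem₂ _ 4Δ)))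
      where
      opaque
        unfolding _+_
        lem : ∀ a D i j → (1ℚ + 4ℚ * D * i) * (a - j) ≡ a + (j * (1ℚ - 4ℚ * D * i) + 2ℚ * (D + D - j)) + 4ℚ * D * (a * i - 1ℚ)
        lem = solve-∀ ringℚ
        lem₂ : ∀ s t → s + t * (1ℚ - 1ℚ) ≡ s
        lem₂ = solve-∀ ringℚ
    κ₀^≤κ : ∀ j → j ℕ.≤ Δ ℕ.+ Δ → κ₀ ^ j ≤ κ
    κ₀^≤κ j j≤ = ≤-trans (1+x^≤ j 0≤y y≤1) (+-mono ≤-refl (≤-trans (*-monoʳ 0≤y (≤-trans (x-y≤x 0≤1) (^-monoʳ (x≤x+y 0≤1) j≤))) (≡⇒≤ (sym (*-assoc _ _ _)))))
    1≤κ : 1ℚ ≤ κ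
    1≤κ = x≤x+y (0≤* (<⇒≤ 0<Cκ) (0≤inv _))
    κ≤2 : κ ≤ 2ℚ
    κ≤2 = +-mono ≤-refl (÷-≤ 0<a (≤-trans (big (there (here refl))) (≡⇒≤ (sym (*-identityˡ _)))))
    κ≤1+h₀ : κ ≤ 1ℚ + h₀
    κ≤1+h₀ = +-mono ≤-refl (÷-≤ 0<a (≤-trans (÷-≤⁻¹ 0<h₀ (big (there (there (here refl))))) (≡⇒≤ (*-comm _ _))))
    κ-1≤ : (κ - 1ℚ) * ⟦ a ⟧ ≤ Cκ
    κ-1≤ = ≡⇒≤ (trans (cong (_* ⟦ a ⟧) (lem (Cκ * ia))) (*-inv-cancel′ Cκ 0<a))
      where
      opaque
        unfolding _+_
        lem : ∀ s → 1ℚ + s - 1ℚ ≡ s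
        lem = solve-∀ ringℚ

    k : ℕ
    k = ℕ._/_ a D {{ℕ.>-nonZero 1≤D}}
    kD≤a : ⟦ k ⟧ * ⟦ D ⟧ ≤ ⟦ a ⟧
    kD≤a = ≤-trans (≡⇒≤ (sym (⟦*⟧ k D))) (⟦⟧-mono (ℕ.m/n*n≤m a D {{ℕ.>-nonZero 1≤D}}))
    D≤a : D ℕ.≤ a
    D≤a = ⟦⟧-cancel-≤ (big (there (there (there (there (there (there (here refl))))))))
    1≤k : 1 ℕ.≤ k
    1≤k = ℕ.≤-trans (ℕ.≤-reflexive (sym (ℕ.n/n≡1 D {{ℕ.>-nonZero 1≤D}}))) (ℕ./-monoˡ-≤ D {{ℕ.>-nonZero 1≤D}} D≤a)
    a≤2kD : ⟦ a ⟧ ≤ 2ℚ * ⟦ k ⟧ * ⟦ D ⟧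
    a≤2kD = ≤-trans (⟦⟧-mono (ℕ.≤-trans (ℕ.≤-reflexive (ℕ.m≡m%n+[m/n]*n a D {{ℕ.>-nonZero 1≤D}})) (ℕ.+-monoˡ-≤ (k ℕ.* D) (ℕ.≤-trans (ℕ.<⇒≤ (ℕ.m%n<n a D {{ℕ.>-nonZero 1≤D}})) (ℕ.≤-trans (ℕ.≤-reflexive (sym (ℕ.*-identityˡ D))) (ℕ.*-monoˡ-≤ D 1≤k))))))
      (≡⇒≤ (trans (⟦+⟧ (k ℕ.* D) (k ℕ.* D)) (trans (sym (2*≡ _)) (trans (cong (2ℚ *_) (⟦*⟧ k D)) (sym (*-assoc _ _ _))))))

    Λ Λ′ : ℕ
    Λ = Δ ℕ.* (k ℕ.+ k)
    Λ′ = Λ ℕ.∸ 1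
    suc-Λ′ : suc Λ′ ≡ Λ
    suc-Λ′ = ℕ.m+[n∸m]≡n {1} {Λ} (ℕ.*-mono-≤ 1≤Δ (ℕ.≤-trans 1≤k (ℕ.m≤m+n k k)))
    ⟦Λ⟧ : ⟦ suc Λ′ ⟧ ≡ ⟦ Δ ⟧ * (⟦ k ⟧ + ⟦ k ⟧)
    ⟦Λ⟧ = trans (cong ⟦_⟧ suc-Λ′) (trans (⟦*⟧ Δ (k ℕ.+ k)) (cong (⟦ Δ ⟧ *_) (⟦+⟧ k k)))

    Λ-small : 2ℚ * (⟦ suc Λ′ ⟧ * (⟦ Δ ⟧ * ⟦ Δ ⟧)) ≤ h₀ * (ζ * ⟦ a ⟧)
    Λ-small = ≤-trans (≡⇒≤ (trans (cong (λ z → 2ℚ * (z * (⟦ Δ ⟧ * ⟦ Δ ⟧))) ⟦Λ⟧) (lem ⟦ Δ ⟧ ⟦ k ⟧))) (≤-trans (*-monoˡ (0≤⟦⟧ k) D-bound) (≤-trans (≡⇒≤ (lem₂ ⟦ k ⟧ ⟦ D ⟧ h₀ ζ)) (≤-trans (*-monoˡ (0≤* (<⇒≤ 0<h₀) (<⇒≤ 0<ζ)) kD≤a) (≡⇒≤ (*-assoc _ _ _)))))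
      where
      opaque
        unfolding _+_
        lem : ∀ d k → 2ℚ * (d * (k + k) * (d * d)) ≡ k * (4ℚ * (d * (d * d)))
        lem = solve-∀ ringℚ
        lem₂ : ∀ k D h z → k * (D * (h * z)) ≡ h * z * (k * D)
        lem₂ = solve-∀ ringℚ

    Λθ-small : ⟦ suc Λ′ ⟧ * (⟦ Δ ⟧ * (⟦ Δ ⟧ * (inv pm * ib))) ≤ h₀
    Λθ-small = ≤-trans (≡⇒≤ (lem ⟦ suc Λ′ ⟧ ⟦ Δ ⟧ (inv pm) ib)) (÷-≤ 0<b (÷-≤ 0<pm (≤-trans (≤-trans (≡⇒≤ (sym (*-identityˡ _))) (*-monoʳ (0≤* (0≤⟦⟧ (suc Λ′)) (0≤* 0≤Δ 0≤Δ)) (x≤x+y 0≤1))) (≤-trans Λ-small (≤-trans (*-monoˡ (<⇒≤ 0<h₀) (*-mono (<⇒≤ 0<ζ) (<⇒≤ 0<b) ζ≤pm ⟦a⟧≤⟦b⟧)) (≡⇒≤ (lem₂ h₀ pm ⟦ b ⟧)))))))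
      where
      opaque
        unfolding _+_
        lem : ∀ l d i j → l * (d * (d * (i * j))) ≡ l * (d * d) * i * j
        lem = solve-∀ ringℚ
        lem₂ : ∀ h p b → h * (p * b) ≡ h * b * p
        lem₂ = solve-∀ ringℚ

    -- Bernoulli alone gives growth linear in `k`. The square of `(1 + h₀) ^ k` is at least
    -- `(k h₀)²`, quadratic in `a`, and exceeds `6a` once `a` is large; hence the exponent `k + k`.
    3+3a≤ : ⟦ 3 ⟧ * (1ℚ + ⟦ a ⟧) ≤ (1ℚ + h₀) ^ (k ℕ.+ k)
    3+3a≤ = ≤-trans (≤-by (⟦ 3 ⟧ * (⟦ a ⟧ - 1ℚ)) (0≤* (0≤⟦⟧ 3) (0≤- (1≤⟦⟧ 1≤a))) (lem₁ ⟦ a ⟧)) (≤-trans 6a≤ (≤-trans (*-mono (0≤* (0≤⟦⟧ k) (<⇒≤ 0<h₀)) (0≤^ k (0≤+ 0≤1 (<⇒≤ 0<h₀))) kh≤ kh≤) (≡⇒≤ (sym (^-+ (1ℚ + h₀) k k)))))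
      where
      opaque
        unfolding _+_ ⟦_⟧
        lem₁ : ∀ a → ⟦ 6 ⟧ * a ≡ ⟦ 3 ⟧ * (1ℚ + a) + ⟦ 3 ⟧ * (a - 1ℚ)
        lem₁ = solve-∀ ringℚ
        lem₂ : ∀ a D → ⟦ 6 ⟧ * a * (4ℚ * (D * D)) ≡ a * (⟦ 24 ⟧ * (D * D))
        lem₂ = solve-∀ ringℚ
        lem₃ : ∀ k h D → 2ℚ * k * D * (2ℚ * k * D) * (h * h) ≡ k * h * (k * h) * (4ℚ * (D * D))
        lem₃ = solve-∀ ringℚ
      kh≤ : ⟦ k ⟧ * h₀ ≤ (1ℚ + h₀) ^ k
      kh≤ = ≤-trans (y≤x+y 0≤1) (bernoulli⁺ k (<⇒≤ 0<h₀))
      6a≤ : ⟦ 6 ⟧ * ⟦ a ⟧ ≤ ⟦ k ⟧ * h₀ * (⟦ k ⟧ * h₀)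
      6a≤ = *-cancelʳ (0<* 0<4 (0<* (0<⟦⟧ 1≤D) (0<⟦⟧ 1≤D))) (
        ⟦ 6 ⟧ * ⟦ a ⟧ * (4ℚ * (⟦ D ⟧ * ⟦ D ⟧)) ≡⟨ lem₂ ⟦ a ⟧ ⟦ D ⟧ ⟩≤
        ⟦ a ⟧ * (⟦ 24 ⟧ * (⟦ D ⟧ * ⟦ D ⟧)) ≤⟨ *-monoˡ (0≤⟦⟧ a) (÷-≤⁻¹ (0<* 0<h₀ 0<h₀) (big (there (there (there (there (there (there (there (here refl)))))))))) ⟩
        ⟦ a ⟧ * (⟦ a ⟧ * (h₀ * h₀)) ≡⟨ sym (*-assoc _ _ _) ⟩≤
        ⟦ a ⟧ * ⟦ a ⟧ * (h₀ * h₀) ≤⟨ *-monoʳ (0≤square h₀) (*-mono (0≤⟦⟧ a) (0≤* (0≤* 0≤2 (0≤⟦⟧ k)) (0≤⟦⟧ D)) a≤2kD a≤2kD) ⟩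
        2ℚ * ⟦ k ⟧ * ⟦ D ⟧ * (2ℚ * ⟦ k ⟧ * ⟦ D ⟧) * (h₀ * h₀) ≡⟨ lem₃ ⟦ k ⟧ h₀ ⟦ D ⟧ ⟩≤
        ⟦ k ⟧ * h₀ * (⟦ k ⟧ * h₀) * (4ℚ * (⟦ D ⟧ * ⟦ D ⟧)) ■)

    -- The left side is at most `(3 + 3a) ^ Δ`, and the factor `Δ` in `Λ` matches this power.
    initial : (1ℚ + ⟦ a ⟧) ^ Δ + ⟦ b ⟧ ≤ (1ℚ + h₀) ^ suc Λ′
    initial =
      (1ℚ + ⟦ a ⟧) ^ Δ + ⟦ b ⟧ ≤⟨ +-mono ≤-refl (≤-trans ⟦b⟧≤2⟦a⟧ (*-monoˡ 0≤2 (≤-trans (y≤x+y 0≤1) (≤-trans (≡⇒≤ (sym (*-identityʳ _))) (^-monoʳ {m = 1} (x≤x+y (0≤⟦⟧ a)) 1≤Δ))))) ⟩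
      (1ℚ + ⟦ a ⟧) ^ Δ + 2ℚ * (1ℚ + ⟦ a ⟧) ^ Δ ≡⟨ lem ((1ℚ + ⟦ a ⟧) ^ Δ) ⟩≤
      ⟦ 3 ⟧ * (1ℚ + ⟦ a ⟧) ^ Δ ≤⟨ *-monoʳ (0≤^ Δ (0≤+ 0≤1 (0≤⟦⟧ a))) (≤-trans (≡⇒≤ (sym (*-identityʳ _))) (^-monoʳ {m = 1} (1≤⟦⟧ (s≤s z≤n)) 1≤Δ)) ⟩
      ⟦ 3 ⟧ ^ Δ * (1ℚ + ⟦ a ⟧) ^ Δ ≡⟨ sym (^-distrib-* ⟦ 3 ⟧ (1ℚ + ⟦ a ⟧) Δ) ⟩≤
      (⟦ 3 ⟧ * (1ℚ + ⟦ a ⟧)) ^ Δ ≤⟨ ^-mono Δ (0≤* (0≤⟦⟧ 3) (0≤+ 0≤1 (0≤⟦⟧ a))) 3+3a≤ ⟩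
      ((1ℚ + h₀) ^ (k ℕ.+ k)) ^ Δ ≡⟨ trans (sym (^-* (1ℚ + h₀) Δ (k ℕ.+ k))) (cong ((1ℚ + h₀) ^_) (sym suc-Λ′)) ⟩≤
      (1ℚ + h₀) ^ suc Λ′ ■
      where
      opaque
        unfolding _+_ ⟦_⟧
        lem : ∀ s → s + 2ℚ * s ≡ ⟦ 3 ⟧ * s
        lem = solve-∀ ringℚ

    open Numbers Δ h₀ κ Cκ (⟦ Δ ⟧ * ε) using (ξ; ω)

    ξ≤ : ξ ≤ ξ′ * ε
    ξ≤ = ≤-trans (*-monoˡ 0≤2/h (*-monoʳ (0≤* 0≤Δ (<⇒≤ 0<ε)) κ≤2)) (≡⇒≤ (trans (cong (2ℚ * inv h₀ *_) (sym (*-assoc _ _ _))) (sym (*-assoc _ _ _))))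
    ω≤ : ω ≤ ω′ * ε
    ω≤ = ≤-trans (+-mono (*-monoˡ 0≤2/h (*-monoˡ 0≤m (*-monoʳ (0≤* 0≤Δ (0≤* 0≤Δ (<⇒≤ 0<ε))) κ≤2))) (*-monoʳ (0≤* 0≤4 0≤m) (*-monoˡ 0≤Δ ξ≤))) (≡⇒≤ (lem (2ℚ * inv h₀) m 2ℚ ⟦ Δ ⟧ ε ξ′ (4ℚ * m)))
      where
      opaque
        unfolding _+_
        lem : ∀ s m t d e x f → s * (m * (t * (d * (d * e)))) + d * (x * e) * f ≡ (s * (m * (t * (d * d))) + d * x * f) * e
        lem = solve-∀ ringℚ

    ε₁≤ρ : ⟦ Δ ⟧ * ε ≤ ρ
    ε₁≤ρ = ÷-linear 0<ρ (εB≤1 (there (there (here refl))))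
    devF-small : 2ℚ * inv h₀ * (C₂ * (⟦ Δ ⟧ * ε)) ≤ ρ * ρ
    devF-small = ≤-trans (≡⇒≤ (lem (2ℚ * inv h₀) C₂ ⟦ Δ ⟧ ε)) (÷-linear (0<* 0<ρ 0<ρ) (εB≤1 (there (there (there (here refl))))))
      where
      opaque
        unfolding _+_
        lem : ∀ s c d e → s * (c * (d * e)) ≡ s * (c * d) * e
        lem = solve-∀ ringℚ

    room : 2ℚ * (⟦ Δ ⟧ * ξ * ⟦ Δ ⟧) * m + ⟦ Δ ⟧ * ε + ⟦ Δ ⟧ * (2ℚ * ρ) + inv 4ℚ < 1ℚ
    -- The four summands are at most 1/8, 1/16, 1/8 and 1/4.
    room = ℚ.≤-<-trans (+-mono (+-mono (+-mono (≤-trans (*-monoʳ 0≤m (*-monoˡ 0≤2 (*-monoʳ 0≤Δ (*-monoˡ 0≤Δ ξ≤)))) (≤-trans (≡⇒≤ (lem 2ℚ ⟦ Δ ⟧ ξ′ ε m)) (÷-linear (0<inv 0<8) (εB≤1 (there (there (there (there (here refl))))))))) (≤-trans ε₁≤ρ ρ≤)) (≡⇒≤ Δρ)) ≤-refl) numbers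
      where
      opaque
        unfolding _+_
        lem : ∀ t d x e m → t * (d * (x * e) * d) * m ≡ t * (d * x * d) * m * e
        lem = solve-∀ ringℚ
        lem₂ : ∀ d r → d * (2ℚ * r) ≡ 2ℚ * (d * r)
        lem₂ = solve-∀ ringℚ
      0<16 : 0ℚ < ⟦ 16 ⟧
      0<16 = 0<⟦suc⟧ 15
      ρ≤ : ρ ≤ inv ⟦ 16 ⟧
      ρ≤ = inv-anti 0<16 (≤-trans (≡⇒≤ (sym (*-identityʳ _))) (*-monoˡ (0≤⟦⟧ 16) (1≤⟦⟧ 1≤Δ)))
      Δρ : ⟦ Δ ⟧ * (2ℚ * ρ) ≡ 2ℚ * inv ⟦ 16 ⟧
      Δρ = trans (lem₂ ⟦ Δ ⟧ ρ) (cong (2ℚ *_) (trans (cong (⟦ Δ ⟧ *_) (inv-* 0<16 0<Δ)) (trans (*-swap _ _ _) (trans (cong (inv ⟦ 16 ⟧ *_) (*-inv 0<Δ)) (*-identityʳ _)))))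
      numbers : inv 8ℚ + inv ⟦ 16 ⟧ + 2ℚ * inv ⟦ 16 ⟧ + inv 4ℚ < 1ℚ
      numbers = ℚ.≰⇒> λ q → ≤⇒≯ (≤-trans (*-monoʳ (0≤⟦⟧ 16) q) (≡⇒≤ (trans (lem₃ (inv 8ℚ) (inv ⟦ 16 ⟧) (inv 4ℚ)) (trans (cong₂ _+_ (cong₂ _+_ (cong (2ℚ *_) (*-inv 0<8)) (cong (⟦ 3 ⟧ *_) (*-inv 0<16))) (cong (4ℚ *_) (*-inv 0<4))) nine)))) (subst (⟦ 9 ⟧ <_) (sym (*-identityˡ _)) 9<16)
        where
        opaque
          unfolding _+_ ⟦_⟧
          lem₃ : ∀ x y z → (x + y + 2ℚ * y + z) * ⟦ 16 ⟧ ≡ 2ℚ * (8ℚ * x) + ⟦ 3 ⟧ * (⟦ 16 ⟧ * y) + 4ℚ * (4ℚ * z)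
          lem₃ = solve-∀ ringℚ
          nine : 2ℚ * 1ℚ + ⟦ 3 ⟧ * 1ℚ + 4ℚ * 1ℚ ≡ ⟦ 9 ⟧
          nine = refl
        9<16 : ⟦ 9 ⟧ < ⟦ 16 ⟧
        9<16 = ℚ.<-≤-trans (subst (⟦ 9 ⟧ <_) (sym (⟦suc⟧ 9)) (subst (_< 1ℚ + ⟦ 9 ⟧) (+-identityˡ _) (+-mono-<-≤ 0<1 (≤-refl {⟦ 9 ⟧})))) (⟦⟧-mono (s≤s (s≤s (s≤s (s≤s (s≤s (s≤s (s≤s (s≤s (s≤s (s≤s z≤n)))))))))))

    small-columns : inv (ζ * inv 2ℚ) * (K * (⟦ Δ ⟧ * (2ℚ * (⟦ Δ ⟧ * ξ * ⟦ Δ ⟧)))) ≤ c₀ * inv 4ℚ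
    small-columns = ≤-trans (*-monoˡ (0≤inv _) (*-monoˡ (<⇒≤ 0<K) (*-monoˡ 0≤Δ (*-monoˡ 0≤2 (*-monoʳ 0≤Δ (*-monoˡ 0≤Δ ξ≤)))))) (≤-trans (≡⇒≤ (lem (inv (ζ * inv 2ℚ)) K ⟦ Δ ⟧ 2ℚ ξ′ ε)) (÷-linear (0<* 0<c₀ (0<inv 0<4)) (εB≤1 (there (there (there (there (there (here refl)))))))))
      where
      opaque
        unfolding _+_
        lem : ∀ i k d t x e → i * (k * (d * (t * (d * (x * e) * d)))) ≡ i * (k * (d * (t * (d * x * d)))) * e
        lem = solve-∀ ringℚ
    small-total : inv (ζ * inv 2ℚ) * (K * (⟦ Δ ⟧ * ω)) ≤ h₀
    small-total = ≤-trans (*-monoˡ (0≤inv _) (*-monoˡ (<⇒≤ 0<K) (*-monoˡ 0≤Δ ω≤))) (≤-trans (≡⇒≤ (lem (inv (ζ * inv 2ℚ)) K ⟦ Δ ⟧ ω′ ε)) (÷-linear 0<h₀ (εB≤1 (there (there (there (there (there (there (here refl))))))))))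
      where
      opaque
        unfolding _+_
        lem : ∀ i k d x e → i * (k * (d * (x * e))) ≡ i * (k * (d * x)) * e
        lem = solve-∀ ringℚ

    Omax/b : ∀ {z} → 0ℚ < z → Omax * K * inv z ≤ ⟦ a ⟧ → Omax * (K * ib) ≤ z
    Omax/b {z} 0<z le = ≤-trans (≡⇒≤ (sym (*-assoc _ _ _))) (÷-≤ 0<b (≤-trans (÷-≤⁻¹ 0<z le) (≤-trans (≡⇒≤ (*-comm _ _)) (*-monoˡ (<⇒≤ 0<z) ⟦a⟧≤⟦b⟧))))

    numeric : Numeric a b Δ ε d α
    numeric = record
      { 1≤a = 1≤a ; 1≤b = ℕ.≤-trans 1≤a a≤b ; 1≤Δ = 1≤Δ ; a≤b = ⟦a⟧≤⟦b⟧ ; b≤2a = ⟦b⟧≤2⟦a⟧ ; 0<ε = 0<ε ; 0<α = 0<α ; α≤1 = α≤1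
      ; τ = τ ; 0<τ = 0<τ ; τ≤1 = τ≤1 ; τ≤q = τ≤q ; ε<τ^ = ε<τ^
      ; κ₀ = κ₀ ; κ = κ ; Cκ = Cκ ; 0≤κ₀ = 0≤+ 0≤1 0≤y ; κ₀-bound = κ₀-bound ; κ₀^≤κ = κ₀^≤κ ; 1≤κ = 1≤κ ; κ≤2 = κ≤2 ; κ-1≤ = κ-1≤
      ; h₀ = h₀ ; hmax = hmax ; 0<h₀ = 0<h₀ ; 4h₀≤1 = 4h₀≤1 ; κ≤1+h₀ = κ≤1+h₀ ; ratio = ratio ; Λ′ = Λ′ ; M = M
      ; h₀≤ = ≤-refl ; 3hmax≤1 = nhmax≤1 3 (s≤s (s≤s (s≤s z≤n))) ; C₁-small = C₁-small ; M-bound = M-bound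
      ; Λ-small = Λ-small
      ; Δ²<ζa = ℚ.<-≤-trans (subst (_< 1ℚ + ⟦ Δ ⟧ * ⟦ Δ ⟧) (+-identityˡ _) (+-mono-<-≤ 0<1 (≤-refl {⟦ Δ ⟧ * ⟦ Δ ⟧}))) (≤-trans (÷-≤⁻¹ 0<ζ (big (there (there (there (here refl)))))) (≡⇒≤ (*-comm _ _)))
      ; Λθ-small = Λθ-small ; initial = initial
      ; ρ = ρ ; Omax = Omax ; 0≤ρ = <⇒≤ 0<ρ ; ε₁≤ρ = ε₁≤ρ ; devF-small = devF-small ; room = room
      ; Omax-bound = ≡⇒≤ (sym (*-inv-cancel′ _ 0<g))
      ; Omax-h₀ = Omax/b 0<h₀ (big (there (there (there (there (here refl))))))
      ; Omax-ζ = Omax/b 0<ζ/2 (big (there (there (there (there (there (here refl)))))))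
      ; small-columns = small-columns ; small-total = small-total
      }

-- From graphs to jobs

count : ∀ {n} → (Fin n → Bool) → ℕ
count {n} P = length (filterᵇ P (allFin n))

⟦count⟧ : ∀ {n} (P : Fin n → Bool) → ⟦ count P ⟧ ≡ ∑ (λ x → ind (P x))
⟦count⟧ {n} P = trans (sym (trans (∑L-const (filterᵇ P (allFin n)) 1ℚ) (*-identityʳ _))) (trans (∑L-filter P (λ _ → 1ℚ)) (∑-cong λ x → *-identityʳ _))

⟦⟧-injective : ∀ {m n} → ⟦ m ⟧ ≡ ⟦ n ⟧ → m ≡ n
⟦⟧-injective eq = ℕ.≤-antisym (⟦⟧-cancel-≤ (≡⇒≤ eq)) (⟦⟧-cancel-≤ (≡⇒≤ (sym eq)))

count-not : ∀ {n} (P : Fin n → Bool) → count P ℕ.+ count (λ x → not (P x)) ≡ n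
count-not {n} P = ⟦⟧-injective (trans (⟦+⟧ (count P) _) (trans (cong₂ _+_ (⟦count⟧ P) (⟦count⟧ (λ x → not (P x)))) (trans (sym (∑-+ _ _)) (trans (∑-cong λ x → ind-not (P x)) (trans (∑-const n 1ℚ) (*-identityʳ _))))))

position : ∀ {A : Set} {m} {xs : List A} → length xs ℕ.≤ m → ∀ {x} → x ∈ xs → Fin m
position len x∈ = inject≤ (Any.index x∈) len

lookup-index : ∀ {A : Set} {xs : List A} {x} (x∈ : x ∈ xs) → x ≡ lookup xs (Any.index x∈)
lookup-index (here p) = p
lookup-index (there p) = lookup-index p

position-injective : ∀ {A : Set} {m} {xs : List A} (len : length xs ℕ.≤ m) {x y} (x∈ : x ∈ xs) (y∈ : y ∈ xs) → position len x∈ ≡ position len y∈ → x ≡ y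
position-injective {xs = xs} len x∈ y∈ eq = trans (lookup-index x∈) (trans (cong (lookup xs) (Fin.inject≤-injective len len _ _ eq)) (sym (lookup-index y∈)))

isA : ∀ {a b} → BVert a b → Fin a → Bool
isA (inj₁ i) j = eqF i j
isA (inj₂ _) j = false

isB : ∀ {a b} → BVert a b → Fin b → Bool
isB (inj₁ _) j = false
isB (inj₂ i) j = eqF i j

isA⇒≡ : ∀ {a b} (v : BVert a b) {i} → isA v i ≡ true → v ≡ inj₁ i
isA⇒≡ (inj₁ j) p = cong inj₁ (eqF⇒≡ p)

isB⇒≡ : ∀ {a b} (v : BVert a b) {i} → isB v i ≡ true → v ≡ inj₂ i
isB⇒≡ (inj₂ j) p = cong inj₂ (eqF⇒≡ p)

degreeℚ : ∀ {n} (H : Graph n) x → ⟦ degree H x ⟧ ≡ ∑ (λ y → ind (adj H x y))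
degreeℚ H x = trans (⟦sumFin⟧ (λ y → b2n (adj H x y))) (∑-cong λ y → ⟦b2n⟧ (adj H x y))

-- A class of a bipartition that is small enough to go into A; the complement leaves a proportion c of B unused up to isolated vertices.
record Side {n : ℕ} (H : Graph n) (a b : ℕ) (c : ℚ) : Set where
  field
    P : Fin n → Bool
    1≤P : 1 ℕ.≤ count P
    P≤a : count P ℕ.≤ a
    crossing : ∀ x y → adj H x y ≡ true → P x ≡ not (P y)
    slack : ∑ (λ y → ind (anyF (adj H y) ∧ not (P y))) ≤ (1ℚ - c) * ⟦ b ⟧

module Relabel {n a Δ : ℕ} (H : Graph n) (maxdeg : MaxDegreeAtMost H Δ) {c : ℚ} (side : Side H a (n ℕ.∸ 1) c) where
  open Side side

  b : ℕ
  b = n ℕ.∸ 1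

  -- B has only `n - 1` vertices, so the class that goes to A must be non-empty; this is the purpose
  -- of `1≤P`.
  notP≤b : count (λ x → not (P x)) ℕ.≤ b
  notP≤b = ℕ.≤-trans (ℕ.≤-reflexive (sym (ℕ.m+n∸m≡n (count P) _))) (ℕ.≤-trans (ℕ.≤-reflexive (cong (ℕ._∸ count P) (count-not P))) (ℕ.∸-monoʳ-≤ n 1≤P))

  -- A vertex is numbered by its position in the list of its class. The colour and its proof are
  -- arguments, so that later proofs can split on them.
  labelᵇ : ∀ x q → P x ≡ q → BVert a b
  labelᵇ x true p = inj₁ (position P≤a (∈-filterᵇ⁺ P (∈-allFin x) p))
  labelᵇ x false p = inj₂ (position notP≤b (∈-filterᵇ⁺ (λ x → not (P x)) (∈-allFin x) (cong not p)))

  label : Fin n → BVert a b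
  label x = labelᵇ x (P x) refl

  label-injective : Injective _≡_ _≡_ label
  label-injective {x} {y} = go (P x) refl (P y) refl
    where
    go : ∀ q (p : P x ≡ q) q′ (p′ : P y ≡ q′) → labelᵇ x q p ≡ labelᵇ y q′ p′ → x ≡ y
    go true p true p′ eq = position-injective P≤a (∈-filterᵇ⁺ P (∈-allFin x) p) (∈-filterᵇ⁺ P (∈-allFin y) p′) (Sum.inj₁-injective eq)
    go false p false p′ eq = position-injective notP≤b (∈-filterᵇ⁺ (λ x → not (P x)) (∈-allFin x) (cong not p)) (∈-filterᵇ⁺ (λ x → not (P x)) (∈-allFin y) (cong not p′)) (Sum.inj₂-injective eq)

  label-true : ∀ x → P x ≡ true → ∃ λ i → label x ≡ inj₁ i
  label-true x p = go (P x) refl p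
    where
    go : ∀ q (r : P x ≡ q) → q ≡ true → ∃ λ i → labelᵇ x q r ≡ inj₁ i
    go true r _ = _ , refl

  label-false : ∀ x → P x ≡ false → ∃ λ j → label x ≡ inj₂ j
  label-false x p = go (P x) refl p
    where
    go : ∀ q (r : P x ≡ q) → q ≡ false → ∃ λ j → labelᵇ x q r ≡ inj₂ j
    go false r _ = _ , refl

  label-A⁻ : ∀ x {i} → label x ≡ inj₁ i → P x ≡ true
  label-A⁻ x {i} eq = go (P x) refl eq
    where
    go : ∀ q (r : P x ≡ q) → labelᵇ x q r ≡ inj₁ i → P x ≡ true
    go true r _ = r

  label-B⁻ : ∀ x {j} → label x ≡ inj₂ j → P x ≡ false
  label-B⁻ x {j} eq = go (P x) refl eq
    where
    go : ∀ q (r : P x ≡ q) → labelᵇ x q r ≡ inj₂ j → P x ≡ false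
    go false r _ = r

  J : BipGraph a b
  J = record { edge = λ i j → anyF λ x → anyF λ y → adj H x y ∧ (isA (label x) i ∧ isB (label y) j) }

  J⁺ : ∀ {x y i j} → adj H x y ≡ true → label x ≡ inj₁ i → label y ≡ inj₂ j → edge J i j ≡ true
  J⁺ {x} {y} {i} {j} p q r = anyF⁺ {P = λ x → anyF λ y → adj H x y ∧ (isA (label x) i ∧ isB (label y) j)} x (anyF⁺ {P = λ y → adj H x y ∧ (isA (label x) i ∧ isB (label y) j)} y
    (∧⁺ p (∧⁺ (trans (cong (λ v → isA v i) q) (eqF-refl i)) (trans (cong (λ v → isB v j) r) (eqF-refl j)))))

  J⁻ : ∀ {i j} → edge J i j ≡ true → ∃ λ x → ∃ λ y → adj H x y ≡ true × label x ≡ inj₁ i × label y ≡ inj₂ j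
  J⁻ {i} {j} e with x , e₁ ← anyF⁻ {P = λ x → anyF λ y → adj H x y ∧ (isA (label x) i ∧ isB (label y) j)} e
    with y , e₂ ← anyF⁻ {P = λ y → adj H x y ∧ (isA (label x) i ∧ isB (label y) j)} e₁ =
    x , y , ∧⁻ˡ e₂ , isA⇒≡ (label x) (∧⁻ˡ (∧⁻ʳ {adj H x y} e₂)) , isB⇒≡ (label y) (∧⁻ʳ {isA (label x) i} (∧⁻ʳ {adj H x y} e₂))

  ∑-isA : ∀ v → ∑ (λ i → ind (isA {a} {b} v i)) ≤ 1ℚ
  ∑-isA (inj₁ i) = ≡⇒≤ (∑-at₁ i)
  ∑-isA (inj₂ j) = ≤-trans (≡⇒≤ (∑-0 {a})) 0≤1

  ∑-isB : ∀ v → ∑ (λ j → ind (isB {a} {b} v j)) ≤ 1ℚ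
  ∑-isB (inj₁ i) = ≤-trans (≡⇒≤ (∑-0 {b})) 0≤1
  ∑-isB (inj₂ j) = ≡⇒≤ (∑-at₁ j)

  ∑-label-A : ∀ i → ∑ (λ x → ind (isA (label x) i)) ≤ 1ℚ
  ∑-label-A i = ∑-ind≤1 _ λ x y p q → label-injective (trans (isA⇒≡ (label x) p) (sym (isA⇒≡ (label y) q)))

  ∑-label-B : ∀ j → ∑ (λ x → ind (isB (label x) j)) ≤ 1ℚ
  ∑-label-B j = ∑-ind≤1 _ λ x y p q → label-injective (trans (isB⇒≡ (label x) p) (sym (isB⇒≡ (label y) q)))

  edge≤ : ∀ i j → ind (edge J i j) ≤ ∑ (λ x → ∑ λ y → ind (adj H x y) * (ind (isA (label x) i) * ind (isB (label y) j)))
  edge≤ i j = ≤-trans (ind-anyF _) (∑-mono λ x → ≤-trans (ind-anyF _) (∑-mono λ y → ≡⇒≤ (trans (ind-∧ (adj H x y) _) (cong (ind (adj H x y) *_) (ind-∧ (isA (label x) i) (isB (label y) j))))))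

  deg≤Δ : ∀ x → ∑ (λ y → ind (adj H x y)) ≤ ⟦ Δ ⟧
  deg≤Δ x = ≤-trans (≡⇒≤ (sym (degreeℚ H x))) (⟦⟧-mono (maxdeg x))

  adj-sym : ∀ x y → ind (adj H x y) ≡ ind (adj H y x)
  adj-sym x y = cong ind (Graph.sym H x y)

  degA-J : ∀ i → degA J i ≤ ⟦ Δ ⟧
  degA-J i =
    ∑ (λ j → ind (edge J i j)) ≤⟨ ∑-mono (edge≤ i) ⟩
    ∑ (λ j → ∑ λ x → ∑ λ y → ind (adj H x y) * (ind (isA (label x) i) * ind (isB (label y) j))) ≡⟨ trans (∑-swap _) (∑-cong λ x → trans (∑-swap _) (∑-cong λ y → trans (∑-cong λ j → sym (*-assoc _ _ _)) (∑-*ˡ (ind (adj H x y) * ind (isA (label x) i)) _))) ⟩≤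
    ∑ (λ x → ∑ λ y → ind (adj H x y) * ind (isA (label x) i) * ∑ (λ j → ind (isB (label y) j))) ≤⟨ ∑-mono (λ x → ∑-mono λ y → ≤-trans (*-monoˡ (0≤* (0≤ind (adj H x y)) (0≤ind (isA (label x) i))) (∑-isB (label y))) (≡⇒≤ (*-identityʳ _))) ⟩
    ∑ (λ x → ∑ λ y → ind (adj H x y) * ind (isA (label x) i)) ≤⟨ ∑-mono (λ x → ≤-trans (≡⇒≤ (∑-*ʳ (ind (isA (label x) i)) _)) (*-monoʳ (0≤ind (isA (label x) i)) (deg≤Δ x))) ⟩
    ∑ (λ x → ⟦ Δ ⟧ * ind (isA (label x) i)) ≤⟨ ≤-trans (≡⇒≤ (∑-*ˡ ⟦ Δ ⟧ _)) (≤-trans (*-monoˡ (0≤⟦⟧ Δ) (∑-label-A i)) (≡⇒≤ (*-identityʳ _))) ⟩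
    ⟦ Δ ⟧ ■

  degB-J : ∀ j → degB J j ≤ ⟦ Δ ⟧
  degB-J j =
    ∑ (λ i → ind (edge J i j)) ≤⟨ ∑-mono (λ i → edge≤ i j) ⟩
    ∑ (λ i → ∑ λ x → ∑ λ y → ind (adj H x y) * (ind (isA (label x) i) * ind (isB (label y) j))) ≡⟨ trans (∑-swap _) (∑-cong λ x → trans (∑-swap _) (∑-cong λ y → trans (∑-cong λ i → lem (ind (adj H x y)) (ind (isA (label x) i)) (ind (isB (label y) j))) (∑-*ˡ (ind (adj H x y) * ind (isB (label y) j)) _))) ⟩≤
    ∑ (λ x → ∑ λ y → ind (adj H x y) * ind (isB (label y) j) * ∑ (λ i → ind (isA (label x) i))) ≤⟨ ∑-mono (λ x → ∑-mono λ y → ≤-trans (*-monoˡ (0≤* (0≤ind (adj H x y)) (0≤ind (isB (label y) j))) (∑-isA (label x))) (≡⇒≤ (*-identityʳ _))) ⟩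
    ∑ (λ x → ∑ λ y → ind (adj H x y) * ind (isB (label y) j)) ≡⟨ trans (∑-swap _) (∑-cong λ y → trans (∑-*ʳ (ind (isB (label y) j)) _) (cong (_* ind (isB (label y) j)) (∑-cong λ x → adj-sym x y))) ⟩≤
    ∑ (λ y → ∑ (λ x → ind (adj H y x)) * ind (isB (label y) j)) ≤⟨ ∑-mono (λ y → *-monoʳ (0≤ind (isB (label y) j)) (deg≤Δ y)) ⟩
    ∑ (λ y → ⟦ Δ ⟧ * ind (isB (label y) j)) ≤⟨ ≤-trans (≡⇒≤ (∑-*ˡ ⟦ Δ ⟧ _)) (≤-trans (*-monoˡ (0≤⟦⟧ Δ) (∑-label-B j)) (≡⇒≤ (*-identityʳ _))) ⟩
    ⟦ Δ ⟧ ■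
    where
    opaque
      unfolding _+_
      lem : ∀ x y z → x * (y * z) ≡ x * z * y
      lem = solve-∀ ringℚ

  fits : JobFits J Δ c
  fits = record { bounded = record { degA≤ = degA-J ; degB≤ = degB-J } ; slack = ≤-trans few slack }
    where
    Q : Fin n → Bool
    Q y = anyF (adj H y) ∧ not (P y)
    few : ∑ (λ j → ind (nonisolated J j)) ≤ ∑ (λ y → ind (Q y))
    few =
      ∑ (λ j → ind (nonisolated J j)) ≤⟨ ∑-mono (λ j → ≤-trans (ind-mono {nonisolated J j} λ q → witness j (anyF⁻ {P = λ i → edge J i j} q)) (≤-trans (ind-anyF _) (∑-mono λ y → ≡⇒≤ (ind-∧ (Q y) _)))) ⟩
      ∑ (λ j → ∑ λ y → ind (Q y) * ind (isB (label y) j)) ≡⟨ trans (∑-swap _) (∑-cong λ y → ∑-*ˡ (ind (Q y)) _) ⟩≤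
      ∑ (λ y → ind (Q y) * ∑ (λ j → ind (isB (label y) j))) ≤⟨ ∑-mono (λ y → ≤-trans (*-monoˡ (0≤ind (Q y)) (∑-isB (label y))) (≡⇒≤ (*-identityʳ _))) ⟩
      ∑ (λ y → ind (Q y)) ■
      where
      witness : ∀ j → (∃ λ i → edge J i j ≡ true) → anyF (λ y → Q y ∧ isB (label y) j) ≡ true
      witness j (i , e) with x , y , xy , lx , ly ← J⁻ e =
        anyF⁺ {P = λ y → Q y ∧ isB (label y) j} y (∧⁺ (∧⁺ (anyF⁺ {P = adj H y} x (trans (Graph.sym H y x) xy)) (cong not (label-B⁻ y ly))) (trans (cong (λ v → isB v j) ly) (eqF-refl j)))

  E : ℚ
  E = ∑ λ x → ind (P x) * ∑ (λ y → ind (adj H x y))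

  size-J≤E : size J ≤ E
  size-J≤E =
    ∑ (λ i → ∑ λ j → ind (edge J i j)) ≤⟨ ∑-mono (λ i → ∑-mono λ j → ≤-trans (edge≤ i j) (∑-mono λ x → ∑-mono λ y → *-monoˡ (0≤ind (adj H x y)) (*-monoʳ (0≤ind (isB (label y) j)) (≤-trans (≡⇒≤ (sym (ind-idem (isA (label x) i)))) (*-monoˡ (0≤ind (isA (label x) i)) (ind-mono {isA (label x) i} λ q → label-A⁻ x (isA⇒≡ (label x) q))))))) ⟩
    ∑ (λ i → ∑ λ j → ∑ λ x → ∑ λ y → ind (adj H x y) * (ind (isA (label x) i) * ind (P x) * ind (isB (label y) j))) ≡⟨ trans (∑-cong λ i → trans (∑-swap _) (∑-cong λ x → trans (∑-swap _) (∑-cong λ y → trans (∑-cong λ j → lem (ind (adj H x y)) (ind (isA (label x) i)) (ind (P x)) (ind (isB (label y) j))) (∑-*ˡ (ind (isA (label x) i) * (ind (P x) * ind (adj H x y))) _)))) (∑-swap _) ⟩≤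
    ∑ (λ x → ∑ λ i → ∑ λ y → ind (isA (label x) i) * (ind (P x) * ind (adj H x y)) * ∑ (λ j → ind (isB (label y) j))) ≤⟨ ∑-mono (λ x → ∑-mono λ i → ∑-mono λ y → ≤-trans (*-monoˡ (0≤* (0≤ind (isA (label x) i)) (0≤* (0≤ind (P x)) (0≤ind (adj H x y)))) (∑-isB (label y))) (≡⇒≤ (*-identityʳ _))) ⟩
    ∑ (λ x → ∑ λ i → ∑ λ y → ind (isA (label x) i) * (ind (P x) * ind (adj H x y))) ≡⟨ ∑-cong (λ x → trans (∑-cong λ i → trans (∑-*ˡ (ind (isA (label x) i)) _) (cong (ind (isA (label x) i) *_) (∑-*ˡ (ind (P x)) _))) (∑-*ʳ (ind (P x) * ∑ (λ y → ind (adj H x y))) _)) ⟩≤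
    ∑ (λ x → ∑ (λ i → ind (isA (label x) i)) * (ind (P x) * ∑ (λ y → ind (adj H x y)))) ≤⟨ ∑-mono (λ x → ≤-trans (*-monoʳ (0≤* (0≤ind (P x)) (0≤∑ λ y → 0≤ind (adj H x y))) (∑-isA (label x))) (≡⇒≤ (*-identityˡ _))) ⟩
    E ■
    where
    opaque
      unfolding _+_
      lem : ∀ h i p j → h * (i * p * j) ≡ i * (p * h) * j
      lem = solve-∀ ringℚ

  -- By `crossing` each edge has one end in `P` and one outside, so counting the edges from either
  -- side gives the same number.
  E+E : E + E ≡ ⟦ sumFin (degree H) ⟧
  E+E = begin
    E + E ≡⟨ cong (E +_) flip-E ⟩
    E + ∑ (λ x → ind (not (P x)) * ∑ (λ y → ind (adj H x y))) ≡⟨ sym (∑-+ _ _) ⟩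
    ∑ (λ x → ind (P x) * ∑ (λ y → ind (adj H x y)) + ind (not (P x)) * ∑ (λ y → ind (adj H x y))) ≡⟨ ∑-cong (λ x → trans (sym (*-distribʳ-+ _ _ _)) (trans (cong (_* ∑ (λ y → ind (adj H x y))) (ind-not (P x))) (trans (*-identityˡ _) (sym (degreeℚ H x))))) ⟩
    ∑ (λ x → ⟦ degree H x ⟧) ≡⟨ sym (⟦sumFin⟧ (degree H)) ⟩
    ⟦ sumFin (degree H) ⟧ ∎
    where
    open ≡-Reasoning
    swap-ind : ∀ x y → ind (P x) * ind (adj H x y) ≡ ind (not (P y)) * ind (adj H y x)
    swap-ind x y = trans (*-comm _ _) (trans (ind-cong (adj H x y) λ q → cong ind (crossing x y q)) (trans (*-comm _ _) (cong (ind (not (P y)) *_) (adj-sym x y))))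
    flip-E : E ≡ ∑ (λ x → ind (not (P x)) * ∑ (λ y → ind (adj H x y)))
    flip-E = trans (∑-cong λ x → trans (sym (∑-*ˡ (ind (P x)) _)) (∑-cong λ y → swap-ind x y)) (trans (∑-swap _) (∑-cong λ y → ∑-*ˡ (ind (not (P y))) _))

  size-J≤ : size J ≤ ⟦ edges H ⟧
  size-J≤ = ≤-trans (≡⇒≤ (sym (⟦bedges⟧ J))) (⟦⟧-mono (ℕ.≤-trans (ℕ.≤-reflexive (sym (ℕ.m*n/n≡m (bedges J) 2))) (ℕ./-monoˡ-≤ 2 (⟦⟧-cancel-≤ (
    ⟦ bedges J ℕ.* 2 ⟧ ≡⟨ trans (cong ⟦_⟧ (trans (ℕ.*-comm (bedges J) 2) (cong (bedges J ℕ.+_) (ℕ.+-identityʳ _)))) (⟦+⟧ (bedges J) (bedges J)) ⟩≤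
    ⟦ bedges J ⟧ + ⟦ bedges J ⟧ ≤⟨ +-mono (≤-trans (≡⇒≤ (⟦bedges⟧ J)) size-J≤E) (≤-trans (≡⇒≤ (⟦bedges⟧ J)) size-J≤E) ⟩
    E + E ≡⟨ E+E ⟩≤
    ⟦ sumFin (degree H) ⟧ ■)))))

  ends : ∀ {x y} → adj H x y ≡ true → (∃ λ i → ∃ λ j → label x ≡ inj₁ i × label y ≡ inj₂ j) ⊎ (∃ λ i → ∃ λ j → label y ≡ inj₁ i × label x ≡ inj₂ j)
  ends {x} {y} xy = caseᵇ (P x)
    (λ p → inj₁ (proj₁ (label-true x p) , proj₁ (label-false y (not≡true (trans (sym (crossing x y xy)) p))) , proj₂ (label-true x p) , proj₂ (label-false y (not≡true (trans (sym (crossing x y xy)) p)))))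
    (λ p → inj₂ (proj₁ (label-true y (not-false (trans (sym (crossing x y xy)) p))) , proj₁ (label-false x p) , proj₂ (label-true y (not-false (trans (sym (crossing x y xy)) p))) , proj₂ (label-false x p)))

module Sides {n Δ : ℕ} (H : Graph n) (bip : IsBipartite H) (maxdeg : MaxDegreeAtMost H Δ) (1≤Δ : 1 ℕ.≤ Δ) (2Δ+2≤n : 2 ℕ.* suc Δ ℕ.≤ n) where

  a b : ℕ
  a = n ℕ./ 2
  b = n ℕ.∸ 1

  c : ℚ
  c = inv (2ℚ * (1ℚ + ⟦ Δ ⟧))

  2≤n : 2 ℕ.≤ n
  2≤n = ℕ.≤-trans (ℕ.*-monoʳ-≤ 2 (s≤s z≤n)) 2Δ+2≤n

  0<2D : 0ℚ < 2ℚ * (1ℚ + ⟦ Δ ⟧)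
  0<2D = 0<* 0<2 (0<+ 0<1 (0≤⟦⟧ Δ))

  ⟦b⟧ : ⟦ b ⟧ ≡ ⟦ n ⟧ - 1ℚ
  ⟦b⟧ = trans (⟦∸⟧ (ℕ.≤-trans (s≤s z≤n) 2≤n)) (cong (λ z → ⟦ n ⟧ - z) ⟦1⟧)

  -- The hypothesis says `Y ≤ (1 - 1 / (1 + Δ)) n`. That `c` is only half of `1 / (1 + Δ)` pays for
  -- the difference between `n` and `b = n - 1`, as `n ≥ 2 (1 + Δ)`.
  slack-bound : ∀ {Y} → Y * (1ℚ + ⟦ Δ ⟧) ≤ ⟦ Δ ⟧ * ⟦ n ⟧ → Y ≤ (1ℚ - c) * ⟦ b ⟧
  slack-bound {Y} le = *-cancelʳ 0<2D (≤-trans (≤-trans (≡⇒≤ (lem₁ Y ⟦ Δ ⟧)) (*-monoˡ 0≤2 le)) (≤-by (⟦ n ⟧ - (2ℚ * (1ℚ + ⟦ Δ ⟧)) + 1ℚ) (0≤+ (0≤- n≥) 0≤1)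
    (trans (cong (λ z → (1ℚ - c) * z * (2ℚ * (1ℚ + ⟦ Δ ⟧))) ⟦b⟧) (trans (lem₂ c ⟦ n ⟧ (2ℚ * (1ℚ + ⟦ Δ ⟧))) (trans (cong (λ z → (⟦ n ⟧ - 1ℚ) * (2ℚ * (1ℚ + ⟦ Δ ⟧) - z)) (*-inv 0<2D)) (lem₃ ⟦ n ⟧ ⟦ Δ ⟧))))))
    where
    n≥ : 2ℚ * (1ℚ + ⟦ Δ ⟧) ≤ ⟦ n ⟧
    n≥ = ≤-trans (≡⇒≤ (trans (2*≡ _) (trans (cong (λ z → z + z) (sym (⟦suc⟧ Δ))) (trans (sym (⟦+⟧ (suc Δ) (suc Δ))) (cong (λ z → ⟦ suc Δ ℕ.+ z ⟧) (sym (ℕ.+-identityʳ (suc Δ)))))))) (⟦⟧-mono 2Δ+2≤n)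
    opaque
      unfolding _+_
      lem₁ : ∀ y d → y * (2ℚ * (1ℚ + d)) ≡ 2ℚ * (y * (1ℚ + d))
      lem₁ = solve-∀ ringℚ
      lem₂ : ∀ c n t → (1ℚ - c) * (n - 1ℚ) * t ≡ (n - 1ℚ) * (t - t * c)
      lem₂ = solve-∀ ringℚ
      lem₃ : ∀ n d → (n - 1ℚ) * (2ℚ * (1ℚ + d) - 1ℚ) ≡ 2ℚ * (d * n) + ((n - 2ℚ * (1ℚ + d)) + 1ℚ)
      lem₃ = solve-∀ ringℚ

  active : Fin n → Bool
  active x = anyF (adj H x)

  class : Bool → Fin n → Bool
  class q x = active x ∧ (if q then proj₁ bip x else not (proj₁ bip x))

  colour-differs : ∀ x y → adj H x y ≡ true → proj₁ bip x ≡ not (proj₁ bip y)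
  colour-differs x y e with proj₁ bip x in p | proj₁ bip y in q
  ... | true | true = ⊥-elim (proj₂ bip x y e (trans p (sym q)))
  ... | true | false = refl
  ... | false | true = refl
  ... | false | false = ⊥-elim (proj₂ bip x y e (trans p (sym q)))

  active-l : ∀ {x y} → adj H x y ≡ true → active x ≡ true
  active-l {x} {y} e = anyF⁺ {P = adj H x} y e

  active-r : ∀ {x y} → adj H x y ≡ true → active y ≡ true
  active-r {x} {y} e = anyF⁺ {P = adj H y} x (trans (Graph.sym H y x) e)

  class-crossing : ∀ q x y → adj H x y ≡ true → class q x ≡ not (class q y)
  class-crossing true x y e = trans (cong (_∧ proj₁ bip x) (active-l e)) (trans (colour-differs x y e) (cong (λ z → not (z ∧ proj₁ bip y)) (sym (active-r e))))
  class-crossing false x y e = trans (cong (_∧ not (proj₁ bip x)) (active-l e)) (trans (cong not (colour-differs x y e)) (cong (λ z → not (z ∧ not (proj₁ bip y))) (sym (active-r e))))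

  other : Bool → Fin n → Bool
  other q y = active y ∧ not (class q y)

  -- Every active vertex outside the class has a neighbour in it.
  other≤ : ∀ q → ∑ (λ y → ind (other q y)) ≤ ⟦ Δ ⟧ * ∑ (λ x → ind (class q x))
  other≤ q =
    ∑ (λ y → ind (other q y)) ≤⟨ ∑-mono (λ y → ≤-trans (ind-mono {other q y} λ r → neighbour y r (anyF⁻ {P = adj H y} (∧⁻ˡ r))) (≤-trans (ind-anyF _) (∑-mono λ x → ≡⇒≤ (ind-∧ (class q x) (adj H x y))))) ⟩
    ∑ (λ y → ∑ λ x → ind (class q x) * ind (adj H x y)) ≡⟨ trans (∑-swap _) (∑-cong λ x → ∑-*ˡ (ind (class q x)) _) ⟩≤
    ∑ (λ x → ind (class q x) * ∑ (λ y → ind (adj H x y))) ≤⟨ ∑-mono (λ x → *-monoˡ (0≤ind (class q x)) (≤-trans (≡⇒≤ (sym (degreeℚ H x))) (⟦⟧-mono (maxdeg x)))) ⟩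
    ∑ (λ x → ind (class q x) * ⟦ Δ ⟧) ≡⟨ trans (∑-*ʳ ⟦ Δ ⟧ _) (*-comm _ _) ⟩≤
    ⟦ Δ ⟧ * ∑ (λ x → ind (class q x)) ■
    where
    neighbour : ∀ y → other q y ≡ true → (∃ λ x → adj H y x ≡ true) → anyF (λ x → class q x ∧ adj H x y) ≡ true
    neighbour y r (x , e) = anyF⁺ {P = λ x → class q x ∧ adj H x y} x (∧⁺ (trans (class-crossing q x y e′) (∧⁻ʳ {active y} r)) e′)
      where
      e′ : adj H x y ≡ true
      e′ = trans (Graph.sym H x y) e

  other+class : ∀ q → ∑ (λ y → ind (other q y)) + ∑ (λ x → ind (class q x)) ≤ ⟦ n ⟧
  other+class q = ≤-trans (≡⇒≤ (sym (∑-+ _ _))) (≤-trans (∑-mono λ x → lem (active x) (class q x)) (≡⇒≤ (trans (∑-const n 1ℚ) (*-identityʳ _))))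
    where
    lem : ∀ p r → ind (p ∧ not r) + ind r ≤ 1ℚ
    lem true r = ≡⇒≤ (trans (+-comm _ _) (ind-not r))
    lem false r = ≤-trans (≡⇒≤ (+-identityˡ _)) (ind≤1 r)

  -- From `Y ≤ Δ X` and `X + Y ≤ n` follows `(1 + Δ) Y ≤ Δ (X + Y) ≤ Δ n`.
  slack : ∀ q → ∑ (λ y → ind (other q y)) ≤ (1ℚ - c) * ⟦ b ⟧
  slack q = slack-bound (≤-trans (≤-trans (≡⇒≤ (lem Y ⟦ Δ ⟧)) (+-mono (other≤ q) ≤-refl)) (≤-trans (≡⇒≤ (lem₂ ⟦ Δ ⟧ X Y)) (*-monoˡ (0≤⟦⟧ Δ) (other+class q))))
    where
    X = ∑ (λ x → ind (class q x))
    Y = ∑ (λ y → ind (other q y))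
    opaque
      unfolding _+_
      lem : ∀ y d → y * (1ℚ + d) ≡ y + d * y
      lem = solve-∀ ringℚ
      lem₂ : ∀ d x y → d * x + d * y ≡ d * (y + x)
      lem₂ = solve-∀ ringℚ

  classes : count (class true) ℕ.+ count (class false) ℕ.≤ n
  classes = ⟦⟧-cancel-≤ (≤-trans (≡⇒≤ (trans (⟦+⟧ (count (class true)) _) (trans (cong₂ _+_ (⟦count⟧ (class true)) (⟦count⟧ (class false))) (sym (∑-+ _ _))))) (≤-trans (∑-mono λ x → lem (active x) (proj₁ bip x)) (≡⇒≤ (trans (∑-const n 1ℚ) (*-identityʳ _)))))
    where
    lem : ∀ p r → ind (p ∧ r) + ind (p ∧ not r) ≤ 1ℚ
    lem true r = ≡⇒≤ (ind-not r)
    lem false r = ≤-trans (≡⇒≤ (+-identityˡ _)) 0≤1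

  half : ∀ {k} → k ℕ.+ k ℕ.≤ n → k ℕ.≤ a
  half {k} le = ℕ.≤-trans (ℕ.≤-reflexive (sym (ℕ.m*n/n≡m k 2))) (ℕ./-monoˡ-≤ 2 (ℕ.≤-trans (ℕ.≤-reflexive (trans (ℕ.*-comm k 2) (cong (k ℕ.+_) (ℕ.+-identityʳ k)))) le))

  smaller : ∃ λ q → count (class q) ℕ.≤ a
  smaller with ℕ.≤-total (count (class true)) (count (class false))
  ... | inj₁ le = true , half (ℕ.≤-trans (ℕ.+-monoʳ-≤ _ le) classes)
  ... | inj₂ le = false , half (ℕ.≤-trans (ℕ.+-monoˡ-≤ _ le) classes)

  side : Side H a b c
  side = build (proj₁ smaller) (proj₂ smaller) (1 ℕ.≤? count (class (proj₁ smaller)))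
    where
    build : ∀ q → count (class q) ℕ.≤ a → Dec (1 ℕ.≤ count (class q)) → Side H a b c
    build q le (yes 1≤) = record { P = class q ; 1≤P = 1≤ ; P≤a = le ; crossing = class-crossing q ; slack = slack q }
    -- An empty class means that `H` has no edges; a single vertex then serves as the non-empty
    -- class.
    build q le (no empty) = record
      { P = eqF v₀ ; 1≤P = ℕ.≤-reflexive (sym one) ; P≤a = ℕ.≤-trans (ℕ.≤-reflexive one) (half 2≤n)
      ; crossing = λ x y e → ⊥-elim (none x y e)
      ; slack = ≤-trans (≤-trans (∑-mono λ y → ind-mono {active y ∧ not (eqF v₀ y)} {other q y} λ r → ⊥-elim (isolated y (∧⁻ˡ r))) ≤-refl) (slack q)
      }
      where
      v₀ : Fin n
      v₀ = fromℕ< (ℕ.≤-trans (s≤s z≤n) 2≤n)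
      one : count (eqF v₀) ≡ 1
      one = ⟦⟧-injective (trans (⟦count⟧ (eqF v₀)) (trans (∑-at₁ v₀) (sym ⟦1⟧)))
      no-class : ∀ x → class q x ≡ false
      no-class x = caseᵇ (class q x) (λ r → ⊥-elim (empty (⟦⟧-cancel-≤ (≤-trans (≡⇒≤ ⟦1⟧) (≤-trans (≡⇒≤ (cong ind (sym r))) (≤-trans (f≤∑ {f = λ x → ind (class q x)} (λ x → 0≤ind (class q x)) x) (≡⇒≤ (sym (⟦count⟧ (class q)))))))))) id
      none : ∀ x y → adj H x y ≡ true → ⊥
      none x y e = true≢false (trans (class-crossing q x y e) (cong not (no-class y))) (no-class x)
      isolated : ∀ y → active y ≡ true → ⊥
      isolated y r with x , e ← anyF⁻ {P = adj H y} r = none y x e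

embedded : ∀ {a b} → (Fin a → Fin a) → (Fin b → Fin b) → BVert a b → BVert a b
embedded σ τ (inj₁ i) = inj₁ (σ i)
embedded σ τ (inj₂ j) = inj₂ (τ j)

embedded-injective : ∀ {a b} {σ : Fin a → Fin a} {τ : Fin b → Fin b} → Injective _≡_ _≡_ σ → Injective _≡_ _≡_ τ → Injective _≡_ _≡_ (embedded σ τ)
embedded-injective σi τi {inj₁ x} {inj₁ y} eq = cong inj₁ (σi (Sum.inj₁-injective eq))
embedded-injective σi τi {inj₂ x} {inj₂ y} eq = cong inj₂ (τi (Sum.inj₂-injective eq))

module PackGraphs {n s Δ : ℕ} (H : Fin s → Graph n) (maxdeg : ∀ k → MaxDegreeAtMost (H k) Δ) {c : ℚ} (side : ∀ k → Side (H k) (n ℕ./ 2) (n ℕ.∸ 1) c)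
  (G : BipGraph (n ℕ./ 2) (n ℕ.∸ 1)) where

  module Re (k : Fin s) = Relabel (H k) (maxdeg k) (side k)

  pack-graphs : Packing (λ k → Re.J k) G → PackInto H G
  pack-graphs P = φ , copy , disjoint′
    where
    open Packing P
    φ : Fin s → Fin n → BVert (n ℕ./ 2) (n ℕ.∸ 1)
    φ k x = embedded (σ k) (τ k) (Re.label k x)

    φ-A : ∀ k {x i} → Re.label k x ≡ inj₁ i → φ k x ≡ inj₁ (σ k i)
    φ-A k = cong (embedded (σ k) (τ k))
    φ-B : ∀ k {x j} → Re.label k x ≡ inj₂ j → φ k x ≡ inj₂ (τ k j)
    φ-B k = cong (embedded (σ k) (τ k))

    copy : ∀ k → IsCopy (H k) G (φ k)
    copy k = (λ eq → Re.label-injective k (embedded-injective (σ-injective k) (τ-injective k) eq)) , to-adj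
      where
      to-adj : ∀ x y → adj (H k) x y ≡ true → badj G (φ k x) (φ k y) ≡ true
      to-adj x y e = cases (Re.ends k e)
        where
        cases : (∃ λ i → ∃ λ j → Re.label k x ≡ inj₁ i × Re.label k y ≡ inj₂ j) ⊎ (∃ λ i → ∃ λ j → Re.label k y ≡ inj₁ i × Re.label k x ≡ inj₂ j) → badj G (φ k x) (φ k y) ≡ true
        cases (inj₁ (i , j , lx , ly)) = trans (cong₂ (badj G) (φ-A k lx) (φ-B k ly)) (to-edge k i j (Re.J⁺ k e lx ly))
        cases (inj₂ (i , j , ly , lx)) = trans (cong₂ (badj G) (φ-B k lx) (φ-A k ly)) (to-edge k i j (Re.J⁺ k (trans (Graph.sym (H k) y x) e) ly lx))

    Oriented : Fin s → Fin n → Fin n → Set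
    Oriented k x y = ∃ λ i → ∃ λ j → Re.label k x ≡ inj₁ i × Re.label k y ≡ inj₂ j

    apart : ∀ k l → k ≢ l → ∀ {u v u′ v′} → adj (H k) u v ≡ true → adj (H l) u′ v′ ≡ true → Oriented k u v → Oriented l u′ v′ → φ k u ≡ φ l u′ → φ k v ≡ φ l v′ → ⊥
    apart k l k≢l e e′ (i , j , lu , lv) (i′ , j′ , lu′ , lv′) p q = disjoint k l k≢l i j i′ j′ (Re.J⁺ k e lu lv) (Re.J⁺ l e′ lu′ lv′)
      (Sum.inj₁-injective (trans (sym (φ-A k lu)) (trans p (φ-A l lu′))) , Sum.inj₂-injective (trans (sym (φ-B k lv)) (trans q (φ-B l lv′))))

    mixed : ∀ k l {x y i j} → Re.label k x ≡ inj₁ i → Re.label l y ≡ inj₂ j → φ k x ≡ φ l y → ⊥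
    mixed k l lx ly p with () ← trans (sym (φ-A k lx)) (trans p (φ-B l ly))

    -- Equal images lie on the same side of the host, so two edges with a common image are oriented
    -- alike; edges listed from their end in B are turned round by symmetry.
    disjoint′ : ∀ k l → k ≢ l → ∀ u v u′ v′ → adj (H k) u v ≡ true → adj (H l) u′ v′ ≡ true → ¬ (φ k u ≡ φ l u′ × φ k v ≡ φ l v′)
    disjoint′ k l k≢l u v u′ v′ e e′ (p , q) = cases (Re.ends k e) (Re.ends l e′)
      where
      cases : Oriented k u v ⊎ Oriented k v u → Oriented l u′ v′ ⊎ Oriented l v′ u′ → ⊥
      cases (inj₁ o) (inj₁ o′) = apart k l k≢l e e′ o o′ p q
      cases (inj₂ o) (inj₂ o′) = apart k l k≢l (trans (Graph.sym (H k) v u) e) (trans (Graph.sym (H l) v′ u′) e′) o o′ q p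
      cases (inj₁ (_ , _ , lu , _)) (inj₂ (_ , _ , _ , lu′)) = mixed k l lu lu′ p
      cases (inj₂ (_ , _ , lv , _)) (inj₁ (_ , _ , _ , lv′)) = mixed k l lv lv′ q

-- `α` and `d` are only assumed positive, while the estimates want factors at most 1. Lowering `α`
-- relaxes the budget for the edges, and a lower bound `d₁` for `d` suffices to define `τ`.
at-most-one : ∀ x → 0ℚ < x → ∃ λ y → 0ℚ < y × y ≤ 1ℚ × y ≤ x
at-most-one x 0<x with ℚ.≤-total x 1ℚ
... | inj₁ le = x , 0<x , le , ≤-refl
... | inj₂ ge = 1ℚ , 0<1 , ≤-refl , ge

opaque
  unfolding _+_ ⟦_⟧
  budget : ∀ {α α′} → α′ ≤ α → ∀ m k → ℕtoℚ m ≤ (1ℚ ℚ.- α) ℚ.* ℕtoℚ k → ⟦ m ⟧ ≤ (1ℚ - α′) * ⟦ k ⟧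
  budget {α} {α′} le m k p = ≤-trans p (*-monoʳ (0≤⟦⟧ k) (-monoʳ {1ℚ} le))

theorem8p5 : (α d : ℚ) (Δ : ℕ) → 0ℚ ℚ.< α → 0ℚ ℚ.< d → 1 ℕ.≤ Δ →
    Σ ℚ λ ε₀ → 0ℚ ℚ.< ε₀ ×
    ((ε : ℚ) → 0ℚ ℚ.< ε → ε ℚ.≤ ε₀ →
    Σ ℕ λ n₀ → (n : ℕ) → n ℕ.≥ n₀ →
    (s : ℕ) (H : Fin s → Graph n) →
    (∀ i → IsBipartite (H i)) →
    (∀ i → MaxDegreeAtMost (H i) Δ) →
    (G : BipGraph (n ℕ./ 2) (n ℕ.∸ 1)) →
    SuperRegular ε d G →
    ℕtoℚ (sumFin (λ i → edges (H i))) ℚ.≤ (1ℚ ℚ.- α) ℚ.* ℕtoℚ (bedges G) →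
    PackInto H G)
theorem8p5 α d Δ 0<α 0<d 1≤Δ = ε₀ , 0<ε₀ , λ ε 0<ε ε≤ε₀ → n₀ , conclude ε 0<ε ε≤ε₀
  where
  α₁ = at-most-one α 0<α
  α′ = proj₁ α₁
  d₁ = at-most-one d 0<d
  open Constants α′ d (proj₁ d₁) Δ (proj₁ (proj₂ α₁)) (proj₁ (proj₂ (proj₂ α₁))) (proj₁ (proj₂ d₁)) (proj₁ (proj₂ (proj₂ d₁))) (proj₂ (proj₂ (proj₂ d₁))) 1≤Δ

  -- The first summand makes the order of A at least `A₀`; the second is what `Sides` needs to leave
  -- a share of B free.
  n₀ : ℕ
  n₀ = A₀ ℕ.* 2 ℕ.+ 2 ℕ.* suc Δ

  conclude : ∀ ε → 0ℚ < ε → ε ≤ ε₀ → ∀ n → n ℕ.≥ n₀ → ∀ s (H : Fin s → Graph n) → (∀ i → IsBipartite (H i)) → (∀ i → MaxDegreeAtMost (H i) Δ) →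
    (G : BipGraph (n ℕ./ 2) (n ℕ.∸ 1)) → SuperRegular ε d G → ℕtoℚ (sumFin (λ i → edges (H i))) ℚ.≤ (1ℚ ℚ.- α) ℚ.* ℕtoℚ (bedges G) → PackInto H G
  conclude ε 0<ε ε≤ε₀ n n≥n₀ s H bip maxdeg G reg le = PG.pack-graphs (Iteration.packing numeric G reg s (λ k → PG.Re.J k) (λ k → PG.Re.fits k) total)
    where
    2Δ+2≤n : 2 ℕ.* suc Δ ℕ.≤ n
    2Δ+2≤n = ℕ.≤-trans (ℕ.m≤n+m _ (A₀ ℕ.* 2)) n≥n₀
    2≤n : 2 ℕ.≤ n
    2≤n = ℕ.≤-trans (ℕ.*-monoʳ-≤ 2 (s≤s z≤n)) 2Δ+2≤n
    1≤a : 1 ℕ.≤ n ℕ./ 2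
    1≤a = ℕ./-monoˡ-≤ 2 2≤n
    A₀≤a : A₀ ℕ.≤ n ℕ./ 2
    A₀≤a = ℕ.≤-trans (ℕ.≤-reflexive (sym (ℕ.m*n/n≡m A₀ 2))) (ℕ./-monoˡ-≤ 2 (ℕ.≤-trans (ℕ.m≤m+n (A₀ ℕ.* 2) (2 ℕ.* suc Δ)) n≥n₀))
    n≡ : n ≡ n ℕ.% 2 ℕ.+ (n ℕ./ 2 ℕ.+ n ℕ./ 2)
    n≡ = trans (ℕ.m≡m%n+[m/n]*n n 2) (cong (n ℕ.% 2 ℕ.+_) (trans (ℕ.*-comm (n ℕ./ 2) 2) (cong (n ℕ./ 2 ℕ.+_) (ℕ.+-identityʳ _))))
    a≤b : n ℕ./ 2 ℕ.≤ n ℕ.∸ 1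
    a≤b = ℕ.≤-trans (ℕ.≤-reflexive (sym (ℕ.m+n∸n≡m (n ℕ./ 2) 1))) (ℕ.∸-monoˡ-≤ 1 (ℕ.≤-trans (ℕ.+-monoʳ-≤ (n ℕ./ 2) 1≤a) (ℕ.≤-trans (ℕ.m≤n+m _ (n ℕ.% 2)) (ℕ.≤-reflexive (sym n≡)))))
    b≤2a : n ℕ.∸ 1 ℕ.≤ n ℕ./ 2 ℕ.+ n ℕ./ 2
    b≤2a = ℕ.≤-trans (ℕ.∸-monoˡ-≤ 1 (ℕ.≤-trans (ℕ.≤-reflexive n≡) (ℕ.+-monoˡ-≤ _ (ℕ.≤-pred (ℕ.m%n<n n 2))))) ℕ.≤-refl
    open Instance (n ℕ./ 2) (n ℕ.∸ 1) ε 0<ε ε≤ε₀ 1≤a A₀≤a a≤b b≤2a using (numeric)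
    module PG = PackGraphs H maxdeg (λ k → Sides.side (H k) (bip k) (maxdeg k) 1≤Δ 2Δ+2≤n) G
    total : ∑ (λ k → size (PG.Re.J k)) ≤ (1ℚ - α′) * size G
    total = ≤-trans (∑-mono λ k → PG.Re.size-J≤ k) (≤-trans (≡⇒≤ (sym (⟦sumFin⟧ (λ i → edges (H i))))) (≤-trans (budget (proj₂ (proj₂ (proj₂ α₁))) _ _ le) (≡⇒≤ (cong ((1ℚ - α′) *_) (⟦bedges⟧ G)))))
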